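{- Let the gallery $C^{(0)},C^{(1)},\ldots$, the half trees $Y$ and $\mathfrak{X}_+$ and all notation be as in the context. (a) There exists an isomorphism of simplicial complexes $\Theta:Y\to\mathfrak{X}_+$ such that for all $\mathbf{v}\in Y^0$ and all $b\in\mathbb{Z}_{\ge0}$ the composition of bijections $$]\mathbf{v}[\ \xrightarrow{\Theta}\ ]\Theta(\mathbf{v})[\ \xrightarrow{\nu^b}\ ]\nu^b(\Theta(\mathbf{v}))[\ \xrightarrow{\Theta^{ -1}}\ ]\Theta^{ -1}(\nu^b(\Theta(\mathbf{v})))[$$ is induced by the action of some element $g(\mathbf{v},b)$ of $N_0$. (b) Let $\phi\in N(T)$ and $r\in\mathbb{N}$ be such that $\phi(C^{(i)})=C^{(i+r)}$ for all $i\ge0$. Then $\phi(Y^1)\subset Y^1$, and the isomorphism $\Theta$ and the $g(\mathbf{v},b)$ in (a) can be chosen such that $\varphi^r\circ\Theta=\Theta\circ\phi$ and such that in $G$ we have $g(\phi(\mathbf{v}),p^r)\cdot\phi=\phi\cdot g(\mathbf{v},1)$ for all $\mathbf{v}\in Y^0$. (c) Let $\tau:\mathbb{Z}_p^\times\to T$ be a homomorphism such that $\alpha^{(i)}\circ\tau=\mathrm{id}_{\mathbb{Z}_p^\times}$ for all $i\ge0$. Then (for suitable $\Theta$ and $g(\mathbf{v},b)$ as in (a)) there exists for each $\mathbf{v}\in Y^0$ and each $a\in\mathbb{Z}_p^\times$ some element $h(\mathbf{v},a)$ in $N_0\cdot\tau(a)$ which induces the composition of bijections $$]\mathbf{v}[\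 \xrightarrow{\Theta}\ ]\Theta(\mathbf{v})[\ \xrightarrow{\gamma(a)}\ ]\gamma(a)(\Theta(\mathbf{v}))[\ \xrightarrow{\Theta^{ -1}}\ ]\Theta^{ -1}(\gamma(a)(\Theta(\mathbf{v})))[.$$ For $a\in\mathbb{N}\cap\mathbb{Z}_p^\times$ these $h(\mathbf{v},a)$ can be chosen such that in $G$ we have $$h(g(\mathbf{v},1)\mathbf{v},a)\cdot g(\mathbf{v},1)=g(h(\mathbf{v},a)\mathbf{v},a)\cdot h(\mathbf{v},a).$$ (d) Let $\phi$ be as in (b) and $\tau$ as in (c), such that $\tau(a)\phi=\phi\tau(a)$ in $G$ for all $a\in\mathbb{Z}_p^\times$. Then $\Theta$, the $g(\mathbf{v},b)$ and the $h(\mathbf{v},a)$ (with the properties in (a), (b), (c)) can be chosen such that in addition, in $G$, $h(\phi(\mathbf{v}),a)\cdot\phi=\phi\cdot h(\mathbf{v},a)$.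
   Context: $\mathbb{N}=\{1,2,\ldots\}$. **Group and gallery.** $G$ is the group of $\mathbb{Q}_p$-points of a $\mathbb{Q}_p$-split connected reductive group over $\mathbb{Q}_p$, $T$ a maximal split torus, $N(T)$ its normalizer, $\Phi$ the set of roots, $N_\alpha$ ($\alpha\in\Phi$) the root subgroups, $\Phi^+$ a positive system, $N=\prod_{\alpha\in\Phi^+}N_\alpha$. $X$ is the semisimple Bruhat–Tits building of $G$, $A\subset X$ the apartment of $T$. Facets are by convention closed; a chamber is a facet of codimension $0$; $I_C$ is the Iwahori subgroup fixing a chamber $C$. Given is a semiinfinite chamber gallery $C^{(0)},C^{(1)},C^{(2)},\ldots$ in $A$ such that the groups $N_0^{(i)}=I_{C^{(i)}}\cap N=\prod_{\alpha\in\Phi^+}I_{C^{(i)}}\cap N_\alpha$ satisfy $N_0^{(0)}\supset N_0^{(1)}\supset N_0^{(2)}\supset\ldots$ with $[N_0^{(i)}:N_0^{(i+1)}]=p$ for all $i\ge0$. Put $N_0=N_0^{(0)}$. There is a unique sequence $\alpha^{(0)},\alpha^{(1)},\ldots$ in $\Phi^+$ such that, with $e[i,\alpha]=|\{0\le j\le i-1:\alpha=\alpha^{(j)}\}|$, one has $N_0^{(i)}=\prod_{\alpha\in\Phi^+}(N_0\cap N_\alpha)^{p^{e[i,\alpha]}}$ for all $i$. **The half tree $Y$.** Its set $Y^0$ of vertices and its set $Y^1$ of edges are both identified with the set of chambers of $X$ of the form $n\cdot C^{(i)}$, $n\in N_0$, $i\ge0$, with the obvious $N_0$-action. The chamber $C^{(i)}$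 is written $\mathbf{v}_i$ as a vertex and $\mathbf{e}_i$ as an edge. For $n\in N_0$, $i\ge0$ the edge $n\mathbf{e}_{i+1}$ contains the two vertices $n\mathbf{v}_i$ and $n\mathbf{v}_{i+1}$; the edge $\mathbf{e}_0$ contains only the vertex $\mathbf{v}_0$ (loose end). For $\mathbf{v}\in Y^0$ let $]\mathbf{v}[\,=\{\mathbf{w}\in Y^0:\{\mathbf{v},\mathbf{w}\}\in Y^1,\ \mathbf{v}\in[\mathbf{w},\mathbf{v}_0]\}$, where $[\mathbf{w},\mathbf{v}_0]$ is the set of vertices on the geodesic from $\mathbf{w}$ to $\mathbf{v}_0$. Elements of $G$ act on $Y$ (where defined) through their action on chambers. **The half tree $\mathfrak{X}_+$.** $\mathfrak{X}$ is the Bruhat–Tits tree of $\mathrm{PGL}_2(\mathbb{Q}_p)$, $\mathfrak{v}_0$ the vertex fixed by $\mathrm{PGL}_2(\mathbb{Z}_p)$. In $\mathrm{GL}_2(\mathbb{Q}_p)$: $\varphi=\begin{pmatrix}p&0\\0&1\end{pmatrix}$, $\nu=\begin{pmatrix}1&1\\0&1\end{pmatrix}$, $\gamma(a)=\begin{pmatrix}a&0\\0&1\end{pmatrix}$ for $a\in\mathbb{Z}_p^\times$, $\mathfrak{N}_0=\begin{pmatrix}1&\mathbb{Z}_p\\0&1\end{pmatrix}$. $\mathfrak{v}_i=\varphi^i(\mathfrak{v}_0)$, $\mathfrak{e}_i=\{\mathfrak{v}_i,\mathfrak{v}_{i-1}\}$. $\mathfrak{X}_+$ has vertices $\mathfrak{X}_+^0=\coprod_{i\ge0}\mathfrak{N}_0\mathfrak{v}_i$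 and edges $\mathfrak{X}_+^1=\coprod_{i\ge0}\mathfrak{N}_0\mathfrak{e}_i$; $\mathfrak{e}_0$ is a loose end containing only $\mathfrak{v}_0$. For $\mathfrak{v}\in\mathfrak{X}_+^0$, $]\mathfrak{v}[\,=\{\mathfrak{w}\in\mathfrak{X}_+^0:\{\mathfrak{v},\mathfrak{w}\}\in\mathfrak{X}_+^1,\ \mathfrak{v}\in[\mathfrak{w},\mathfrak{v}_0]\}$. -}

module Defs where

open import Level using (0ℓ)
open import Algebra.Bundles using (Monoid; Group; CommutativeRing)
import Algebra.Construct.Pointwise as Pointwise
import Algebra.Definitions.RawMonoid as RawMonoidDefs
import Algebra.Morphism.Construct.Composition as Compose
import Algebra.Morphism.Construct.Identity as Identity
open import Algebra.Morphism.Structures using (module RingMorphisms; module GroupMorphisms; module MonoidMorphisms)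
import Algebra.Properties.Group as GroupProperties
import Algebra.Properties.Ring as RingProperties
import Algebra.Properties.Semiring.Exp as Exp
import Algebra.Properties.Semiring.Sum as Sum
open import Data.Fin.Base as Fin using (Fin; zero; suc)
import Data.Fin.Properties as FinP
open import Data.Integer.Base as ℤ using (ℤ; +_; -[1+_]; 0ℤ; 1ℤ)
open import Data.Integer.Divisibility.Signed using (_∣_; divides; ∣m⇒∣-m; ∣m∣n⇒∣m+n; ∣m⇒∣m*n; ∣n⇒∣m*n)
import Data.Integer.Properties as ℤP
open import Data.Integer.Tactic.RingSolver using () renaming (solve-∀ to ℤ-solve-∀)
open import Data.List.Base using (List; []; _∷_; foldr; filter; length; upTo; allFin)
open import Data.List.Relation.Binary.Permutation.Propositional using (_↭_)
open import Data.Nat.Base as ℕ using (ℕ)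
import Data.Nat.Properties as ℕP
open import Data.Product.Base using (Σ-syntax; ∃; ∃-syntax; _×_; _,_; proj₁; proj₂)
open import Data.Rational.Base as ℚ using (ℚ)
open import Data.Sum.Base using (_⊎_; inj₁; inj₂)
open import Function.Base using (_∘_; _on_)
open import Function.Bundles using (_⇔_; mk⇔; Inverse; Equivalence)
open import Relation.Binary.Bundles using (Setoid)
import Relation.Binary.Construct.On as On
open import Relation.Binary.PropositionalEquality as ≡ using (_≡_; _≢_; _≗_)
import Relation.Binary.Reasoning.Setoid as SetoidReasoning
open import Relation.Nullary.Negation using (¬_)

Ring : Set₁
Ring = CommutativeRing 0ℓ 0ℓ

Grp : Set₁
Grp = Group 0ℓ 0ℓ

∣_∣ʳ : Ring → Set
∣ R ∣ʳ = CommutativeRing.Carrier R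

∣_∣ᵍ : Grp → Set
∣ G ∣ᵍ = Group.Carrier G

------------------------------------------------------------------------
-- Units, matrices, powers

module Units (M : Monoid 0ℓ 0ℓ) where
  open Monoid M

  record Unit : Set where
    no-eta-equality
    field
      val     : Carrier
      inv     : Carrier
      val∙inv : val ∙ inv ≈ ε
      inv∙val : inv ∙ val ≈ ε
  open Unit public

  infix 4 _≈ᵘ_
  record _≈ᵘ_ (x y : Unit) : Set where
    constructor mk≈ᵘ
    field
      val≈ : val x ≈ val y
  open _≈ᵘ_ public

  private
    cancel-middle : ∀ {a b c d} → b ∙ c ≈ ε → a ∙ d ≈ ε → (a ∙ b) ∙ (c ∙ d) ≈ ε
    cancel-middle {a} {b} {c} {d} bc ad = begin
      (a ∙ b) ∙ (c ∙ d) ≈⟨ assoc a b (c ∙ d) ⟩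
      a ∙ (b ∙ (c ∙ d)) ≈⟨ ∙-congˡ (assoc b c d) ⟨
      a ∙ ((b ∙ c) ∙ d) ≈⟨ ∙-congˡ (∙-congʳ bc) ⟩
      a ∙ (ε ∙ d)       ≈⟨ ∙-congˡ (identityˡ d) ⟩
      a ∙ d             ≈⟨ ad ⟩
      ε                 ∎
      where open SetoidReasoning setoid

    inv-unique : ∀ x y → val x ≈ val y → inv x ≈ inv y
    inv-unique x y x≈y = begin
      inv x                     ≈⟨ identityʳ (inv x) ⟨
      inv x ∙ ε                 ≈⟨ ∙-congˡ (val∙inv y) ⟨
      inv x ∙ (val y ∙ inv y)   ≈⟨ ∙-congˡ (∙-congʳ x≈y) ⟨
      inv x ∙ (val x ∙ inv y)   ≈⟨ assoc (inv x) (val x) (inv y) ⟨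
      (inv x ∙ val x) ∙ inv y   ≈⟨ ∙-congʳ (inv∙val x) ⟩
      ε ∙ inv y                 ≈⟨ identityˡ (inv y) ⟩
      inv y                     ∎
      where open SetoidReasoning setoid

  mulᵘ : Unit → Unit → Unit
  mulᵘ x y .val     = val x ∙ val y
  mulᵘ x y .inv     = inv y ∙ inv x
  mulᵘ x y .val∙inv = cancel-middle (val∙inv y) (val∙inv x)
  mulᵘ x y .inv∙val = cancel-middle (inv∙val x) (inv∙val y)

  εᵘ : Unit
  εᵘ .val     = ε
  εᵘ .inv     = ε
  εᵘ .val∙inv = identityˡ ε
  εᵘ .inv∙val = identityˡ ε

  invᵘ : Unit → Unit
  invᵘ x .val     = inv x
  invᵘ x .inv     = val x
  invᵘ x .val∙inv = inv∙val x
  invᵘ x .inv∙val = val∙inv x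

  group : Grp
  group = record
    { Carrier = Unit
    ; _≈_     = _≈ᵘ_
    ; _∙_     = mulᵘ
    ; ε       = εᵘ
    ; _⁻¹     = invᵘ
    ; isGroup = record
      { isMonoid = record
        { isSemigroup = record
          { isMagma = record
            { isEquivalence = record
              { refl  = mk≈ᵘ refl
              ; sym   = λ (mk≈ᵘ h) → mk≈ᵘ (sym h)
              ; trans = λ (mk≈ᵘ h) (mk≈ᵘ k) → mk≈ᵘ (trans h k)
              }
            ; ∙-cong = λ (mk≈ᵘ h) (mk≈ᵘ k) → mk≈ᵘ (∙-cong h k)
            }
          ; assoc = λ x y z → mk≈ᵘ (assoc (val x) (val y) (val z))
          }
        ; identity = (λ x → mk≈ᵘ (identityˡ (val x))) , (λ x → mk≈ᵘ (identityʳ (val x)))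
        }
      ; inverse = (λ x → mk≈ᵘ (inv∙val x)) , (λ x → mk≈ᵘ (val∙inv x))
      ; ⁻¹-cong = λ {x} {y} (mk≈ᵘ h) → mk≈ᵘ (inv-unique x y h)
      }
    }

open Units using (val; inv; val∙inv; inv∙val; mk≈ᵘ; val≈) public

-- The group Rˣ.
_ˣ : Ring → Grp
R ˣ = Units.group (CommutativeRing.*-monoid R)

module _ (G : Grp) where
  open Group G
  open RawMonoidDefs rawMonoid using () renaming (_×_ to _times_)

  power : Carrier → ℤ → Carrier
  power g (+ n)    = n times g
  power g -[1+ n ] = (ℕ.suc n times g) ⁻¹

module Matrices (R : Ring) where
  open CommutativeRing R hiding (zero)
  open Sum semiring using (sum; sum-cong-≋; sum-replicate-zero; *-distribˡ-sum; *-distribʳ-sum; ∑-comm)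
  private module Eq = SetoidReasoning setoid

  Mat : ℕ → Set
  Mat n = Fin n → Fin n → Carrier

  1M : ∀ {n} → Mat n
  1M zero    zero    = 1#
  1M zero    (suc j) = 0#
  1M (suc i) zero    = 0#
  1M (suc i) (suc j) = 1M i j

  mul : ∀ {n} → Mat n → Mat n → Mat n
  mul A B i k = sum (λ j → A i j * B j k)

  private
    sum-zero : ∀ {n} (t : Fin n → Carrier) → (∀ i → t i ≈ 0#) → sum t ≈ 0#
    sum-zero {n} t t≈0 = trans (sum-cong-≋ t≈0) (sum-replicate-zero n)

    mul-assoc : ∀ {n} (A B C : Mat n) i l → mul (mul A B) C i l ≈ mul A (mul B C) i l
    mul-assoc A B C i l = Eq.begin
      sum (λ k → sum (λ j → A i j * B j k) * C k l)
        Eq.≈⟨ sum-cong-≋ (λ k → *-distribʳ-sum (C k l) (λ j → A i j * B j k)) ⟩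
      sum (λ k → sum (λ j → A i j * B j k * C k l))
        Eq.≈⟨ ∑-comm (λ k j → A i j * B j k * C k l) ⟩
      sum (λ j → sum (λ k → A i j * B j k * C k l))
        Eq.≈⟨ sum-cong-≋ (λ j → sum-cong-≋ (λ k → *-assoc (A i j) (B j k) (C k l))) ⟩
      sum (λ j → sum (λ k → A i j * (B j k * C k l)))
        Eq.≈⟨ sum-cong-≋ (λ j → *-distribˡ-sum (A i j) (λ k → B j k * C k l)) ⟨
      sum (λ j → A i j * sum (λ k → B j k * C k l)) Eq.∎

    1M-left : ∀ {n} (v : Fin n → Carrier) i → sum (λ j → 1M i j * v j) ≈ v i
    1M-left v zero = Eq.begin
      1# * v zero + sum (λ j → 0# * v (suc j))
        Eq.≈⟨ +-cong (*-identityˡ (v zero)) (sum-zero _ (λ j → zeroˡ (v (suc j)))) ⟩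
      v zero + 0# Eq.≈⟨ +-identityʳ (v zero) ⟩
      v zero Eq.∎
    1M-left v (suc i) = Eq.begin
      0# * v zero + sum (λ j → 1M i j * v (suc j))
        Eq.≈⟨ +-cong (zeroˡ (v zero)) (1M-left (λ j → v (suc j)) i) ⟩
      0# + v (suc i) Eq.≈⟨ +-identityˡ (v (suc i)) ⟩
      v (suc i) Eq.∎

    1M-right : ∀ {n} (v : Fin n → Carrier) k → sum (λ j → v j * 1M j k) ≈ v k
    1M-right v zero = Eq.begin
      v zero * 1# + sum (λ j → v (suc j) * 0#)
        Eq.≈⟨ +-cong (*-identityʳ (v zero)) (sum-zero _ (λ j → zeroʳ (v (suc j)))) ⟩
      v zero + 0# Eq.≈⟨ +-identityʳ (v zero) ⟩
      v zero Eq.∎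
    1M-right v (suc k) = Eq.begin
      v zero * 0# + sum (λ j → v (suc j) * 1M j k)
        Eq.≈⟨ +-cong (zeroʳ (v zero)) (1M-right (λ j → v (suc j)) k) ⟩
      0# + v (suc k) Eq.≈⟨ +-identityˡ (v (suc k)) ⟩
      v (suc k) Eq.∎

  matrixMonoid : ℕ → Monoid 0ℓ 0ℓ
  matrixMonoid n = record
    { Carrier  = Mat n
    ; _≈_      = λ A B → ∀ i j → A i j ≈ B i j
    ; _∙_      = mul
    ; ε        = 1M
    ; isMonoid = record
      { isSemigroup = record
        { isMagma = record
          { isEquivalence = record
            { refl  = λ _ _ → CommutativeRing.refl R
            ; sym   = λ p i j → sym (p i j)
            ; trans = λ p q i j → trans (p i j) (q i j)
            }
          ; ∙-cong = λ p q i k → sum-cong-≋ (λ j → *-cong (p i j) (q j k))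
          }
        ; assoc = mul-assoc
        }
      ; identity = (λ A i k → 1M-left (λ j → A j k) i) , (λ A i k → 1M-right (λ j → A i j) k)
      }
    }

GL : ℕ → Ring → Grp
GL n R = Units.group (Matrices.matrixMonoid R n)

------------------------------------------------------------------------
-- Algebras and group functors

IsRingHom : (R S : Ring) → (∣ R ∣ʳ → ∣ S ∣ʳ) → Set
IsRingHom R S = RingMorphisms.IsRingHomomorphism (CommutativeRing.rawRing R) (CommutativeRing.rawRing S)

IsGroupHom : (G H : Grp) → (∣ G ∣ᵍ → ∣ H ∣ᵍ) → Set
IsGroupHom G H = GroupMorphisms.IsGroupHomomorphism (Group.rawGroup G) (Group.rawGroup H)

record Alg (k : Ring) : Set₁ where
  field
    ring         : Ring
    scalar       : ∣ k ∣ʳ → ∣ ring ∣ʳ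
    scalar-isHom : IsRingHom k ring scalar

  open CommutativeRing ring public hiding (ring)

base : (k : Ring) → Alg k
base k = record
  { ring         = k
  ; scalar       = λ a → a
  ; scalar-isHom = Identity.isRingHomomorphism (CommutativeRing.rawRing k) (CommutativeRing.refl k)
  }

module _ {k : Ring} where

  record AlgHom (A B : Alg k) : Set where
    private
      module A = Alg A
      module B = Alg B
    field
      fun      : A.Carrier → B.Carrier
      isHom    : IsRingHom A.ring B.ring fun
      commutes : ∀ a → fun (A.scalar a) B.≈ B.scalar a

    open RingMorphisms.IsRingHomomorphism isHom public

  open AlgHom using (fun) public

  idHom : (A : Alg k) → AlgHom A A
  idHom A = record
    { fun      = λ a → a
    ; isHom    = Identity.isRingHomomorphism (CommutativeRing.rawRing (Alg.ring A)) (Alg.refl A)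
    ; commutes = λ _ → Alg.refl A
    }

  compHom : {A B C : Alg k} → AlgHom A B → AlgHom B C → AlgHom A C
  compHom {C = C} f g = record
    { fun      = fun g ∘ fun f
    ; isHom    = Compose.isRingHomomorphism (Alg.trans C) (AlgHom.isHom f) (AlgHom.isHom g)
    ; commutes = λ a → Alg.trans C (AlgHom.⟦⟧-cong g (AlgHom.commutes f a)) (AlgHom.commutes g a)
    }

-- A K-algebra regarded as a k-algebra.
restrictAlg : {k : Ring} (K : Alg k) → Alg (Alg.ring K) → Alg k
restrictAlg K S = record
  { ring         = Alg.ring S
  ; scalar       = Alg.scalar S ∘ Alg.scalar K
  ; scalar-isHom = Compose.isRingHomomorphism (Alg.trans S) (Alg.scalar-isHom K) (Alg.scalar-isHom S)
  }

restrictHom : {k : Ring} (K : Alg k) {S S′ : Alg (Alg.ring K)} →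
              AlgHom S S′ → AlgHom (restrictAlg K S) (restrictAlg K S′)
restrictHom K f = record
  { fun      = fun f
  ; isHom    = AlgHom.isHom f
  ; commutes = λ a → AlgHom.commutes f (Alg.scalar K a)
  }

record GroupFunctor (k : Ring) : Set₁ where
  field
    points : Alg k → Grp

  private module P (A : Alg k) = Group (points A)

  field
    map       : {A B : Alg k} → AlgHom A B → P.Carrier A → P.Carrier B
    map-isHom : {A B : Alg k} (f : AlgHom A B) → IsGroupHom (points A) (points B) (map f)
    map-cong  : {A B : Alg k} {f g : AlgHom A B} →
                (∀ a → Alg._≈_ B (fun f a) (fun g a)) → ∀ x → P._≈_ B (map f x) (map g x)
    map-id    : {A : Alg k} (x : P.Carrier A) → P._≈_ A (map (idHom A) x) x
    map-comp  : {A B C : Alg k} (f : AlgHom A B) (g : AlgHom B C) (x : P.Carrier A) →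
                P._≈_ C (map (compHom f g) x) (map g (map f x))

open GroupFunctor public using (points)

restrict : {k : Ring} (K : Alg k) → GroupFunctor k → GroupFunctor (Alg.ring K)
restrict K G = record
  { points    = λ S → points G (restrictAlg K S)
  ; map       = λ f → GroupFunctor.map G (restrictHom K f)
  ; map-isHom = λ f → GroupFunctor.map-isHom G (restrictHom K f)
  ; map-cong  = GroupFunctor.map-cong G
  ; map-id    = λ {S} x → Group.trans (points G (restrictAlg K S))
                  (GroupFunctor.map-cong G (λ _ → Alg.refl S) x)
                  (GroupFunctor.map-id G x)
  ; map-comp  = λ {_} {_} {C} f g x → Group.trans (points G (restrictAlg K C))
                  (GroupFunctor.map-cong G (λ _ → Alg.refl C) x)
                  (GroupFunctor.map-comp G (restrictHom K f) (restrictHom K g) x)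
  }

record _⟹_ {k : Ring} (F G : GroupFunctor k) : Set₁ where
  private
    module F = GroupFunctor F
    module G = GroupFunctor G
  field
    at      : (A : Alg k) → ∣ points F A ∣ᵍ → ∣ points G A ∣ᵍ
    isHom   : (A : Alg k) → IsGroupHom (points F A) (points G A) (at A)
    natural : {A B : Alg k} (f : AlgHom A B) (x : ∣ points F A ∣ᵍ) →
              Group._≈_ (points G B) (at B (F.map f x)) (G.map f (at A x))

open _⟹_ public using (at)

Monic : {k : Ring} {F G : GroupFunctor k} → F ⟹ G → Set₁
Monic {k} {F} {G} η = (A : Alg k) (x y : ∣ points F A ∣ᵍ) →
  Group._≈_ (points G A) (at η A x) (at η A y) → Group._≈_ (points F A) x y

------------------------------------------------------------------------
-- The group functors 𝔾ₐ, 𝔾ₘʳ and GLₙ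

𝔾ₐ : (k : Ring) → GroupFunctor k
𝔾ₐ k = record
  { points    = λ A → Alg.+-group A
  ; map       = fun
  ; map-isHom = AlgHom.+-isGroupHomomorphism
  ; map-cong  = λ f≈g → f≈g
  ; map-id    = λ {A} _ → Alg.refl A
  ; map-comp  = λ {_} {_} {C} _ _ _ → Alg.refl C
  }

-- A monoid homomorphism induces a homomorphism of unit groups.
module _ (M N : Monoid 0ℓ 0ℓ) (f : Monoid.Carrier M → Monoid.Carrier N)
         (f-isHom : MonoidMorphisms.IsMonoidHomomorphism (Monoid.rawMonoid M) (Monoid.rawMonoid N) f) where
  private
    module N = Monoid N
    open MonoidMorphisms.IsMonoidHomomorphism f-isHom

    f-inverse : ∀ {a b} → Monoid._≈_ M (Monoid._∙_ M a b) (Monoid.ε M) → (f a N.∙ f b) N.≈ N.ε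
    f-inverse ab≈ε = N.trans (N.sym (homo _ _)) (N.trans (⟦⟧-cong ab≈ε) ε-homo)

  mapUnit : Units.Unit M → Units.Unit N
  mapUnit x .val     = f (val x)
  mapUnit x .inv     = f (inv x)
  mapUnit x .val∙inv = f-inverse (val∙inv x)
  mapUnit x .inv∙val = f-inverse (inv∙val x)

  mapUnit-isHom : IsGroupHom (Units.group M) (Units.group N) mapUnit
  mapUnit-isHom = record
    { isMonoidHomomorphism = record
      { isMagmaHomomorphism = record
        { isRelHomomorphism = record { cong = λ (mk≈ᵘ h) → mk≈ᵘ (⟦⟧-cong h) }
        ; homo              = λ x y → mk≈ᵘ (homo (val x) (val y))
        }
      ; ε-homo = mk≈ᵘ ε-homo
      }
    ; ⁻¹-homo = λ _ → mk≈ᵘ N.refl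
    }

module _ {R S : Ring} (f : ∣ R ∣ʳ → ∣ S ∣ʳ) (f-isHom : IsRingHom R S f) where
  open RingMorphisms.IsRingHomomorphism f-isHom
  private
    module R = CommutativeRing R
    module S = CommutativeRing S
    module MR = Matrices R
    module MS = Matrices S
    module ΣR = Sum R.semiring
    module ΣS = Sum S.semiring

    sum-homo : ∀ {n} (t : Fin n → R.Carrier) → f (ΣR.sum t) S.≈ ΣS.sum (λ i → f (t i))
    sum-homo {ℕ.zero}  t = 0#-homo
    sum-homo {ℕ.suc n} t = S.trans (+-homo _ _) (S.+-congˡ (sum-homo (λ i → t (suc i))))

    1M-homo : ∀ {n} (i j : Fin n) → f (MR.1M i j) S.≈ MS.1M i j
    1M-homo zero    zero    = 1#-homo
    1M-homo zero    (suc j) = 0#-homo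
    1M-homo (suc i) zero    = 0#-homo
    1M-homo (suc i) (suc j) = 1M-homo i j

    mat-isHom : ∀ n → MonoidMorphisms.IsMonoidHomomorphism
      (Monoid.rawMonoid (MR.matrixMonoid n)) (Monoid.rawMonoid (MS.matrixMonoid n)) (λ A i j → f (A i j))
    mat-isHom n = record
      { isMagmaHomomorphism = record
        { isRelHomomorphism = record { cong = λ p i j → ⟦⟧-cong (p i j) }
        ; homo = λ A B i k → S.trans (sum-homo (λ j → A i j R.* B j k))
                                     (ΣS.sum-cong-≋ (λ j → *-homo (A i j) (B j k)))
        }
      ; ε-homo = 1M-homo
      }

  mapˣ : ∣ R ˣ ∣ᵍ → ∣ S ˣ ∣ᵍ
  mapˣ = mapUnit R.*-monoid S.*-monoid f *-isMonoidHomomorphism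

  mapˣ-isHom : IsGroupHom (R ˣ) (S ˣ) mapˣ
  mapˣ-isHom = mapUnit-isHom R.*-monoid S.*-monoid f *-isMonoidHomomorphism

  mapGL : ∀ {n} → ∣ GL n R ∣ᵍ → ∣ GL n S ∣ᵍ
  mapGL {n} = mapUnit (MR.matrixMonoid n) (MS.matrixMonoid n) _ (mat-isHom n)

  mapGL-isHom : ∀ n → IsGroupHom (GL n R) (GL n S) mapGL
  mapGL-isHom n = mapUnit-isHom (MR.matrixMonoid n) (MS.matrixMonoid n) _ (mat-isHom n)

private
  pointwise-isHom : {I : Set} (G H : Grp) (f : ∣ G ∣ᵍ → ∣ H ∣ᵍ) → IsGroupHom G H f →
                    IsGroupHom (Pointwise.group I G) (Pointwise.group I H) (λ t i → f (t i))
  pointwise-isHom G H f f-isHom = record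
    { isMonoidHomomorphism = record
      { isMagmaHomomorphism = record
        { isRelHomomorphism = record { cong = λ p i → ⟦⟧-cong (p i) }
        ; homo              = λ s t i → homo (s i) (t i)
        }
      ; ε-homo = λ _ → ε-homo
      }
    ; ⁻¹-homo = λ t i → ⁻¹-homo (t i)
    }
    where open GroupMorphisms.IsGroupHomomorphism f-isHom

𝔾ₘ^ : ℕ → (k : Ring) → GroupFunctor k
𝔾ₘ^ r k = record
  { points    = λ A → Pointwise.group (Fin r) (Alg.ring A ˣ)
  ; map       = λ {A} {B} f t i → mapˣ {Alg.ring A} {Alg.ring B} (fun f) (AlgHom.isHom f) (t i)
  ; map-isHom = λ {A} {B} f →
      pointwise-isHom (Alg.ring A ˣ) (Alg.ring B ˣ) _ (mapˣ-isHom {Alg.ring A} {Alg.ring B} (fun f) (AlgHom.isHom f))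
  ; map-cong  = λ f≈g t i → mk≈ᵘ (f≈g (val (t i)))
  ; map-id    = λ {A} _ _ → mk≈ᵘ (Alg.refl A)
  ; map-comp  = λ {_} {_} {C} _ _ _ _ → mk≈ᵘ (Alg.refl C)
  }

GLᶠ : ℕ → (k : Ring) → GroupFunctor k
GLᶠ n k = record
  { points    = λ A → GL n (Alg.ring A)
  ; map       = λ f → mapGL (fun f) (AlgHom.isHom f)
  ; map-isHom = λ f → mapGL-isHom (fun f) (AlgHom.isHom f) n
  ; map-cong  = λ f≈g x → mk≈ᵘ (λ i j → f≈g (val x i j))
  ; map-id    = λ {A} _ → mk≈ᵘ (λ _ _ → Alg.refl A)
  ; map-comp  = λ {_} {_} {C} _ _ _ → mk≈ᵘ (λ _ _ → Alg.refl C)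
  }

------------------------------------------------------------------------
-- Affine group schemes

-- Representability; 𝒪 is the coordinate ring.
record Affine {k : Ring} (G : GroupFunctor k) : Set₁ where
  open GroupFunctor G using (map)
  field
    𝒪          : Alg k
    universal  : ∣ points G 𝒪 ∣ᵍ
    classify   : {A : Alg k} → ∣ points G A ∣ᵍ → AlgHom 𝒪 A
    classifies : {A : Alg k} (x : ∣ points G A ∣ᵍ) →
                 Group._≈_ (points G A) (map (classify {A} x) universal) x
    unique     : {A : Alg k} (f g : AlgHom 𝒪 A) →
                 Group._≈_ (points G A) (map f universal) (map g universal) →
                 ∀ a → Alg._≈_ A (fun f a) (fun g a)

-- The subalgebra generated by a family of elements.
data Adjoin {k : Ring} (A : Alg k) {n : ℕ} (gens : Fin n → Alg.Carrier A) : Alg.Carrier A → Set where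
  generator : ∀ i → Adjoin A gens (gens i)
  constant  : ∀ c → Adjoin A gens (Alg.scalar A c)
  plus      : ∀ {a b} → Adjoin A gens a → Adjoin A gens b → Adjoin A gens (Alg._+_ A a b)
  times     : ∀ {a b} → Adjoin A gens a → Adjoin A gens b → Adjoin A gens (Alg._*_ A a b)
  respects  : ∀ {a b} → Alg._≈_ A a b → Adjoin A gens a → Adjoin A gens b

FiniteType : {k : Ring} → Alg k → Set
FiniteType A = ∃[ n ] Σ[ gens ∈ (Fin n → Alg.Carrier A) ] ∀ a → Adjoin A gens a

-- Spec A is connected: the only idempotents are 0 and 1.
Connected : {k : Ring} → Alg k → Set
Connected A = ∀ e → e * e ≈ e → e ≈ 0# ⊎ e ≈ 1#
  where open Alg A

IsField : Ring → Set
IsField K = ¬ 1# ≈ 0# × (∀ a → ¬ a ≈ 0# → ∃[ b ] a * b ≈ 1#)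
  where open CommutativeRing K

-- Over a field, a monomorphism of affine group schemes is a closed immersion, so this
-- says that U is isomorphic to a closed subgroup of the group of upper unitriangular matrices.
Unipotent : {K : Ring} → GroupFunctor K → Set₁
Unipotent {K} U = Σ[ n ∈ ℕ ] Σ[ ρ ∈ U ⟹ GLᶠ n K ] Monic ρ ×
  ((A : Alg K) (x : ∣ points U A ∣ᵍ) → let open Alg A in
    (∀ i → val (at ρ A x) i i ≈ 1#) × (∀ i j → j Fin.< i → val (at ρ A x) i j ≈ 0#))

-- The geometric unipotent radical is trivial: over every extension field K there is no
-- nontrivial normal unipotent closed subgroup.  Smoothness and connectedness of U are not
-- required, being automatic in characteristic 0.
Reductive : {k : Ring} → GroupFunctor k → Set₁
Reductive {k} G = (K : Alg k) → IsField (Alg.ring K) →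
  (U : GroupFunctor (Alg.ring K)) → Affine U → Unipotent U →
  (j : U ⟹ restrict K G) → Monic j →
  (∀ A g u → let open Group (points (restrict K G) A) in ∃[ u′ ] ((g ∙ at j A u) ∙ g ⁻¹) ≈ at j A u′) →
  ∀ A u → Group._≈_ (points U A) u (Group.ε (points U A))

-- Over every extension field K, each torus containing T is contained in T.  (Over an
-- algebraically closed K every torus is split, so this is maximality among all tori.)
MaximalTorus : {k : Ring} (G : GroupFunctor k) (r : ℕ) → 𝔾ₘ^ r k ⟹ G → Set₁
MaximalTorus {k} G r T = (K : Alg k) → IsField (Alg.ring K) →
  (s : ℕ) (T′ : 𝔾ₘ^ s (Alg.ring K) ⟹ restrict K G) → Monic T′ →
  (∀ A t → ∃[ t′ ] Group._≈_ (points (restrict K G) A) (at T′ A t′) (at T (restrictAlg K A) t)) →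
  (∀ A t′ → ∃[ t ] Group._≈_ (points (restrict K G) A) (at T′ A t′) (at T (restrictAlg K A) t))

-- A connected reductive group scheme over a field k of characteristic 0 together with a
-- split maximal torus T.
record SplitReductiveGroup (k : Ring) : Set₁ where
  field
    scheme     : GroupFunctor k
    affine     : Affine scheme
    finiteType : FiniteType (Affine.𝒪 affine)
    connected  : Connected (Affine.𝒪 affine)
    reductive  : Reductive scheme
    rank       : ℕ
    T          : 𝔾ₘ^ rank k ⟹ scheme
    T-monic    : Monic T
    T-maximal  : MaximalTorus scheme rank T

------------------------------------------------------------------------
-- Characters and cocharacters of 𝔾ₘʳ

Lattice : ℕ → Set
Lattice r = Fin r → ℤ

⟪_,_⟫ : ∀ {r} → Lattice r → Lattice r → ℤ
⟪ χ , μ ⟫ = RawMonoidDefs.sum ℤ.+-0-rawMonoid (λ i → χ i ℤ.* μ i)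

character : ∀ {r} (R : Ring) → Lattice r → (Fin r → ∣ R ˣ ∣ᵍ) → ∣ R ˣ ∣ᵍ
character R χ t = RawMonoidDefs.sum (Group.rawMonoid (R ˣ)) (λ i → power (R ˣ) (t i) (χ i))

cocharacter : ∀ {r} (R : Ring) → Lattice r → ∣ R ˣ ∣ᵍ → (Fin r → ∣ R ˣ ∣ᵍ)
cocharacter R μ s i = power (R ˣ) s (μ i)

------------------------------------------------------------------------
-- Subgroups

conj : (G : Grp) → ∣ G ∣ᵍ → ∣ G ∣ᵍ → ∣ G ∣ᵍ
conj G g x = (g ∙ x) ∙ g ⁻¹
  where open Group G

data Generated (G : Grp) (P : ∣ G ∣ᵍ → Set) : ∣ G ∣ᵍ → Set where
  member   : ∀ {g} → P g → Generated G P g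
  identity : Generated G P (Group.ε G)
  product  : ∀ {g h} → Generated G P g → Generated G P h → Generated G P (Group._∙_ G g h)
  inverse  : ∀ {g} → Generated G P g → Generated G P (Group._⁻¹ G g)
  respects : ∀ {g h} → Group._≈_ G g h → Generated G P g → Generated G P h

------------------------------------------------------------------------
-- Roots and Chevalley systems

module _ {k : Ring} (𝐆 : SplitReductiveGroup k) where
  open SplitReductiveGroup 𝐆
  private module G (A : Alg k) = Group (points scheme A)

  -- Conjugation by T acts on the image of y through the character χ.
  HasWeight : Lattice rank → 𝔾ₐ k ⟹ scheme → Set₁
  HasWeight χ y = ∀ A t u → let open G A in
    conj (points scheme A) (at T A t) (at y A u) ≈ at y A (Alg._*_ A (val (character (Alg.ring A) χ t)) u)

  -- By x and complete, the roots are the nonzero characters of T that occur as weights of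
  -- one-parameter unipotent subgroups; x α parametrises the root subgroup of α.
  record RootDatum : Set₁ where
    field
      #Φ             : ℕ
      root           : Fin #Φ → Lattice rank
      root-injective : ∀ α β → root α ≗ root β → α ≡ β
      root-nonzero   : ∀ α → ¬ (∀ i → root α i ≡ 0ℤ)
      x              : Fin #Φ → 𝔾ₐ k ⟹ scheme
      x-monic        : ∀ α → Monic (x α)
      x-weight       : ∀ α → HasWeight (root α) (x α)
      complete       : ∀ χ (y : 𝔾ₐ k ⟹ scheme) → Monic y → HasWeight χ y →
                       ¬ (∀ i → χ i ≡ 0ℤ) → ∃[ α ] root α ≗ χ
      coroot         : Fin #Φ → Lattice rank
      pairing-two    : ∀ α → ⟪ root α , coroot α ⟫ ≡ + 2
      reflect        : Fin #Φ → Fin #Φ → Fin #Φ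
      root-reflect   : ∀ α β i → root (reflect α β) i ≡ root β i ℤ.- ⟪ root β , coroot α ⟫ ℤ.* root α i
      coroot-reflect : ∀ α β i → coroot (reflect α β) i ≡ coroot β i ℤ.- ⟪ root α , coroot β ⟫ ℤ.* coroot α i
      reduced        : ∀ α β (m n : ℤ) → m ≢ 0ℤ → (∀ i → m ℤ.* root β i ≡ n ℤ.* root α i) →
                       β ≡ α ⊎ β ≡ reflect α α

    Φ : Set
    Φ = Fin #Φ

    neg : Φ → Φ
    neg α = reflect α α

    -- The representative of the reflection in α given by x α and x (neg α).
    w : Φ → ∀ A → G.Carrier A
    w α A = (at (x α) A 1# ∙ at (x (neg α)) A (- 1#)) ∙ at (x α) A 1#
      where
      open G A
      open Alg A using (1#; -_)

    productOver : ∀ A → List Φ → (Φ → Alg.Carrier A) → G.Carrier A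
    productOver A L u = foldr (λ α g → at (x α) A (u α) ∙ g) ε L
      where open G A

    -- A factor x γ (coeff · uⁱvʲ), γ = iα + jβ, of the commutator of x α u and x β v.
    record CommutatorTerm (α β : Φ) : Set where
      field
        i j   : ℕ
        i>0   : 0 ℕ.< i
        j>0   : 0 ℕ.< j
        γ     : Φ
        coeff : ℤ
        sum-γ : ∀ l → root γ l ≡ + i ℤ.* root α l ℤ.+ + j ℤ.* root β l

      value : ∀ A → Alg.Carrier A → Alg.Carrier A → G.Carrier A
      value A u v = at (x γ) A (power (Alg.+-group A) (u ^ i * v ^ j) coeff)
        where
        open Alg A using (_*_)
        open Exp (Alg.semiring A) using (_^_)

  open RootDatum using (Φ; #Φ; root; x)

  -- The sets Φ⁺ = {α : ⟨α, ℓ⟩ > 0} for a cocharacter ℓ on no root hyperplane.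
  record PositiveSystem (R : RootDatum) : Set where
    field
      ℓ       : Lattice rank
      regular : ∀ α → ⟪ root R α , ℓ ⟫ ≢ 0ℤ

    Positive Negative : Φ R → Set
    Positive α = 0ℤ ℤ.< ⟪ root R α , ℓ ⟫
    Negative α = ⟪ root R α , ℓ ⟫ ℤ.< 0ℤ

    positives : List (Φ R)
    positives = filter (λ α → 0ℤ ℤP.<? ⟪ root R α , ℓ ⟫) (allFin (#Φ R))

  open PositiveSystem

  rootSubgroup : (R : RootDatum) (A : Alg k) → Φ R → G.Carrier A → Set
  rootSubgroup R A α g = ∃[ u ] G._≈_ A g (at (x R α) A u)

  -- The subgroup of G(A) generated by the root subgroups of the roots in S.
  rootGenerated : (R : RootDatum) (A : Alg k) (S : Φ R → Set) → G.Carrier A → Set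
  rootGenerated R A S = Generated (points scheme A) (λ g → ∃[ α ] S α × rootSubgroup R A α g)

  -- The normalizer N(T) in G(k).
  NormalisesT : G.Carrier (base k) → Set
  NormalisesT m = ∀ t → (∃[ t′ ] conj (points scheme _) m (at T _ t) ≈ at T _ t′)
                      × (∃[ t′ ] conj (points scheme _) (m ⁻¹) (at T _ t) ≈ at T _ t′)
    where open G (base k)

  -- A Chevalley system: parametrisations x of the root subgroups, normalised as in
  -- SGA 3, Exp. XXIII, with the accompanying standard relations.  Every split group has one.
  record ChevalleySystem (R : RootDatum) : Set₁ where
    open RootDatum R using (neg; w; productOver; CommutatorTerm; reflect; coroot) renaming (x to xₐ)
    field
      opposite   : ∀ α A u v (d : ∣ Alg.ring A ˣ ∣ᵍ) →
                   let open G A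
                       open Alg A using (_+_; _*_; 1#)
                   in
                   Alg._≈_ A (val d) (1# + u * v) →
                   at (xₐ α) A u ∙ at (xₐ (neg α)) A v ≈
                   (at (xₐ (neg α)) A (inv d * v) ∙ at T A (cocharacter (Alg.ring A) (coroot α) d))
                     ∙ at (xₐ α) A (inv d * u)

      commutator : ∀ α β → β ≢ α → β ≢ neg α → Σ[ terms ∈ List (CommutatorTerm α β) ]
                   (∀ A u v → let open G A in
                     conj (points scheme A) (at (xₐ α) A u) (at (xₐ β) A v) ∙ at (xₐ β) A v ⁻¹ ≈
                     foldr (λ c g → CommutatorTerm.value c A u v ∙ g) ε terms)

      weyl       : ∀ α β →
                   (∀ A u → let open G A in
                     conj (points scheme A) (w α A) (at (xₐ β) A u) ≈ at (xₐ (reflect α β)) A u)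
                   ⊎ (∀ A u → let open G A in
                     conj (points scheme A) (w α A) (at (xₐ β) A u) ≈ at (xₐ (reflect α β)) A (Alg.-_ A u))

      -- N(T)/T is generated by the reflections.
      normaliser : ∀ m → NormalisesT m → let open G (base k) in
                   ∃[ t ] Σ[ L ∈ List (Φ R) ] m ≈ at T _ t ∙ foldr (λ α g → w α _ ∙ g) ε L

      -- The product map from the root subgroups of Φ⁺, in any order, to the group they
      -- generate is bijective.
      factor     : ∀ (Ψ : PositiveSystem R) A L → L ↭ positives Ψ →
                   ∀ g → rootGenerated R A (Positive Ψ) g → ∃[ u ] G._≈_ A g (productOver A L u)
      factor-unique : ∀ (Ψ : PositiveSystem R) A L → L ↭ positives Ψ → ∀ u v →
                   G._≈_ A (productOver A L u) (productOver A L v) →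
                   ∀ α → Positive Ψ α → Alg._≈_ A (u α) (v α)

      -- N⁻ × T × N → G is injective.
      bigCell    : ∀ (Ψ : PositiveSystem R) A n⁻ t n → let open G A in
                   rootGenerated R A (Negative Ψ) n⁻ → rootGenerated R A (Positive Ψ) n →
                   (n⁻ ∙ at T A t) ∙ n ≈ ε →
                   n⁻ ≈ ε × at T A t ≈ ε × n ≈ ε

------------------------------------------------------------------------
-- p-adic numbers

-- ℤ_p as the inverse limit of the rings ℤ/pⁿ.
module _ (p : ℕ) where
  open ≡ using (refl; subst; sym)

  record PadicInteger : Set where
    field
      approx   : ℕ → ℤ
      coherent : ∀ n → + (p ℕ.^ n) ∣ approx (ℕ.suc n) ℤ.- approx n
  open PadicInteger

  infix 4 _≋_
  record _≋_ (a b : PadicInteger) : Set where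
    constructor mk≋
    field
      congruent : ∀ n → + (p ℕ.^ n) ∣ approx a n ℤ.- approx b n

  private
    ∣-subst : ∀ {d m n} → m ≡ n → d ∣ m → d ∣ n
    ∣-subst {d} = subst (d ∣_)

    ∣0 : ∀ {d} → d ∣ + 0
    ∣0 = divides (+ 0) refl

    +-diff : ∀ a b c d → (a ℤ.- b) ℤ.+ (c ℤ.- d) ≡ (a ℤ.+ c) ℤ.- (b ℤ.+ d)
    +-diff = ℤ-solve-∀

    *-diff : ∀ a b c d → (a ℤ.- b) ℤ.* c ℤ.+ b ℤ.* (c ℤ.- d) ≡ a ℤ.* c ℤ.- b ℤ.* d
    *-diff = ℤ-solve-∀

    neg-diff : ∀ a b → ℤ.- (a ℤ.- b) ≡ ℤ.- a ℤ.- ℤ.- b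
    neg-diff = ℤ-solve-∀

    flip-diff : ∀ a b → ℤ.- (a ℤ.- b) ≡ b ℤ.- a
    flip-diff = ℤ-solve-∀

    trans-diff : ∀ a b c → (a ℤ.- b) ℤ.+ (b ℤ.- c) ≡ a ℤ.- c
    trans-diff = ℤ-solve-∀

    ∣-+ : ∀ {e} a b c d → e ∣ a ℤ.- b → e ∣ c ℤ.- d → e ∣ (a ℤ.+ c) ℤ.- (b ℤ.+ d)
    ∣-+ a b c d h k = ∣-subst (+-diff a b c d) (∣m∣n⇒∣m+n h k)

    ∣-* : ∀ {e} a b c d → e ∣ a ℤ.- b → e ∣ c ℤ.- d → e ∣ a ℤ.* c ℤ.- b ℤ.* d
    ∣-* a b c d h k = ∣-subst (*-diff a b c d) (∣m∣n⇒∣m+n (∣m⇒∣m*n c h) (∣n⇒∣m*n b k))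

    ∣-neg : ∀ {e} a b → e ∣ a ℤ.- b → e ∣ ℤ.- a ℤ.- ℤ.- b
    ∣-neg a b h = ∣-subst (neg-diff a b) (∣m⇒∣-m h)

    pointwise : ∀ {d} {a b : ℤ} → a ≡ b → d ∣ a ℤ.- b
    pointwise {a = a} refl = ∣-subst (sym (ℤP.+-inverseʳ a)) ∣0

  fromℤ : ℤ → PadicInteger
  fromℤ m = record { approx = λ _ → m ; coherent = λ _ → pointwise {a = m} refl }

  private
    _+ₚ_ _*ₚ_ : PadicInteger → PadicInteger → PadicInteger
    a +ₚ b = record
      { approx   = λ n → approx a n ℤ.+ approx b n
      ; coherent = λ n → ∣-+ (approx a (ℕ.suc n)) (approx a n) _ _ (coherent a n) (coherent b n)
      }
    a *ₚ b = record
      { approx   = λ n → approx a n ℤ.* approx b n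
      ; coherent = λ n → ∣-* (approx a (ℕ.suc n)) (approx a n) _ _ (coherent a n) (coherent b n)
      }

    -ₚ_ : PadicInteger → PadicInteger
    -ₚ a = record
      { approx   = λ n → ℤ.- approx a n
      ; coherent = λ n → ∣-neg (approx a (ℕ.suc n)) (approx a n) (coherent a n)
      }

  ℤₚ-ring : Ring
  ℤₚ-ring = record
    { Carrier = PadicInteger
    ; _≈_ = _≋_
    ; _+_ = _+ₚ_
    ; _*_ = _*ₚ_
    ; -_  = -ₚ_
    ; 0#  = fromℤ (+ 0)
    ; 1#  = fromℤ (+ 1)
    ; isCommutativeRing = record
      { isRing = record
        { +-isAbelianGroup = record
          { isGroup = record
            { isMonoid = record
              { isSemigroup = record
                { isMagma = record
                  { isEquivalence = record
                    { refl  = λ {a} → mk≋ λ n → pointwise {a = approx a n} refl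
                    ; sym   = λ {a} {b} (mk≋ h) → mk≋ λ n → ∣-subst (flip-diff (approx a n) (approx b n)) (∣m⇒∣-m (h n))
                    ; trans = λ {a} {b} {c} (mk≋ h) (mk≋ k) → mk≋ λ n →
                        ∣-subst (trans-diff (approx a n) (approx b n) (approx c n)) (∣m∣n⇒∣m+n (h n) (k n))
                    }
                  ; ∙-cong = λ {a} {b} {c} {d} (mk≋ h) (mk≋ k) → mk≋ λ n → ∣-+ (approx a n) (approx b n) (approx c n) (approx d n) (h n) (k n)
                  }
                ; assoc = λ a b c → mk≋ λ n → pointwise (ℤP.+-assoc (approx a n) (approx b n) (approx c n))
                }
              ; identity = (λ a → mk≋ λ n → pointwise (ℤP.+-identityˡ (approx a n))) , (λ a → mk≋ λ n → pointwise (ℤP.+-identityʳ (approx a n)))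
              }
            ; inverse = (λ a → mk≋ λ n → pointwise (ℤP.+-inverseˡ (approx a n))) , (λ a → mk≋ λ n → pointwise (ℤP.+-inverseʳ (approx a n)))
            ; ⁻¹-cong = λ {a} {b} (mk≋ h) → mk≋ λ n → ∣-neg (approx a n) (approx b n) (h n)
            }
          ; comm = λ a b → mk≋ λ n → pointwise (ℤP.+-comm (approx a n) (approx b n))
          }
        ; *-cong = λ {a} {b} {c} {d} (mk≋ h) (mk≋ k) → mk≋ λ n → ∣-* (approx a n) (approx b n) (approx c n) (approx d n) (h n) (k n)
        ; *-assoc = λ a b c → mk≋ λ n → pointwise (ℤP.*-assoc (approx a n) (approx b n) (approx c n))
        ; *-identity = (λ a → mk≋ λ n → pointwise (ℤP.*-identityˡ (approx a n))) , (λ a → mk≋ λ n → pointwise (ℤP.*-identityʳ (approx a n)))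
        ; distrib = (λ a b c → mk≋ λ n → pointwise (ℤP.*-distribˡ-+ (approx a n) (approx b n) (approx c n)))
                  , (λ a b c → mk≋ λ n → pointwise (ℤP.*-distribʳ-+ (approx a n) (approx b n) (approx c n)))
        }
      ; *-comm = λ a b → mk≋ λ n → pointwise (ℤP.*-comm (approx a n) (approx b n))
      }
    }

-- The localisation R[1/f]; (a , k) stands for a / fᵏ.
module Localisation (R : Ring) (f : ∣ R ∣ʳ) where
  open CommutativeRing R hiding (refl; sym; trans)
  open ≡ using (refl; sym)
  private
    module R = CommutativeRing R
    module Eq = SetoidReasoning setoid
  open Exp semiring using (_^_; ^-homo-*)

  record Fraction : Set where
    constructor _/^_
    field
      num : Carrier
      den : ℕ
  open Fraction

  infix 4 _∼_
  record _∼_ (x y : Fraction) : Set where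
    constructor _,_
    field
      expand : ℕ
      agree  : f ^ expand * (f ^ den y * num x) ≈ f ^ expand * (f ^ den x * num y)

  private
    open import Algebra.Solver.Ring.NaturalCoefficients.Default commutativeSemiring
      using (solve; _:=_; _:+_; _:*_)
    open RingProperties R.ring using (-‿distribʳ-*)

    exp : ∀ m n → f ^ (m ℕ.+ n) ≈ f ^ m * f ^ n
    exp = ^-homo-* f

    -- Fractions that agree after expanding a common power of f.
    equal : ∀ {x y} → f ^ den y * num x ≈ f ^ den x * num y → x ∼ y
    equal h = 0 , *-congˡ h

    ∼-trans : ∀ {x y z} → x ∼ y → y ∼ z → x ∼ z
    ∼-trans {a /^ k} {b /^ l} {c /^ m} (s , p) (t , q) = (s ℕ.+ t) ℕ.+ l , (Eq.begin
      f ^ ((s ℕ.+ t) ℕ.+ l) * (f ^ m * a)          Eq.≈⟨ *-congʳ split ⟩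
      ((f ^ s * f ^ t) * f ^ l) * (f ^ m * a)       Eq.≈⟨ step₁ (f ^ s) (f ^ t) (f ^ l) (f ^ m) a ⟩
      (f ^ t * f ^ m) * (f ^ s * (f ^ l * a))       Eq.≈⟨ *-congˡ p ⟩
      (f ^ t * f ^ m) * (f ^ s * (f ^ k * b))       Eq.≈⟨ step₂ (f ^ s) (f ^ t) (f ^ k) (f ^ m) b ⟩
      (f ^ s * f ^ k) * (f ^ t * (f ^ m * b))       Eq.≈⟨ *-congˡ q ⟩
      (f ^ s * f ^ k) * (f ^ t * (f ^ l * c))       Eq.≈⟨ step₃ (f ^ s) (f ^ t) (f ^ l) (f ^ k) c ⟩
      ((f ^ s * f ^ t) * f ^ l) * (f ^ k * c)       Eq.≈⟨ *-congʳ split ⟨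
      f ^ ((s ℕ.+ t) ℕ.+ l) * (f ^ k * c)          Eq.∎)
      where
      split : f ^ ((s ℕ.+ t) ℕ.+ l) ≈ (f ^ s * f ^ t) * f ^ l
      split = R.trans (exp (s ℕ.+ t) l) (*-congʳ (exp s t))
      step₁ : ∀ s t l m a → ((s * t) * l) * (m * a) ≈ (t * m) * (s * (l * a))
      step₁ = solve 5 (λ s t l m a → ((s :* t) :* l) :* (m :* a) := (t :* m) :* (s :* (l :* a))) R.refl
      step₂ : ∀ s t k m b → (t * m) * (s * (k * b)) ≈ (s * k) * (t * (m * b))
      step₂ = solve 5 (λ s t k m b → (t :* m) :* (s :* (k :* b)) := (s :* k) :* (t :* (m :* b))) R.refl
      step₃ : ∀ s t l k c → (s * k) * (t * (l * c)) ≈ ((s * t) * l) * (k * c)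
      step₃ = solve 5 (λ s t l k c → (s :* k) :* (t :* (l :* c)) := ((s :* t) :* l) :* (k :* c)) R.refl

    _+ᶠ_ _*ᶠ_ : Fraction → Fraction → Fraction
    (a /^ k) +ᶠ (b /^ l) = (f ^ l * a + f ^ k * b) /^ (k ℕ.+ l)
    (a /^ k) *ᶠ (b /^ l) = (a * b) /^ (k ℕ.+ l)

    -ᶠ_ : Fraction → Fraction
    -ᶠ (a /^ k) = (- a) /^ k

    +ᶠ-cong : ∀ {x y u v} → x ∼ y → u ∼ v → (x +ᶠ u) ∼ (y +ᶠ v)
    +ᶠ-cong {a /^ k} {b /^ l} {c /^ m} {e /^ n} (s , p) (t , q) = s ℕ.+ t , (Eq.begin
      f ^ (s ℕ.+ t) * (f ^ (l ℕ.+ n) * (f ^ m * a + f ^ k * c))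
        Eq.≈⟨ *-cong (exp s t) (*-congʳ (exp l n)) ⟩
      (f ^ s * f ^ t) * ((f ^ l * f ^ n) * (f ^ m * a + f ^ k * c))
        Eq.≈⟨ step (f ^ s) (f ^ t) (f ^ k) (f ^ l) (f ^ m) (f ^ n) a c ⟩
      ((f ^ t * f ^ n) * f ^ m) * (f ^ s * (f ^ l * a)) + ((f ^ s * f ^ l) * f ^ k) * (f ^ t * (f ^ n * c))
        Eq.≈⟨ +-cong (*-congˡ p) (*-congˡ q) ⟩
      ((f ^ t * f ^ n) * f ^ m) * (f ^ s * (f ^ k * b)) + ((f ^ s * f ^ l) * f ^ k) * (f ^ t * (f ^ m * e))
        Eq.≈⟨ step′ (f ^ s) (f ^ t) (f ^ k) (f ^ l) (f ^ m) (f ^ n) b e ⟩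
      (f ^ s * f ^ t) * ((f ^ k * f ^ m) * (f ^ n * b + f ^ l * e))
        Eq.≈⟨ *-cong (exp s t) (*-congʳ (exp k m)) ⟨
      f ^ (s ℕ.+ t) * (f ^ (k ℕ.+ m) * (f ^ n * b + f ^ l * e)) Eq.∎)
      where
      step : ∀ s t k l m n a c → (s * t) * ((l * n) * (m * a + k * c)) ≈
             ((t * n) * m) * (s * (l * a)) + ((s * l) * k) * (t * (n * c))
      step = solve 8 (λ s t k l m n a c → (s :* t) :* ((l :* n) :* (m :* a :+ k :* c)) := ((t :* n) :* m) :* (s :* (l :* a)) :+ ((s :* l) :* k) :* (t :* (n :* c))) R.refl
      step′ : ∀ s t k l m n b e →
              ((t * n) * m) * (s * (k * b)) + ((s * l) * k) * (t * (m * e)) ≈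
              (s * t) * ((k * m) * (n * b + l * e))
      step′ = solve 8 (λ s t k l m n b e → ((t :* n) :* m) :* (s :* (k :* b)) :+ ((s :* l) :* k) :* (t :* (m :* e)) := (s :* t) :* ((k :* m) :* (n :* b :+ l :* e))) R.refl

    *ᶠ-cong : ∀ {x y u v} → x ∼ y → u ∼ v → (x *ᶠ u) ∼ (y *ᶠ v)
    *ᶠ-cong {a /^ k} {b /^ l} {c /^ m} {e /^ n} (s , p) (t , q) = s ℕ.+ t , (Eq.begin
      f ^ (s ℕ.+ t) * (f ^ (l ℕ.+ n) * (a * c))
        Eq.≈⟨ *-cong (exp s t) (*-congʳ (exp l n)) ⟩
      (f ^ s * f ^ t) * ((f ^ l * f ^ n) * (a * c))
        Eq.≈⟨ step (f ^ s) (f ^ t) (f ^ l) (f ^ n) a c ⟩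
      (f ^ s * (f ^ l * a)) * (f ^ t * (f ^ n * c))
        Eq.≈⟨ *-cong p q ⟩
      (f ^ s * (f ^ k * b)) * (f ^ t * (f ^ m * e))
        Eq.≈⟨ step (f ^ s) (f ^ t) (f ^ k) (f ^ m) b e ⟨
      (f ^ s * f ^ t) * ((f ^ k * f ^ m) * (b * e))
        Eq.≈⟨ *-cong (exp s t) (*-congʳ (exp k m)) ⟨
      f ^ (s ℕ.+ t) * (f ^ (k ℕ.+ m) * (b * e)) Eq.∎)
      where
      step : ∀ s t l n a c → (s * t) * ((l * n) * (a * c)) ≈ (s * (l * a)) * (t * (n * c))
      step = solve 6 (λ s t l n a c → (s :* t) :* ((l :* n) :* (a :* c)) := (s :* (l :* a)) :* (t :* (n :* c))) R.refl

    -ᶠ-cong : ∀ {x y} → x ∼ y → (-ᶠ x) ∼ (-ᶠ y)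
    -ᶠ-cong {a /^ k} {b /^ l} (s , p) = s , (Eq.begin
      f ^ s * (f ^ l * - a)   Eq.≈⟨ step (f ^ s) (f ^ l) a ⟩
      - (f ^ s * (f ^ l * a)) Eq.≈⟨ -‿cong p ⟩
      - (f ^ s * (f ^ k * b)) Eq.≈⟨ step (f ^ s) (f ^ k) b ⟨
      f ^ s * (f ^ k * - b)   Eq.∎)
      where
      step : ∀ s l a → s * (l * - a) ≈ - (s * (l * a))
      step s l a = R.trans (*-congˡ (R.sym (-‿distribʳ-* l a))) (R.sym (-‿distribʳ-* s (l * a)))

    +ᶠ-assoc : ∀ x y z → ((x +ᶠ y) +ᶠ z) ∼ (x +ᶠ (y +ᶠ z))
    +ᶠ-assoc (a /^ k) (b /^ l) (c /^ m) = equal (*-cong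
      (reflexive-exp (ℕP.+-assoc k l m))
      (Eq.begin
        f ^ m * (f ^ l * a + f ^ k * b) + f ^ (k ℕ.+ l) * c
          Eq.≈⟨ +-congˡ (*-congʳ (exp k l)) ⟩
        f ^ m * (f ^ l * a + f ^ k * b) + (f ^ k * f ^ l) * c
          Eq.≈⟨ step (f ^ k) (f ^ l) (f ^ m) a b c ⟩
        (f ^ l * f ^ m) * a + f ^ k * (f ^ m * b + f ^ l * c)
          Eq.≈⟨ +-congʳ (*-congʳ (exp l m)) ⟨
        f ^ (l ℕ.+ m) * a + f ^ k * (f ^ m * b + f ^ l * c) Eq.∎))
      where
      reflexive-exp : ∀ {i j} → i ≡ j → f ^ j ≈ f ^ i
      reflexive-exp refl = R.refl
      step : ∀ k l m a b c → m * (l * a + k * b) + (k * l) * c ≈ (l * m) * a + k * (m * b + l * c)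
      step = solve 6 (λ k l m a b c → m :* (l :* a :+ k :* b) :+ (k :* l) :* c := (l :* m) :* a :+ k :* (m :* b :+ l :* c)) R.refl

    +ᶠ-comm : ∀ x y → (x +ᶠ y) ∼ (y +ᶠ x)
    +ᶠ-comm (a /^ k) (b /^ l) = equal (*-cong
      (R.reflexive (cong-exp (ℕP.+-comm l k))) (+-comm (f ^ l * a) (f ^ k * b)))
      where
      cong-exp : ∀ {i j} → i ≡ j → f ^ i ≡ f ^ j
      cong-exp refl = refl

    +ᶠ-identityˡ : ∀ x → ((0# /^ 0) +ᶠ x) ∼ x
    +ᶠ-identityˡ (a /^ k) = equal (*-congˡ (R.trans
      (+-cong (zeroʳ (f ^ k)) (*-identityˡ a)) (+-identityˡ a)))

    +ᶠ-inverseˡ : ∀ x → ((-ᶠ x) +ᶠ x) ∼ (0# /^ 0)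
    +ᶠ-inverseˡ (a /^ k) = equal (Eq.begin
      1# * (f ^ k * - a + f ^ k * a) Eq.≈⟨ *-identityˡ _ ⟩
      f ^ k * - a + f ^ k * a        Eq.≈⟨ distribˡ (f ^ k) (- a) a ⟨
      f ^ k * (- a + a)              Eq.≈⟨ *-congˡ (-‿inverseˡ a) ⟩
      f ^ k * 0#                     Eq.≈⟨ zeroʳ (f ^ k) ⟩
      0#                             Eq.≈⟨ zeroʳ _ ⟨
      f ^ (k ℕ.+ k) * 0#             Eq.∎)

    *ᶠ-assoc : ∀ x y z → ((x *ᶠ y) *ᶠ z) ∼ (x *ᶠ (y *ᶠ z))
    *ᶠ-assoc (a /^ k) (b /^ l) (c /^ m) = equal (*-cong
      (R.reflexive (cong-exp (sym (ℕP.+-assoc k l m)))) (*-assoc a b c))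
      where
      cong-exp : ∀ {i j} → i ≡ j → f ^ i ≡ f ^ j
      cong-exp refl = refl

    *ᶠ-comm : ∀ x y → (x *ᶠ y) ∼ (y *ᶠ x)
    *ᶠ-comm (a /^ k) (b /^ l) = equal (*-cong
      (R.reflexive (cong-exp (ℕP.+-comm l k))) (*-comm a b))
      where
      cong-exp : ∀ {i j} → i ≡ j → f ^ i ≡ f ^ j
      cong-exp refl = refl

    *ᶠ-identityˡ : ∀ x → ((1# /^ 0) *ᶠ x) ∼ x
    *ᶠ-identityˡ (a /^ k) = equal (*-congˡ (*-identityˡ a))

    distribˡᶠ : ∀ x y z → (x *ᶠ (y +ᶠ z)) ∼ ((x *ᶠ y) +ᶠ (x *ᶠ z))
    distribˡᶠ (a /^ k) (b /^ l) (c /^ m) = equal (Eq.begin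
      f ^ ((k ℕ.+ l) ℕ.+ (k ℕ.+ m)) * (a * (f ^ m * b + f ^ l * c))
        Eq.≈⟨ *-congʳ (R.trans (exp (k ℕ.+ l) (k ℕ.+ m)) (*-cong (exp k l) (exp k m))) ⟩
      ((f ^ k * f ^ l) * (f ^ k * f ^ m)) * (a * (f ^ m * b + f ^ l * c))
        Eq.≈⟨ step (f ^ k) (f ^ l) (f ^ m) a b c ⟩
      (f ^ k * (f ^ l * f ^ m)) * ((f ^ k * f ^ m) * (a * b) + (f ^ k * f ^ l) * (a * c))
        Eq.≈⟨ *-cong (R.trans (exp k (l ℕ.+ m)) (*-congˡ (exp l m)))
                     (+-cong (*-congʳ (exp k m)) (*-congʳ (exp k l))) ⟨
      f ^ (k ℕ.+ (l ℕ.+ m)) * (f ^ (k ℕ.+ m) * (a * b) + f ^ (k ℕ.+ l) * (a * c)) Eq.∎)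
      where
      step : ∀ k l m a b c → ((k * l) * (k * m)) * (a * (m * b + l * c)) ≈
             (k * (l * m)) * ((k * m) * (a * b) + (k * l) * (a * c))
      step = solve 6 (λ k l m a b c → ((k :* l) :* (k :* m)) :* (a :* (m :* b :+ l :* c)) := (k :* (l :* m)) :* ((k :* m) :* (a :* b) :+ (k :* l) :* (a :* c))) R.refl

    ∼-sym : ∀ {x y} → x ∼ y → y ∼ x
    ∼-sym (s , p) = s , R.sym p

  localisation : Ring
  localisation = record
    { Carrier = Fraction
    ; _≈_ = _∼_
    ; _+_ = _+ᶠ_
    ; _*_ = _*ᶠ_
    ; -_  = -ᶠ_
    ; 0#  = 0# /^ 0
    ; 1#  = 1# /^ 0
    ; isCommutativeRing = record
      { isRing = record
        { +-isAbelianGroup = record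
          { isGroup = record
            { isMonoid = record
              { isSemigroup = record
                { isMagma = record
                  { isEquivalence = record
                    { refl = 0 , R.refl
                    ; sym = ∼-sym
                    ; trans = ∼-trans }
                  ; ∙-cong = +ᶠ-cong
                  }
                ; assoc = +ᶠ-assoc
                }
              ; identity = +ᶠ-identityˡ , λ x → ∼-trans (+ᶠ-comm x (0# /^ 0)) (+ᶠ-identityˡ x)
              }
            ; inverse = +ᶠ-inverseˡ , λ x → ∼-trans (+ᶠ-comm x (-ᶠ x)) (+ᶠ-inverseˡ x)
            ; ⁻¹-cong = -ᶠ-cong
            }
          ; comm = +ᶠ-comm
          }
        ; *-cong = *ᶠ-cong
        ; *-assoc = *ᶠ-assoc
        ; *-identity = *ᶠ-identityˡ , λ x → ∼-trans (*ᶠ-comm x (1# /^ 0)) (*ᶠ-identityˡ x)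
        ; distrib = distribˡᶠ , λ x y z →
            ∼-trans (*ᶠ-comm (y +ᶠ z) x)
              (∼-trans (distribˡᶠ x y z)
                (+ᶠ-cong (*ᶠ-comm x y) (*ᶠ-comm x z)))
        }
      ; *-comm = *ᶠ-comm
      }
    }

  fromRing : Carrier → Fraction
  fromRing a = a /^ 0

  fromRing-isHom : IsRingHom R localisation fromRing
  fromRing-isHom = record
    { isSemiringHomomorphism = record
      { isNearSemiringHomomorphism = record
        { +-isMonoidHomomorphism = record
          { isMagmaHomomorphism = record
            { isRelHomomorphism = record { cong = λ h → equal (*-congˡ h) }
            ; homo = λ a b → equal (*-congˡ (R.sym (+-cong (*-identityˡ a) (*-identityˡ b))))
            }
          ; ε-homo = equal R.refl
          }
        ; *-homo = λ _ _ → equal R.refl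
        }
      ; 1#-homo = equal R.refl
      }
    ; -‿homo = λ _ → equal R.refl
    }

  private
    inverse-num : ∀ a → a ≈ f → 1# * a ≈ (f * 1#) * 1#
    inverse-num a a≈f = R.trans (*-identityˡ a) (R.trans a≈f (R.sym (R.trans (*-identityʳ (f * 1#)) (*-identityʳ f))))

  fˣ : ∣ localisation ˣ ∣ᵍ
  fˣ .val     = f /^ 0
  fˣ .inv     = 1# /^ 1
  fˣ .val∙inv = equal (inverse-num (f * 1#) (*-identityʳ f))
  fˣ .inv∙val = equal (inverse-num (1# * f) (*-identityˡ f))

------------------------------------------------------------------------
-- Half trees

-- Graphs with a marked vertex in which an edge may have fewer than two vertices.
record HalfTree : Set₁ where
  field
    vertices : Setoid 0ℓ 0ℓ
    edges    : Setoid 0ℓ 0ℓ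

  open Setoid vertices public using () renaming (Carrier to Vertex; _≈_ to _≈ᵛ_)
  open Setoid edges public using () renaming (Carrier to Edge; _≈_ to _≈ᵉ_)

  field
    _∈ᵉ_   : Vertex → Edge → Set
    origin : Vertex

  -- {v , w} is an edge with two distinct vertices.
  Adjacent : Vertex → Vertex → Set
  Adjacent v w = ¬ v ≈ᵛ w × ∃[ e ] ∀ u → (u ∈ᵉ e) ⇔ (u ≈ᵛ v ⊎ u ≈ᵛ w)

  data Path : Vertex → Vertex → ℕ → Set where
    stop : ∀ {v w} → v ≈ᵛ w → Path v w 0
    step : ∀ {v u w n} → Adjacent v u → Path u w n → Path v w (ℕ.suc n)

  data _On_ (z : Vertex) : ∀ {v w n} → Path v w n → Set where
    here-stop : ∀ {v w} {v≈w : v ≈ᵛ w} → z ≈ᵛ v → z On stop v≈w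
    here-step : ∀ {v u w n} {a : Adjacent v u} {π : Path u w n} → z ≈ᵛ v → z On step a π
    later     : ∀ {v u w n} {a : Adjacent v u} {π : Path u w n} → z On π → z On step a π

  Geodesic : ∀ {v w n} → Path v w n → Set
  Geodesic {v} {w} {n} _ = ∀ {m} → Path v w m → n ℕ.≤ m

  -- z ∈ [v , w]
  _∈[_,_] : Vertex → Vertex → Vertex → Set
  z ∈[ v , w ] = ∃[ n ] Σ[ π ∈ Path v w n ] Geodesic π × z On π

  -- w ∈ ]v[
  _∈]_[ : Vertex → Vertex → Set
  w ∈] v [ = Adjacent v w × v ∈[ w , origin ]

record _≅_ (Y Z : HalfTree) : Set where
  private
    module Y = HalfTree Y
    module Z = HalfTree Z
  field
    onVertices : Inverse Y.vertices Z.vertices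
    onEdges    : Inverse Y.edges Z.edges

  Θᵛ : Y.Vertex → Z.Vertex
  Θᵛ = Inverse.to onVertices

  Θᵉ : Y.Edge → Z.Edge
  Θᵉ = Inverse.to onEdges

  field
    incidence : ∀ v e → (v Y.∈ᵉ e) ⇔ (Θᵛ v Z.∈ᵉ Θᵉ e)

------------------------------------------------------------------------
-- The half tree 𝔛₊

module Matrices₂ (R : Ring) where
  open CommutativeRing R hiding (zero)
  open Matrices R using (Mat; mul; 1M)
  private module Eq = SetoidReasoning setoid

  matrix : (a b c d : Carrier) → Mat 2
  matrix a b c d zero       zero       = a
  matrix a b c d zero       (suc zero) = b
  matrix a b c d (suc zero) zero       = c
  matrix a b c d (suc zero) (suc zero) = d

  private
    infix 4 _≈ᴹ_
    _≈ᴹ_ : Mat 2 → Mat 2 → Set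
    A ≈ᴹ B = ∀ i j → A i j ≈ B i j

    entry : ∀ a b c d {e} → a * b + c * d ≈ e → a * b + (c * d + 0#) ≈ e
    entry a b c d h = trans (+-congˡ (+-identityʳ (c * d))) h

    left : ∀ {a b c d e} → a * b ≈ e → c * d ≈ 0# → a * b + c * d ≈ e
    left h k = trans (+-cong h k) (+-identityʳ _)

    right : ∀ {a b c d e} → a * b ≈ 0# → c * d ≈ e → a * b + c * d ≈ e
    right h k = trans (+-cong h k) (+-identityˡ _)

    diag-inverse : ∀ a a′ d d′ → a * a′ ≈ 1# → d * d′ ≈ 1# →
                   mul (matrix a 0# 0# d) (matrix a′ 0# 0# d′) ≈ᴹ 1M
    diag-inverse a a′ d d′ h k zero       zero       = entry a a′ 0# 0# (left h (zeroˡ 0#))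
    diag-inverse a a′ d d′ h k zero       (suc zero) = entry a 0# 0# d′ (left (zeroʳ a) (zeroˡ d′))
    diag-inverse a a′ d d′ h k (suc zero) zero       = entry 0# a′ d 0# (left (zeroˡ a′) (zeroʳ d))
    diag-inverse a a′ d d′ h k (suc zero) (suc zero) = entry 0# 0# d d′ (right (zeroˡ 0#) k)

    upper-inverse : ∀ u u′ → u′ + u ≈ 0# →
                    mul (matrix 1# u 0# 1#) (matrix 1# u′ 0# 1#) ≈ᴹ 1M
    upper-inverse u u′ h zero       zero       = entry 1# 1# u 0# (left (*-identityˡ 1#) (zeroʳ u))
    upper-inverse u u′ h zero       (suc zero) = entry 1# u′ u 1#
      (trans (+-cong (*-identityˡ u′) (*-identityʳ u)) h)
    upper-inverse u u′ h (suc zero) zero       = entry 0# 1# 1# 0# (left (zeroˡ 1#) (zeroʳ 1#))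
    upper-inverse u u′ h (suc zero) (suc zero) = entry 0# u′ 1# 1# (right (zeroˡ u′) (*-identityˡ 1#))

  diag : ∣ R ˣ ∣ᵍ → ∣ R ˣ ∣ᵍ → ∣ GL 2 R ∣ᵍ
  diag a d .val     = matrix (val a) 0# 0# (val d)
  diag a d .inv     = matrix (inv a) 0# 0# (inv d)
  diag a d .val∙inv = diag-inverse (val a) (inv a) (val d) (inv d) (val∙inv a) (val∙inv d)
  diag a d .inv∙val = diag-inverse (inv a) (val a) (inv d) (val d) (inv∙val a) (inv∙val d)

  upper : Carrier → ∣ GL 2 R ∣ᵍ
  upper u .val     = matrix 1# u 0# 1#
  upper u .inv     = matrix 1# (- u) 0# 1#
  upper u .val∙inv = upper-inverse u (- u) (-‿inverseˡ u)
  upper u .inv∙val = upper-inverse (- u) u (-‿inverseʳ u)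

  homothety : ∣ R ˣ ∣ᵍ → ∣ GL 2 R ∣ᵍ
  homothety z = diag z z

  homothety-isHom : IsGroupHom (R ˣ) (GL 2 R) homothety
  homothety-isHom = record
    { isMonoidHomomorphism = record
      { isMagmaHomomorphism = record
        { isRelHomomorphism = record { cong = λ (mk≈ᵘ h) → mk≈ᵘ (diagonal h) }
        ; homo              = λ z z′ → mk≈ᵘ (∙-homo (val z) (val z′))
        }
      ; ε-homo = mk≈ᵘ 1-homo
      }
    ; ⁻¹-homo = λ _ → mk≈ᵘ (λ _ _ → refl)
    }
    where
    diagonal : ∀ {a b} → a ≈ b → matrix a 0# 0# a ≈ᴹ matrix b 0# 0# b
    diagonal h zero       zero       = h
    diagonal h zero       (suc zero) = refl
    diagonal h (suc zero) zero       = refl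
    diagonal h (suc zero) (suc zero) = h

    ∙-homo : ∀ a b → matrix (a * b) 0# 0# (a * b) ≈ᴹ mul (matrix a 0# 0# a) (matrix b 0# 0# b)
    ∙-homo a b zero       zero       = sym (entry a b 0# 0# (left refl (zeroˡ 0#)))
    ∙-homo a b zero       (suc zero) = sym (entry a 0# 0# b (left (zeroʳ a) (zeroˡ b)))
    ∙-homo a b (suc zero) zero       = sym (entry 0# b a 0# (left (zeroˡ b) (zeroʳ a)))
    ∙-homo a b (suc zero) (suc zero) = sym (entry 0# 0# a b (right (zeroˡ 0#) refl))

    1-homo : matrix 1# 0# 0# 1# ≈ᴹ 1M
    1-homo zero       zero       = refl
    1-homo zero       (suc zero) = refl
    1-homo (suc zero) zero       = refl
    1-homo (suc zero) (suc zero) = refl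

  homothety-central : ∀ z g → let open Group (GL 2 R) using () renaming (_∙_ to _·_; _≈_ to _≃_) in
                      homothety z · g ≃ g · homothety z
  homothety-central z g = mk≈ᵘ λ i k → trans (rows (val z) (val g) i k) (sym (columns (val z) (val g) i k))
    where
    rows : ∀ a (A : Mat 2) i k → mul (matrix a 0# 0# a) A i k ≈ A i k * a
    rows a A zero       k = entry a _ 0# _ (left (*-comm a _) (zeroˡ _))
    rows a A (suc zero) k = entry 0# _ a _ (right (zeroˡ _) (*-comm a _))

    columns : ∀ a (A : Mat 2) i k → mul A (matrix a 0# 0# a) i k ≈ A i k * a
    columns a A i zero       = entry _ a _ 0# (left refl (zeroʳ _))
    columns a A i (suc zero) = entry _ 0# _ a (right (zeroʳ _) refl)

subsetoid : (S : Setoid 0ℓ 0ℓ) → (Setoid.Carrier S → Set) → Setoid 0ℓ 0ℓ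
subsetoid S P = record
  { Carrier       = ∃ P
  ; _≈_           = _≈_ on proj₁
  ; isEquivalence = On.isEquivalence proj₁ isEquivalence
  }
  where open Setoid S

unorderedPairs : Setoid 0ℓ 0ℓ → Setoid 0ℓ 0ℓ
unorderedPairs S = record
  { Carrier       = Carrier × Carrier
  ; _≈_           = λ (a , b) (c , d) → (a ≈ c × b ≈ d) ⊎ (a ≈ d × b ≈ c)
  ; isEquivalence = record
    { refl  = inj₁ (refl , refl)
    ; sym   = λ { (inj₁ (h , k)) → inj₁ (sym h , sym k)
                ; (inj₂ (h , k)) → inj₂ (sym k , sym h) }
    ; trans = λ { (inj₁ (h , k)) (inj₁ (h′ , k′)) → inj₁ (trans h h′ , trans k k′)
                ; (inj₁ (h , k)) (inj₂ (h′ , k′)) → inj₂ (trans h h′ , trans k k′)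
                ; (inj₂ (h , k)) (inj₁ (h′ , k′)) → inj₂ (trans h k′ , trans k h′)
                ; (inj₂ (h , k)) (inj₂ (h′ , k′)) → inj₁ (trans h k′ , trans k h′) }
    }
  }
  where open Setoid S

-- g and h represent the same left coset modulo the subgroup f(Z) j(K), f(Z) being central.
record SameCoset (G : Grp) {Z K : Set} (f : Z → ∣ G ∣ᵍ) (j : K → ∣ G ∣ᵍ) (g h : ∣ G ∣ᵍ) : Set where
  constructor sameCoset
  open Group G
  field
    z      : Z
    k      : K
    factor : h ≈ (g ∙ f z) ∙ j k

module _ (G Z K : Grp) (f : ∣ Z ∣ᵍ → ∣ G ∣ᵍ) (f-isHom : IsGroupHom Z G f)
  (j : ∣ K ∣ᵍ → ∣ G ∣ᵍ) (j-isHom : IsGroupHom K G j)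
  (f-central : ∀ z g → Group._≈_ G (Group._∙_ G (f z) g) (Group._∙_ G g (f z))) where
  open Group G
  private
    module Z = Group Z
    module K = Group K
    module f = GroupMorphisms.IsGroupHomomorphism f-isHom
    module j = GroupMorphisms.IsGroupHomomorphism j-isHom
    open SetoidReasoning setoid

  cosets : Setoid 0ℓ 0ℓ
  cosets = record
    { Carrier       = Carrier
    ; _≈_           = SameCoset G f j
    ; isEquivalence = record { refl = reflᶜ ; sym = symᶜ ; trans = transᶜ }
    }
    where
    reflᶜ : ∀ {g} → SameCoset G f j g g
    reflᶜ {g} = sameCoset Z.ε K.ε (sym (begin
      (g ∙ f Z.ε) ∙ j K.ε ≈⟨ ∙-cong (∙-congˡ f.ε-homo) j.ε-homo ⟩
      (g ∙ ε) ∙ ε         ≈⟨ identityʳ (g ∙ ε) ⟩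
      g ∙ ε               ≈⟨ identityʳ g ⟩
      g                   ∎))

    symᶜ : ∀ {g h} → SameCoset G f j g h → SameCoset G f j h g
    symᶜ {g} {h} (sameCoset z k e) = sameCoset (z Z.⁻¹) (k K.⁻¹) (sym (begin
      (h ∙ f (z Z.⁻¹)) ∙ j (k K.⁻¹)         ≈⟨ ∙-cong (sym (f-central (z Z.⁻¹) h)) (j.⁻¹-homo k) ⟩
      (f (z Z.⁻¹) ∙ h) ∙ j k ⁻¹             ≈⟨ assoc _ _ _ ⟩
      f (z Z.⁻¹) ∙ (h ∙ j k ⁻¹)             ≈⟨ ∙-congˡ (∙-congʳ e) ⟩
      f (z Z.⁻¹) ∙ (((g ∙ f z) ∙ j k) ∙ j k ⁻¹) ≈⟨ ∙-congˡ (cancel (g ∙ f z) (j k)) ⟩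
      f (z Z.⁻¹) ∙ (g ∙ f z)                ≈⟨ f-central (z Z.⁻¹) (g ∙ f z) ⟩
      (g ∙ f z) ∙ f (z Z.⁻¹)                ≈⟨ ∙-congˡ (f.⁻¹-homo z) ⟩
      (g ∙ f z) ∙ f z ⁻¹                    ≈⟨ cancel g (f z) ⟩
      g                                     ∎))
      where
      cancel : ∀ a b → (a ∙ b) ∙ b ⁻¹ ≈ a
      cancel a b = trans (assoc a b (b ⁻¹)) (trans (∙-congˡ (inverseʳ b)) (identityʳ a))

    transᶜ : ∀ {g h l} → SameCoset G f j g h → SameCoset G f j h l → SameCoset G f j g l
    transᶜ {g} {h} {l} (sameCoset z k e) (sameCoset z′ k′ e′) = sameCoset (z Z.∙ z′) (k K.∙ k′) (begin
      l                                    ≈⟨ e′ ⟩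
      (h ∙ f z′) ∙ j k′                    ≈⟨ ∙-congʳ (∙-congʳ e) ⟩
      (((g ∙ f z) ∙ j k) ∙ f z′) ∙ j k′    ≈⟨ ∙-congʳ (assoc (g ∙ f z) (j k) (f z′)) ⟩
      ((g ∙ f z) ∙ (j k ∙ f z′)) ∙ j k′    ≈⟨ ∙-congʳ (∙-congˡ (f-central z′ (j k))) ⟨
      ((g ∙ f z) ∙ (f z′ ∙ j k)) ∙ j k′    ≈⟨ ∙-congʳ (assoc (g ∙ f z) (f z′) (j k)) ⟨
      (((g ∙ f z) ∙ f z′) ∙ j k) ∙ j k′    ≈⟨ assoc ((g ∙ f z) ∙ f z′) (j k) (j k′) ⟩
      ((g ∙ f z) ∙ f z′) ∙ (j k ∙ j k′)    ≈⟨ ∙-cong (assoc g (f z) (f z′)) (sym (j.homo k k′)) ⟩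
      (g ∙ (f z ∙ f z′)) ∙ j (k K.∙ k′)    ≈⟨ ∙-congʳ (∙-congˡ (f.homo z z′)) ⟨
      (g ∙ f (z Z.∙ z′)) ∙ j (k K.∙ k′)    ∎)

-- Only used for ℤ_p ⊂ ℚ_p with ϖ = p.
record LocalField : Set₁ where
  field
    𝒪       : Ring
    K       : Ring
    ι       : ∣ 𝒪 ∣ʳ → ∣ K ∣ʳ
    ι-isHom : IsRingHom 𝒪 K ι
    ϖ       : ∣ K ˣ ∣ᵍ

module Tree (𝐊 : LocalField) where
  open LocalField 𝐊 renaming (𝒪 to ℤₚ; K to ℚₚ)
  open Matrices₂ ℚₚ public

  GL₂ : Grp
  GL₂ = GL 2 ℚₚ

  φ ν : ∣ GL₂ ∣ᵍ
  φ = diag ϖ (Group.ε (ℚₚ ˣ))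
  ν = upper (CommutativeRing.1# ℚₚ)

  γ : ∣ ℤₚ ˣ ∣ᵍ → ∣ GL₂ ∣ᵍ
  γ a = diag (mapˣ {ℤₚ} {ℚₚ} ι ι-isHom a) (Group.ε (ℚₚ ˣ))

  -- The vertices of 𝔛 are the cosets of GL₂(ℚ_p) modulo ℚ_pˣ GL₂(ℤ_p).
  𝔛⁰ : Setoid 0ℓ 0ℓ
  𝔛⁰ = cosets GL₂ (ℚₚ ˣ) (GL 2 ℤₚ)
    homothety homothety-isHom
    (mapGL {ℤₚ} {ℚₚ} ι ι-isHom) (mapGL-isHom {ℤₚ} {ℚₚ} ι ι-isHom 2)
    homothety-central

  open Group GL₂ using (_∙_)
  open Setoid 𝔛⁰ using () renaming (_≈_ to _≈ᵗ_)

  𝔳 : ℤ → ∣ GL₂ ∣ᵍ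
  𝔳 = power GL₂ φ

  In𝔛₊⁰ : ∣ GL₂ ∣ᵍ → Set
  In𝔛₊⁰ x = Σ[ u ∈ ∣ ℤₚ ∣ʳ ] Σ[ i ∈ ℕ ] x ≈ᵗ upper (ι u) ∙ 𝔳 (+ i)

  -- The edges of 𝔛 are given by unordered pairs of vertices.
  open Setoid (unorderedPairs 𝔛⁰) using () renaming (_≈_ to _≈ᵖ_)

  _·ᵖ_ : ∣ GL₂ ∣ᵍ → ∣ GL₂ ∣ᵍ × ∣ GL₂ ∣ᵍ → ∣ GL₂ ∣ᵍ × ∣ GL₂ ∣ᵍ
  g ·ᵖ (a , b) = g ∙ a , g ∙ b

  𝔢 : ℕ → ∣ GL₂ ∣ᵍ × ∣ GL₂ ∣ᵍ
  𝔢 i = 𝔳 (+ i) , 𝔳 (+ i ℤ.- 1ℤ)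

  In𝔛₊¹ : ∣ GL₂ ∣ᵍ × ∣ GL₂ ∣ᵍ → Set
  In𝔛₊¹ e = Σ[ u ∈ ∣ ℤₚ ∣ʳ ] Σ[ i ∈ ℕ ] e ≈ᵖ upper (ι u) ·ᵖ 𝔢 i

  -- An edge of 𝔛₊ contains those of its ends that lie in 𝔛₊; hence 𝔢 0 = {𝔳 0 , 𝔳 -1}
  -- contains only 𝔳 0.
  𝔛₊ : HalfTree
  𝔛₊ = record
    { vertices = subsetoid 𝔛⁰ In𝔛₊⁰
    ; edges    = subsetoid (unorderedPairs 𝔛⁰) In𝔛₊¹
    ; _∈ᵉ_     = λ v e → proj₁ v ≈ᵗ proj₁ (proj₁ e) ⊎ proj₁ v ≈ᵗ proj₂ (proj₁ e)
    ; origin   = upper (ι 0#) ∙ 𝔳 (+ 0) , 0# , 0 , Setoid.refl 𝔛⁰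
    }
    where open CommutativeRing ℤₚ using (0#)

------------------------------------------------------------------------
-- The group G of ℚ_p-points and its building

module Building (𝐊 : LocalField) (𝐆 : SplitReductiveGroup (LocalField.K 𝐊)) (R : RootDatum 𝐆) where
  open LocalField 𝐊 renaming (𝒪 to ℤₚ; K to ℚₚ)
  open SplitReductiveGroup 𝐆 using (scheme; rank; T)
  open RootDatum R using (Φ; root; neg; x)

  G : Grp
  G = points scheme (base ℚₚ)

  open Group G hiding (identity; inverse)

  torus : Grp
  torus = points (𝔾ₘ^ rank ℚₚ) (base ℚₚ)

  inT : ∣ torus ∣ᵍ → Carrier
  inT = at T (base ℚₚ)

  rootGroup : Φ → Carrier → Set
  rootGroup α = rootSubgroup 𝐆 R (base ℚₚ) α

  -- u ∈ pᵏℤ_p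
  _∈p^_ : ∣ ℚₚ ∣ʳ → ℤ → Set
  u ∈p^ k = ∃[ z ] u ≈ℚ (val (power (ℚₚ ˣ) ϖ k) *ℚ ι z)
    where open CommutativeRing ℚₚ using () renaming (_≈_ to _≈ℚ_; _*_ to _*ℚ_)

  -- Points of X_*(T) ⊗ ℚ.  As chambers of the apartment A are open, and the walls rational,
  -- rational points suffice to describe chambers and panels.
  Point : Set
  Point = Fin rank → ℚ

  _at-point_ : Lattice rank → Point → ℚ
  χ at-point y = RawMonoidDefs.sum ℚ.+-0-rawMonoid (λ i → (χ i ℚ./ 1) ℚ.* y i)

  OnWall : Point → Φ → Set
  OnWall y α = ∃[ k ] root α at-point y ≡ k ℚ./ 1

  -- A chamber of A, given by a point in its interior; two points give the same chamber if they
  -- are on the same side of every wall.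
  record Alcove : Set where
    field
      point   : Point
      generic : ∀ α → ¬ OnWall point α
  open Alcove

  InClosure : Alcove → Point → Set
  InClosure C y = ∀ α (k : ℤ) → k ℚ./ 1 ℚ.≤ root α at-point (point C) → k ℚ./ 1 ℚ.≤ root α at-point y

  -- C and D have a common facet of codimension 1: their closures share a point lying on
  -- exactly one wall.
  AdjacentAlcoves : Alcove → Alcove → Set
  AdjacentAlcoves C D = ∃[ y ] InClosure C y × InClosure D y ×
    ∃[ α ] OnWall y α × (∀ β → OnWall y β → β ≡ α ⊎ β ≡ neg α)

  -- The subgroup of N_α fixing C: the elements x α u with u ∈ pᵏℤ_p fix the half
  -- apartment α + k ≥ 0.
  fixingRootGroup : Φ → Alcove → Carrier → Set
  fixingRootGroup α C g = ∃[ k ] ℚ.- (root α at-point (point C)) ℚ.≤ k ℚ./ 1 ×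
                 ∃[ u ] (u ∈p^ k) × g ≈ at (x α) (base ℚₚ) u

  -- T(ℤ_p)
  T₀ : Carrier → Set
  T₀ g = Σ[ t ∈ (Fin rank → ∣ ℤₚ ˣ ∣ᵍ) ] g ≈ inT (λ i → mapˣ {ℤₚ} {ℚₚ} ι ι-isHom (t i))

  -- I_C
  Iwahori : Alcove → Carrier → Set
  Iwahori C = Generated G (λ g → T₀ g ⊎ ∃[ α ] fixingRootGroup α C g)

  -- m ∈ N(T) and mC = D; here D = mC means I_D = m I_C m⁻¹, as a chamber of A is determined
  -- by its Iwahori subgroup.
  Moves : Carrier → Alcove → Alcove → Set
  Moves m C D = NormalisesT 𝐆 m × (∀ g → Iwahori C g ⇔ Iwahori D (conj G m g))

  -- The chamber gC of the building X = (G × A) / ∼, where (g , C) ∼ (h , D) if there is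
  -- n ∈ N(T) with D = nC and g⁻¹hn ∈ I_C.
  record Chamber : Set where
    constructor _⋆_
    field
      translate : Carrier
      alcove    : Alcove
  open Chamber

  infix 4 _∼_
  record _∼_ (c d : Chamber) : Set where
    field
      n       : Carrier
      moves   : Moves n (alcove c) (alcove d)
      iwahori : Iwahori (alcove c) ((translate c ⁻¹ ∙ translate d) ∙ n)

  private
    open GroupProperties G using (⁻¹-anti-homo-∙; ⁻¹-involutive; ε⁻¹≈ε)
    open SetoidReasoning setoid

    conj-cong : ∀ {a b g h} → a ≈ b → g ≈ h → conj G a g ≈ conj G b h
    conj-cong e e′ = ∙-cong (∙-cong e e′) (⁻¹-cong e)

    conj-ε : ∀ g → conj G ε g ≈ g
    conj-ε g = trans (∙-cong (identityˡ g) ε⁻¹≈ε) (identityʳ g)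

    conj-∙ : ∀ a b g → conj G (a ∙ b) g ≈ conj G a (conj G b g)
    conj-∙ a b g = begin
      ((a ∙ b) ∙ g) ∙ (a ∙ b) ⁻¹    ≈⟨ ∙-cong (assoc a b g) (⁻¹-anti-homo-∙ a b) ⟩
      (a ∙ (b ∙ g)) ∙ (b ⁻¹ ∙ a ⁻¹) ≈⟨ assoc (a ∙ (b ∙ g)) (b ⁻¹) (a ⁻¹) ⟨
      ((a ∙ (b ∙ g)) ∙ b ⁻¹) ∙ a ⁻¹ ≈⟨ ∙-congʳ (assoc a (b ∙ g) (b ⁻¹)) ⟩
      (a ∙ ((b ∙ g) ∙ b ⁻¹)) ∙ a ⁻¹ ∎

    conj-conj⁻¹ : ∀ a g → conj G a (conj G (a ⁻¹) g) ≈ g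
    conj-conj⁻¹ a g = trans (sym (conj-∙ a (a ⁻¹) g)) (trans (conj-cong (inverseʳ a) refl) (conj-ε g))

    moves-refl : ∀ {C} → Moves ε C C
    moves-refl = (λ t → (t , conj-ε (inT t)) , (t , trans (conj-cong ε⁻¹≈ε refl) (conj-ε (inT t))))
               , λ g → mk⇔ (respects (sym (conj-ε g))) (respects (conj-ε g))

    moves-sym : ∀ {m C D} → Moves m C D → Moves (m ⁻¹) D C
    moves-sym {m} (nt , iw) =
        (λ t → proj₂ (nt t) , (proj₁ (proj₁ (nt t)) , trans (conj-cong (⁻¹-involutive m) refl) (proj₂ (proj₁ (nt t)))))
      , λ g → mk⇔ (λ h → Equivalence.from (iw (conj G (m ⁻¹) g)) (respects (sym (conj-conj⁻¹ m g)) h))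
                  (λ h → respects (conj-conj⁻¹ m g) (Equivalence.to (iw (conj G (m ⁻¹) g)) h))

    moves-trans : ∀ {m m′ C D E} → Moves m C D → Moves m′ D E → Moves (m′ ∙ m) C E
    moves-trans {m} {m′} (nt , iw) (nt′ , iw′) =
        (λ t → (let (t₁ , e₁) = proj₁ (nt t) ; (t₂ , e₂) = proj₁ (nt′ t₁) in
                  t₂ , trans (conj-∙ m′ m (inT t)) (trans (conj-cong refl e₁) e₂))
             , (let (t₁ , e₁) = proj₂ (nt′ t) ; (t₂ , e₂) = proj₂ (nt t₁) in
                  t₂ , trans (conj-cong (⁻¹-anti-homo-∙ m′ m) refl)
                         (trans (conj-∙ (m ⁻¹) (m′ ⁻¹) (inT t)) (trans (conj-cong refl e₁) e₂))))
      , λ g → mk⇔ (λ h → respects (sym (conj-∙ m′ m g)) (Equivalence.to (iw′ _) (Equivalence.to (iw g) h)))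
                  (λ h → Equivalence.from (iw g) (Equivalence.from (iw′ _) (respects (conj-∙ m′ m g) h)))

    ≈⇒∼ : ∀ {g h C} → g ≈ h → (g ⋆ C) ∼ (h ⋆ C)
    ≈⇒∼ {g} {C = C} g≈h = record
      { n = ε ; moves = moves-refl {C}
      ; iwahori = respects (sym (trans (identityʳ _) (trans (∙-congˡ (sym g≈h)) (inverseˡ g)))) identity
      }

    ∼-sym : ∀ {c d} → c ∼ d → d ∼ c
    ∼-sym {g ⋆ C} {h ⋆ D} record { n = m ; moves = mv ; iwahori = i } = record
      { n = m ⁻¹ ; moves = moves-sym {m} {C} {D} mv
      ; iwahori = respects eq (Equivalence.to (proj₂ mv _) (inverse i)) }
      where
      eq : conj G m (((g ⁻¹ ∙ h) ∙ m) ⁻¹) ≈ (h ⁻¹ ∙ g) ∙ m ⁻¹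
      eq = ∙-congʳ (begin
        m ∙ ((g ⁻¹ ∙ h) ∙ m) ⁻¹         ≈⟨ ∙-congˡ (⁻¹-anti-homo-∙ (g ⁻¹ ∙ h) m) ⟩
        m ∙ (m ⁻¹ ∙ (g ⁻¹ ∙ h) ⁻¹)      ≈⟨ assoc m (m ⁻¹) ((g ⁻¹ ∙ h) ⁻¹) ⟨
        (m ∙ m ⁻¹) ∙ (g ⁻¹ ∙ h) ⁻¹      ≈⟨ ∙-cong (inverseʳ m) (⁻¹-anti-homo-∙ (g ⁻¹) h) ⟩
        ε ∙ (h ⁻¹ ∙ (g ⁻¹) ⁻¹)          ≈⟨ identityˡ _ ⟩
        h ⁻¹ ∙ (g ⁻¹) ⁻¹                ≈⟨ ∙-congˡ (⁻¹-involutive g) ⟩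
        h ⁻¹ ∙ g                        ∎)

    ∼-trans : ∀ {c d e} → c ∼ d → d ∼ e → c ∼ e
    ∼-trans {g ⋆ C} {h ⋆ D} {l ⋆ E} record { n = m ; moves = mv ; iwahori = i }
                                    record { n = m′ ; moves = mv′ ; iwahori = i′ } = record
      { n = m′ ∙ m ; moves = moves-trans {m} {m′} {C} {D} {E} mv mv′
      ; iwahori = respects eq (product i (Equivalence.from (proj₂ mv _)
                    (respects (sym (conj-conj⁻¹ m ((h ⁻¹ ∙ l) ∙ m′))) i′))) }
      where
      y = (h ⁻¹ ∙ l) ∙ m′
      eq : ((g ⁻¹ ∙ h) ∙ m) ∙ conj G (m ⁻¹) y ≈ (g ⁻¹ ∙ l) ∙ (m′ ∙ m)
      eq = begin
        ((g ⁻¹ ∙ h) ∙ m) ∙ ((m ⁻¹ ∙ y) ∙ (m ⁻¹) ⁻¹) ≈⟨ ∙-congˡ (assoc (m ⁻¹) y ((m ⁻¹) ⁻¹)) ⟩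
        ((g ⁻¹ ∙ h) ∙ m) ∙ (m ⁻¹ ∙ (y ∙ (m ⁻¹) ⁻¹)) ≈⟨ assoc ((g ⁻¹ ∙ h) ∙ m) (m ⁻¹) (y ∙ (m ⁻¹) ⁻¹) ⟨
        (((g ⁻¹ ∙ h) ∙ m) ∙ m ⁻¹) ∙ (y ∙ (m ⁻¹) ⁻¹) ≈⟨ ∙-cong (cancel (g ⁻¹ ∙ h) m) (∙-congˡ (⁻¹-involutive m)) ⟩
        (g ⁻¹ ∙ h) ∙ (((h ⁻¹ ∙ l) ∙ m′) ∙ m)        ≈⟨ ∙-congˡ (trans (assoc (h ⁻¹ ∙ l) m′ m) (assoc (h ⁻¹) l (m′ ∙ m))) ⟩
        (g ⁻¹ ∙ h) ∙ (h ⁻¹ ∙ (l ∙ (m′ ∙ m)))        ≈⟨ assoc (g ⁻¹ ∙ h) (h ⁻¹) (l ∙ (m′ ∙ m)) ⟨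
        ((g ⁻¹ ∙ h) ∙ h ⁻¹) ∙ (l ∙ (m′ ∙ m))        ≈⟨ ∙-congʳ (cancel (g ⁻¹) h) ⟩
        g ⁻¹ ∙ (l ∙ (m′ ∙ m))                       ≈⟨ assoc (g ⁻¹) l (m′ ∙ m) ⟨
        (g ⁻¹ ∙ l) ∙ (m′ ∙ m)                       ∎
        where
        cancel : ∀ a b → (a ∙ b) ∙ b ⁻¹ ≈ a
        cancel a b = trans (assoc a b (b ⁻¹)) (trans (∙-congˡ (inverseʳ b)) (identityʳ a))

  -- The chambers of X.
  chambers : Setoid 0ℓ 0ℓ
  chambers = record
    { Carrier       = Chamber
    ; _≈_           = _∼_
    ; isEquivalence = record { refl = ≈⇒∼ refl ; sym = ∼-sym ; trans = ∼-trans }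
    }

  infixr 7 _·_
  _·_ : Carrier → Chamber → Chamber
  g · (h ⋆ C) = (g ∙ h) ⋆ C

  -- C as a chamber of X.
  [_] : Alcove → Chamber
  [ C ] = ε ⋆ C

------------------------------------------------------------------------
-- The gallery and the half tree Y

  -- [H : K] = m for subgroups K ⊂ H.
  HasIndex : (H K : Carrier → Set) → ℕ → Set
  HasIndex H K m = Σ[ r ∈ (Fin m → Carrier) ] (∀ i → H (r i)) ×
    (∀ h → H h → ∃[ i ] K (r i ⁻¹ ∙ h)) × (∀ i j → K (r i ⁻¹ ∙ r j) → i ≡ j)

  -- The set of products of elements of the sets S α, α running through a list of roots.
  Products : List Φ → (Φ → Carrier → Set) → Carrier → Set
  Products []      S g = g ≈ ε
  Products (α ∷ L) S g = ∃[ a ] ∃[ b ] S α a × Products L S b × g ≈ a ∙ b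

  _^ᵍ_ : Carrier → ℕ → Carrier
  g ^ᵍ n = power G g (+ n)

  record Gallery (p : ℕ) (Φ⁺ : PositiveSystem 𝐆 R) : Set where
    open PositiveSystem Φ⁺ using (Positive; positives)

    -- The product of the N_α, α ∈ Φ⁺, is the group they generate.
    N : Carrier → Set
    N = rootGenerated 𝐆 R (base ℚₚ) Positive

    field
      C        : ℕ → Alcove
      adjacent : ∀ i → AdjacentAlcoves (C i) (C (ℕ.suc i))

    N₀[_] : ℕ → Carrier → Set
    N₀[ i ] g = Iwahori (C i) g × N g

    N₀ : Carrier → Set
    N₀ = N₀[ 0 ]

    field
      decreasing : ∀ i g → N₀[ ℕ.suc i ] g → N₀[ i ] g
      index-p    : ∀ i → HasIndex N₀[ i ] N₀[ ℕ.suc i ] p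
      α          : ℕ → Φ
      α-positive : ∀ i → Positive (α i)

    e[_,_] : ℕ → Φ → ℕ
    e[ i , β ] = length (filter (λ j → β FinP.≟ α j) (upTo i))

    field
      -- The defining property of the sequence α.
      factors    : ∀ i g → N₀[ i ] g ⇔
                   Products positives (λ β a → ∃[ b ] N₀ b × rootGroup β b × a ≈ b ^ᵍ (p ℕ.^ e[ i , β ])) g

  -- Vertices and edges of Y are the chambers n·C⁽ⁱ⁾.
  module HalfTreeY (Φ⁺ : PositiveSystem 𝐆 R) {p : ℕ} (𝒞 : Gallery p Φ⁺) where
    open Gallery 𝒞 using (C; N₀)

    InY : Chamber → Set
    InY c = ∃[ n ] N₀ n × ∃[ i ] c ∼ n · [ C i ]

    Y : HalfTree
    Y = record
      { vertices = subsetoid chambers InY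
      ; edges    = subsetoid chambers InY
      ; _∈ᵉ_     = λ (v , _) (e , _) →
          (∃[ n ] N₀ n × ∃[ i ] e ∼ n · [ C (ℕ.suc i) ] × (v ∼ n · [ C i ] ⊎ v ∼ n · [ C (ℕ.suc i) ]))
          ⊎ (e ∼ [ C 0 ] × v ∼ [ C 0 ])
      ; origin   = [ C 0 ] , ε , (identity , identity) , 0 , ≈⇒∼ (sym (identityˡ ε))
      }

------------------------------------------------------------------------
-- The properties of Θ, g and h

module Comparison (𝐊 : LocalField) (𝐆 : SplitReductiveGroup (LocalField.K 𝐊)) (R : RootDatum 𝐆)
  (Φ⁺ : PositiveSystem 𝐆 R) (p : ℕ) (𝒞 : Building.Gallery 𝐊 𝐆 R p Φ⁺) where

  open LocalField 𝐊 public renaming (𝒪 to ℤₚ; K to ℚₚ)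
  open Tree 𝐊 public using (GL₂; ν; γ; 𝔛⁰; 𝔛₊; _·ᵖ_) renaming (φ to φ₂)
  open Building 𝐊 𝐆 R public using (G; torus; inT; chambers; _∼_; _·_; [_]; module HalfTreeY)
  open HalfTreeY Φ⁺ 𝒞 public using (Y)
  open Building.Gallery 𝒞 public using (C; N₀; α)
  open HalfTree Y public using (Vertex; Edge; _≈ᵛ_; _∈]_[)

  open Group G
  open Setoid 𝔛⁰ using () renaming (_≈_ to _≈ᵗ_)
  open Setoid (unorderedPairs 𝔛⁰) using () renaming (_≈_ to _≈ᵖ_)
  open Group GL₂ using () renaming (_∙_ to _∙₂_)
  open _≅_ using (Θᵛ; Θᵉ)

  natural : ℕ → ∣ ℤₚ ∣ʳ
  natural m = power (CommutativeRing.+-group ℤₚ) (CommutativeRing.1# ℤₚ) (+ m)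

  _^₂_ : ∣ GL₂ ∣ᵍ → ℕ → ∣ GL₂ ∣ᵍ
  g ^₂ n = power GL₂ g (+ n)

  -- v′ = k v in Y, for k ∈ G.
  _↦⟨_⟩_ : Vertex → Carrier → Vertex → Set
  v ↦⟨ k ⟩ v′ = proj₁ v′ ∼ k · proj₁ v

  -- Θ(v′) = m Θ(v), for m ∈ GL₂(ℚ_p).
  _↦[_,_]_ : Vertex → Y ≅ 𝔛₊ → ∣ GL₂ ∣ᵍ → Vertex → Set
  v ↦[ Θ , m ] v′ = proj₁ (Θᵛ Θ v′) ≈ᵗ m ∙₂ proj₁ (Θᵛ Θ v)

  -- Θ⁻¹ ∘ m ∘ Θ restricts to a bijection ]v[ → ]Θ⁻¹(m Θ(v))[, w ↦ k w.  (It is injective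
  -- as Θ is.)
  Induces : Y ≅ 𝔛₊ → ∣ GL₂ ∣ᵍ → Vertex → Carrier → Set
  Induces Θ m v k = Σ[ v′ ∈ Vertex ] v ↦[ Θ , m ] v′ ×
    (∀ w → w ∈] v [ → Σ[ w′ ∈ Vertex ] w′ ∈] v′ [ × w ↦[ Θ , m ] w′ × w ↦⟨ k ⟩ w′) ×
    (∀ w′ → w′ ∈] v′ [ → Σ[ w ∈ Vertex ] w ∈] v [ × w ↦[ Θ , m ] w′)

  record PropertyA (Θ : Y ≅ 𝔛₊) (g : Vertex → ℕ → Carrier) : Set where
    field
      g-cong  : ∀ {v v′} b → v ≈ᵛ v′ → g v b ≈ g v′ b
      g∈N₀    : ∀ v b → N₀ (g v b)
      induces : ∀ v b → Induces Θ (ν ^₂ b) v (g v b)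

  -- φ(C⁽ⁱ⁾) = C⁽ⁱ⁺ʳ⁾ for all i.
  record Shift (φ : Carrier) (r : ℕ) : Set where
    field
      r>0        : 0 ℕ.< r
      normalises : NormalisesT 𝐆 φ
      shifts     : ∀ i → φ · [ C i ] ∼ [ C (i ℕ.+ r) ]

  PreservesY¹ : Carrier → Set
  PreservesY¹ φ = ∀ (e : Edge) → Σ[ e′ ∈ Edge ] proj₁ e′ ∼ φ · proj₁ e

  record PropertyB (φ : Carrier) (r : ℕ) (Θ : Y ≅ 𝔛₊) (g : Vertex → ℕ → Carrier) : Set where
    field
      equivariantᵛ : ∀ (v v′ : Vertex) → v ↦⟨ φ ⟩ v′ → v ↦[ Θ , φ₂ ^₂ r ] v′
      equivariantᵉ : ∀ (e e′ : Edge) → proj₁ e′ ∼ φ · proj₁ e →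
                     proj₁ (Θᵉ Θ e′) ≈ᵖ ((φ₂ ^₂ r) ·ᵖ proj₁ (Θᵉ Θ e))
      commutes     : ∀ v v′ → v ↦⟨ φ ⟩ v′ → g v′ (p ℕ.^ r) ∙ φ ≈ φ ∙ g v 1

  -- α⁽ⁱ⁾ ∘ τ = id for all i.
  record Section (τ : ∣ ℤₚ ˣ ∣ᵍ → ∣ torus ∣ᵍ) : Set where
    field
      isHom   : IsGroupHom (ℤₚ ˣ) torus τ
      section : ∀ i a → CommutativeRing._≈_ ℚₚ (val (character ℚₚ (RootDatum.root R (α i)) (τ a))) (ι (val a))

  record PropertyC (τ : ∣ ℤₚ ˣ ∣ᵍ → ∣ torus ∣ᵍ) (Θ : Y ≅ 𝔛₊)
                   (g : Vertex → ℕ → Carrier) (h : Vertex → ∣ ℤₚ ˣ ∣ᵍ → Carrier) : Set where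
    field
      h-cong  : ∀ {v v′ a a′} → v ≈ᵛ v′ → Group._≈_ (ℤₚ ˣ) a a′ → h v a ≈ h v′ a′
      h∈N₀τ   : ∀ v a → ∃[ n ] N₀ n × h v a ≈ n ∙ inT (τ a)
      induces : ∀ v a → Induces Θ (γ a) v (h v a)
      -- h(v,a)v lies in Y⁰.
      h-acts  : ∀ v a → Σ[ v′ ∈ Vertex ] v ↦⟨ h v a ⟩ v′
      -- m = a ∈ ℕ ∩ ℤ_pˣ, v₁ = g(v,1)v, v₂ = h(v,a)v
      cocycle : ∀ (m : ℕ) (a : ∣ ℤₚ ˣ ∣ᵍ) → CommutativeRing._≈_ ℤₚ (val a) (natural m) →
                ∀ v v₁ v₂ → v ↦⟨ g v 1 ⟩ v₁ → v ↦⟨ h v a ⟩ v₂ →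
                h v₁ a ∙ g v 1 ≈ g v₂ m ∙ h v a

  CommutesWith : Carrier → (∣ ℤₚ ˣ ∣ᵍ → ∣ torus ∣ᵍ) → Set
  CommutesWith φ τ = ∀ a → inT (τ a) ∙ φ ≈ φ ∙ inT (τ a)

  PropertyD : Carrier → (Vertex → ∣ ℤₚ ˣ ∣ᵍ → Carrier) → Set
  PropertyD φ h = ∀ v v′ a → v ↦⟨ φ ⟩ v′ → h v′ a ∙ φ ≈ φ ∙ h v a

-- ℚ_p = ℤ_p[1/p].
padic : ℕ → LocalField
padic p = record
  { 𝒪       = ℤₚ-ring p
  ; K       = localisation
  ; ι       = fromRing
  ; ι-isHom = fromRing-isHom
  ; ϖ       = fˣ
  }
  where open Localisation (ℤₚ-ring p) (fromℤ p (+ p))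

-- On both sides the vertices of level i are the cosets z + pⁱℤ_p: on 𝔛₊ as νᶻ 𝔳ᵢ, on Y by means of
-- elements ξⱼ(c) of root subgroups with N₀⁽ʲ⁾ = ∐ ξⱼ(d) N₀⁽ʲ⁺¹⁾, 0 ≤ d < p.  If z has the digits
-- d₀, d₁, … and the i-th remainder q, then Fᵢ(z) = ξ₀(d₀) ⋯ ξᵢ₋₁(dᵢ₋₁) ξᵢ(q) carries C⁽ⁱ⁾ to the
-- vertex z + pⁱℤ_p of Y.  If s normalises all ξⱼ and scales them by a, then z ↦ az + b is induced at
-- this vertex by Fᵢ(az + b) s Fᵢ(z)⁻¹, with s = 1 for ν and s = τ(a) for γ(a).  These elements
-- telescope, which gives the cocycle relation, and if the ξⱼ are chosen r-periodically with respect
-- to φ, then φ Fᵢ(z) φ⁻¹ = Fᵢ₊ᵣ(pʳz), which gives the compatibility with φ.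
--
-- That n C⁽ⁱ⁾ determines i and n N₀⁽ⁱ⁾ rests on the Iwahori decomposition I_C = U⁻ T₀ U⁺.  It is
-- carried from Φ⁺ to -Φ⁺ by replacing one root at a time by its negative, in the order of the slopes.
-- Comparing it with the big cell shows that a product u m ∈ I_C, u ∈ N, m ∈ N(T), has u ∈ I_C.
-- Finally, τ(a) fixes the chambers of A because ℤ_pˣ has no nontrivial homomorphism to ℤ.
{-# OPTIONS --safe #-}
module Submission where

open import Defs
open import Algebra.Bundles using (Group; CommutativeRing)
open import Algebra.Morphism.Structures using (module RingMorphisms; module GroupMorphisms)
import Algebra.Definitions.RawMonoid as RawMonoidDefs
import Algebra.Properties.Group as GroupProperties
import Algebra.Properties.Monoid.Mult as Mult
import Algebra.Properties.Ring as RingProperties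
import Algebra.Properties.Semiring.Exp as Exp
import Algebra.Properties.Semiring.Mult as SemiringMult
import Algebra.Solver.Ring.NaturalCoefficients.Default as SemiringSolver
open import Data.Bool.Base using (Bool; true; false; not)
open import Data.Empty using (⊥; ⊥-elim)
open import Data.Fin.Base as Fin using (Fin; zero; suc)
import Data.Fin.Properties as FinP
open import Data.Integer.Base as ℤ using (ℤ; +_; -[1+_]; 0ℤ; 1ℤ)
import Data.Integer.Properties as ℤP
open import Data.List.Base as List using (List; []; _∷_)
open import Data.List.Membership.Propositional using (_∈_)
open import Data.List.Membership.Propositional.Properties using (∈-filter⁻)
open import Data.List.Properties using (filter-++; length-++; upTo-∷ʳ; filter-accept; filter-reject)
open import Data.List.Relation.Binary.Permutation.Propositional using (↭-refl)
open import Data.List.Relation.Unary.All as All using (All; []; _∷_)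
open import Data.List.Relation.Unary.All.Properties using (all-filter)
open import Data.List.Relation.Unary.Any using (here; there)
open import Data.Nat.Base as ℕ using (ℕ)
open import Data.Nat.Coprimality using (coprime-Bézout; prime⇒coprime)
import Data.Nat.Divisibility as ℕD
open import Data.Nat.DivMod using (_/_; _%_; m≡m%n+[m/n]*n; [m+n]%n≡m%n; m/n≡1+[m∸n]/n)
open import Data.Nat.GCD using (module Bézout)
open import Data.Nat.Primality using (Prime; prime⇒nonTrivial; prime⇒nonZero)
import Data.Nat.Properties as ℕP
open import Data.Product.Base using (Σ-syntax; ∃; ∃-syntax; _×_; _,_; proj₁; proj₂)
open import Data.Rational.Base as ℚ using (ℚ)
open import Data.Sum.Base using (_⊎_; inj₁; inj₂; [_,_]′) renaming (swap to ⊎-swap)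
open import Data.Vec.Base as Vec using (Vec)
open import Function.Base using (_∘_)
open import Function.Bundles using (_⇔_; mk⇔; Inverse; Equivalence)
import Function.Construct.Composition as Compose
import Function.Construct.Symmetry as Symmetry
open import Level using (0ℓ)
open import Relation.Binary.Bundles using (Setoid)
open import Relation.Binary.Definitions using (tri<; tri≈; tri>)
open import Relation.Binary.PropositionalEquality as ≡ using (_≡_; _≢_; _≗_)
import Relation.Binary.Reasoning.Setoid as SetoidReasoning
import Relation.Binary.Reflection as Reflection
open import Relation.Nullary.Decidable using (Dec; yes; no; _×-dec_)
open import Relation.Nullary.Negation using (¬_; contradiction)

-- N₀ need not be commutative, so z ↦ Fᵢ(z) is no homomorphism and one cannot expect a single
-- element of N₀ to match ν on all of Y; this is why g and h depend on the vertex. What survives is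
-- Fᵢ(z + pⁱc) = Fᵢ(z) ξᵢ(c). It is for this identity that the whole remainder q, and not just its
-- digit, stands in the last factor: Fᵢ(az + b) s Fᵢ(z)⁻¹ then depends on z only modulo pⁱ. So it is
-- attached to the vertex as an element of G and not merely as a coset, which the relations in G
-- require, and it serves all vertices of ]v[ at once. Iwahori subgroups are given by generators, so
-- it is not clear at first which elements lie outside them. The triangular decomposition bounds
-- them from above: it tells which x α u lie in I_C, and hence that ξⱼ(c) ∈ N₀⁽ʲ⁺¹⁾ forces p to
-- divide c. Its proof rests on the fact that U⁻ T₀ U⁺ is the same set for all sets of roots passed
-- on the way from Φ⁺ to -Φ⁺. Every root group belongs to the left factor for one of them, so this
-- set absorbs left multiplication by all generators.

-- A decision procedure for group identities, and integer powers.

module GroupSolver (G : Grp) where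
  open Group G
  open GroupProperties G using (⁻¹-anti-homo-∙; ⁻¹-involutive; ε⁻¹≈ε)
  private module Eq = SetoidReasoning setoid

  infixl 7 _⊙_
  infix  8 _⊖

  data Expr (n : ℕ) : Set where
    var : Fin n → Expr n
    𝟏   : Expr n
    _⊙_ : Expr n → Expr n → Expr n
    _⊖  : Expr n → Expr n

  ⟦_⟧ : ∀ {n} → Expr n → Vec Carrier n → Carrier
  ⟦ var i ⟧ ρ = Vec.lookup ρ i
  ⟦ 𝟏 ⟧     ρ = ε
  ⟦ a ⊙ b ⟧ ρ = ⟦ a ⟧ ρ ∙ ⟦ b ⟧ ρ
  ⟦ a ⊖ ⟧   ρ = ⟦ a ⟧ ρ ⁻¹

  private
    Letter : ℕ → Set
    Letter n = Bool × Fin n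

    signed : Bool → Carrier → Carrier
    signed true  g = g
    signed false g = g ⁻¹

    word : ∀ {n} → List (Letter n) → Vec Carrier n → Carrier
    word []            ρ = ε
    word ((s , i) ∷ w) ρ = signed s (Vec.lookup ρ i) ∙ word w ρ

    cons : ∀ {n} → Bool → Fin n → List (Letter n) → List (Letter n)
    cons s i []            = (s , i) ∷ []
    cons true i ((false , j) ∷ w) with i FinP.≟ j
    ... | yes _ = w
    ... | no  _ = (true , i) ∷ (false , j) ∷ w
    cons false i ((true , j) ∷ w) with i FinP.≟ j
    ... | yes _ = w
    ... | no  _ = (false , i) ∷ (true , j) ∷ w
    cons true i ((true , j) ∷ w) = (true , i) ∷ (true , j) ∷ w
    cons false i ((false , j) ∷ w) = (false , i) ∷ (false , j) ∷ w

    -- The sign says whether the expression stands inverted and the list is the word that follows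
    -- it, so a product is reversed and reduced in the same pass.
    normal : ∀ {n} → Expr n → Bool → List (Letter n) → List (Letter n)
    normal (var i) s     w = cons s i w
    normal 𝟏       s     w = w
    normal (a ⊙ b) true  w = normal a true (normal b true w)
    normal (a ⊙ b) false w = normal b false (normal a false w)
    normal (a ⊖)   s     w = normal a (not s) w

    cancelˡ : ∀ {g h} w → g ∙ h ≈ ε → w ≈ g ∙ (h ∙ w)
    cancelˡ w gh = sym (trans (sym (assoc _ _ w)) (trans (∙-congʳ gh) (identityˡ w)))

    cons-correct : ∀ {n} s i (w : List (Letter n)) ρ →
                   word (cons s i w) ρ ≈ signed s (Vec.lookup ρ i) ∙ word w ρ
    cons-correct s i [] ρ = refl
    cons-correct true i ((false , j) ∷ w) ρ with i FinP.≟ j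
    ... | yes ≡.refl = cancelˡ _ (inverseʳ _)
    ... | no  _      = refl
    cons-correct false i ((true , j) ∷ w) ρ with i FinP.≟ j
    ... | yes ≡.refl = cancelˡ _ (inverseˡ _)
    ... | no  _      = refl
    cons-correct true i ((true , j) ∷ w) ρ = refl
    cons-correct false i ((false , j) ∷ w) ρ = refl

    signed-not : ∀ s g → signed (not s) g ≈ signed s (g ⁻¹)
    signed-not true  g = refl
    signed-not false g = sym (⁻¹-involutive g)

    signed-ε : ∀ s w → w ≈ signed s ε ∙ w
    signed-ε true  w = sym (identityˡ w)
    signed-ε false w = sym (trans (∙-congʳ ε⁻¹≈ε) (identityˡ w))

    normal-correct : ∀ {n} (a : Expr n) s w ρ → word (normal a s w) ρ ≈ signed s (⟦ a ⟧ ρ) ∙ word w ρ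
    normal-correct (var i) s w ρ = cons-correct s i w ρ
    normal-correct 𝟏 s w ρ = signed-ε s _
    normal-correct (a ⊙ b) true w ρ =
      trans (normal-correct a true _ ρ) (trans (∙-congˡ (normal-correct b true w ρ)) (sym (assoc _ _ _)))
    normal-correct (a ⊙ b) false w ρ =
      trans (normal-correct b false _ ρ) (trans (∙-congˡ (normal-correct a false w ρ))
        (trans (sym (assoc _ _ _)) (∙-congʳ (sym (⁻¹-anti-homo-∙ _ _)))))
    normal-correct (a ⊖) s w ρ =
      trans (normal-correct a (not s) w ρ) (∙-congʳ (signed-not s _))

  ⟦_⇓⟧ : ∀ {n} → Expr n → Vec Carrier n → Carrier
  ⟦ a ⇓⟧ = word (normal a true [])

  private
    correct : ∀ {n} (a : Expr n) ρ → ⟦ a ⇓⟧ ρ ≈ ⟦ a ⟧ ρ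
    correct a ρ = trans (normal-correct a true [] ρ) (identityʳ _)

  open Reflection setoid var ⟦_⟧ ⟦_⇓⟧ correct public using (solve; _⊜_)

module Powers (G : Grp) where
  open Group G
  open GroupProperties G using (⁻¹-anti-homo-∙; ε⁻¹≈ε; ⁻¹-involutive)
  open Mult monoid public using () renaming (_×_ to _⋅_; ×-homo-+ to ⋅-+; ×-congʳ to ⋅-cong)
  open GroupSolver G

  ⋅-commute : ∀ g h n → g ∙ h ≈ h ∙ g → (n ⋅ g) ∙ h ≈ h ∙ (n ⋅ g)
  ⋅-commute g h ℕ.zero    gh = trans (identityˡ h) (sym (identityʳ h))
  ⋅-commute g h (ℕ.suc n) gh = begin
    (g ∙ (n ⋅ g)) ∙ h ≈⟨ assoc _ _ _ ⟩
    g ∙ ((n ⋅ g) ∙ h) ≈⟨ ∙-congˡ (⋅-commute g h n gh) ⟩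
    g ∙ (h ∙ (n ⋅ g)) ≈⟨ assoc _ _ _ ⟨
    (g ∙ h) ∙ (n ⋅ g) ≈⟨ ∙-congʳ gh ⟩
    (h ∙ g) ∙ (n ⋅ g) ≈⟨ assoc _ _ _ ⟩
    h ∙ (g ∙ (n ⋅ g)) ∎
    where open SetoidReasoning setoid

  power-cong : ∀ {g h} k → g ≈ h → power G g k ≈ power G h k
  power-cong (+ n)    e = ⋅-cong n e
  power-cong -[1+ n ] e = ⁻¹-cong (⋅-cong (ℕ.suc n) e)

  power-⊖ : ∀ g m n → power G g (m ℤ.⊖ n) ≈ (m ⋅ g) ∙ (n ⋅ g) ⁻¹
  power-⊖ g m         ℕ.zero    = sym (trans (∙-congˡ ε⁻¹≈ε) (identityʳ _))
  power-⊖ g ℕ.zero    (ℕ.suc n) = sym (identityˡ _)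
  power-⊖ g (ℕ.suc m) (ℕ.suc n) = begin
    power G g (ℕ.suc m ℤ.⊖ ℕ.suc n)           ≡⟨ ≡.cong (power G g) (ℤP.[1+m]⊖[1+n]≡m⊖n m n) ⟩
    power G g (m ℤ.⊖ n)                       ≈⟨ power-⊖ g m n ⟩
    (m ⋅ g) ∙ (n ⋅ g) ⁻¹              ≈⟨ solve 3 (λ m n g → m ⊙ n ⊖ ⊜ (m ⊙ g) ⊙ (n ⊙ g) ⊖) refl _ _ g ⟩
    ((m ⋅ g) ∙ g) ∙ ((n ⋅ g) ∙ g) ⁻¹  ≈⟨ ∙-cong (⋅-commute g g m refl) (⁻¹-cong (⋅-commute g g n refl)) ⟩
    (ℕ.suc m ⋅ g) ∙ (ℕ.suc n ⋅ g) ⁻¹  ∎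
    where open SetoidReasoning setoid

  power-+ : ∀ g k l → power G g (k ℤ.+ l) ≈ power G g k ∙ power G g l
  power-+ g (+ m)    (+ n)    = ⋅-+ g m n
  power-+ g (+ m)    -[1+ n ] = power-⊖ g m (ℕ.suc n)
  power-+ g -[1+ m ] (+ n)    = begin
    power G g (n ℤ.⊖ ℕ.suc m)           ≈⟨ power-⊖ g n (ℕ.suc m) ⟩
    (n ⋅ g) ∙ (ℕ.suc m ⋅ g) ⁻¹  ≈⟨ swap (⋅-commute g _ n (sym (⋅-commute g g (ℕ.suc m) refl))) ⟩
    (ℕ.suc m ⋅ g) ⁻¹ ∙ (n ⋅ g)  ∎
    where
    open SetoidReasoning setoid
    swap : ∀ {a b} → a ∙ b ≈ b ∙ a → a ∙ b ⁻¹ ≈ b ⁻¹ ∙ a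
    swap {a} {b} ab = trans (solve 2 (λ a b → a ⊙ b ⊖ ⊜ (b ⊖ ⊙ (b ⊙ a)) ⊙ b ⊖) refl a b)
      (trans (∙-congʳ (∙-congˡ (sym ab))) (solve 2 (λ a b → b ⊖ ⊙ (a ⊙ b) ⊙ b ⊖ ⊜ b ⊖ ⊙ a) refl a b))
  power-+ g -[1+ m ] -[1+ n ] = begin
    (ℕ.suc (ℕ.suc (m ℕ.+ n)) ⋅ g) ⁻¹            ≡⟨ ≡.cong (λ k → (k ⋅ g) ⁻¹) (≡.cong ℕ.suc (≡.trans (≡.cong ℕ.suc (ℕP.+-comm m n)) (≡.sym (ℕP.+-suc n m)))) ⟩
    ((ℕ.suc n ℕ.+ ℕ.suc m) ⋅ g) ⁻¹              ≈⟨ ⁻¹-cong (⋅-+ g (ℕ.suc n) (ℕ.suc m)) ⟩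
    ((ℕ.suc n ⋅ g) ∙ (ℕ.suc m ⋅ g)) ⁻¹      ≈⟨ ⁻¹-anti-homo-∙ _ _ ⟩
    (ℕ.suc m ⋅ g) ⁻¹ ∙ (ℕ.suc n ⋅ g) ⁻¹     ∎
    where open SetoidReasoning setoid

  power-neg : ∀ g k → power G g (ℤ.- k) ≈ power G g k ⁻¹
  power-neg g (+ ℕ.zero)   = sym ε⁻¹≈ε
  power-neg g (+ ℕ.suc n)  = refl
  power-neg g -[1+ n ]     = sym (⁻¹-involutive _)

  ⋅-ε : ∀ n → n ⋅ ε ≈ ε
  ⋅-ε ℕ.zero    = refl
  ⋅-ε (ℕ.suc n) = trans (identityˡ _) (⋅-ε n)

  power-power : ∀ g k l → power G (power G g k) l ≈ power G g (l ℤ.* k)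
  power-power g k (+ n)    = natural n
    where
    natural : ∀ n → power G (power G g k) (+ n) ≈ power G g (+ n ℤ.* k)
    natural ℕ.zero    = reflexive (≡.cong (power G g) (≡.sym (ℤP.*-zeroˡ k)))
    natural (ℕ.suc n) = begin
      power G g k ∙ power G (power G g k) (+ n)    ≈⟨ ∙-congˡ (natural n) ⟩
      power G g k ∙ power G g (+ n ℤ.* k)          ≈⟨ power-+ g k (+ n ℤ.* k) ⟨
      power G g (k ℤ.+ + n ℤ.* k)                  ≡⟨ ≡.cong (power G g) (ℤP.suc-* (+ n) k) ⟨
      power G g (+ ℕ.suc n ℤ.* k)                  ∎
      where open SetoidReasoning setoid
  power-power g k -[1+ n ] = begin
    power G (power G g k) (+ ℕ.suc n) ⁻¹   ≈⟨ ⁻¹-cong (power-power g k (+ ℕ.suc n)) ⟩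
    power G g (+ ℕ.suc n ℤ.* k) ⁻¹         ≈⟨ power-neg g (+ ℕ.suc n ℤ.* k) ⟨
    power G g (ℤ.- (+ ℕ.suc n ℤ.* k))      ≡⟨ ≡.cong (power G g) (ℤP.neg-distribˡ-* (+ ℕ.suc n) k) ⟩
    power G g (-[1+ n ] ℤ.* k)             ∎
    where open SetoidReasoning setoid

module _ (G H : Grp) (f : ∣ G ∣ᵍ → ∣ H ∣ᵍ) (f-isHom : IsGroupHom G H f) where
  open Group H
  private
    module G = Group G
    module f = GroupMorphisms.IsGroupHomomorphism f-isHom

  ⋅-homo : ∀ g n → f (power G g (+ n)) ≈ power H (f g) (+ n)
  ⋅-homo g ℕ.zero    = f.ε-homo
  ⋅-homo g (ℕ.suc n) = trans (f.homo g _) (∙-congˡ (⋅-homo g n))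

  power-homo : ∀ g k → f (power G g k) ≈ power H (f g) k
  power-homo g (+ n)    = ⋅-homo g n
  power-homo g -[1+ n ] = trans (f.⁻¹-homo _) (⁻¹-cong (⋅-homo g (ℕ.suc n)))

-- ℤ_p ⊂ ℚ_p through a list of axioms, and the valuation.

module PadicAxioms (p : ℕ) (𝐊 : LocalField) where
  open LocalField 𝐊
  module O = CommutativeRing 𝒪
  module K = CommutativeRing K
  open Exp O.semiring using (_^_)

  nat : ℕ → O.Carrier
  nat n = power O.+-group O.1# (+ n)

  π : O.Carrier
  π = nat p

  ι-Injective π-Cancel Expand Digit-unique 1+π-Unit Fraction Take-root : Set
  ι-Injective  = ∀ a b → ι a K.≈ ι b → a O.≈ b
  π-Cancel     = ∀ a b → π O.* a O.≈ π O.* b → a O.≈ b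
  Expand       = ∀ a → ∃[ d ] ∃[ b ] d ℕ.< p × a O.≈ nat d O.+ π O.* b
  Digit-unique = ∀ d d′ b b′ → d ℕ.< p → d′ ℕ.< p → nat d O.+ π O.* b O.≈ nat d′ O.+ π O.* b′ → d ≡ d′
  1+π-Unit     = ∀ z → ∃[ w ] (O.1# O.+ π O.* z) O.* w O.≈ O.1#
  Fraction     = ∀ x → ∃[ k ] ∃[ a ] x K.* val (power (K ˣ) ϖ (+ k)) K.≈ ι a
  Take-root    = ∀ b z M → 0 ℕ.< M → b O.≈ O.1# O.+ π O.* z → ∃[ c ]
                 (∃[ z′ ] c O.≈ O.1# O.+ π O.* z′) × c O.≈ b O.* c ^ (p ℕ.^ M)

-- What is used about ℤ_p ⊂ ℚ_p: one step of the p-adic expansion, and as a trace of completeness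
-- the existence of (pᴹ-1)-th roots of elements 1 + pz (written so that only powers with
-- exponent in ℕ occur).
record PadicField (p : ℕ) (𝐊 : LocalField) : Set where
  open LocalField 𝐊
  open PadicAxioms p 𝐊 public
  field
    prime         : Prime p
    ϖ≈p           : val ϖ K.≈ ι π
    ι-injective′  : ι-Injective
    π-cancel′     : π-Cancel
    expand        : Expand
    digit-unique′ : Digit-unique
    1+π-unit      : 1+π-Unit
    fraction      : Fraction
    take-root     : Take-root

  ι-injective : ∀ {a b} → ι a K.≈ ι b → a O.≈ b
  ι-injective = ι-injective′ _ _

  π-cancel : ∀ {a b} → π O.* a O.≈ π O.* b → a O.≈ b
  π-cancel = π-cancel′ _ _

  digit-unique : ∀ {d d′ b b′} → d ℕ.< p → d′ ℕ.< p → nat d O.+ π O.* b O.≈ nat d′ O.+ π O.* b′ → d ≡ d′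
  digit-unique = digit-unique′ _ _ _ _

≤⇒∃+ : ∀ {k l} → k ℤ.≤ l → ∃[ n ] l ≡ k ℤ.+ + n
≤⇒∃+ {k} {l} k≤l = ℤ.∣ l ℤ.- k ∣ , ≡.sym (≡.trans
  (≡.cong (λ i → k ℤ.+ i) (ℤP.0≤i⇒+∣i∣≡i (ℤP.i≤j⇒0≤j-i k≤l)))
  (≡.trans (ℤP.+-comm k (l ℤ.- k)) (≡.trans (ℤP.+-assoc l (ℤ.- k) k)
    (≡.trans (≡.cong (λ i → l ℤ.+ i) (ℤP.+-inverseˡ k)) (ℤP.+-identityʳ l)))))

module Valuation (p : ℕ) (𝐊 : LocalField) (P : PadicField p 𝐊) where
  open LocalField 𝐊
  open PadicField P public
  open Exp O.semiring using (_^_) public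
  open Powers (K ˣ) public using (power-+)
  module ι = RingMorphisms.IsRingHomomorphism ι-isHom
  open SemiringSolver K.commutativeSemiring using (solve; _:=_; _:*_)

  pow : ℤ → K.Carrier
  pow k = val (power (K ˣ) ϖ k)

  pow-+ : ∀ k l → pow (k ℤ.+ l) K.≈ pow k K.* pow l
  pow-+ k l = val≈ (power-+ ϖ k l)

  pow-inverse : ∀ k → pow (ℤ.- k) K.* pow k K.≈ K.1#
  pow-inverse k = K.trans (K.sym (pow-+ (ℤ.- k) k)) (K.reflexive (≡.cong pow (ℤP.+-inverseˡ k)))

  pow-nat : ∀ n → pow (+ n) K.≈ ι (π ^ n)
  pow-nat ℕ.zero    = K.sym ι.1#-homo
  pow-nat (ℕ.suc n) = K.trans (K.*-cong ϖ≈p (pow-nat n)) (K.sym (ι.*-homo π (π ^ n)))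

  pow-cancel : ∀ k {x y} → pow k K.* x K.≈ pow k K.* y → x K.≈ y
  pow-cancel k {x} {y} h = begin
    x                            ≈⟨ unfold x ⟨
    pow (ℤ.- k) K.* (pow k K.* x) ≈⟨ K.*-congˡ h ⟩
    pow (ℤ.- k) K.* (pow k K.* y) ≈⟨ unfold y ⟩
    y                            ∎
    where
    open SetoidReasoning K.setoid
    unfold : ∀ z → pow (ℤ.- k) K.* (pow k K.* z) K.≈ z
    unfold z = K.trans (K.sym (K.*-assoc _ _ _)) (K.trans (K.*-congʳ (pow-inverse k)) (K.*-identityˡ z))

  infix 4 _∈p^_
  -- The same condition as the ∃-type used for the building; as a record, its type determines `u`
  -- and `k`.
  record _∈p^_ (u : K.Carrier) (k : ℤ) : Set where
    constructor _,_
    field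
      quotient : O.Carrier
      equality : u K.≈ pow k K.* ι quotient

  ∈-cong : ∀ {u v k} → u K.≈ v → u ∈p^ k → v ∈p^ k
  ∈-cong uv (z , e) = z , K.trans (K.sym uv) e

  ∈-0 : ∀ k → K.0# ∈p^ k
  ∈-0 k = O.0# , K.sym (K.trans (K.*-congˡ ι.0#-homo) (K.zeroʳ _))

  ∈-+ : ∀ {u v k} → u ∈p^ k → v ∈p^ k → (u K.+ v) ∈p^ k
  ∈-+ {u} {v} {k} (a , e) (b , f) = a O.+ b , (begin
    u K.+ v                         ≈⟨ K.+-cong e f ⟩
    pow k K.* ι a K.+ pow k K.* ι b ≈⟨ K.distribˡ _ _ _ ⟨
    pow k K.* (ι a K.+ ι b)         ≈⟨ K.*-congˡ (ι.+-homo a b) ⟨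
    pow k K.* ι (a O.+ b)           ∎)
    where open SetoidReasoning K.setoid

  ∈-* : ∀ {u v k l} → u ∈p^ k → v ∈p^ l → (u K.* v) ∈p^ (k ℤ.+ l)
  ∈-* {u} {v} {k} {l} (a , e) (b , f) = a O.* b , (begin
    u K.* v                             ≈⟨ K.*-cong e f ⟩
    (pow k K.* ι a) K.* (pow l K.* ι b) ≈⟨ solve 4 (λ x a y b → (x :* a) :* (y :* b) := (x :* y) :* (a :* b)) K.refl _ _ _ _ ⟩
    (pow k K.* pow l) K.* (ι a K.* ι b) ≈⟨ K.*-cong (pow-+ k l) (ι.*-homo a b) ⟨
    pow (k ℤ.+ l) K.* ι (a O.* b)       ∎)
    where open SetoidReasoning K.setoid

  ∈-ι : ∀ a → ι a ∈p^ 0ℤ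
  ∈-ι a = a , K.sym (K.*-identityˡ _)

  ∈-pow : ∀ k → pow k ∈p^ k
  ∈-pow k = O.1# , K.sym (K.trans (K.*-congˡ ι.1#-homo) (K.*-identityʳ _))

  ∈-ι* : ∀ {u k} a → u ∈p^ k → (ι a K.* u) ∈p^ k
  ∈-ι* {u} {k} a h = ≡.subst ((ι a K.* u) ∈p^_) (ℤP.+-identityˡ k) (∈-* (∈-ι a) h)

  ∈-neg : ∀ {u k} → u ∈p^ k → (K.- u) ∈p^ k
  ∈-neg {u} h = ∈-cong
    (K.trans (K.*-congʳ (K.trans (ι.-‿homo O.1#) (K.-‿cong ι.1#-homo))) (RingProperties.-1*x≈-x K.ring u))
    (∈-ι* (O.- O.1#) h)

  ∈-mono : ∀ {u k l} → k ℤ.≤ l → u ∈p^ l → u ∈p^ k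
  ∈-mono {u} {k} {l} k≤l (a , e) with n , eq ← ≤⇒∃+ k≤l = π ^ n O.* a , (begin
    u                                  ≈⟨ e ⟩
    pow l K.* ι a                      ≡⟨ ≡.cong (λ i → pow i K.* ι a) eq ⟩
    pow (k ℤ.+ + n) K.* ι a            ≈⟨ K.*-congʳ (K.trans (pow-+ k (+ n)) (K.*-congˡ (pow-nat n))) ⟩
    (pow k K.* ι (π ^ n)) K.* ι a      ≈⟨ K.*-assoc _ _ _ ⟩
    pow k K.* (ι (π ^ n) K.* ι a)      ≈⟨ K.*-congˡ (ι.*-homo _ _) ⟨
    pow k K.* ι (π ^ n O.* a)          ∎)
    where open SetoidReasoning K.setoid

  ∈-^ : ∀ {u k} n → u ∈p^ k → (Exp._^_ K.semiring u n) ∈p^ (+ n ℤ.* k)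
  ∈-^ {u} {k} ℕ.zero    h = ∈-cong ι.1#-homo (≡.subst (ι O.1# ∈p^_) (≡.sym (ℤP.*-zeroˡ k)) (∈-ι O.1#))
  ∈-^ {u} {k} (ℕ.suc n) h = ≡.subst (_ ∈p^_) (≡.sym (ℤP.suc-* (+ n) k)) (∈-* h (∈-^ n h))

  ∈-multiple : ∀ {u k} c → u ∈p^ k → power K.+-group u c ∈p^ k
  ∈-multiple c h = multiple c
    where
    natural : ∀ n → power K.+-group _ (+ n) ∈p^ _
    natural ℕ.zero    = ∈-0 _
    natural (ℕ.suc n) = ∈-+ h (natural n)
    multiple : ∀ c → power K.+-group _ c ∈p^ _
    multiple (+ n)    = natural n
    multiple -[1+ n ] = ∈-neg (natural (ℕ.suc n))

  p>1 : 1 ℕ.< p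
  p>1 = ℕ.nonTrivial⇒n>1 p {{prime⇒nonTrivial prime}}

  -- Otherwise one number would have expansions with the first digits 1 and 0.
  π-nonunit : ∀ z → ¬ O.1# O.≈ π O.* z
  π-nonunit z h = ℕP.1+n≢0 (digit-unique p>1 (ℕP.<-trans ℕ.z<s p>1)
    (O.trans (O.+-cong (O.+-identityʳ O.1#) (O.zeroʳ π)) (O.trans (O.+-identityʳ O.1#) (O.trans h (O.sym (O.+-identityˡ _))))))

  -- For l > k, dividing by pᵏ would make 1 a multiple of π.
  pow∈⇒≤ : ∀ k l → pow k ∈p^ l → l ℤ.≤ k
  pow∈⇒≤ k l (z , e) with l ℤP.≤? k
  ... | yes l≤k = l≤k
  ... | no  l≰k with n , eq ← ≤⇒∃+ (ℤP.i<j⇒suc[i]≤j (ℤP.≰⇒> l≰k)) = contradiction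
      (ι-injective (pow-cancel k (begin
        pow k K.* ι O.1#                                       ≈⟨ K.*-congˡ ι.1#-homo ⟩
        pow k K.* K.1#                                         ≈⟨ K.*-identityʳ _ ⟩
        pow k                                                  ≈⟨ e ⟩
        pow l K.* ι z                                          ≡⟨ ≡.cong (λ i → pow i K.* ι z) eq′ ⟩
        pow (k ℤ.+ + ℕ.suc n) K.* ι z                          ≈⟨ K.*-congʳ (K.trans (pow-+ k (+ ℕ.suc n)) (K.*-congˡ (pow-nat (ℕ.suc n)))) ⟩
        (pow k K.* ι (π ^ ℕ.suc n)) K.* ι z                    ≈⟨ K.*-assoc _ _ _ ⟩
        pow k K.* (ι (π ^ ℕ.suc n) K.* ι z)                    ≈⟨ K.*-congˡ (ι.*-homo _ _) ⟨
        pow k K.* ι (π ^ ℕ.suc n O.* z)                        ∎)))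
      (λ h → π-nonunit (π ^ n O.* z) (O.trans h (O.*-assoc _ _ _)))
    where
    open SetoidReasoning K.setoid
    eq′ : l ≡ k ℤ.+ + ℕ.suc n
    eq′ = ≡.trans eq (≡.trans (ℤP.+-assoc 1ℤ k (+ n)) (≡.trans (≡.cong (λ i → 1ℤ ℤ.+ i) (ℤP.+-comm k (+ n)))
            (≡.trans (≡.sym (ℤP.+-assoc 1ℤ (+ n) k)) (ℤP.+-comm (+ ℕ.suc n) k))))

  1+π : O.Carrier → ∣ 𝒪 ˣ ∣ᵍ
  1+π z .val     = O.1# O.+ π O.* z
  1+π z .inv     = proj₁ (1+π-unit z)
  1+π z .val∙inv = proj₂ (1+π-unit z)
  1+π z .inv∙val = O.trans (O.*-comm _ _) (proj₂ (1+π-unit z))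

  ∈-positive : ∀ {u k} → 1ℤ ℤ.≤ k → u ∈p^ k → ∃[ z ] u K.≈ ι (π O.* z)
  ∈-positive {u} 1≤k h with z , e ← ∈-mono 1≤k h =
    z , K.trans e (K.trans (K.*-congʳ (K.trans (K.*-identityʳ _) ϖ≈p)) (K.sym (ι.*-homo π z)))

  -- If u = p²u then (1 - p²)u = 0 and 1 - p² is a unit.
  pow2-fixed : ∀ {u} → u K.≈ pow (+ 2) K.* u → u K.≈ K.0#
  pow2-fixed {u} h = begin
    u                                     ≈⟨ K.*-identityˡ u ⟨
    K.1# K.* u                            ≈⟨ K.*-congʳ (K.trans (K.sym ι.1#-homo) (ι.⟦⟧-cong (O.sym (inv∙val d)))) ⟩
    ι (inv d O.* val d) K.* u             ≈⟨ K.*-congʳ (ι.*-homo _ _) ⟩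
    (ι (inv d) K.* ι (val d)) K.* u       ≈⟨ K.*-assoc _ _ _ ⟩
    ι (inv d) K.* (ι (val d) K.* u)       ≈⟨ K.*-congˡ d*u≈0 ⟩
    ι (inv d) K.* K.0#                    ≈⟨ K.zeroʳ _ ⟩
    K.0#                                  ∎
    where
    open SetoidReasoning K.setoid
    d = 1+π (O.- π)
    d*u≈0 : ι (val d) K.* u K.≈ K.0#
    d*u≈0 = begin
      ι (O.1# O.+ π O.* O.- π) K.* u                 ≈⟨ K.*-congʳ (ι.⟦⟧-cong (O.+-congˡ (O.sym (RingProperties.-‿distribʳ-* O.ring π π)))) ⟩
      ι (O.1# O.+ O.- (π O.* π)) K.* u               ≈⟨ K.*-congʳ (K.trans (ι.+-homo _ _) (K.+-cong ι.1#-homo (ι.-‿homo _))) ⟩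
      (K.1# K.+ K.- ι (π O.* π)) K.* u               ≈⟨ K.distribʳ _ _ _ ⟩
      K.1# K.* u K.+ K.- ι (π O.* π) K.* u           ≈⟨ K.+-cong (K.*-identityˡ u) (K.sym (RingProperties.-‿distribˡ-* K.ring _ u)) ⟩
      u K.+ K.- (ι (π O.* π) K.* u)                  ≈⟨ K.+-congˡ (K.-‿cong (K.*-congʳ (K.trans (ι.⟦⟧-cong (O.*-congˡ (O.sym (O.*-identityʳ π)))) (K.sym (pow-nat 2))))) ⟩
      u K.+ K.- (pow (+ 2) K.* u)                    ≈⟨ K.+-congˡ (K.-‿cong h) ⟨
      u K.+ K.- u                                    ≈⟨ K.-‿inverseʳ u ⟩
      K.0#                                           ∎

-- Pairings on lattices, and the order of the roots by slope.

module Counting where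
  count : ∀ {n} {P : Fin n → Set} → (∀ i → Dec (P i)) → ℕ
  count {ℕ.zero}  P? = 0
  count {ℕ.suc n} P? with P? zero
  ... | yes _ = ℕ.suc (count (P? ∘ suc))
  ... | no  _ = count (P? ∘ suc)

  count-mono : ∀ {n} {P Q : Fin n → Set} (P? : ∀ i → Dec (P i)) (Q? : ∀ i → Dec (Q i)) →
               (∀ i → P i → Q i) → count P? ℕ.≤ count Q?
  count-mono {ℕ.zero}  P? Q? P⊆Q = ℕ.z≤n
  count-mono {ℕ.suc n} P? Q? P⊆Q with P? zero | Q? zero
  ... | yes _ | yes _ = ℕ.s≤s (count-mono (P? ∘ suc) (Q? ∘ suc) (P⊆Q ∘ suc))
  ... | yes a | no ¬b = contradiction (P⊆Q zero a) ¬b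
  ... | no _  | yes _ = ℕP.m≤n⇒m≤1+n (count-mono (P? ∘ suc) (Q? ∘ suc) (P⊆Q ∘ suc))
  ... | no _  | no _  = count-mono (P? ∘ suc) (Q? ∘ suc) (P⊆Q ∘ suc)

  count-strict : ∀ {n} {P Q : Fin n → Set} (P? : ∀ i → Dec (P i)) (Q? : ∀ i → Dec (Q i)) →
                 (∀ i → P i → Q i) → ∀ j → Q j → ¬ P j → count P? ℕ.< count Q?
  count-strict P? Q? P⊆Q zero Qj ¬Pj with P? zero | Q? zero
  ... | yes a | _     = contradiction a ¬Pj
  ... | no _  | yes _ = ℕ.s≤s (count-mono (P? ∘ suc) (Q? ∘ suc) (P⊆Q ∘ suc))
  ... | no _  | no ¬b = contradiction Qj ¬b
  count-strict P? Q? P⊆Q (suc j) Qj ¬Pj with P? zero | Q? zero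
  ... | yes _ | yes _ = ℕ.s≤s (count-strict (P? ∘ suc) (Q? ∘ suc) (P⊆Q ∘ suc) j Qj ¬Pj)
  ... | yes a | no ¬b = contradiction (P⊆Q zero a) ¬b
  ... | no _  | yes _ = ℕP.m≤n⇒m≤1+n (count-strict (P? ∘ suc) (Q? ∘ suc) (P⊆Q ∘ suc) j Qj ¬Pj)
  ... | no _  | no _  = count-strict (P? ∘ suc) (Q? ∘ suc) (P⊆Q ∘ suc) j Qj ¬Pj

  upper-bound : ∀ {n} (f : Fin n → ℕ) → ∃[ M ] ∀ i → f i ℕ.≤ M
  upper-bound {ℕ.zero}  f = 0 , λ ()
  upper-bound {ℕ.suc n} f with M , h ← upper-bound (f ∘ suc) = f zero ℕ.⊔ M , λ where
    zero    → ℕP.m≤m⊔n (f zero) M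
    (suc i) → ℕP.≤-trans (h i) (ℕP.m≤n⊔m (f zero) M)

module Lattices where
  open import Data.Integer.Tactic.RingSolver using (solve-∀)

  ⟪⟫-cong : ∀ {r} {χ ψ : Lattice r} → χ ≗ ψ → ∀ μ → ⟪ χ , μ ⟫ ≡ ⟪ ψ , μ ⟫
  ⟪⟫-cong {ℕ.zero}  h μ = ≡.refl
  ⟪⟫-cong {ℕ.suc r} h μ = ≡.cong₂ ℤ._+_ (≡.cong (ℤ._* μ zero) (h zero)) (⟪⟫-cong (h ∘ suc) (μ ∘ suc))

  ⟪⟫-linearˡ : ∀ {r} (a b : ℤ) (α β μ : Lattice r) →
               ⟪ (λ i → a ℤ.* α i ℤ.+ b ℤ.* β i) , μ ⟫ ≡ a ℤ.* ⟪ α , μ ⟫ ℤ.+ b ℤ.* ⟪ β , μ ⟫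
  ⟪⟫-linearˡ {ℕ.zero}  a b α β μ = ≡.sym (≡.cong₂ ℤ._+_ (ℤP.*-zeroʳ a) (ℤP.*-zeroʳ b))
  ⟪⟫-linearˡ {ℕ.suc r} a b α β μ = ≡.trans
    (≡.cong (λ s → (a ℤ.* α zero ℤ.+ b ℤ.* β zero) ℤ.* μ zero ℤ.+ s) (⟪⟫-linearˡ a b (α ∘ suc) (β ∘ suc) (μ ∘ suc)))
    (rearrange a b (α zero) (β zero) (μ zero) _ _)
    where
    rearrange : ∀ a b α β μ s t → (a ℤ.* α ℤ.+ b ℤ.* β) ℤ.* μ ℤ.+ (a ℤ.* s ℤ.+ b ℤ.* t) ≡
                a ℤ.* (α ℤ.* μ ℤ.+ s) ℤ.+ b ℤ.* (β ℤ.* μ ℤ.+ t)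
    rearrange = solve-∀

  ⟪⟫-comm : ∀ {r} (α β : Lattice r) → ⟪ α , β ⟫ ≡ ⟪ β , α ⟫
  ⟪⟫-comm {ℕ.zero}  α β = ≡.refl
  ⟪⟫-comm {ℕ.suc r} α β = ≡.cong₂ ℤ._+_ (ℤP.*-comm (α zero) (β zero)) (⟪⟫-comm (α ∘ suc) (β ∘ suc))

  ⟪⟫-linearʳ : ∀ {r} (a b : ℤ) (μ α β : Lattice r) →
               ⟪ μ , (λ i → a ℤ.* α i ℤ.+ b ℤ.* β i) ⟫ ≡ a ℤ.* ⟪ μ , α ⟫ ℤ.+ b ℤ.* ⟪ μ , β ⟫
  ⟪⟫-linearʳ a b μ α β = ≡.trans (⟪⟫-comm μ _) (≡.trans (⟪⟫-linearˡ a b α β μ)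
    (≡.cong₂ (λ s t → a ℤ.* s ℤ.+ b ℤ.* t) (⟪⟫-comm α μ) (⟪⟫-comm β μ)))

  ⟪⟫-scaleʳ : ∀ {r} (a : ℤ) (μ α : Lattice r) → ⟪ μ , (λ i → a ℤ.* α i) ⟫ ≡ a ℤ.* ⟪ μ , α ⟫
  ⟪⟫-scaleʳ {ℕ.zero}  a μ α = ≡.sym (ℤP.*-zeroʳ a)
  ⟪⟫-scaleʳ {ℕ.suc r} a μ α = ≡.trans
    (≡.cong (λ s → μ zero ℤ.* (a ℤ.* α zero) ℤ.+ s) (⟪⟫-scaleʳ a (μ ∘ suc) (α ∘ suc)))
    (rearrange (μ zero) a (α zero) _)
    where
    rearrange : ∀ μ a α s → μ ℤ.* (a ℤ.* α) ℤ.+ a ℤ.* s ≡ a ℤ.* (μ ℤ.* α ℤ.+ s)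
    rearrange = solve-∀

  -- The vector (1, M, M², ...): pairing with it reads a vector as an expansion in base M.
  digits : ℕ → ∀ {r} → Lattice r
  digits M zero    = 1ℤ
  digits M (suc i) = + M ℤ.* digits M i

  -- Expansions in base M with small coefficients are unique.
  ⟪⟫-digits : ∀ {r} M (v : Lattice r) → (∀ i → ℤ.∣ v i ∣ ℕ.< M) → ⟪ v , digits M ⟫ ≡ 0ℤ → ∀ i → v i ≡ 0ℤ
  ⟪⟫-digits {ℕ.suc r} M v small h = λ where
      zero    → v₀≡0
      (suc i) → ⟪⟫-digits M (v ∘ suc) (small ∘ suc) rest≡0 i
    where
    rest = ⟪ v ∘ suc , digits M ⟫

    expansion : v zero ℤ.+ + M ℤ.* rest ≡ 0ℤ
    expansion = ≡.trans (≡.cong₂ ℤ._+_ (≡.sym (ℤP.*-identityʳ (v zero)))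
      (≡.sym (⟪⟫-scaleʳ (+ M) (v ∘ suc) (digits M)))) h

    multiple : v zero ≡ + M ℤ.* (ℤ.- rest)
    multiple = ≡.trans (move (v zero) (+ M ℤ.* rest)) (≡.trans (≡.cong (ℤ._+ ℤ.- (+ M ℤ.* rest)) expansion)
      (≡.trans (ℤP.+-identityˡ _) (ℤP.neg-distribʳ-* (+ M) rest)))
      where
      move : ∀ x y → x ≡ (x ℤ.+ y) ℤ.+ ℤ.- y
      move = solve-∀

    rest-small : ∀ z → v zero ≡ + M ℤ.* z → z ≡ 0ℤ
    rest-small z e = by-size _ ≡.refl
      where
      by-size : ∀ n → ℤ.∣ z ∣ ≡ n → z ≡ 0ℤ
      by-size ℕ.zero    eq = ℤP.∣i∣≡0⇒i≡0 eq
      by-size (ℕ.suc n) eq = contradiction (small zero) (ℕP.≤⇒≯ (≡.subst (M ℕ.≤_)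
        (≡.sym (≡.trans (≡.cong ℤ.∣_∣ e) (≡.trans (ℤP.∣i*j∣≡∣i∣*∣j∣ (+ M) z) (≡.cong (M ℕ.*_) eq)))) (ℕP.m≤m*n M (ℕ.suc n))))

    rest≡0 : rest ≡ 0ℤ
    rest≡0 = ≡.trans (≡.sym (ℤP.neg-involutive rest)) (≡.cong ℤ.-_ (rest-small _ multiple))

    v₀≡0 : v zero ≡ 0ℤ
    v₀≡0 = ≡.trans multiple (≡.trans (≡.cong (+ M ℤ.*_) (rest-small _ multiple)) (ℤP.*-zeroʳ (+ M)))

module Roots {k : Ring} (𝐆 : SplitReductiveGroup k) (R : RootDatum 𝐆) where
  open import Data.Integer.Tactic.RingSolver using (solve-∀)
  open SplitReductiveGroup 𝐆 using (rank)
  open RootDatum R using (Φ; root; neg; root-injective; root-reflect; pairing-two; reduced)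
  open Lattices
  open Counting

  root-neg : ∀ α i → root (neg α) i ≡ ℤ.- root α i
  root-neg α i = ≡.trans (root-reflect α α i) (≡.trans
    (≡.cong (λ k → root α i ℤ.- k ℤ.* root α i) (pairing-two α)) (simplify (root α i)))
    where
    simplify : ∀ a → a ℤ.- + 2 ℤ.* a ≡ ℤ.- a
    simplify = solve-∀

  neg-neg : ∀ α → neg (neg α) ≡ α
  neg-neg α = root-injective _ _ λ i →
    ≡.trans (root-neg (neg α) i) (≡.trans (≡.cong ℤ.-_ (root-neg α i)) (ℤP.neg-involutive _))

  pairing-neg : ∀ α ℓ → ⟪ root (neg α) , ℓ ⟫ ≡ ℤ.- ⟪ root α , ℓ ⟫
  pairing-neg α ℓ = ≡.trans (⟪⟫-cong (λ i → ≡.trans (root-neg α i) (lemma (root α i))) ℓ)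
    (≡.trans (⟪⟫-linearˡ (ℤ.- 1ℤ) 0ℤ (root α) (root α) ℓ) (≡.sym (lemma _)))
    where
    lemma : ∀ a → ℤ.- a ≡ ℤ.- 1ℤ ℤ.* a ℤ.+ 0ℤ ℤ.* a
    lemma = solve-∀

  pairing-combination : ∀ {α β γ} i j → (∀ l → root γ l ≡ i ℤ.* root α l ℤ.+ j ℤ.* root β l) →
                        ∀ ℓ → ⟪ root γ , ℓ ⟫ ≡ i ℤ.* ⟪ root α , ℓ ⟫ ℤ.+ j ℤ.* ⟪ root β , ℓ ⟫
  pairing-combination i j h ℓ = ≡.trans (⟪⟫-cong h ℓ) (⟪⟫-linearˡ i j _ _ ℓ)

  -- On a line through 0 there are only two roots, so a functional that is nonzero on a suitable
  -- finite set of vectors has different slopes relative to ℓ on different positive roots.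
  record Slopes (Ψ : PositiveSystem 𝐆 R) : Set where
    open PositiveSystem Ψ
    field
      μ        : Lattice rank
      separate : ∀ θ β → ⟪ root θ , ℓ ⟫ ℤ.* ⟪ root β , μ ⟫ ≡ ⟪ root θ , μ ⟫ ℤ.* ⟪ root β , ℓ ⟫ →
                 β ≡ θ ⊎ β ≡ neg θ

  abstract
    -- M exceeds all coordinates of the vectors v θ β = ⟨θ, ℓ⟩β - ⟨β, ℓ⟩θ. If θ and β have equal
    -- slopes, v θ β pairs to 0 with (1, M, M², ...), so it vanishes, θ and β are proportional, and
    -- `reduced` applies. Being abstract, the constant is never unfolded.
    slopes : (Ψ : PositiveSystem 𝐆 R) → Slopes Ψ
    slopes Ψ = record { μ = digits M ; separate = separate }
      where
      open PositiveSystem Ψ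

      v : Φ → Φ → Lattice rank
      v θ β i = ⟪ root θ , ℓ ⟫ ℤ.* root β i ℤ.+ (ℤ.- ⟪ root β , ℓ ⟫) ℤ.* root θ i

      bound₁ : ∀ θ β → ∃[ M ] ∀ i → ℤ.∣ v θ β i ∣ ℕ.≤ M
      bound₁ θ β = upper-bound (λ i → ℤ.∣ v θ β i ∣)
      bound₂ : ∀ θ → ∃[ M ] ∀ β → proj₁ (bound₁ θ β) ℕ.≤ M
      bound₂ θ = upper-bound (λ β → proj₁ (bound₁ θ β))
      bound₃ : ∃[ M ] ∀ θ → proj₁ (bound₂ θ) ℕ.≤ M
      bound₃ = upper-bound (λ θ → proj₁ (bound₂ θ))

      M : ℕ
      M = ℕ.suc (proj₁ bound₃)

      small : ∀ θ β i → ℤ.∣ v θ β i ∣ ℕ.< M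
      small θ β i = ℕ.s≤s (ℕP.≤-trans (proj₂ (bound₁ θ β) i) (ℕP.≤-trans (proj₂ (bound₂ θ) β) (proj₂ bound₃ θ)))

      separate : ∀ θ β → ⟪ root θ , ℓ ⟫ ℤ.* ⟪ root β , digits M ⟫ ≡ ⟪ root θ , digits M ⟫ ℤ.* ⟪ root β , ℓ ⟫ →
                 β ≡ θ ⊎ β ≡ neg θ
      separate θ β h = reduced θ β ⟪ root θ , ℓ ⟫ ⟪ root β , ℓ ⟫ (regular θ) (λ i →
        ≡.trans (move (⟪ root θ , ℓ ⟫ ℤ.* root β i) ⟪ root β , ℓ ⟫ (root θ i))
          (≡.trans (≡.cong (ℤ._+ ⟪ root β , ℓ ⟫ ℤ.* root θ i) (⟪⟫-digits M (v θ β) (small θ β) zero-pairing i)) (ℤP.+-identityˡ _)))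
        where
        move : ∀ x a b → x ≡ (x ℤ.+ (ℤ.- a) ℤ.* b) ℤ.+ a ℤ.* b
        move = solve-∀
        cancel : ∀ a b → a ℤ.* b ℤ.+ (ℤ.- b) ℤ.* a ≡ 0ℤ
        cancel = solve-∀
        b : ℤ
        b = ⟪ root θ , digits M ⟫
        zero-pairing : ⟪ v θ β , digits M ⟫ ≡ 0ℤ
        zero-pairing = ≡.trans (⟪⟫-linearˡ ⟪ root θ , ℓ ⟫ (ℤ.- ⟪ root β , ℓ ⟫) (root β) (root θ) (digits M))
          (≡.trans (≡.cong (λ z → z ℤ.+ (ℤ.- ⟪ root β , ℓ ⟫) ℤ.* b) h) (cancel b ⟪ root β , ℓ ⟫))

module RootOrder {k : Ring} (𝐆 : SplitReductiveGroup k) (R : RootDatum 𝐆) (Ψ : PositiveSystem 𝐆 R)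
  (slope : Roots.Slopes 𝐆 R Ψ) where
  open import Data.Integer.Tactic.RingSolver using (solve-∀)
  open SplitReductiveGroup 𝐆 using (rank)
  open RootDatum R using (Φ; root; neg)
  open PositiveSystem Ψ
  open Roots 𝐆 R
  open Slopes slope
  open Counting
  open Lattices

  -- The pair (ℓ, μ) maps the roots to a plane; this is the determinant of the images of θ and β. By
  -- the choice of μ it vanishes only for β = θ and β = -θ.
  det : Φ → Φ → ℤ
  det θ β = ⟪ root θ , ℓ ⟫ ℤ.* ⟪ root β , μ ⟫ ℤ.- ⟪ root θ , μ ⟫ ℤ.* ⟪ root β , ℓ ⟫

  -- The functional `det θ` as a cocharacter. Small perturbations of it give the positive systems
  -- next to the hyperplane of θ.
  ℓ[_] : Φ → Lattice rank
  ℓ[ θ ] i = ⟪ root θ , ℓ ⟫ ℤ.* μ i ℤ.+ (ℤ.- ⟪ root θ , μ ⟫) ℤ.* ℓ i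

  pairing-ℓ[] : ∀ θ β → ⟪ root β , ℓ[ θ ] ⟫ ≡ det θ β
  pairing-ℓ[] θ β = ≡.trans (⟪⟫-linearʳ ⟪ root θ , ℓ ⟫ (ℤ.- ⟪ root θ , μ ⟫) (root β) μ ℓ)
    (≡.cong (λ z → ⟪ root θ , ℓ ⟫ ℤ.* ⟪ root β , μ ⟫ ℤ.+ z)
      (≡.sym (ℤP.neg-distribˡ-* ⟪ root θ , μ ⟫ ⟪ root β , ℓ ⟫)))

  det-self : ∀ θ → det θ θ ≡ 0ℤ
  det-self θ = cancel ⟪ root θ , ℓ ⟫ ⟪ root θ , μ ⟫
    where
    cancel : ∀ a b → a ℤ.* b ℤ.- b ℤ.* a ≡ 0ℤ
    cancel = solve-∀

  det-swap : ∀ θ β → det θ β ≡ ℤ.- det β θ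
  det-swap θ β = swap ⟪ root θ , ℓ ⟫ ⟪ root β , μ ⟫ ⟪ root θ , μ ⟫ ⟪ root β , ℓ ⟫
    where
    swap : ∀ a b c d → a ℤ.* b ℤ.- c ℤ.* d ≡ ℤ.- (d ℤ.* c ℤ.- b ℤ.* a)
    swap = solve-∀

  det-negʳ : ∀ θ β → det θ (neg β) ≡ ℤ.- det θ β
  det-negʳ θ β = ≡.trans
    (≡.cong₂ (λ a b → ⟪ root θ , ℓ ⟫ ℤ.* a ℤ.- ⟪ root θ , μ ⟫ ℤ.* b) (pairing-neg β μ) (pairing-neg β ℓ))
    (pull ⟪ root θ , ℓ ⟫ ⟪ root β , μ ⟫ ⟪ root θ , μ ⟫ ⟪ root β , ℓ ⟫)
    where
    pull : ∀ a b c d → a ℤ.* ℤ.- b ℤ.- c ℤ.* ℤ.- d ≡ ℤ.- (a ℤ.* b ℤ.- c ℤ.* d)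
    pull = solve-∀

  det-combination : ∀ θ {α β γ} i j → (∀ l → root γ l ≡ i ℤ.* root α l ℤ.+ j ℤ.* root β l) →
                    det θ γ ≡ i ℤ.* det θ α ℤ.+ j ℤ.* det θ β
  det-combination θ {α} {β} i j h = ≡.trans
    (≡.cong₂ (λ a b → ⟪ root θ , ℓ ⟫ ℤ.* a ℤ.- ⟪ root θ , μ ⟫ ℤ.* b)
      (pairing-combination i j h μ) (pairing-combination i j h ℓ))
    (distribute i j ⟪ root θ , ℓ ⟫ ⟪ root θ , μ ⟫ ⟪ root α , μ ⟫ ⟪ root β , μ ⟫ ⟪ root α , ℓ ⟫ ⟪ root β , ℓ ⟫)
    where
    distribute : ∀ i j p q a b c d → p ℤ.* (i ℤ.* a ℤ.+ j ℤ.* b) ℤ.- q ℤ.* (i ℤ.* c ℤ.+ j ℤ.* d) ≡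
                 i ℤ.* (p ℤ.* a ℤ.- q ℤ.* c) ℤ.+ j ℤ.* (p ℤ.* b ℤ.- q ℤ.* d)
    distribute = solve-∀

  det≡0 : ∀ θ β → det θ β ≡ 0ℤ → β ≡ θ ⊎ β ≡ neg θ
  det≡0 θ β h = separate θ β (ℤP.i-j≡0⇒i≡j _ _ h)

  Above Below : Φ → Φ → Set
  Above θ β = 0ℤ ℤ.< det θ β
  Below θ β = det θ β ℤ.< 0ℤ

  negative⇒neg-positive : ∀ {a b} → b ≡ ℤ.- a → a ℤ.< 0ℤ → 0ℤ ℤ.< b
  negative⇒neg-positive ≡.refl h = ℤP.neg-mono-< h

  positive⇒neg-negative : ∀ {a b} → b ≡ ℤ.- a → 0ℤ ℤ.< a → b ℤ.< 0ℤ
  positive⇒neg-negative ≡.refl h = ℤP.neg-mono-< h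

  neg-positive : ∀ {β} → Negative β → Positive (neg β)
  neg-positive {β} = negative⇒neg-positive (pairing-neg β ℓ)

  neg-negative : ∀ {β} → Positive β → Negative (neg β)
  neg-negative {β} = positive⇒neg-negative (pairing-neg β ℓ)

  sign : ∀ β → Positive β ⊎ Negative β
  sign β with ℤP.<-cmp 0ℤ ⟪ root β , ℓ ⟫
  ... | tri< p _ _ = inj₁ p
  ... | tri≈ _ e _ = contradiction (≡.sym e) (regular β)
  ... | tri> _ _ n = inj₂ n

  ¬both : ∀ {β} → Positive β → ¬ Negative β
  ¬both p n = ℤP.<-asym p n

  *-positive : ∀ {a b} → 0ℤ ℤ.< a → 0ℤ ℤ.< b → 0ℤ ℤ.< a ℤ.* b
  *-positive {a} {b} p q = ≡.subst (ℤ._< a ℤ.* b) (ℤP.*-zeroʳ a) (ℤP.*-monoˡ-<-pos a {{ℤ.positive p}} q)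

  -- The relation b(a∧c) = c(a∧b) + a(b∧c) between three vectors of the plane with first coordinates
  -- a, b, c > 0.
  Above-trans : ∀ {a b c} → Positive a → Positive b → Positive c → Above a b → Above b c → Above a c
  Above-trans {a} {b} {c} pa pb pc ab bc = ℤP.*-cancelˡ-<-nonNeg ⟪ root b , ℓ ⟫ {{ℤ.nonNegative (ℤP.<⇒≤ pb)}}
    (≡.subst₂ ℤ._<_ (≡.sym (ℤP.*-zeroʳ ⟪ root b , ℓ ⟫))
      (transitivity ⟪ root a , ℓ ⟫ ⟪ root b , ℓ ⟫ ⟪ root c , ℓ ⟫ ⟪ root a , μ ⟫ ⟪ root b , μ ⟫ ⟪ root c , μ ⟫)
      (ℤP.+-mono-< (*-positive pc ab) (*-positive pa bc)))
    where
    transitivity : ∀ a b c x y z → c ℤ.* (a ℤ.* y ℤ.- x ℤ.* b) ℤ.+ a ℤ.* (b ℤ.* z ℤ.- y ℤ.* c) ≡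
               b ℤ.* (a ℤ.* z ℤ.- x ℤ.* c)
    transitivity = solve-∀

  private
    below? : ∀ θ γ → Dec (Positive γ × Above γ θ)
    below? θ γ = (0ℤ ℤP.<? _) ×-dec (0ℤ ℤP.<? _)

  -- The position of a positive root in the order by slope.
  index : Φ → ℕ
  index θ = count (below? θ)

  index-< : ∀ {θ β} → Positive θ → Positive β → Above θ β → index θ ℕ.< index β
  index-< {θ} {β} pθ pβ h = count-strict (below? θ) (below? β)
    (λ γ (pγ , γθ) → pγ , Above-trans {γ} {θ} {β} pγ pθ pβ γθ h) θ (pθ , h)
    (λ (_ , θθ) → ℤP.<-irrefl (≡.sym (det-self θ)) θθ)

  -- Going through the positive roots in this order and replacing them by their negatives one at a
  -- time, these sets and their negatives are all closed.
  Upper Lower : ℕ → Φ → Set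
  Upper k β = (Positive β × k ℕ.≤ index β) ⊎ (Negative β × index (neg β) ℕ.< k)
  Lower k β = (Negative β × k ℕ.≤ index (neg β)) ⊎ (Positive β × index β ℕ.< k)

  compare : ∀ θ β → Above θ β ⊎ (β ≡ θ ⊎ β ≡ neg θ) ⊎ Below θ β
  compare θ β with ℤP.<-cmp 0ℤ (det θ β)
  ... | tri< p _ _ = inj₁ p
  ... | tri≈ _ e _ = inj₂ (inj₁ (det≡0 θ β (≡.sym e)))
  ... | tri> _ _ n = inj₂ (inj₂ n)

  Above-neg : ∀ θ β → Below θ β → Above θ (neg β)
  Above-neg θ β = negative⇒neg-positive (det-negʳ θ β)

  Below-neg : ∀ θ β → Above θ β → Below θ (neg β)
  Below-neg θ β = positive⇒neg-negative (det-negʳ θ β)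

  Above-swap : ∀ θ β → Below θ β → Above β θ
  Above-swap θ β = negative⇒neg-positive (det-swap β θ)

  -- When k passes from index θ to its successor, the open half plane `Above θ` stays in `Upper` and
  -- the boundary root θ is exchanged for -θ. `Lower` keeps `Below θ` and exchanges -θ for θ.
  module At (θ : Φ) (pθ : Positive θ) where
    k₀ = index θ

    private
      above⇒< : ∀ {β} → Positive β → Above θ β → k₀ ℕ.< index β
      above⇒< pβ h = index-< pθ pβ h

      below⇒< : ∀ {β} → Positive β → Below θ β → index β ℕ.< k₀
      below⇒< {β} pβ h = index-< pβ pθ (Above-swap θ β h)

      not-neg : ∀ {β} → Positive β → β ≢ neg θ
      not-neg pβ ≡.refl = ¬both pβ (neg-negative pθ)

      not-pos : ∀ {β} → Negative β → β ≢ θ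
      not-pos nβ ≡.refl = ¬both pθ nβ

      index-neg-neg : index (neg (neg θ)) ≡ k₀
      index-neg-neg = ≡.cong index (neg-neg θ)

      below-neg⇒ : ∀ {β} → Negative β → Below θ β → k₀ ℕ.< index (neg β)
      below-neg⇒ {β} nβ h = above⇒< (neg-positive nβ) (Above-neg θ β h)

      above-neg⇒ : ∀ {β} → Negative β → Above θ β → index (neg β) ℕ.< k₀
      above-neg⇒ {β} nβ h = below⇒< (neg-positive nβ) (Below-neg θ β h)

    Upper-θ : Upper k₀ θ
    Upper-θ = inj₁ (pθ , ℕP.≤-refl)

    Lower-neg : Lower k₀ (neg θ)
    Lower-neg = inj₁ (neg-negative pθ , ℕP.≤-reflexive (≡.sym index-neg-neg))

    Upper⁺-neg : Upper (ℕ.suc k₀) (neg θ)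
    Upper⁺-neg = inj₂ (neg-negative pθ , ℕP.≤-reflexive (≡.cong ℕ.suc index-neg-neg))

    Lower⁺-θ : Lower (ℕ.suc k₀) θ
    Lower⁺-θ = inj₂ (pθ , ℕP.≤-refl)

    Above⇒Upper : ∀ {β} → Above θ β → Upper k₀ β × Upper (ℕ.suc k₀) β
    Above⇒Upper {β} h with sign β
    ... | inj₁ pβ = inj₁ (pβ , ℕP.<⇒≤ (above⇒< pβ h)) , inj₁ (pβ , above⇒< pβ h)
    ... | inj₂ nβ = inj₂ (nβ , above-neg⇒ nβ h) , inj₂ (nβ , ℕP.m≤n⇒m≤1+n (above-neg⇒ nβ h))

    Below⇒Lower : ∀ {β} → Below θ β → Lower k₀ β × Lower (ℕ.suc k₀) β
    Below⇒Lower {β} h with sign β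
    ... | inj₁ pβ = inj₂ (pβ , below⇒< pβ h) , inj₂ (pβ , ℕP.m≤n⇒m≤1+n (below⇒< pβ h))
    ... | inj₂ nβ = inj₁ (nβ , ℕP.<⇒≤ (below-neg⇒ nβ h)) , inj₁ (nβ , below-neg⇒ nβ h)

    Upper-split : ∀ {β} → Upper k₀ β → Above θ β ⊎ β ≡ θ
    Upper-split {β} u with compare θ β
    Upper-split {β} u | inj₁ h = inj₁ h
    Upper-split {β} u | inj₂ (inj₁ (inj₁ e)) = inj₂ e
    Upper-split {β} (inj₁ (pβ , _)) | inj₂ (inj₁ (inj₂ e)) = contradiction e (not-neg pβ)
    Upper-split {β} (inj₂ (nβ , h)) | inj₂ (inj₁ (inj₂ ≡.refl)) =
      contradiction h (ℕP.<-irrefl index-neg-neg)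
    Upper-split {β} (inj₁ (pβ , h)) | inj₂ (inj₂ b) = contradiction h (ℕP.<⇒≱ (below⇒< pβ b))
    Upper-split {β} (inj₂ (nβ , h)) | inj₂ (inj₂ b) = contradiction h (ℕP.<-asym (below-neg⇒ nβ b))

    Upper⁺-split : ∀ {β} → Upper (ℕ.suc k₀) β → Above θ β ⊎ β ≡ neg θ
    Upper⁺-split {β} u with compare θ β
    Upper⁺-split {β} u | inj₁ h = inj₁ h
    Upper⁺-split {β} u | inj₂ (inj₁ (inj₂ e)) = inj₂ e
    Upper⁺-split {β} (inj₁ (pβ , h)) | inj₂ (inj₁ (inj₁ ≡.refl)) = contradiction h (ℕP.<-irrefl ≡.refl)
    Upper⁺-split {β} (inj₂ (nβ , _)) | inj₂ (inj₁ (inj₁ e)) = contradiction e (not-pos nβ)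
    Upper⁺-split {β} (inj₁ (pβ , h)) | inj₂ (inj₂ b) = contradiction h (ℕP.<-asym (below⇒< pβ b))
    Upper⁺-split {β} (inj₂ (nβ , h)) | inj₂ (inj₂ b) = contradiction h (ℕP.<⇒≱ (ℕ.s<s (below-neg⇒ nβ b)))

    Lower-split : ∀ {β} → Lower k₀ β → Below θ β ⊎ β ≡ neg θ
    Lower-split {β} u with compare θ β
    Lower-split {β} u | inj₂ (inj₂ h) = inj₁ h
    Lower-split {β} u | inj₂ (inj₁ (inj₂ e)) = inj₂ e
    Lower-split {β} (inj₁ (nβ , _)) | inj₂ (inj₁ (inj₁ e)) = contradiction e (not-pos nβ)
    Lower-split {β} (inj₂ (pβ , h)) | inj₂ (inj₁ (inj₁ ≡.refl)) = contradiction h (ℕP.<-irrefl ≡.refl)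
    Lower-split {β} (inj₁ (nβ , h)) | inj₁ b = contradiction h (ℕP.<⇒≱ (above-neg⇒ nβ b))
    Lower-split {β} (inj₂ (pβ , h)) | inj₁ b = contradiction h (ℕP.<-asym (above⇒< pβ b))

    Lower⁺-split : ∀ {β} → Lower (ℕ.suc k₀) β → Below θ β ⊎ β ≡ θ
    Lower⁺-split {β} u with compare θ β
    Lower⁺-split {β} u | inj₂ (inj₂ h) = inj₁ h
    Lower⁺-split {β} u | inj₂ (inj₁ (inj₁ e)) = inj₂ e
    Lower⁺-split {β} (inj₁ (nβ , h)) | inj₂ (inj₁ (inj₂ ≡.refl)) = contradiction h (ℕP.<-irrefl (≡.sym index-neg-neg))
    Lower⁺-split {β} (inj₂ (pβ , _)) | inj₂ (inj₁ (inj₂ e)) = contradiction e (not-neg pβ)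
    Lower⁺-split {β} (inj₁ (nβ , h)) | inj₁ b = contradiction h (ℕP.<-asym (above-neg⇒ nβ b))
    Lower⁺-split {β} (inj₂ (pβ , h)) | inj₁ b = contradiction h (ℕP.<⇒≱ (ℕ.s<s (above⇒< pβ b)))

  -- At a number that is the index of no positive root both sets stay the same, so k may run through
  -- all of ℕ.
  module Gap (k₀ : ℕ) (gap : ∀ θ → Positive θ → index θ ≢ k₀) where
    Upper⇒Upper⁺ : ∀ {β} → Upper k₀ β → Upper (ℕ.suc k₀) β
    Upper⇒Upper⁺ {β} (inj₁ (pβ , h)) = inj₁ (pβ , ℕP.≤∧≢⇒< h (gap β pβ ∘ ≡.sym))
    Upper⇒Upper⁺     (inj₂ (nβ , h)) = inj₂ (nβ , ℕP.m≤n⇒m≤1+n h)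

    Upper⁺⇒Upper : ∀ {β} → Upper (ℕ.suc k₀) β → Upper k₀ β
    Upper⁺⇒Upper     (inj₁ (pβ , h)) = inj₁ (pβ , ℕP.<⇒≤ h)
    Upper⁺⇒Upper {β} (inj₂ (nβ , h)) = inj₂ (nβ , ℕP.≤∧≢⇒< (ℕ.s≤s⁻¹ h) (gap (neg β) (neg-positive nβ)))

    Lower⇒Lower⁺ : ∀ {β} → Lower k₀ β → Lower (ℕ.suc k₀) β
    Lower⇒Lower⁺ {β} (inj₁ (nβ , h)) = inj₁ (nβ , ℕP.≤∧≢⇒< h (gap (neg β) (neg-positive nβ) ∘ ≡.sym))
    Lower⇒Lower⁺     (inj₂ (pβ , h)) = inj₂ (pβ , ℕP.m≤n⇒m≤1+n h)

    Lower⁺⇒Lower : ∀ {β} → Lower (ℕ.suc k₀) β → Lower k₀ β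
    Lower⁺⇒Lower     (inj₁ (nβ , h)) = inj₁ (nβ , ℕP.<⇒≤ h)
    Lower⁺⇒Lower {β} (inj₂ (pβ , h)) = inj₂ (pβ , ℕP.≤∧≢⇒< (ℕ.s≤s⁻¹ h) (gap β pβ))

  at-index? : ∀ k → (∃[ θ ] Positive θ × index θ ≡ k) ⊎ (∀ θ → Positive θ → index θ ≢ k)
  at-index? k with FinP.any? (λ θ → (0ℤ ℤP.<? ⟪ root θ , ℓ ⟫) ×-dec (index θ ℕP.≟ k))
  ... | yes found = inj₁ found
  ... | no  none  = inj₂ λ θ pθ e → none (θ , pθ , e)

-- Values of affine roots at a point of the apartment.

module IntegersInℚ where
  import Data.Rational.Properties as ℚP
  open import Data.Rational.Solver using (module +-*-Solver)
  open +-*-Solver using (solve; _:=_; _:+_; _:*_)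
  import Data.Rational.Unnormalised.Base as ℚᵘ
  import Data.Rational.Unnormalised.Properties as ℚᵘP
  open import Data.Integer.Tactic.RingSolver using (solve-∀)

  int : ℤ → ℚ
  int k = k ℚ./ 1

  private
    toℚᵘ-int : ∀ k → ℚ.toℚᵘ (int k) ℚᵘ.≃ ℚᵘ.mkℚᵘ k 0
    toℚᵘ-int k = ℚP.toℚᵘ-fromℚᵘ (ℚᵘ.mkℚᵘ k 0)

  int-+ : ∀ k l → int (k ℤ.+ l) ≡ int k ℚ.+ int l
  int-+ k l = ℚP.toℚᵘ-injective (ℚᵘP.≃-trans (toℚᵘ-int (k ℤ.+ l)) (ℚᵘP.≃-trans (ℚᵘ.*≡* (expand k l))
    (ℚᵘP.≃-trans (ℚᵘP.≃-sym (ℚᵘP.+-cong (toℚᵘ-int k) (toℚᵘ-int l))) (ℚᵘP.≃-sym (ℚP.toℚᵘ-homo-+ (int k) (int l))))))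
    where
    expand : ∀ k l → (k ℤ.+ l) ℤ.* 1ℤ ≡ (k ℤ.* 1ℤ ℤ.+ l ℤ.* 1ℤ) ℤ.* 1ℤ
    expand = solve-∀

  int-* : ∀ k l → int (k ℤ.* l) ≡ int k ℚ.* int l
  int-* k l = ℚP.toℚᵘ-injective (ℚᵘP.≃-trans (toℚᵘ-int (k ℤ.* l)) (ℚᵘP.≃-trans (ℚᵘ.*≡* ≡.refl)
    (ℚᵘP.≃-trans (ℚᵘP.≃-sym (ℚᵘP.*-cong (toℚᵘ-int k) (toℚᵘ-int l))) (ℚᵘP.≃-sym (ℚP.toℚᵘ-homo-* (int k) (int l))))))

  int-mono : ∀ {k l} → k ℤ.≤ l → int k ℚ.≤ int l
  int-mono {k} {l} h = ℚP.toℚᵘ-cancel-≤ (ℚᵘP.≤-trans (ℚᵘP.≤-reflexive (toℚᵘ-int k))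
    (ℚᵘP.≤-trans (ℚᵘ.*≤* (ℤP.*-monoʳ-≤-nonNeg 1ℤ h)) (ℚᵘP.≤-reflexive (ℚᵘP.≃-sym (toℚᵘ-int l)))))

  int-cancel : ∀ {k l} → int k ℚ.≤ int l → k ℤ.≤ l
  int-cancel {k} {l} h with ℚᵘP.≤-trans (ℚᵘP.≤-reflexive (ℚᵘP.≃-sym (toℚᵘ-int k)))
    (ℚᵘP.≤-trans (ℚP.toℚᵘ-mono-≤ h) (ℚᵘP.≤-reflexive (toℚᵘ-int l)))
  ... | ℚᵘ.*≤* k≤l = ≡.subst₂ ℤ._≤_ (ℤP.*-identityʳ k) (ℤP.*-identityʳ l) k≤l

  int-neg : ∀ k → int (ℤ.- k) ≡ ℚ.- int k
  int-neg k = ℚP.toℚᵘ-injective (ℚᵘP.≃-trans (toℚᵘ-int (ℤ.- k))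
    (ℚᵘP.≃-trans (ℚᵘP.≃-sym (ℚᵘP.-‿cong (toℚᵘ-int k))) (ℚᵘP.≃-sym (ℚP.toℚᵘ-homo‿- (int k)))))

  infix 8 _∙ℚ_
  _∙ℚ_ : ∀ {r} → Lattice r → (Fin r → ℚ) → ℚ
  χ ∙ℚ y = RawMonoidDefs.sum ℚ.+-0-rawMonoid (λ i → (χ i ℚ./ 1) ℚ.* y i)

  ∙ℚ-cong : ∀ {r} {χ ψ : Lattice r} → χ ≗ ψ → ∀ y → χ ∙ℚ y ≡ ψ ∙ℚ y
  ∙ℚ-cong {ℕ.zero}  h y = ≡.refl
  ∙ℚ-cong {ℕ.suc r} h y = ≡.cong₂ ℚ._+_ (≡.cong (λ z → int z ℚ.* y zero) (h zero)) (∙ℚ-cong (h ∘ suc) (y ∘ suc))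

  ∙ℚ-linear : ∀ {r} (a b : ℤ) (α β : Lattice r) y →
              (λ i → a ℤ.* α i ℤ.+ b ℤ.* β i) ∙ℚ y ≡ int a ℚ.* α ∙ℚ y ℚ.+ int b ℚ.* β ∙ℚ y
  ∙ℚ-linear {ℕ.zero}  a b α β y = ≡.sym (≡.cong₂ ℚ._+_ (ℚP.*-zeroʳ (int a)) (ℚP.*-zeroʳ (int b)))
  ∙ℚ-linear {ℕ.suc r} a b α β y = ≡.trans
    (≡.cong₂ (λ s t → s ℚ.* y zero ℚ.+ t)
      (≡.trans (int-+ (a ℤ.* α zero) (b ℤ.* β zero)) (≡.cong₂ ℚ._+_ (int-* a (α zero)) (int-* b (β zero))))
      (∙ℚ-linear a b (α ∘ suc) (β ∘ suc) (y ∘ suc)))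
    (solve 7 (λ a b α β y s t → (a :* α :+ b :* β) :* y :+ (a :* s :+ b :* t) :=
                                a :* (α :* y :+ s) :+ b :* (β :* y :+ t)) ≡.refl
      (int a) (int b) (int (α zero)) (int (β zero)) (y zero) _ _)

module Depths {k : Ring} (𝐆 : SplitReductiveGroup k) (R : RootDatum 𝐆) (y : Fin (SplitReductiveGroup.rank 𝐆) → ℚ) where
  open RootDatum R using (Φ; root; neg)
  open Roots 𝐆 R using (root-neg)
  open IntegersInℚ
  import Data.Rational.Properties as ℚP

  open GroupProperties ℚP.+-0-group using () renaming (⁻¹-involutive to neg-involutive)

  -- The half apartment α + k ≥ 0 contains `y` exactly when depth α ≤ k.
  depth : Φ → ℚ
  depth α = ℚ.- (root α ∙ℚ y)

  private
    -‿linear : ∀ i j a b → ℚ.- (i ℚ.* a ℚ.+ j ℚ.* b) ≡ i ℚ.* (ℚ.- a) ℚ.+ j ℚ.* (ℚ.- b)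
    -‿linear i j a b = ≡.trans (ℚP.neg-distrib-+ (i ℚ.* a) (j ℚ.* b))
      (≡.cong₂ ℚ._+_ (ℚP.neg-distribʳ-* i a) (ℚP.neg-distribʳ-* j b))

    nonNeg-scale : ∀ i {a b} → a ℚ.≤ b → int (+ i) ℚ.* a ℚ.≤ int (+ i) ℚ.* b
    nonNeg-scale i = ℚP.*-monoˡ-≤-nonNeg (int (+ i)) {{ℚ.nonNegative (int-mono {0ℤ} {+ i} (ℤ.+≤+ ℕ.z≤n))}}

  -- Depth is linear in the root. So the terms in the commutator of two root elements that fix `y`
  -- fix `y` again.
  depth-combination : ∀ {α β γ} i j → (∀ l → root γ l ≡ + i ℤ.* root α l ℤ.+ + j ℤ.* root β l) →
                      ∀ {k l} → depth α ℚ.≤ int k → depth β ℚ.≤ int l → depth γ ℚ.≤ int (+ i ℤ.* k ℤ.+ + j ℤ.* l)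
  depth-combination {α} {β} {γ} i j h {k} {l} hk hl = ≡.subst₂ ℚ._≤_
    (≡.sym (≡.trans (≡.cong ℚ.-_ (≡.trans (∙ℚ-cong h y) (∙ℚ-linear (+ i) (+ j) (root α) (root β) y)))
      (-‿linear (int (+ i)) (int (+ j)) _ _)))
    (≡.sym (≡.trans (int-+ (+ i ℤ.* k) (+ j ℤ.* l)) (≡.cong₂ ℚ._+_ (int-* (+ i) k) (int-* (+ j) l))))
    (ℚP.+-mono-≤ (nonNeg-scale i hk) (nonNeg-scale j hl))

  depth-neg : ∀ α → depth (neg α) ≡ ℚ.- depth α
  depth-neg α = ≡.cong ℚ.-_ (≡.trans (∙ℚ-cong (λ i → ≡.trans (root-neg α i) (combine (root α i))) y)
    (≡.trans (∙ℚ-linear (ℤ.- 1ℤ) 0ℤ (root α) (root α) y)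
      (≡.trans (≡.cong₂ ℚ._+_ (≡.trans (≡.sym (ℚP.neg-distribˡ-* ℚ.1ℚ v)) (≡.cong ℚ.-_ (ℚP.*-identityˡ v))) (ℚP.*-zeroˡ v))
        (ℚP.+-identityʳ _))))
    where
    open import Data.Integer.Tactic.RingSolver using (solve-∀)
    v = root α ∙ℚ y
    combine : ∀ a → ℤ.- a ≡ ℤ.- 1ℤ ℤ.* a ℤ.+ 0ℤ ℤ.* a
    combine = solve-∀

  module _ (generic : ∀ α → ¬ (∃[ k ] root α ∙ℚ y ≡ int k)) where

    depth≢int : ∀ {α k} → depth α ≢ int k
    depth≢int {α} {k} e = generic α (ℤ.- k ,
      ≡.trans (≡.sym (neg-involutive _)) (≡.trans (≡.cong ℚ.-_ e) (≡.sym (int-neg k))))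

    -- From k ≥ depth α and l ≥ -depth α follows k + l ≥ 0, and equality would make the depth an
    -- integer and put `y` on a wall. Hence the product of two opposite coordinates lies in pℤ_p.
    depth-opposite : ∀ {α k l} → depth α ℚ.≤ int k → depth (neg α) ℚ.≤ int l → 1ℤ ℤ.≤ k ℤ.+ l
    depth-opposite {α} {k} {l} hk hl with ℤP.<-cmp 0ℤ (k ℤ.+ l)
    ... | tri< p _ _ = ℤP.i<j⇒suc[i]≤j p
    ... | tri≈ _ e _ = contradiction (ℚP.≤-antisym hk (≡.subst₂ ℚ._≤_ eq (neg-involutive (depth α))
            (ℚP.neg-antimono-≤ (≡.subst (ℚ._≤ int l) (depth-neg α) hl)))) (depth≢int {α} {k})
      where
      eq : ℚ.- int l ≡ int k
      eq = ≡.trans (≡.sym (int-neg l)) (≡.cong int (≡.trans (≡.sym (ℤP.+-identityˡ (ℤ.- l)))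
        (≡.trans (≡.cong (ℤ._+ ℤ.- l) e) (≡.trans (ℤP.+-assoc k l (ℤ.- l))
          (≡.trans (≡.cong (λ z → k ℤ.+ z) (ℤP.+-inverseʳ l)) (ℤP.+-identityʳ k))))))
    ... | tri> _ _ n = contradiction n (ℤP.≤⇒≯ (int-cancel (≡.subst₂ ℚ._≤_ (ℚP.+-inverseʳ (depth α)) (≡.sym (int-+ k l))
            (ℚP.+-mono-≤ hk (≡.subst (ℚ._≤ int l) (depth-neg α) hl)))))

-- Conjugation, characters, and the root subgroups over ℚ_p.

module Conjugation (G : Grp) where
  open Group G hiding (identity; inverse)
  open GroupSolver G

  conj-cong : ∀ {a b g h} → a ≈ b → g ≈ h → conj G a g ≈ conj G b h
  conj-cong e f = ∙-cong (∙-cong e f) (⁻¹-cong e)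

  conj-∙ : ∀ a g h → conj G a (g ∙ h) ≈ conj G a g ∙ conj G a h
  conj-∙ = solve 3 (λ a g h → (a ⊙ (g ⊙ h)) ⊙ a ⊖ ⊜ ((a ⊙ g) ⊙ a ⊖) ⊙ ((a ⊙ h) ⊙ a ⊖)) refl

  conj-⁻¹ : ∀ a g → conj G a (g ⁻¹) ≈ conj G a g ⁻¹
  conj-⁻¹ = solve 2 (λ a g → (a ⊙ g ⊖) ⊙ a ⊖ ⊜ ((a ⊙ g) ⊙ a ⊖) ⊖) refl

  conj-identity : ∀ a → conj G a ε ≈ ε
  conj-identity = solve 1 (λ a → (a ⊙ 𝟏) ⊙ a ⊖ ⊜ 𝟏) refl

  conj-by-∙ : ∀ a b g → conj G (a ∙ b) g ≈ conj G a (conj G b g)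
  conj-by-∙ = solve 3 (λ a b g → ((a ⊙ b) ⊙ g) ⊙ (a ⊙ b) ⊖ ⊜ (a ⊙ ((b ⊙ g) ⊙ b ⊖)) ⊙ a ⊖) refl

  conj-by-ε : ∀ g → conj G ε g ≈ g
  conj-by-ε = solve 1 (λ g → (𝟏 ⊙ g) ⊙ 𝟏 ⊖ ⊜ g) refl

  conj-inverseˡ : ∀ a g → conj G (a ⁻¹) (conj G a g) ≈ g
  conj-inverseˡ = solve 2 (λ a g → (a ⊖ ⊙ ((a ⊙ g) ⊙ a ⊖)) ⊙ a ⊖ ⊖ ⊜ g) refl

  conj-inverseʳ : ∀ a g → conj G a (conj G (a ⁻¹) g) ≈ g
  conj-inverseʳ = solve 2 (λ a g → (a ⊙ ((a ⊖ ⊙ g) ⊙ a ⊖ ⊖)) ⊙ a ⊖ ⊜ g) refl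

  conj-commutator : ∀ a b → (conj G a b ∙ b ⁻¹) ∙ b ≈ conj G a b
  conj-commutator = solve 2 (λ a b → (((a ⊙ b) ⊙ a ⊖) ⊙ b ⊖) ⊙ b ⊜ (a ⊙ b) ⊙ a ⊖) refl

  generated-map : ∀ {P Q : Carrier → Set} → (∀ {g} → P g → Generated G Q g) →
                  ∀ {g} → Generated G P g → Generated G Q g
  generated-map f (member h)     = f h
  generated-map f identity       = identity
  generated-map f (product h k)  = product (generated-map f h) (generated-map f k)
  generated-map f (inverse h)    = inverse (generated-map f h)
  generated-map f (respects e h) = respects e (generated-map f h)

  generated-conj : ∀ {P Q : Carrier → Set} a → (∀ {g} → P g → Generated G Q (conj G a g)) →
                   ∀ {g} → Generated G P g → Generated G Q (conj G a g)
  generated-conj a f (member h)     = f h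
  generated-conj a f identity       = respects (sym (conj-identity a)) identity
  generated-conj a f (product h k)  = respects (sym (conj-∙ a _ _)) (product (generated-conj a f h) (generated-conj a f k))
  generated-conj a f (inverse h)    = respects (sym (conj-⁻¹ a _)) (inverse (generated-conj a f h))
  generated-conj a f (respects e h) = respects (conj-cong refl e) (generated-conj a f h)

module _ {R S : Ring} (f : ∣ R ∣ʳ → ∣ S ∣ʳ) (f-isHom : IsRingHom R S f) where
  private
    module Sˣ = Group (S ˣ)
    module f = GroupMorphisms.IsGroupHomomorphism (mapˣ-isHom {R} {S} f f-isHom)

  character-homo : ∀ {r} (χ : Lattice r) t →
    character S χ (λ i → mapˣ {R} {S} f f-isHom (t i)) Sˣ.≈ mapˣ {R} {S} f f-isHom (character R χ t)
  character-homo {ℕ.zero}  χ t = Sˣ.sym f.ε-homo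
  character-homo {ℕ.suc r} χ t = Sˣ.trans
    (Sˣ.∙-cong (Sˣ.sym (power-homo (R ˣ) (S ˣ) _ (mapˣ-isHom {R} {S} f f-isHom) (t zero) (χ zero)))
               (character-homo (χ ∘ suc) (t ∘ suc)))
    (Sˣ.sym (f.homo _ _))

module _ (R : Ring) where
  private module Rˣ = Group (R ˣ)

  character-cong : ∀ {r} (χ : Lattice r) {t s} → (∀ i → t i Rˣ.≈ s i) → character R χ t Rˣ.≈ character R χ s
  character-cong {ℕ.zero}  χ h = Rˣ.refl
  character-cong {ℕ.suc r} χ h = Rˣ.∙-cong (Powers.power-cong (R ˣ) (χ zero) (h zero)) (character-cong (χ ∘ suc) (h ∘ suc))

  character-cocharacter : ∀ {r} (χ μ : Lattice r) s → character R χ (cocharacter R μ s) Rˣ.≈ power (R ˣ) s ⟪ χ , μ ⟫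
  character-cocharacter {ℕ.zero}  χ μ s = Rˣ.refl
  character-cocharacter {ℕ.suc r} χ μ s = Rˣ.trans
    (Rˣ.∙-cong (power-power s (μ zero) (χ zero)) (character-cocharacter (χ ∘ suc) (μ ∘ suc) s))
    (Rˣ.sym (power-+ s (χ zero ℤ.* μ zero) _))
    where open Powers (R ˣ)

≤-archimedean : ∀ q → ∃[ k ] q ℚ.≤ IntegersInℚ.int k
≤-archimedean q@(ℚ.mkℚ n d _) = + ℤ.∣ n ∣ , ℚP.toℚᵘ-cancel-≤
  (ℚᵘP.≤-trans (ℚᵘ.*≤* (≡.subst₂ ℤ._≤_ (≡.sym (ℤP.*-identityʳ n)) (ℤP.pos-* ℤ.∣ n ∣ (ℕ.suc d))
    (ℤP.≤-trans (i≤∣i∣ n) (ℤ.+≤+ (ℕP.m≤m*n ℤ.∣ n ∣ (ℕ.suc d))))))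
    (ℚᵘP.≤-reflexive (ℚᵘP.≃-sym (ℚP.toℚᵘ-fromℚᵘ (ℚᵘ.mkℚᵘ (+ ℤ.∣ n ∣) 0)))))
  where
  import Data.Rational.Properties as ℚP
  import Data.Rational.Unnormalised.Base as ℚᵘ
  import Data.Rational.Unnormalised.Properties as ℚᵘP
  i≤∣i∣ : ∀ i → i ℤ.≤ + ℤ.∣ i ∣
  i≤∣i∣ (+ n)    = ℤP.≤-refl
  i≤∣i∣ -[1+ n ] = ℤ.-≤+

module RootGroups (p : ℕ) (𝐊 : LocalField) (P : PadicField p 𝐊) (𝐆 : SplitReductiveGroup (LocalField.K 𝐊))
  (R : RootDatum 𝐆) where
  open LocalField 𝐊 renaming (K to ℚₚ)
  open Valuation p 𝐊 P
  open Building 𝐊 𝐆 R using (G; torus; inT; T₀)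
  open SplitReductiveGroup 𝐆 using (rank; T)
  open RootDatum R using (Φ; root; x-weight; x-monic; coroot; pairing-two) renaming (x to xₐ)
  open Group G hiding (identity; inverse)
  open Conjugation G

  x : Φ → K.Carrier → Carrier
  x α = at (xₐ α) (base ℚₚ)

  private module x (α : Φ) = GroupMorphisms.IsGroupHomomorphism (_⟹_.isHom (xₐ α) (base ℚₚ))
  private module T = GroupMorphisms.IsGroupHomomorphism (_⟹_.isHom T (base ℚₚ))

  x-cong : ∀ {α u v} → u K.≈ v → x α u ≈ x α v
  x-cong {α} = x.⟦⟧-cong α

  x-+ : ∀ α u v → x α (u K.+ v) ≈ x α u ∙ x α v
  x-+ α = x.homo α

  x-0 : ∀ α → x α K.0# ≈ ε
  x-0 α = x.ε-homo α

  x-neg : ∀ α u → x α (K.- u) ≈ x α u ⁻¹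
  x-neg α = x.⁻¹-homo α

  x-injective : ∀ α {u v} → x α u ≈ x α v → u K.≈ v
  x-injective α = x-monic α (base ℚₚ) _ _

  x-injective-0 : ∀ α {u} → x α u ≈ ε → u K.≈ K.0#
  x-injective-0 α h = x-injective α (trans h (sym (x-0 α)))

  inT-cong : ∀ {t s} → Group._≈_ torus t s → inT t ≈ inT s
  inT-cong = T.⟦⟧-cong

  inT-∙ : ∀ t s → inT (Group._∙_ torus t s) ≈ inT t ∙ inT s
  inT-∙ = T.homo

  inT-ε : inT (Group.ε torus) ≈ ε
  inT-ε = T.ε-homo

  inT-⁻¹ : ∀ t → inT (Group._⁻¹ torus t) ≈ inT t ⁻¹
  inT-⁻¹ = T.⁻¹-homo

  torus-comm : ∀ t s → Group._≈_ torus (Group._∙_ torus t s) (Group._∙_ torus s t)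
  torus-comm t s i = mk≈ᵘ (K.*-comm (val (t i)) (val (s i)))

  inT-commute : ∀ t s → inT t ∙ inT s ≈ inT s ∙ inT t
  inT-commute t s = trans (sym (inT-∙ t s)) (trans (inT-cong (torus-comm t s)) (inT-∙ s t))

  χ : Φ → ∣ torus ∣ᵍ → K.Carrier
  χ α t = val (character ℚₚ (root α) t)

  conj-x : ∀ α t u → conj G (inT t) (x α u) ≈ x α (χ α t K.* u)
  conj-x α t u = x-weight α (base ℚₚ) t u

  integral : (Fin rank → ∣ 𝒪 ˣ ∣ᵍ) → ∣ torus ∣ᵍ
  integral t i = mapˣ {𝒪} {ℚₚ} ι ι-isHom (t i)

  χ-integral : ∀ α t → χ α (integral t) K.≈ ι (val (character 𝒪 (root α) t))
  χ-integral α t = val≈ (character-homo {𝒪} {ℚₚ} ι ι-isHom (root α) t)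

  T₀-ε : T₀ ε
  T₀-ε = (λ _ → Group.ε (𝒪 ˣ)) , sym (trans (inT-cong (λ _ → mk≈ᵘ ι.1#-homo)) inT-ε)

  T₀-∙ : ∀ {g h} → T₀ g → T₀ h → T₀ (g ∙ h)
  T₀-∙ (t , e) (s , f) = (λ i → Group._∙_ (𝒪 ˣ) (t i) (s i)) , trans (∙-cong e f)
    (sym (trans (inT-cong (λ i → mk≈ᵘ (ι.*-homo (val (t i)) (val (s i))))) (inT-∙ _ _)))

  T₀-⁻¹ : ∀ {g} → T₀ g → T₀ (g ⁻¹)
  T₀-⁻¹ (t , e) = (λ i → Group._⁻¹ (𝒪 ˣ) (t i)) , trans (⁻¹-cong e)
    (sym (trans (inT-cong (λ i → mk≈ᵘ K.refl)) (inT-⁻¹ _)))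

  T₀-coroot : ∀ α (d : ∣ 𝒪 ˣ ∣ᵍ) → T₀ (inT (cocharacter ℚₚ (coroot α) (mapˣ {𝒪} {ℚₚ} ι ι-isHom d)))
  T₀-coroot α d = (λ i → power (𝒪 ˣ) d (coroot α i)) ,
    inT-cong (λ i → Group.sym (ℚₚ ˣ) (power-homo (𝒪 ˣ) (ℚₚ ˣ) _ (mapˣ-isHom {𝒪} {ℚₚ} ι ι-isHom) d (coroot α i)))

  -- The exponent is ⟨α, α∨⟩ = 2. Thus conjugation by α∨(p) changes every nonzero coordinate at α.
  χ-coroot-ϖ : ∀ α → χ α (cocharacter ℚₚ (coroot α) ϖ) K.≈ pow (+ 2)
  χ-coroot-ϖ α = K.trans (val≈ (character-cocharacter ℚₚ (root α) (coroot α) ϖ))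
    (K.reflexive (≡.cong pow (pairing-two α)))

-- Product sets U⁻ T₀ U⁺ in a group with root subgroups.

-- The properties of the groups I_C ∩ N_α and T₀ behind the Iwahori decomposition I_C = U⁻ T₀ U⁺.
record RootGroupSystem (G : Grp) {Φ : Set} (neg : Φ → Φ) : Set₁ where
  open Group G
  field
    neg-neg    : ∀ α → neg (neg α) ≡ α
    F          : Φ → Carrier → Set
    T₀         : Carrier → Set
    F-ε        : ∀ α → F α ε
    F-∙        : ∀ {α g h} → F α g → F α h → F α (g ∙ h)
    F-⁻¹       : ∀ {α g} → F α g → F α (g ⁻¹)
    T₀-ε       : T₀ ε
    T₀-∙       : ∀ {g h} → T₀ g → T₀ h → T₀ (g ∙ h)
    T₀-⁻¹      : ∀ {g} → T₀ g → T₀ (g ⁻¹)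
    F-conj-T₀  : ∀ {α t g} → T₀ t → F α g → F α (conj G t g)
    F-opposite : ∀ {α a b} → F α a → F (neg α) b →
                 ∃[ b′ ] ∃[ t ] ∃[ a′ ] F (neg α) b′ × T₀ t × F α a′ × a ∙ b ≈ (b′ ∙ t) ∙ a′

module Triangular (G : Grp) {Φ : Set} (neg : Φ → Φ) (𝐅 : RootGroupSystem G neg) where
  open RootGroupSystem 𝐅
  open Group G hiding (identity; inverse)
  open Conjugation G
  open GroupSolver G
  open SetoidReasoning setoid

  U : (Φ → Set) → Carrier → Set
  U S = Generated G (λ g → ∃[ α ] S α × F α g)

  U-mono : ∀ {S S′} → (∀ {α} → S α → S′ α) → ∀ {g} → U S g → U S′ g
  U-mono S⊆S′ = generated-map λ (α , s , f) → member (α , S⊆S′ s , f)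

  U-root : ∀ {S α g} → S α → F α g → U S g
  U-root s f = member (_ , s , f)

  U-conj-T₀ : ∀ {S t g} → T₀ t → U S g → U S (conj G t g)
  U-conj-T₀ t₀ = generated-conj _ λ (α , s , f) → U-root s (F-conj-T₀ t₀ f)

  record Normalised (S : Φ → Set) (α : Φ) : Set where
    constructor mkNormalised
    field
      root-conj : ∀ {β a g} → F α a → S β → F β g → U S (conj G a g)
  open Normalised

  U-conj : ∀ {S α a g} → Normalised S α → F α a → U S g → U S (conj G a g)
  U-conj n f = generated-conj _ λ (β , s , f′) → root-conj n f s f′

  -- As F α normalises U V, the set F α · U V is closed under products and inverses, and it contains
  -- all generators of U S.
  U-split : ∀ {S V α} → Normalised V α → (∀ {β} → S β → V β ⊎ β ≡ α) → ∀ {g} → U S g →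
            ∃[ a ] ∃[ v ] F α a × U V v × g ≈ a ∙ v
  U-split {S} {V} {α} n split (member {g} (β , s , f)) with split s
  ... | inj₁ v      = ε , g , F-ε α , U-root v f , sym (identityˡ g)
  ... | inj₂ ≡.refl = g , ε , f , identity , sym (identityʳ g)
  U-split {α = α} n split identity = ε , ε , F-ε α , identity , sym (identityˡ ε)
  U-split n split (product h k)
    with a , v , fa , uv , e ← U-split n split h | b , w , fb , uw , f ← U-split n split k =
    a ∙ b , conj G (b ⁻¹) v ∙ w , F-∙ fa fb , product (U-conj n (F-⁻¹ fb) uv) uw ,
    trans (∙-cong e f) (solve 4 (λ a v b w → (a ⊙ v) ⊙ (b ⊙ w) ⊜ (a ⊙ b) ⊙ (((b ⊖ ⊙ v) ⊙ b ⊖ ⊖) ⊙ w)) refl a v b w)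
  U-split n split (inverse h) with a , v , fa , uv , e ← U-split n split h =
    a ⁻¹ , conj G a (v ⁻¹) , F-⁻¹ fa , U-conj n fa (inverse uv) ,
    trans (⁻¹-cong e) (solve 2 (λ a v → (a ⊙ v) ⊖ ⊜ a ⊖ ⊙ ((a ⊙ v ⊖) ⊙ a ⊖)) refl a v)
  U-split n split (respects e h) with a , v , fa , uv , f ← U-split n split h =
    a , v , fa , uv , trans (sym e) f

  U-splitʳ : ∀ {S V α} → Normalised V α → (∀ {β} → S β → V β ⊎ β ≡ α) → ∀ {g} → U S g →
             ∃[ v ] ∃[ a ] U V v × F α a × g ≈ v ∙ a
  U-splitʳ n split {g} h with a , v , fa , uv , e ← U-split n split (inverse h) =
    v ⁻¹ , a ⁻¹ , inverse uv , F-⁻¹ fa , (begin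
      g            ≈⟨ solve 1 (λ g → g ⊜ g ⊖ ⊖) refl g ⟩
      (g ⁻¹) ⁻¹    ≈⟨ ⁻¹-cong e ⟩
      (a ∙ v) ⁻¹   ≈⟨ solve 2 (λ a v → (a ⊙ v) ⊖ ⊜ v ⊖ ⊙ a ⊖) refl a v ⟩
      v ⁻¹ ∙ a ⁻¹  ∎)

  -- The product set U(A) T₀ U(B), with no claim that it is a subgroup.
  record X (A B : Φ → Set) (g : Carrier) : Set where
    constructor mkX
    field
      {a t b} : Carrier
      a∈     : U A a
      t∈     : T₀ t
      b∈     : U B b
      factor : g ≈ (a ∙ t) ∙ b

  X-respects : ∀ {A B g h} → g ≈ h → X A B g → X A B h
  X-respects e (mkX a t b f) = mkX a t b (trans (sym e) f)

  X-mono : ∀ {A B A′ B′} → (∀ {α} → A α → A′ α) → (∀ {α} → B α → B′ α) → ∀ {g} → X A B g → X A′ B′ g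
  X-mono A⊆ B⊆ (mkX a t b f) = mkX (U-mono A⊆ a) t (U-mono B⊆ b) f

  X-left : ∀ {A B u g} → U A u → X A B g → X A B (u ∙ g)
  X-left u (mkX a t b f) = mkX (product u a) t b (trans (∙-congˡ f)
    (solve 4 (λ u a t b → u ⊙ ((a ⊙ t) ⊙ b) ⊜ ((u ⊙ a) ⊙ t) ⊙ b) refl _ _ _ _))

  X-T₀ : ∀ {A B s g} → T₀ s → X A B g → X A B (s ∙ g)
  X-T₀ s (mkX a t b f) = mkX (U-conj-T₀ s a) (T₀-∙ s t) b (trans (∙-congˡ f)
    (solve 4 (λ s a t b → s ⊙ ((a ⊙ t) ⊙ b) ⊜ (((s ⊙ a) ⊙ s ⊖) ⊙ (s ⊙ t)) ⊙ b) refl _ _ _ _))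

  X-ε : ∀ {A B} → X A B ε
  X-ε = mkX identity T₀-ε identity (solve 0 (𝟏 ⊜ (𝟏 ⊙ 𝟏) ⊙ 𝟏) refl)

  -- U₋α T₀ Uα = Uα T₀ U₋α, and Uα and U₋α normalise the groups generated by V⁻ and V⁺.
  X-flip : ∀ {V⁻ V⁺ A B A′ B′ α} →
           Normalised V⁻ (neg α) → Normalised V⁺ α →
           (∀ {β} → A β → V⁻ β ⊎ β ≡ neg α) → (∀ {β} → B β → V⁺ β ⊎ β ≡ α) →
           (∀ {β} → V⁻ β → A′ β) → A′ α → (∀ {β} → V⁺ β → B′ β) → B′ (neg α) →
           ∀ {g} → X A B g → X A′ B′ g
  X-flip {α = α} n⁻ n⁺ A-split B-split A′-V A′-α B′-V B′-α {g} (mkX {a} {t} {b} a∈ t∈ b∈ f)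
    with v , c , v∈ , c∈ , e ← U-splitʳ n⁻ A-split a∈ | d , w , d∈ , w∈ , e′ ← U-split n⁺ B-split b∈
    -- With t moved to the left, the factors from F (neg α) and F α meet in the middle. `F-opposite`
    -- exchanges them with -α in the role of its root, whence the transports along `neg-neg`.
    with d′ , s , c′ , d′∈ , s∈ , c′∈ , e″ ← F-opposite {neg α} (F-conj-T₀ (T₀-⁻¹ t∈) c∈) (≡.subst (λ β → F β d) (≡.sym (neg-neg α)) d∈)
    = mkX (product (U-mono A′-V v∈) (U-root A′-α (F-conj-T₀ t∈ (≡.subst (λ β → F β d′) (neg-neg α) d′∈))))
          (T₀-∙ t∈ s∈)
          (product (U-root B′-α c′∈) (U-mono B′-V w∈))
          (begin
            g                                           ≈⟨ f ⟩
            (a ∙ t) ∙ b                                 ≈⟨ ∙-cong (∙-congʳ e) e′ ⟩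
            ((v ∙ c) ∙ t) ∙ (d ∙ w)
              ≈⟨ solve 5 (λ v c t d w → ((v ⊙ c) ⊙ t) ⊙ (d ⊙ w) ⊜ (v ⊙ t) ⊙ ((((t ⊖ ⊙ c) ⊙ t ⊖ ⊖) ⊙ d) ⊙ w)) refl v c t d w ⟩
            (v ∙ t) ∙ ((conj G (t ⁻¹) c ∙ d) ∙ w)       ≈⟨ ∙-congˡ (∙-congʳ e″) ⟩
            (v ∙ t) ∙ (((d′ ∙ s) ∙ c′) ∙ w)
              ≈⟨ solve 6 (λ v t d s c w → (v ⊙ t) ⊙ (((d ⊙ s) ⊙ c) ⊙ w) ⊜ ((v ⊙ ((t ⊙ d) ⊙ t ⊖)) ⊙ (t ⊙ s)) ⊙ (c ⊙ w)) refl v t d′ s c′ w ⟩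
            ((v ∙ conj G t d′) ∙ (t ∙ s)) ∙ (c′ ∙ w)    ∎)

  module _ {A B : Φ → Set} (root-stable : ∀ {α u g} → F α u → X A B g → X A B (u ∙ g)) where
    private
      I : Carrier → Set
      I = Generated G (λ g → T₀ g ⊎ ∃[ α ] F α g)

      -- Stability under g⁻¹ is carried along because the case of an inverse asks for it.
      stable : ∀ {g} → I g → (∀ {h} → X A B h → X A B (g ∙ h)) × (∀ {h} → X A B h → X A B (g ⁻¹ ∙ h))
      stable (member (inj₁ t₀))      = X-T₀ t₀ , X-T₀ (T₀-⁻¹ t₀)
      stable (member (inj₂ (α , f))) = root-stable f , root-stable (F-⁻¹ f)
      stable identity = X-respects (sym (identityˡ _)) , X-respects (solve 1 (λ h → h ⊜ 𝟏 ⊖ ⊙ h) refl _)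
      stable (product {g} {k} h h′) with p , p⁻ ← stable h | q , q⁻ ← stable h′ =
        X-respects (sym (assoc _ _ _)) ∘ p ∘ q ,
        X-respects (solve 3 (λ g k h → k ⊖ ⊙ (g ⊖ ⊙ h) ⊜ (g ⊙ k) ⊖ ⊙ h) refl g k _) ∘ q⁻ ∘ p⁻
      stable (inverse {g} h) with p , p⁻ ← stable h =
        p⁻ , X-respects (∙-congʳ (solve 1 (λ g → g ⊜ g ⊖ ⊖) refl g)) ∘ p
      stable (respects e h) with p , p⁻ ← stable h =
        X-respects (∙-congʳ e) ∘ p , X-respects (∙-congʳ (⁻¹-cong e)) ∘ p⁻

    -- The set contains ε and is stable under left multiplication by I, so it contains I.
    X-generated : ∀ {g} → I g → X A B g
    X-generated {g} h = X-respects (identityʳ g) (proj₁ (stable h) X-ε)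

-- The Iwahori decomposition.

module IwahoriGroup (p : ℕ) (𝐊 : LocalField) (P : PadicField p 𝐊) (𝐆 : SplitReductiveGroup (LocalField.K 𝐊))
  (R : RootDatum 𝐆) (chev : ChevalleySystem 𝐆 R) (C : Building.Alcove 𝐊 𝐆 R) where
  open LocalField 𝐊 renaming (K to ℚₚ)
  open Valuation p 𝐊 P
  open Building 𝐊 𝐆 R using (G; T₀; fixingRootGroup; Iwahori; module Alcove)
  open RootDatum R using (Φ; root; neg; CommutatorTerm)
  open ChevalleySystem chev
  open Group G hiding (identity; inverse)
  open Conjugation G
  open RootGroups p 𝐊 P 𝐆 R
  open Roots 𝐆 R using (neg-neg; slopes)
  open IntegersInℚ
  open Depths 𝐆 R (Alcove.point C)

  -- The fractional ideal pᵏℤ_p for the least integer k ≥ depth α, written as a union over all such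
  -- k so that no rational number has to be rounded.
  record 𝔞 (α : Φ) (u : K.Carrier) : Set where
    constructor mk𝔞
    field
      level   : ℤ
      deep    : depth α ℚ.≤ int level
      divides : u ∈p^ level

  𝔞-cong : ∀ {α u v} → u K.≈ v → 𝔞 α u → 𝔞 α v
  𝔞-cong e (mk𝔞 k h d) = mk𝔞 k h (∈-cong e d)

  𝔞-0 : ∀ α → 𝔞 α K.0#
  𝔞-0 α with k , h ← ≤-archimedean (depth α) = mk𝔞 k h (∈-0 k)

  𝔞-+ : ∀ {α u v} → 𝔞 α u → 𝔞 α v → 𝔞 α (u K.+ v)
  𝔞-+ (mk𝔞 k h d) (mk𝔞 l h′ d′) with ℤP.≤-total k l
  ... | inj₁ k≤l = mk𝔞 k h (∈-+ d (∈-mono k≤l d′))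
  ... | inj₂ l≤k = mk𝔞 l h′ (∈-+ (∈-mono l≤k d) d′)

  𝔞-neg : ∀ {α u} → 𝔞 α u → 𝔞 α (K.- u)
  𝔞-neg (mk𝔞 k h d) = mk𝔞 k h (∈-neg d)

  𝔞-ι* : ∀ {α u} z → 𝔞 α u → 𝔞 α (ι z K.* u)
  𝔞-ι* z (mk𝔞 k h d) = mk𝔞 k h (∈-ι* z d)

  𝔞-combination : ∀ {α β γ} i j → (∀ l → root γ l ≡ + i ℤ.* root α l ℤ.+ + j ℤ.* root β l) →
                  ∀ {u v} c → 𝔞 α u → 𝔞 β v →
                  𝔞 γ (power K.+-group (Exp._^_ K.semiring u i K.* Exp._^_ K.semiring v j) c)
  𝔞-combination {α} {β} {γ} i j h c (mk𝔞 k hk d) (mk𝔞 l hl d′) =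
    mk𝔞 (+ i ℤ.* k ℤ.+ + j ℤ.* l) (depth-combination {α} {β} {γ} i j h hk hl)
      (∈-multiple c (∈-* (∈-^ i d) (∈-^ j d′)))

  𝔞-opposite : ∀ {α u v} → 𝔞 α u → 𝔞 (neg α) v → ∃[ z ] u K.* v K.≈ ι (π O.* z)
  𝔞-opposite {α} (mk𝔞 k h d) (mk𝔞 l h′ d′) =
    ∈-positive (depth-opposite (Alcove.generic C) {α} {k} {l} h h′) (∈-* d d′)

  F : Φ → Carrier → Set
  F α = fixingRootGroup α C

  F-intro : ∀ {α u g} → 𝔞 α u → g ≈ x α u → F α g
  F-intro {u = u} (mk𝔞 k h (z , d)) e = k , h , u , (z , d) , e

  F-elim : ∀ {α g} → F α g → ∃[ u ] 𝔞 α u × g ≈ x α u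
  F-elim (k , h , u , (z , d) , e) = u , mk𝔞 k h (z , d) , e

  F-ε : ∀ α → F α ε
  F-ε α = F-intro (𝔞-0 α) (sym (x-0 α))

  F-∙ : ∀ {α g h} → F α g → F α h → F α (g ∙ h)
  F-∙ {α} f f′ with u , d , e ← F-elim f | v , d′ , e′ ← F-elim f′ =
    F-intro (𝔞-+ d d′) (trans (∙-cong e e′) (sym (x-+ α u v)))

  F-⁻¹ : ∀ {α g} → F α g → F α (g ⁻¹)
  F-⁻¹ {α} f with u , d , e ← F-elim f = F-intro (𝔞-neg d) (trans (⁻¹-cong e) (sym (x-neg α u)))

  F-conj-T₀ : ∀ {α t g} → T₀ t → F α g → F α (conj G t g)
  F-conj-T₀ {α} (t , e) f with u , d , e′ ← F-elim f = F-intro (𝔞-ι* _ d)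
    (trans (conj-cong e e′) (trans (conj-x α (integral t) u) (x-cong (K.*-congʳ (χ-integral α t)))))

  -- The relation `opposite` with d = 1 + uv, which is a unit because uv ∈ pℤ_p.
  F-opposite : ∀ {α a b} → F α a → F (neg α) b →
               ∃[ b′ ] ∃[ t ] ∃[ a′ ] F (neg α) b′ × T₀ t × F α a′ × a ∙ b ≈ (b′ ∙ t) ∙ a′
  F-opposite {α} fa fb with u , d , e ← F-elim fa | v , d′ , e′ ← F-elim fb
    with z , uv ← 𝔞-opposite d d′ =
      _ , _ , _ , F-intro (𝔞-ι* (inv w) d′) refl , T₀-coroot α w , F-intro (𝔞-ι* (inv w) d) refl ,
      trans (∙-cong e e′) (opposite α (base ℚₚ) u v (mapˣ {𝒪} {ℚₚ} ι ι-isHom w)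
        (K.trans (ι.+-homo _ _) (K.+-cong ι.1#-homo (K.sym uv))))
    where w = 1+π z

  system : RootGroupSystem G neg
  system = record
    { neg-neg = neg-neg ; F = F ; T₀ = T₀ ; F-ε = F-ε ; F-∙ = F-∙ ; F-⁻¹ = F-⁻¹
    ; T₀-ε = T₀-ε ; T₀-∙ = T₀-∙ ; T₀-⁻¹ = T₀-⁻¹ ; F-conj-T₀ = F-conj-T₀ ; F-opposite = F-opposite }

  open Triangular G neg system

  U-generated : ∀ {S g} → U S g → rootGenerated 𝐆 R (base ℚₚ) S g
  U-generated = generated-map λ (α , s , f) → member (α , s , proj₁ (F-elim f) , proj₂ (proj₂ (F-elim f)))

  U⊆Iwahori : ∀ {S g} → U S g → Iwahori C g
  U⊆Iwahori = generated-map λ (α , s , f) → member (inj₂ (α , f))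

  -- The hypotheses under which the commutator formula shows that F α normalises U S: it applies to
  -- α and the roots of S, and its terms stay in S.
  record Closed (S : Φ → Set) (α : Φ) : Set where
    field
      distinct  : ∀ {β} → S β → β ≢ α
      distinct′ : ∀ {β} → S β → β ≢ neg α
      closed    : ∀ {β γ} i j → 0 ℕ.< i → 0 ℕ.< j → S β →
                  (∀ l → root γ l ≡ + i ℤ.* root α l ℤ.+ + j ℤ.* root β l) → S γ
  open Closed

  U-terms : ∀ {S α β u v} → Closed S α → S β → 𝔞 α u → 𝔞 β v → (L : List (CommutatorTerm α β)) →
            U S (List.foldr (λ c g → CommutatorTerm.value c (base ℚₚ) u v ∙ g) ε L)
  U-terms n s d d′ []      = identity
  U-terms n s d d′ (c ∷ L) = product
    (U-root (closed n i j i>0 j>0 s sum-γ) (F-intro (𝔞-combination i j sum-γ coeff d d′) refl))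
    (U-terms n s d d′ L)
    where open CommutatorTerm c

  -- aga⁻¹ is the commutator of a and g times g, and the terms of the commutator belong to roots iα
  -- + jβ in S.
  normalised : ∀ {S α} → Closed S α → Normalised S α
  normalised {S} {α} n = mkNormalised generator-conj
    where
    generator-conj : ∀ {β a g} → F α a → S β → F β g → U S (conj G a g)
    generator-conj {β} {a} {g} f s f′ with u , d , e ← F-elim f | v , d′ , e′ ← F-elim f′
      with L , commutes ← commutator α β (distinct n s) (distinct′ n s) = respects
        (trans (∙-congʳ (sym (commutes (base ℚₚ) u v))) (trans (conj-commutator (x α u) (x β v)) (sym (conj-cong e e′))))
        (product (U-terms n s d d′ L) (U-root s (F-intro d′ refl)))

  module Decomposition (Ψ : PositiveSystem 𝐆 R) where
    open PositiveSystem Ψ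
    open RootOrder 𝐆 R Ψ (slopes Ψ)

    module _ {θ} (pθ : Positive θ) where
      private
        scaled : ∀ {α β γ} i j → det θ α ≡ 0ℤ → (∀ l → root γ l ≡ + i ℤ.* root α l ℤ.+ + j ℤ.* root β l) →
                 det θ γ ≡ + j ℤ.* det θ β
        scaled {α} {β} {γ} i j z h = ≡.trans (det-combination θ {α} {β} {γ} (+ i) (+ j) h)
          (≡.trans (≡.cong (ℤ._+ + j ℤ.* det θ β) (≡.trans (≡.cong (λ w → + i ℤ.* w) z) (ℤP.*-zeroʳ (+ i)))) (ℤP.+-identityˡ _))

        det-neg-self : det θ (neg θ) ≡ 0ℤ
        det-neg-self = ≡.trans (det-negʳ θ θ) (≡.cong ℤ.-_ (det-self θ))

        apart : ∀ {S : Φ → Set} {α} → det θ α ≡ 0ℤ → (∀ {β} → S β → det θ β ≢ 0ℤ) → ∀ {β} → S β → β ≢ α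
        apart z nz s ≡.refl = nz s z

        line : ∀ {α} → det θ α ≡ 0ℤ → det θ (neg α) ≡ 0ℤ
        line {α} z = ≡.trans (det-negʳ θ α) (≡.cong ℤ.-_ z)

        above≢0 : ∀ {β} → Above θ β → det θ β ≢ 0ℤ
        above≢0 h e = ℤP.<-irrefl (≡.sym e) h

        below≢0 : ∀ {β} → Below θ β → det θ β ≢ 0ℤ
        below≢0 h e = ℤP.<-irrefl e h

      -- For α on the line of θ, det θ (iα + jβ) = j det θ β has the sign of det θ β.
      closed-Above : ∀ {α} → det θ α ≡ 0ℤ → Closed (Above θ) α
      closed-Above {α} z = record
        { distinct  = apart {S = Above θ} z above≢0
        ; distinct′ = apart {S = Above θ} (line z) above≢0
        ; closed    = λ {β} {γ} i j _ j>0 h e → ≡.subst (0ℤ ℤ.<_) (≡.sym (scaled {α} {β} {γ} i j z e))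
            (*-positive (ℤ.+<+ j>0) h)
        }

      closed-Below : ∀ {α} → det θ α ≡ 0ℤ → Closed (Below θ) α
      closed-Below {α} z = record
        { distinct  = apart {S = Below θ} z below≢0
        ; distinct′ = apart {S = Below θ} (line z) below≢0
        ; closed    = λ {β} {γ} i j _ j>0 h e → ≡.subst (ℤ._< 0ℤ) (≡.sym (scaled {α} {β} {γ} i j z e))
            (≡.subst (+ j ℤ.* det θ β ℤ.<_) (ℤP.*-zeroʳ (+ j)) (ℤP.*-monoˡ-<-pos (+ j) {{ℤ.positive (ℤ.+<+ j>0)}} h))
        }

      normalised-Above : ∀ {α} → det θ α ≡ 0ℤ → Normalised (Above θ) α
      normalised-Above z = normalised (closed-Above z)

      normalised-Below : ∀ {α} → det θ α ≡ 0ℤ → Normalised (Below θ) α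
      normalised-Below z = normalised (closed-Below z)

      module θ = At θ pθ

      flip : ∀ {g} → X (Lower θ.k₀) (Upper θ.k₀) g → X (Lower (ℕ.suc θ.k₀)) (Upper (ℕ.suc θ.k₀)) g
      flip = X-flip (normalised-Below det-neg-self) (normalised-Above (det-self θ))
        θ.Lower-split θ.Upper-split (proj₂ ∘ θ.Below⇒Lower) θ.Lower⁺-θ (proj₂ ∘ θ.Above⇒Upper) θ.Upper⁺-neg

      -- `X-flip` with -θ in the role of α, so its hypotheses mention neg (neg θ).
      unflip : ∀ {g} → X (Lower (ℕ.suc θ.k₀)) (Upper (ℕ.suc θ.k₀)) g → X (Lower θ.k₀) (Upper θ.k₀) g
      unflip = X-flip {α = neg θ}
        (≡.subst (Normalised (Below θ)) (≡.sym (neg-neg θ)) (normalised-Below (det-self θ)))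
        (normalised-Above det-neg-self)
        (λ l → ≡.subst (λ z → Below θ _ ⊎ _ ≡ z) (≡.sym (neg-neg θ)) (θ.Lower⁺-split l))
        θ.Upper⁺-split (proj₁ ∘ θ.Below⇒Lower) θ.Lower-neg (proj₁ ∘ θ.Above⇒Upper)
        (≡.subst (Upper θ.k₀) (≡.sym (neg-neg θ)) θ.Upper-θ)

    Xₖ : ℕ → Carrier → Set
    Xₖ k = X (Lower k) (Upper k)

    Xₖ-suc : ∀ k {g} → Xₖ k g ⇔ Xₖ (ℕ.suc k) g
    Xₖ-suc k with at-index? k
    ... | inj₁ (θ , pθ , ≡.refl) = mk⇔ (flip pθ) (unflip pθ)
    ... | inj₂ gap = mk⇔ (X-mono Lower⇒Lower⁺ Upper⇒Upper⁺) (X-mono Lower⁺⇒Lower Upper⁺⇒Upper)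
      where open Gap k gap

    Xₖ-all : ∀ k {g} → Xₖ 0 g ⇔ Xₖ k g
    Xₖ-all ℕ.zero    = mk⇔ (λ h → h) (λ h → h)
    Xₖ-all (ℕ.suc k) = mk⇔ (Equivalence.to (Xₖ-suc k) ∘ Equivalence.to (Xₖ-all k))
                           (Equivalence.from (Xₖ-all k) ∘ Equivalence.from (Xₖ-suc k))

    -- All Xₖ are the same set. A negative α lies in Lower 0; a positive α lies in Lower (index α +
    -- 1), so in the description of the set by this k the element u is absorbed by the left factor.
    X-stable : ∀ {α u g} → F α u → Xₖ 0 g → Xₖ 0 (u ∙ g)
    X-stable {α} f h with sign α
    ... | inj₂ n = X-left (U-root (inj₁ (n , ℕ.z≤n)) f) h
    ... | inj₁ pα = Equivalence.from (Xₖ-all (ℕ.suc (index α)))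
          (X-left (U-root (At.Lower⁺-θ α pα) f) (Equivalence.to (Xₖ-all (ℕ.suc (index α))) h))

    iwahori-decomposition : ∀ {g} → Iwahori C g → X Negative Positive g
    iwahori-decomposition h = X-mono
      (λ { (inj₁ (n , _)) → n ; (inj₂ (_ , ())) })
      (λ { (inj₁ (q , _)) → q ; (inj₂ (_ , ())) })
      (X-generated X-stable h)

-- The big cell and the normaliser of T.

module BigCellRelations (G : Grp) where
  open Group G
  open Conjugation G
  open GroupSolver G
  open SetoidReasoning setoid

  by-bigCell : ∀ {a t b g} → g ≈ (a ∙ t) ∙ b → (a ∙ t) ∙ (b ∙ g ⁻¹) ≈ ε
  by-bigCell {a} {t} {b} {g} e = trans (solve 4 (λ a t b g → (a ⊙ t) ⊙ (b ⊙ g ⊖) ⊜ ((a ⊙ t) ⊙ b) ⊙ g ⊖) refl a t b g)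
    (trans (∙-congʳ (sym e)) (inverseʳ g))

  cancel-right : ∀ {b g} → b ∙ g ⁻¹ ≈ ε → g ≈ b
  cancel-right {b} {g} e = sym (trans (solve 2 (λ b g → b ⊜ (b ⊙ g ⊖) ⊙ g) refl b g) (trans (∙-congʳ e) (identityˡ g)))

  inverse-from-product : ∀ {b u} → b ∙ u ≈ ε → b ⁻¹ ≈ u
  inverse-from-product {b} {u} h = sym (trans (solve 2 (λ b u → u ⊜ b ⊖ ⊙ (b ⊙ u)) refl b u) (trans (∙-congˡ h) (identityʳ _)))

  inverse-of-product : ∀ u m → m ⁻¹ ≈ (u ∙ m) ⁻¹ ∙ u
  inverse-of-product = solve 2 (λ u m → m ⊖ ⊜ (u ⊙ m) ⊖ ⊙ u) refl

  cancel-all : ∀ a v → ((a ⁻¹ ∙ (a ∙ v)) ∙ ε) ∙ v ⁻¹ ≈ ε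
  cancel-all = solve 2 (λ a v → ((a ⊖ ⊙ (a ⊙ v)) ⊙ 𝟏) ⊙ v ⊖ ⊜ 𝟏) refl

  divide : ∀ r a b → (r ⁻¹ ∙ a) ⁻¹ ∙ (r ⁻¹ ∙ b) ≈ a ⁻¹ ∙ b
  divide = solve 3 (λ r a b → (r ⊖ ⊙ a) ⊖ ⊙ (r ⊖ ⊙ b) ⊜ a ⊖ ⊙ b) refl

  divideˡ : ∀ g a b → (g ∙ a) ⁻¹ ∙ (g ∙ b) ≈ a ⁻¹ ∙ b
  divideˡ = solve 3 (λ g a b → (g ⊙ a) ⊖ ⊙ (g ⊙ b) ⊜ a ⊖ ⊙ b) refl

  cancelˡ : ∀ a m → a ⁻¹ ∙ (a ∙ m) ≈ m
  cancelˡ = solve 2 (λ a m → a ⊖ ⊙ (a ⊙ m) ⊜ m) refl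

  transport-identity : ∀ g h m k → let w = (g ⁻¹ ∙ h) ∙ m in
                       conj G m ((w ⁻¹ ∙ k) ∙ w) ≈ conj G (h ⁻¹ ∙ g) k
  transport-identity = solve 4 (λ g h m k → let w = (g ⊖ ⊙ h) ⊙ m in
    (m ⊙ ((w ⊖ ⊙ k) ⊙ w)) ⊙ m ⊖ ⊜ ((h ⊖ ⊙ g) ⊙ k) ⊙ (h ⊖ ⊙ g) ⊖) refl

  trivial-twist : ∀ a k → conj G (a ⁻¹ ∙ ε) (conj G a k) ≈ k
  trivial-twist = solve 2 (λ a k → ((a ⊖ ⊙ 𝟏) ⊙ ((a ⊙ k) ⊙ a ⊖)) ⊙ (a ⊖ ⊙ 𝟏) ⊖ ⊜ k) refl

  conj-swap : ∀ a b → a ∙ b ≈ conj G a b ∙ a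
  conj-swap = solve 2 (λ a b → a ⊙ b ⊜ ((a ⊙ b) ⊙ a ⊖) ⊙ a) refl

  swap-conj : ∀ m s → s ∙ m ⁻¹ ≈ m ⁻¹ ∙ conj G m s
  swap-conj = solve 2 (λ m s → s ⊙ m ⊖ ⊜ m ⊖ ⊙ ((m ⊙ s) ⊙ m ⊖)) refl

  -- Here a t n = m⁻¹ and w = msm⁻¹. Writing s(atn) as (sas⁻¹) t (sns⁻¹) s and (atn)w as a z
  -- ((sw⁻¹)n(sw⁻¹)⁻¹) s and dividing gives a product of elements of N⁻, T and N that equals ε.
  twisted-relation : ∀ {a t n s w} → s ∙ ((a ∙ t) ∙ n) ≈ ((a ∙ t) ∙ n) ∙ w → t ∙ s ≈ s ∙ t →
    let z = t ∙ (w ∙ s ⁻¹) in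
    (conj G (z ⁻¹) (a ⁻¹ ∙ conj G s a) ∙ (z ⁻¹ ∙ t)) ∙ (conj G s n ∙ conj G (s ∙ w ⁻¹) n ⁻¹) ≈ ε
  twisted-relation {a} {t} {n} {s} {w} twist commute = begin
    (conj G (z ⁻¹) (a ⁻¹ ∙ conj G s a) ∙ (z ⁻¹ ∙ t)) ∙ (conj G s n ∙ conj G (s ∙ w ⁻¹) n ⁻¹)
      ≈⟨ solve 6 (λ a t n s w z →
           (((z ⊖ ⊙ (a ⊖ ⊙ ((s ⊙ a) ⊙ s ⊖))) ⊙ z ⊖ ⊖) ⊙ (z ⊖ ⊙ t)) ⊙ (((s ⊙ n) ⊙ s ⊖) ⊙ (((s ⊙ w ⊖) ⊙ n) ⊙ (s ⊙ w ⊖) ⊖) ⊖)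
           ⊜ (((z ⊖ ⊙ a ⊖) ⊙ (s ⊙ a)) ⊙ (s ⊖ ⊙ (t ⊙ s))) ⊙ (((n ⊙ w ⊖) ⊙ n ⊖) ⊙ (w ⊙ s ⊖))) refl a t n s w z ⟩
    (((z ⁻¹ ∙ a ⁻¹) ∙ (s ∙ a)) ∙ (s ⁻¹ ∙ (t ∙ s))) ∙ (((n ∙ w ⁻¹) ∙ n ⁻¹) ∙ (w ∙ s ⁻¹))
      ≈⟨ ∙-congʳ (∙-congˡ (∙-congˡ commute)) ⟩
    (((z ⁻¹ ∙ a ⁻¹) ∙ (s ∙ a)) ∙ (s ⁻¹ ∙ (s ∙ t))) ∙ (((n ∙ w ⁻¹) ∙ n ⁻¹) ∙ (w ∙ s ⁻¹))
      ≈⟨ solve 6 (λ a t n s w z →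
           (((z ⊖ ⊙ a ⊖) ⊙ (s ⊙ a)) ⊙ (s ⊖ ⊙ (s ⊙ t))) ⊙ (((n ⊙ w ⊖) ⊙ n ⊖) ⊙ (w ⊙ s ⊖))
           ⊜ ((z ⊖ ⊙ a ⊖) ⊙ (s ⊙ ((a ⊙ t) ⊙ n))) ⊙ ((w ⊖ ⊙ n ⊖) ⊙ (w ⊙ s ⊖))) refl a t n s w z ⟩
    ((z ⁻¹ ∙ a ⁻¹) ∙ (s ∙ ((a ∙ t) ∙ n))) ∙ ((w ⁻¹ ∙ n ⁻¹) ∙ (w ∙ s ⁻¹))
      ≈⟨ ∙-congʳ (∙-congˡ twist) ⟩
    ((z ⁻¹ ∙ a ⁻¹) ∙ (((a ∙ t) ∙ n) ∙ w)) ∙ ((w ⁻¹ ∙ n ⁻¹) ∙ (w ∙ s ⁻¹))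
      ≈⟨ solve 5 (λ a t n s w →
           ((((t ⊙ (w ⊙ s ⊖)) ⊖) ⊙ a ⊖) ⊙ (((a ⊙ t) ⊙ n) ⊙ w)) ⊙ ((w ⊖ ⊙ n ⊖) ⊙ (w ⊙ s ⊖)) ⊜ 𝟏) refl a t n s w ⟩
    ε ∎
    where z = t ∙ (w ∙ s ⁻¹)

  -- Since z⁻¹t = sw⁻¹, the first relation says s = w, and the second becomes sns⁻¹ = n.
  twisted-trivial : ∀ {t n s w} → (t ∙ (w ∙ s ⁻¹)) ⁻¹ ∙ t ≈ ε →
                    conj G s n ∙ conj G (s ∙ w ⁻¹) n ⁻¹ ≈ ε → conj G s n ≈ n
  twisted-trivial {t} {n} {s} {w} h k = begin
    conj G s n
      ≈⟨ solve 2 (λ c d → c ⊜ (c ⊙ d ⊖) ⊙ d) refl (conj G s n) (conj G (s ∙ w ⁻¹) n) ⟩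
    (conj G s n ∙ conj G (s ∙ w ⁻¹) n ⁻¹) ∙ conj G (s ∙ w ⁻¹) n
      ≈⟨ ∙-cong k (conj-cong (trans (solve 3 (λ t s w → s ⊙ w ⊖ ⊜ (t ⊙ (w ⊙ s ⊖)) ⊖ ⊙ t) refl t s w) h) refl) ⟩
    ε ∙ conj G ε n
      ≈⟨ solve 1 (λ n → 𝟏 ⊙ ((𝟏 ⊙ n) ⊙ 𝟏 ⊖) ⊜ n) refl n ⟩
    n ∎

module RootDatumConsequences (p : ℕ) (𝐊 : LocalField) (P : PadicField p 𝐊) (𝐆 : SplitReductiveGroup (LocalField.K 𝐊))
  (R : RootDatum 𝐆) (chev : ChevalleySystem 𝐆 R) where
  open LocalField 𝐊 renaming (K to ℚₚ)
  open Valuation p 𝐊 P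
  open Building 𝐊 𝐆 R using (G; torus; inT)
  open RootDatum R using (Φ; root; productOver; coroot)
  open ChevalleySystem chev
  open Group G hiding (identity; inverse)
  open Conjugation G
  open RootGroups p 𝐊 P 𝐆 R
  open PositiveSystem using (Positive; Negative; positives)

  generates : (Φ → Set) → Carrier → Set
  generates = rootGenerated 𝐆 R (base ℚₚ)

  generates-conj-T : ∀ {S t g} → generates S g → generates S (conj G (inT t) g)
  generates-conj-T {t = t} = generated-conj (inT t) λ (α , s , u , e) →
    member (α , s , χ α t K.* u , trans (conj-cong refl e) (conj-x α t u))

  productOver-conj-T : ∀ t L u → conj G (inT t) (productOver (base ℚₚ) L u) ≈ productOver (base ℚₚ) L (λ α → χ α t K.* u α)
  productOver-conj-T t []      u = conj-identity (inT t)
  productOver-conj-T t (α ∷ L) u = trans (conj-∙ (inT t) _ _) (∙-cong (conj-x α t (u α)) (productOver-conj-T t L u))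

  productOver-0 : ∀ L u → All (λ α → u α K.≈ K.0#) L → productOver (base ℚₚ) L u ≈ ε
  productOver-0 []      u []      = refl
  productOver-0 (α ∷ L) u (z ∷ h) = trans (∙-cong (trans (x-cong z) (x-0 α)) (productOver-0 L u h)) (identityˡ ε)

  -- Conjugation by α∨(p) multiplies the coordinate of n at α by p². Coordinates are unique, so u α
  -- = p² u α and u α = 0.
  centralised⇒ε : (Ψ : PositiveSystem 𝐆 R) → ∀ {n} → generates (Positive Ψ) n →
                  (∀ s → conj G (inT s) n ≈ n) → n ≈ ε
  centralised⇒ε Ψ {n} n∈ fixed with u , e ← factor Ψ (base ℚₚ) (positives Ψ) ↭-refl n n∈ =
    trans e (productOver-0 (positives Ψ) u
      (All.map (λ {α} → u≈0 α) (all-filter (λ α → 0ℤ ℤP.<? ⟪ root α , PositiveSystem.ℓ Ψ ⟫) (List.allFin _))))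
    where
    u≈0 : ∀ α → Positive Ψ α → u α K.≈ K.0#
    u≈0 α pα = pow2-fixed (K.trans
      (factor-unique Ψ (base ℚₚ) (positives Ψ) ↭-refl u _
        (trans (sym e) (trans (sym (fixed s)) (trans (conj-cong refl e) (productOver-conj-T s (positives Ψ) u)))) α pα)
      (K.*-congʳ (χ-coroot-ϖ α)))
      where s = cocharacter ℚₚ (coroot α) ϖ

  -- Conjugating m = a t n by s ∈ T gives a second decomposition of the same form, as m
  -- normalises T; by uniqueness s centralises n.
  normaliser∩big-cell : (Ψ : PositiveSystem 𝐆 R) → ∀ {m a n} t → NormalisesT 𝐆 m →
                        generates (Negative Ψ) a → generates (Positive Ψ) n → m ⁻¹ ≈ (a ∙ inT t) ∙ n → n ≈ ε
  normaliser∩big-cell Ψ {m} {a} {n} t normal a∈ n∈ e = centralised⇒ε Ψ n∈ fixed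
    where
    open BigCellRelations G
    open Group torus using () renaming (_⁻¹ to _⁻¹ᵗ; _∙_ to _∙ᵗ_)

    module _ (s : ∣ torus ∣ᵍ) where
      s₁ = proj₁ (proj₁ (normal s))
      t′ = t ∙ᵗ (s₁ ∙ᵗ s ⁻¹ᵗ)
      z  = inT t ∙ (inT s₁ ∙ inT s ⁻¹)

      inv-z : inT (t′ ⁻¹ᵗ) ≈ z ⁻¹
      inv-z = trans (inT-⁻¹ t′) (⁻¹-cong (trans (inT-∙ t _) (∙-congˡ (trans (inT-∙ s₁ _) (∙-congˡ (inT-⁻¹ s))))))

      z⁻¹t : inT (t′ ⁻¹ᵗ ∙ᵗ t) ≈ z ⁻¹ ∙ inT t
      z⁻¹t = trans (inT-∙ _ t) (∙-congʳ inv-z)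

      sw : inT (s ∙ᵗ s₁ ⁻¹ᵗ) ≈ inT s ∙ inT s₁ ⁻¹
      sw = trans (inT-∙ s _) (∙-congˡ (inT-⁻¹ s₁))

      twist : inT s ∙ ((a ∙ inT t) ∙ n) ≈ ((a ∙ inT t) ∙ n) ∙ inT s₁
      twist = trans (∙-congˡ (sym e)) (trans (swap-conj m (inT s)) (∙-cong e (proj₂ (proj₁ (normal s)))))

      fixed : conj G (inT s) n ≈ n
      fixed with _ , trivial , trivial′ ← bigCell Ψ (base ℚₚ)
          (conj G (inT (t′ ⁻¹ᵗ)) (a ⁻¹ ∙ conj G (inT s) a)) (t′ ⁻¹ᵗ ∙ᵗ t)
          (conj G (inT s) n ∙ conj G (inT (s ∙ᵗ s₁ ⁻¹ᵗ)) n ⁻¹)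
          (generates-conj-T (product (inverse a∈) (generates-conj-T a∈)))
          (product (generates-conj-T n∈) (inverse (generates-conj-T n∈)))
          (trans (∙-cong (∙-cong (conj-cong inv-z refl) z⁻¹t) (∙-congˡ (⁻¹-cong (conj-cong sw refl))))
            (twisted-relation twist (inT-commute t s)))
        = twisted-trivial (trans (sym z⁻¹t) trivial) (trans (∙-congˡ (⁻¹-cong (conj-cong (sym sw) refl))) trivial′)

-- Intersections of an Iwahori subgroup with N and with root subgroups.

dominate : ∀ M {d h} → 0ℤ ℤ.< d → ℤ.∣ h ∣ ℕ.< M → 0ℤ ℤ.< + M ℤ.* d ℤ.+ h
dominate M {d} {h} d>0 ∣h∣<M = ≡.subst (ℤ._< + M ℤ.* d ℤ.+ h) (ℤP.+-inverseʳ (+ M))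
  (ℤP.+-mono-≤-< M≤Md (-M<h h ∣h∣<M))
  where
  -M<h : ∀ h → ℤ.∣ h ∣ ℕ.< M → ℤ.- (+ M) ℤ.< h
  -M<h (+ n)    (ℕ.s≤s _)           = ℤ.-<+
  -M<h -[1+ n ] (ℕ.s≤s n<M@(ℕ.s≤s _)) = ℤ.-<- n<M

  M≤Md : + M ℤ.≤ + M ℤ.* d
  M≤Md = ≡.subst (ℤ._≤ + M ℤ.* d) (ℤP.*-identityʳ (+ M)) (ℤP.*-monoˡ-≤-nonNeg (+ M) (ℤP.i<j⇒suc[i]≤j d>0))

module IwahoriFacts (p : ℕ) (𝐊 : LocalField) (P : PadicField p 𝐊) (𝐆 : SplitReductiveGroup (LocalField.K 𝐊))
  (R : RootDatum 𝐆) (chev : ChevalleySystem 𝐆 R) (C : Building.Alcove 𝐊 𝐆 R) where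
  open LocalField 𝐊 renaming (K to ℚₚ)
  open Valuation p 𝐊 P using (module K)
  open Building 𝐊 𝐆 R using (G; torus; inT; Iwahori)
  open SplitReductiveGroup 𝐆 using (rank)
  open RootDatum R using (Φ; root; neg)
  open ChevalleySystem chev
  open Group G hiding (identity; inverse)
  open Conjugation G
  open BigCellRelations G
  open RootGroups p 𝐊 P 𝐆 R
  open RootDatumConsequences p 𝐊 P 𝐆 R chev
  open IwahoriGroup p 𝐊 P 𝐆 R chev C
  open Triangular G neg system
  open Roots 𝐆 R
  open Lattices
  open PositiveSystem using (Positive; Negative)

  -- From g = atb with g ∈ N follows a t (bg⁻¹) = ε with bg⁻¹ ∈ N, and the big cell gives g = b.
  Iwahori∩N : (Ψ : PositiveSystem 𝐆 R) → ∀ {g} → Iwahori C g → generates (Positive Ψ) g → U (Positive Ψ) g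
  Iwahori∩N Ψ {g} g∈ n with mkX {a} {t} {b} a∈ (t₀ , et) b∈ e ← Decomposition.iwahori-decomposition Ψ g∈
    with _ , _ , h ← bigCell Ψ (base ℚₚ) a (integral t₀) (b ∙ g ⁻¹)
           (U-generated a∈) (product (U-generated b∈) (inverse n))
           (trans (∙-congʳ (∙-congˡ (sym et))) (by-bigCell e))
    = respects (sym (cancel-right h)) b∈

  -- In a triangular decomposition of (um)⁻¹ = m⁻¹u⁻¹ the factor in N is u⁻¹.
  Iwahori-N-part : (Ψ : PositiveSystem 𝐆 R) → ∀ {u m} → generates (Positive Ψ) u → NormalisesT 𝐆 m →
                   Iwahori C (u ∙ m) → Iwahori C u
  Iwahori-N-part Ψ {u} {m} n normal h
    with mkX {a} {t} {b} a∈ (t₀ , et) b∈ e ← Decomposition.iwahori-decomposition Ψ (inverse h)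
    = respects (inverse-from-product (normaliser∩big-cell Ψ (integral t₀) normal (U-generated a∈) (product (U-generated b∈) n) m⁻¹≈))
               (inverse (U⊆Iwahori b∈))
    where
    m⁻¹≈ : m ⁻¹ ≈ (a ∙ inT (integral t₀)) ∙ (b ∙ u)
    m⁻¹≈ = trans (inverse-of-product u m)
      (trans (∙-congʳ (trans e (∙-congʳ (∙-congˡ et)))) (assoc _ b u))

  private
    cancel-difference : ∀ {u u′} → K.- u′ K.+ u K.≈ K.0# → u′ K.≈ u
    cancel-difference {u} {u′} h = K.trans (K.sym (K.+-identityʳ u′)) (K.trans (K.+-congˡ (K.sym h))
      (K.trans (K.sym (K.+-assoc u′ _ u)) (K.trans (K.+-congʳ (K.-‿inverseʳ u′)) (K.+-identityˡ u))))

  opposite-system : PositiveSystem 𝐆 R → PositiveSystem 𝐆 R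
  opposite-system Ψ = record
    { ℓ       = λ i → ℤ.- 1ℤ ℤ.* ℓ i
    ; regular = λ α e → regular α (ℤP.neg-injective (≡.trans (≡.sym (pairing-opposite α)) e))
    }
    where
    open PositiveSystem Ψ
    pairing-opposite : ∀ α → ⟪ root α , (λ i → ℤ.- 1ℤ ℤ.* ℓ i) ⟫ ≡ ℤ.- ⟪ root α , ℓ ⟫
    pairing-opposite α = ≡.trans (⟪⟫-scaleʳ (ℤ.- 1ℤ) (root α) ℓ) (ℤP.-1*i≡-i ⟪ root α , ℓ ⟫)

  opposite-positive : ∀ Ψ {α} → Negative Ψ α → Positive (opposite-system Ψ) α
  opposite-positive Ψ {α} h = ≡.subst (0ℤ ℤ.<_)
    (≡.sym (≡.trans (⟪⟫-scaleʳ (ℤ.- 1ℤ) (root α) (PositiveSystem.ℓ Ψ)) (ℤP.-1*i≡-i ⟪ root α , PositiveSystem.ℓ Ψ ⟫))) (ℤP.neg-mono-< h)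

  -- The two positive systems on either side of the hyperplane of α, close to it: M ℓ[ α ] ± ℓ.
  module Adjacent (Ψ : PositiveSystem 𝐆 R) (α : Φ) (pα : Positive Ψ α) where
    open import Data.Integer.Tactic.RingSolver using (solve-∀)
    open PositiveSystem Ψ using (ℓ; regular)
    open RootOrder 𝐆 R Ψ (slopes Ψ)
    open Decomposition Ψ using (normalised-Above)

    private
      bound = Counting.upper-bound (λ β → ℤ.∣ ⟪ root β , ℓ ⟫ ∣)
      M = ℕ.suc (proj₁ bound)

      small : ∀ β → ℤ.∣ ⟪ root β , ℓ ⟫ ∣ ℕ.< M
      small β = ℕ.s≤s (proj₂ bound β)

    -- `s` is 1 or -1. As M exceeds all |⟨β, ℓ⟩|, the sign of ⟨β, ℓ′⟩ is that of `det α β` off the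
    -- line of α, and that of s⟨β, ℓ⟩ on this line.
    module Side (s : ℤ) (s≢0 : ∀ z → s ℤ.* z ≡ 0ℤ → z ≡ 0ℤ) (∣s∣ : ∀ z → ℤ.∣ s ℤ.* z ∣ ≡ ℤ.∣ z ∣) where
      ℓ′ : Lattice rank
      ℓ′ i = + M ℤ.* ℓ[ α ] i ℤ.+ s ℤ.* ℓ i

      pairing : ∀ β → ⟪ root β , ℓ′ ⟫ ≡ + M ℤ.* det α β ℤ.+ s ℤ.* ⟪ root β , ℓ ⟫
      pairing β = ≡.trans (⟪⟫-linearʳ (+ M) s (root β) ℓ[ α ] ℓ)
        (≡.cong (λ z → + M ℤ.* z ℤ.+ s ℤ.* ⟪ root β , ℓ ⟫) (pairing-ℓ[] α β))

      above : ∀ {β} → Above α β → 0ℤ ℤ.< ⟪ root β , ℓ′ ⟫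
      above {β} h = ≡.subst (0ℤ ℤ.<_) (≡.sym (pairing β)) (dominate M h
        (≡.subst (ℕ._< M) (≡.sym (∣s∣ ⟪ root β , ℓ ⟫)) (small β)))

      below : ∀ {β} → Below α β → ⟪ root β , ℓ′ ⟫ ℤ.< 0ℤ
      below {β} h = ≡.subst₂ ℤ._<_ (ℤP.neg-involutive ⟪ root β , ℓ′ ⟫) ≡.refl (ℤP.neg-mono-<
        (≡.subst (0ℤ ℤ.<_) (≡.trans (negate (+ M) (det α β) s ⟪ root β , ℓ ⟫) (≡.cong ℤ.-_ (≡.sym (pairing β))))
          (dominate M (ℤP.neg-mono-< h) (≡.subst (ℕ._< M)
            (≡.sym (≡.trans (ℤP.∣-i∣≡∣i∣ (s ℤ.* ⟪ root β , ℓ ⟫)) (∣s∣ ⟪ root β , ℓ ⟫))) (small β)))))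
        where
        negate : ∀ m d s l → m ℤ.* ℤ.- d ℤ.+ ℤ.- (s ℤ.* l) ≡ ℤ.- (m ℤ.* d ℤ.+ s ℤ.* l)
        negate = solve-∀

      line : ∀ {β} → det α β ≡ 0ℤ → ⟪ root β , ℓ′ ⟫ ≡ s ℤ.* ⟪ root β , ℓ ⟫
      line {β} h = ≡.trans (pairing β) (≡.trans
        (≡.cong (ℤ._+ s ℤ.* ⟪ root β , ℓ ⟫) (≡.trans (≡.cong (λ z → + M ℤ.* z) h) (ℤP.*-zeroʳ (+ M)))) (ℤP.+-identityˡ (s ℤ.* ⟪ root β , ℓ ⟫)))

      det-line : ∀ {β} → β ≡ α ⊎ β ≡ neg α → det α β ≡ 0ℤ
      det-line (inj₁ ≡.refl) = det-self α
      det-line (inj₂ ≡.refl) = ≡.trans (det-negʳ α α) (≡.cong ℤ.-_ (det-self α))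

      Ψ′ : PositiveSystem 𝐆 R
      Ψ′ = record { ℓ = ℓ′ ; regular = regular′ }
        where
        regular′ : ∀ β → ⟪ root β , ℓ′ ⟫ ≢ 0ℤ
        regular′ β e with compare α β
        ... | inj₁ h        = ℤP.<-irrefl (≡.sym e) (above h)
        ... | inj₂ (inj₁ l) = regular β (s≢0 ⟪ root β , ℓ ⟫ (≡.trans (≡.sym (line (det-line l))) e))
        ... | inj₂ (inj₂ h) = ℤP.<-irrefl e (below h)

    private
      ∣-1*z∣ : ∀ z → ℤ.∣ ℤ.- 1ℤ ℤ.* z ∣ ≡ ℤ.∣ z ∣
      ∣-1*z∣ z = ≡.trans (≡.cong ℤ.∣_∣ (ℤP.-1*i≡-i z)) (ℤP.∣-i∣≡∣i∣ z)

    module Ψ⁺ = Side 1ℤ (λ z e → ≡.trans (≡.sym (ℤP.*-identityˡ z)) e) (λ z → ≡.cong ℤ.∣_∣ (ℤP.*-identityˡ z))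
    module Ψ⁻ = Side (ℤ.- 1ℤ) (λ z e → ℤP.∣i∣≡0⇒i≡0 (≡.trans (≡.sym (∣-1*z∣ z)) (≡.cong ℤ.∣_∣ e))) ∣-1*z∣

    Ψ⁺-split : ∀ {β} → Positive Ψ⁺.Ψ′ β → Above α β ⊎ β ≡ α
    Ψ⁺-split {β} h with compare α β
    ... | inj₁ a                   = inj₁ a
    ... | inj₂ (inj₁ (inj₁ e))     = inj₂ e
    ... | inj₂ (inj₁ (inj₂ ≡.refl)) = contradiction
            (≡.subst (0ℤ ℤ.<_) (≡.trans (Ψ⁺.line (Ψ⁺.det-line (inj₂ ≡.refl))) (ℤP.*-identityˡ ⟪ root (neg α) , ℓ ⟫)) h)
            (λ h → ¬both h (neg-negative pα))
    ... | inj₂ (inj₂ b)            = contradiction (Ψ⁺.below b) (ℤP.<-asym h)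

    α∈Ψ⁺ : Positive Ψ⁺.Ψ′ α
    α∈Ψ⁺ = ≡.subst (0ℤ ℤ.<_) (≡.sym (≡.trans (Ψ⁺.line (det-self α)) (ℤP.*-identityˡ ⟪ root α , ℓ ⟫))) pα

    α∉Ψ⁻ : Negative Ψ⁻.Ψ′ α
    α∉Ψ⁻ = ≡.subst (ℤ._< 0ℤ) (≡.sym (≡.trans (Ψ⁻.line (det-self α)) (ℤP.-1*i≡-i _))) (ℤP.neg-mono-< pα)

    -- The coordinate at α of an element of N(Ψ⁺), as N(Ψ⁺) = Nα N(Ψ⁺ ∖ α) with Ψ⁺ ∖ α ⊂ Ψ⁻.
    private
      -- For Ψ⁻ the root α is negative and `Above α` is positive, so x α (u - u′) = v lies in the
      -- unipotent groups of both signs.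
      separated : ∀ {u u′ v} → U (Above α) v → x α u ≈ x α u′ ∙ v → x α (K.- u′ K.+ u) ≈ ε
      separated {u} {u′} {v} v∈ e = proj₁ (bigCell Ψ⁻.Ψ′ (base ℚₚ) (x α (K.- u′ K.+ u)) (Group.ε torus) (v ⁻¹)
        (member (α , α∉Ψ⁻ , K.- u′ K.+ u , refl))
        (inverse (U-generated (U-mono Ψ⁻.above v∈)))
        (trans (∙-congʳ (∙-cong (trans (x-+ α (K.- u′) u) (∙-cong (x-neg α u′) e)) inT-ε))
          (cancel-all (x α u′) v)))

      from-split : ∀ {u} → (∃[ a ] ∃[ v ] F α a × U (Above α) v × x α u ≈ a ∙ v) → 𝔞 α u
      from-split {u} (a , v , fa , v∈ , e) = from-elim (F-elim fa)
        where
        from-elim : (∃[ u′ ] 𝔞 α u′ × a ≈ x α u′) → 𝔞 α u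
        from-elim (u′ , d , e′) = 𝔞-cong (cancel-difference (x-injective-0 α (separated v∈ (trans e (∙-congʳ e′))))) d

    root-coordinate : ∀ {u} → Iwahori C (x α u) → 𝔞 α u
    root-coordinate {u} h = from-split (U-split (normalised-Above pα (det-self α)) Ψ⁺-split
      (Iwahori∩N Ψ⁺.Ψ′ h (member (α , α∈Ψ⁺ , u , refl))))

  -- I_C does not depend on the positive system, so a root that is negative for Ψ is treated with
  -- the opposite system.
  Iwahori-root : PositiveSystem 𝐆 R → ∀ α {u} → Iwahori C (x α u) → 𝔞 α u
  Iwahori-root Ψ α with RootOrder.sign 𝐆 R Ψ (slopes Ψ) α
  ... | inj₁ pα = Adjacent.root-coordinate Ψ α pα
  ... | inj₂ nα = Adjacent.root-coordinate (opposite-system Ψ) α (opposite-positive Ψ nα)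

-- p-adic digits and remainders.

module Expansions (p : ℕ) (𝐊 : LocalField) (P : PadicField p 𝐊) where
  open LocalField 𝐊
  open Valuation p 𝐊 P
  open CommutativeRing 𝒪
  open SemiringSolver commutativeSemiring using (solve; _:=_; _:*_; _:+_)
  open SetoidReasoning setoid

  digit : Carrier → ℕ
  digit a = proj₁ (expand a)

  rest : Carrier → Carrier
  rest a = proj₁ (proj₂ (expand a))

  digit<p : ∀ a → digit a ℕ.< p
  digit<p a = proj₁ (proj₂ (proj₂ (expand a)))

  expansion : ∀ a → a ≈ nat (digit a) + π * rest a
  expansion a = proj₂ (proj₂ (proj₂ (expand a)))

  +-cancelˡ : ∀ a {b c} → a + b ≈ a + c → b ≈ c
  +-cancelˡ a {b} {c} h = trans (cancel b) (trans (+-congˡ h) (sym (cancel c)))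
    where
    cancel : ∀ b → b ≈ - a + (a + b)
    cancel b = sym (trans (sym (+-assoc (- a) a b)) (trans (+-congʳ (-‿inverseˡ a)) (+-identityˡ b)))

  expansion-unique : ∀ {d d′ b b′} → d ℕ.< p → d′ ℕ.< p → nat d + π * b ≈ nat d′ + π * b′ → d ≡ d′ × b ≈ b′
  expansion-unique {d} {d′} d<p d′<p h with ≡.refl ← digit-unique d<p d′<p h = ≡.refl , π-cancel (+-cancelˡ (nat d) h)

  expansion-shift : ∀ {a b} c → a ≈ b + π * c → digit a ≡ digit b × rest a ≈ rest b + c
  expansion-shift {a} {b} c h = expansion-unique (digit<p a) (digit<p b) (begin
    nat (digit a) + π * rest a               ≈⟨ expansion a ⟨
    a                                        ≈⟨ h ⟩
    b + π * c                                ≈⟨ +-congʳ (expansion b) ⟩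
    (nat (digit b) + π * rest b) + π * c     ≈⟨ +-assoc _ _ _ ⟩
    nat (digit b) + (π * rest b + π * c)     ≈⟨ +-congˡ (distribˡ π _ _) ⟨
    nat (digit b) + π * (rest b + c)         ∎)

  expansion-small : ∀ {d} → d ℕ.< p → digit (nat d) ≡ d × rest (nat d) ≈ 0#
  expansion-small d<p = expansion-unique (digit<p _) d<p (trans (sym (expansion _)) (sym (trans (+-congˡ (zeroʳ π)) (+-identityʳ _))))

  quo : ℕ → Carrier → Carrier
  quo ℕ.zero    z = z
  quo (ℕ.suc i) z = rest (quo i z)

  dig : ℕ → Carrier → ℕ
  dig i z = digit (quo i z)

  quo-step : ∀ i z → quo i z ≈ nat (dig i z) + π * quo (ℕ.suc i) z
  quo-step i z = expansion (quo i z)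

  infix 4 _≡_[mod_]
  record _≡_[mod_] (z z′ : Carrier) (i : ℕ) : Set where
    constructor by
    field
      difference : Carrier
      equality   : z ≈ z′ + π ^ i * difference

  mod-refl : ∀ {z z′ i} → z ≈ z′ → z ≡ z′ [mod i ]
  mod-refl h = by 0# (trans h (sym (trans (+-congˡ (zeroʳ _)) (+-identityʳ _))))

  mod-sym : ∀ {z z′ i} → z ≡ z′ [mod i ] → z′ ≡ z [mod i ]
  mod-sym {z} {z′} {i} (by c h) = by (- c) (begin
    z′                                    ≈⟨ +-identityʳ z′ ⟨
    z′ + 0#                               ≈⟨ +-congˡ (trans (sym (zeroʳ (π ^ i))) (*-congˡ (sym (-‿inverseʳ c)))) ⟩
    z′ + π ^ i * (c + - c)                ≈⟨ solve 4 (λ z q c d → z :+ q :* (c :+ d) := (z :+ q :* c) :+ q :* d) refl z′ (π ^ i) c (- c) ⟩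
    (z′ + π ^ i * c) + π ^ i * - c        ≈⟨ +-congʳ h ⟨
    z + π ^ i * - c                       ∎)

  mod-trans : ∀ {z z′ z″ i} → z ≡ z′ [mod i ] → z′ ≡ z″ [mod i ] → z ≡ z″ [mod i ]
  mod-trans {z} {z′} {z″} {i} (by c h) (by c′ h′) = by (c′ + c) (trans h (trans (+-congʳ h′)
    (solve 4 (λ z q c d → (z :+ q :* c) :+ q :* d := z :+ q :* (c :+ d)) refl z″ (π ^ i) c′ c)))

  mod-0 : ∀ {z z′} → z ≡ z′ [mod 0 ]
  mod-0 {z} {z′} = by (- z′ + z) (begin
    z                             ≈⟨ +-identityˡ z ⟨
    0# + z                        ≈⟨ +-congʳ (-‿inverseʳ z′) ⟨
    (z′ + - z′) + z               ≈⟨ +-assoc _ _ _ ⟩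
    z′ + (- z′ + z)               ≈⟨ +-congˡ (*-identityˡ _) ⟨
    z′ + 1# * (- z′ + z)          ∎)

  mod-weaken : ∀ {z z′ i} → z ≡ z′ [mod ℕ.suc i ] → z ≡ z′ [mod i ]
  mod-weaken {z} {z′} {i} (by c h) = by (π * c) (trans h
    (+-congˡ (solve 3 (λ x q c → (x :* q) :* c := q :* (x :* c)) refl π (π ^ i) c)))

  mod-affine : ∀ a b {z z′ i} → z ≡ z′ [mod i ] → a * z + b ≡ a * z′ + b [mod i ]
  mod-affine a b {z} {z′} {i} (by c h) = by (a * c) (trans (+-congʳ (*-congˡ h))
    (solve 5 (λ a b z q c → a :* (z :+ q :* c) :+ b := (a :* z :+ b) :+ q :* (a :* c)) refl a b z′ (π ^ i) c))

  -- Adding pⁱc keeps the first i digits. The induction uses πc one level lower, and splitting off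
  -- one more digit turns it into c.
  quo-mod : ∀ i {z z′} c → z ≈ z′ + π ^ i * c → quo i z ≈ quo i z′ + c
  quo-mod ℕ.zero    c h = trans h (+-congˡ (*-identityˡ c))
  quo-mod (ℕ.suc i) {z} {z′} c h = proj₂ (expansion-shift c (quo-mod i (π * c) (trans h
    (+-congˡ (solve 3 (λ x q c → (x :* q) :* c := q :* (x :* c)) refl π (π ^ i) c)))))

  dig-mod : ∀ i {z z′} → z ≡ z′ [mod ℕ.suc i ] → dig i z ≡ dig i z′
  dig-mod i (by c h) = proj₁ (expansion-shift c (quo-mod i (π * c) (trans h
    (+-congˡ (solve 3 (λ x q c → (x :* q) :* c := q :* (x :* c)) refl π (π ^ i) c)))))

  quo-cong : ∀ i {z z′} → z ≈ z′ → quo i z ≈ quo i z′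
  quo-cong i {z} {z′} h = trans (quo-mod i 0# (trans h (sym (trans (+-congˡ (zeroʳ _)) (+-identityʳ _))))) (+-identityʳ _)

  rest-cong : ∀ {z z′} → z ≈ z′ → rest z ≈ rest z′
  rest-cong = quo-cong 1

  dig-cong : ∀ i {z z′} → z ≈ z′ → dig i z ≡ dig i z′
  dig-cong i h = dig-mod i (mod-refl h)

  quo-0 : ∀ i → quo i 0# ≈ 0#
  quo-0 ℕ.zero    = refl
  quo-0 (ℕ.suc i) = trans (rest-cong (quo-0 i)) (proj₂ (expansion-small (ℕP.<-trans ℕ.z<s p>1)))

  dig-0 : ∀ i → dig i 0# ≡ 0
  dig-0 i = ≡.trans (dig-cong 0 (quo-0 i)) (proj₁ (expansion-small (ℕP.<-trans ℕ.z<s p>1)))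

  -- The expansion of pʳz is that of z behind r zeros.
  quo-shift : ∀ r i z → quo (i ℕ.+ r) (π ^ r * z) ≈ quo i z
  quo-shift r ℕ.zero    z = trans (quo-mod r z (sym (+-identityˡ _))) (trans (+-congʳ (quo-0 r)) (+-identityˡ z))
  quo-shift r (ℕ.suc i) z = rest-cong (quo-shift r i z)

  dig-shift : ∀ r i z → dig (i ℕ.+ r) (π ^ r * z) ≡ dig i z
  dig-shift r i z = dig-cong 0 (quo-shift r i z)

-- p-adic coordinates on N₀.

-- Subgroups N 0 ⊃ N 1 ⊃ … such that N i / N (i + 1) has the representatives ξ i d, 0 ≤ d < p.
record Tower (p : ℕ) (𝐊 : LocalField) (P : PadicField p 𝐊) (G : Grp) (N : ℕ → ∣ G ∣ᵍ → Set) : Set where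
  open LocalField 𝐊
  open Valuation p 𝐊 P
  open Group G
  field
    N-ε        : ∀ i → N i ε
    N-∙        : ∀ {i g h} → N i g → N i h → N i (g ∙ h)
    N-⁻¹       : ∀ {i g} → N i g → N i (g ⁻¹)
    N-respects : ∀ {i g h} → g ≈ h → N i g → N i h
    N-decrease : ∀ {i g} → N (ℕ.suc i) g → N i g
    ξ          : ℕ → O.Carrier → Carrier
    ξ-cong     : ∀ i {c d} → c O.≈ d → ξ i c ≈ ξ i d
    ξ-+        : ∀ i c d → ξ i (c O.+ d) ≈ ξ i c ∙ ξ i d
    ξ∈N        : ∀ i c → N i (ξ i c)
    ξπ∈N       : ∀ i c → N (ℕ.suc i) (ξ i (π O.* c))
    ξ∈N⇒π∣     : ∀ i c → N (ℕ.suc i) (ξ i c) → ∃[ b ] c O.≈ π O.* b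
    cover      : ∀ {i g} → N i g → ∃[ d ] N (ℕ.suc i) (ξ i d ⁻¹ ∙ g)

module TowerCoordinates (p : ℕ) (𝐊 : LocalField) (P : PadicField p 𝐊) (G : Grp) (N : ℕ → ∣ G ∣ᵍ → Set)
  (tower : Tower p 𝐊 P G N) where
  open LocalField 𝐊
  open Valuation p 𝐊 P
  open Expansions p 𝐊 P
  open Group G
  open Tower tower
  open Conjugation G
  open GroupSolver G
  open SetoidReasoning setoid

  ξ-0 : ∀ i → ξ i O.0# ≈ ε
  ξ-0 i = trans (solve 1 (λ a → a ⊜ (a ⊙ a) ⊙ a ⊖) refl (ξ i O.0#))
    (trans (∙-congʳ (trans (sym (ξ-+ i O.0# O.0#)) (ξ-cong i (O.+-identityˡ O.0#)))) (inverseʳ _))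

  N-decrease-to-0 : ∀ i {g} → N i g → N 0 g
  N-decrease-to-0 ℕ.zero    n = n
  N-decrease-to-0 (ℕ.suc i) n = N-decrease-to-0 i (N-decrease n)

  elt : ℕ → O.Carrier → Carrier
  elt ℕ.zero    z = ε
  elt (ℕ.suc i) z = elt i z ∙ ξ i (nat (dig i z))

  -- The product of the ξ j (d j), z = Σ d j pʲ, with the factors for j ≥ i collected in ξ i.
  F : ℕ → O.Carrier → Carrier
  F i z = elt i z ∙ ξ i (quo i z)

  elt-mod : ∀ i {z z′} → z ≡ z′ [mod i ] → elt i z ≈ elt i z′
  elt-mod ℕ.zero    h = refl
  elt-mod (ℕ.suc i) h = ∙-cong (elt-mod i (mod-weaken h)) (reflexive (≡.cong (λ d → ξ i (nat d)) (dig-mod i h)))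

  -- The first i digits agree and the remainders differ by c, so only the additive last factor
  -- changes.
  F-mod : ∀ i {z z′} c → z O.≈ z′ O.+ π ^ i O.* c → F i z ≈ F i z′ ∙ ξ i c
  F-mod i {z} {z′} c h = trans (∙-cong (elt-mod i (by c h)) (trans (ξ-cong i (quo-mod i c h)) (ξ-+ i _ c))) (sym (assoc _ _ _))

  F-cong : ∀ i {z z′} → z O.≈ z′ → F i z ≈ F i z′
  F-cong i h = ∙-cong (elt-mod i (mod-refl h)) (ξ-cong i (quo-cong i h))

  elt∈N : ∀ i z → N 0 (elt i z)
  elt∈N ℕ.zero    z = N-ε 0
  elt∈N (ℕ.suc i) z = N-∙ (elt∈N i z) (N-decrease-to-0 i (ξ∈N i _))

  F∈N : ∀ i z → N 0 (F i z)
  F∈N i z = N-∙ (elt∈N i z) (N-decrease-to-0 i (ξ∈N i _))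

  F-mod-N : ∀ i {z z′} → z ≡ z′ [mod i ] → N i (F i z ⁻¹ ∙ F i z′)
  F-mod-N i {z} {z′} h with by c e ← mod-sym h = N-respects
    (trans (solve 2 (λ a c → c ⊜ a ⊖ ⊙ (a ⊙ c)) refl (F i z) (ξ i c)) (∙-congˡ (sym (F-mod i c e))))
    (ξ∈N i c)

  F-suc : ∀ i z → F i z ≈ elt (ℕ.suc i) z ∙ ξ i (π O.* quo (ℕ.suc i) z)
  F-suc i z = trans (∙-congˡ (trans (ξ-cong i (quo-step i z)) (ξ-+ i _ _))) (sym (assoc _ _ _))

  F-suc-N : ∀ i z → N (ℕ.suc i) (F (ℕ.suc i) z ⁻¹ ∙ F i z)
  F-suc-N i z = N-respects
    (trans (solve 3 (λ a b c → b ⊖ ⊙ c ⊜ (a ⊙ b) ⊖ ⊙ (a ⊙ c)) refl (elt (ℕ.suc i) z) (ξ (ℕ.suc i) (quo (ℕ.suc i) z)) _)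
      (∙-congˡ (sym (F-suc i z))))
    (N-∙ (N-⁻¹ (ξ∈N (ℕ.suc i) _)) (ξπ∈N i _))

  -- A coordinate modulo pⁱ leaves the error F i z⁻¹ ∙ n in N i; `cover` represents it by some ξ i
  -- d, and pⁱd is added to z.
  F-surjective : ∀ i {n} → N 0 n → ∃[ z ] N i (F i z ⁻¹ ∙ n)
  F-surjective ℕ.zero    n∈ = O.0# , N-∙ (N-⁻¹ (F∈N 0 O.0#)) n∈
  F-surjective (ℕ.suc i) {n} n∈ with z , h ← F-surjective i n∈ with d , h′ ← cover h =
    z O.+ π ^ i O.* d , N-respects
      (trans (∙-congʳ (∙-congˡ (F-mod i d O.refl)))
        (solve 4 (λ a b c n → (a ⊖ ⊙ (b ⊙ c)) ⊙ (c ⊖ ⊙ (b ⊖ ⊙ n)) ⊜ a ⊖ ⊙ n) refl _ (F i z) (ξ i d) n))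
      (N-∙ (F-suc-N i (z O.+ π ^ i O.* d)) h′)

  -- Modulo N (i + 1) the elements F (i + 1) may be replaced by F i. There the difference of two
  -- numbers congruent modulo pⁱ is ξ i c, and ξ i c ∈ N (i + 1) forces π to divide c.
  F-injective : ∀ i {z z′} → N i (F i z ⁻¹ ∙ F i z′) → z′ ≡ z [mod i ]
  F-injective ℕ.zero h = mod-0
  F-injective (ℕ.suc i) {z} {z′} h = refine (F-injective i (N-decrease h′))
    where
    h′ : N (ℕ.suc i) (F i z ⁻¹ ∙ F i z′)
    h′ = N-respects (solve 4 (λ a b c d → (a ⊖ ⊙ c) ⊖ ⊙ ((a ⊖ ⊙ b) ⊙ (b ⊖ ⊙ d)) ⊜ c ⊖ ⊙ d) refl
           (F (ℕ.suc i) z) (F (ℕ.suc i) z′) (F i z) (F i z′))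
           (N-∙ (N-⁻¹ (F-suc-N i z)) (N-∙ h (F-suc-N i z′)))
    refine : z′ ≡ z [mod i ] → z′ ≡ z [mod ℕ.suc i ]
    refine (by c e) with b , c≈ ← ξ∈N⇒π∣ i c (N-respects
        (trans (∙-congˡ (F-mod i c e)) (solve 2 (λ a c → a ⊖ ⊙ (a ⊙ c) ⊜ c) refl (F i z) (ξ i c))) h′) =
      by b (O.trans e (O.+-congˡ (O.trans (O.*-congˡ c≈)
        (O.trans (O.sym (O.*-assoc _ _ _)) (O.*-congʳ (O.*-comm _ _))))))

  record Scales (s : Carrier) (a : O.Carrier) : Set where
    constructor mkScales
    field
      scale : ∀ i c → conj G s (ξ i c) ≈ ξ i (a O.* c)
  open Scales

  scales-ε : Scales ε O.1#
  scales-ε = mkScales λ i c → trans (conj-by-ε _) (ξ-cong i (O.sym (O.*-identityˡ c)))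

  elt-conj∈N : ∀ {s a} → Scales s a → ∀ i z → N 0 (conj G s (elt i z))
  elt-conj∈N σ ℕ.zero    z = N-respects (sym (conj-identity _)) (N-ε 0)
  elt-conj∈N σ (ℕ.suc i) z = N-respects (trans (∙-congˡ (sym (scale σ i _))) (sym (conj-∙ _ _ _)))
    (N-∙ (elt-conj∈N σ i z) (N-decrease-to-0 i (ξ∈N i _)))

  F-conj∈N : ∀ {s a} → Scales s a → ∀ i z → N 0 (conj G s (F i z))
  F-conj∈N σ i z = N-respects (trans (∙-congˡ (sym (scale σ i _))) (sym (conj-∙ _ _ _)))
    (N-∙ (elt-conj∈N σ i z) (N-decrease-to-0 i (ξ∈N i _)))

  -- The element taking F i z to F i (a z + b), if s scales by a.
  affine : ℕ → Carrier → O.Carrier → O.Carrier → O.Carrier → Carrier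
  affine i s a b z = (F i (a O.* z O.+ b) ∙ s) ∙ F i z ⁻¹

  -- Adding pⁱc to z multiplies F i z by ξ i c and F i (az + b) by ξ i (ac) = s ξ i c s⁻¹; the two
  -- cancel across s.
  affine-mod : ∀ i {s a} b → Scales s a → ∀ {z z′} → z ≡ z′ [mod i ] → affine i s a b z ≈ affine i s a b z′
  affine-mod i {s} {a} b σ {z} {z′} (by c e) = begin
    (F i (a O.* z O.+ b) ∙ s) ∙ F i z ⁻¹
      ≈⟨ ∙-cong (∙-congʳ (F-mod i (a O.* c) (_≡_[mod_].equality (mod-affine a b {i = i} (by c e))))) (⁻¹-cong (F-mod i c e)) ⟩
    ((F i (a O.* z′ O.+ b) ∙ ξ i (a O.* c)) ∙ s) ∙ (F i z′ ∙ ξ i c) ⁻¹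
      ≈⟨ ∙-congʳ (∙-congʳ (∙-congˡ (scale σ i c))) ⟨
    ((F i (a O.* z′ O.+ b) ∙ conj G s (ξ i c)) ∙ s) ∙ (F i z′ ∙ ξ i c) ⁻¹
      ≈⟨ solve 4 (λ f s c g → ((f ⊙ ((s ⊙ c) ⊙ s ⊖)) ⊙ s) ⊙ (g ⊙ c) ⊖ ⊜ (f ⊙ s) ⊙ g ⊖) refl _ s (ξ i c) (F i z′) ⟩
    (F i (a O.* z′ O.+ b) ∙ s) ∙ F i z′ ⁻¹ ∎

  affine∈N : ∀ i b z → N 0 (affine i ε O.1# b z)
  affine∈N i b z = N-∙ (N-∙ (F∈N i _) (N-ε 0)) (N-⁻¹ (F∈N i z))

  affine∈Ns : ∀ i {s a} b → Scales s a → ∀ z → ∃[ n ] N 0 n × affine i s a b z ≈ n ∙ s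
  affine∈Ns i {s} {a} b σ z = F i (a O.* z O.+ b) ∙ conj G s (F i z) ⁻¹ ,
    N-∙ (F∈N i _) (N-⁻¹ (F-conj∈N σ i z)) ,
    solve 3 (λ f s g → (f ⊙ s) ⊙ g ⊖ ⊜ (f ⊙ ((s ⊙ g) ⊙ s ⊖) ⊖) ⊙ s) refl _ s (F i z)

  affine-compose : ∀ i {s a s′ a′} b b′ → Scales s a → Scales s′ a′ → ∀ z {z′} → z′ ≡ a O.* z O.+ b [mod i ] →
                   affine i s′ a′ b′ z′ ∙ affine i s a b z ≈ affine i (s′ ∙ s) (a′ O.* a) (a′ O.* b O.+ b′) z
  affine-compose i {s} {a} {s′} {a′} b b′ σ σ′ z {z′} h = begin
    affine i s′ a′ b′ z′ ∙ affine i s a b z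
      ≈⟨ ∙-congʳ (affine-mod i b′ σ′ h) ⟩
    affine i s′ a′ b′ (a O.* z O.+ b) ∙ affine i s a b z
      ≈⟨ solve 5 (λ f s g t h → ((f ⊙ s) ⊙ g ⊖) ⊙ ((g ⊙ t) ⊙ h ⊖) ⊜ (f ⊙ (s ⊙ t)) ⊙ h ⊖) refl _ s′ (F i (a O.* z O.+ b)) s (F i z) ⟩
    (F i (a′ O.* (a O.* z O.+ b) O.+ b′) ∙ (s′ ∙ s)) ∙ F i z ⁻¹
      ≈⟨ ∙-congʳ (∙-congʳ (F-cong i (ring a′ a z b b′))) ⟩
    affine i (s′ ∙ s) (a′ O.* a) (a′ O.* b O.+ b′) z ∎
    where
    ring : ∀ x a z b c → x O.* (a O.* z O.+ b) O.+ c O.≈ (x O.* a) O.* z O.+ (x O.* b O.+ c)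
    ring = S.solve 5 (λ x a z b c → x S.:* (a S.:* z S.:+ b) S.:+ c S.:= (x S.:* a) S.:* z S.:+ (x S.:* b S.:+ c)) O.refl
      where module S = SemiringSolver O.commutativeSemiring

  affine-apply : ∀ i s a b z → affine i s a b z ∙ F i z ≈ F i (a O.* z O.+ b) ∙ s
  affine-apply i s a b z = solve 3 (λ f s g → ((f ⊙ s) ⊙ g ⊖) ⊙ g ⊜ f ⊙ s) refl _ s (F i z)

  module Shifted (φ : Carrier) (r : ℕ) (shift : ∀ i c → conj G φ (ξ i c) ≈ ξ (i ℕ.+ r) c) where

    elt-multiple : ∀ i z → elt i (π ^ i O.* z) ≈ ε
    elt-multiple i z = trans (elt-mod i (by z (O.sym (O.+-identityˡ _)))) (elt-0 i)
      where
      elt-0 : ∀ i → elt i O.0# ≈ ε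
      elt-0 ℕ.zero    = refl
      elt-0 (ℕ.suc i) = trans (∙-cong (elt-0 i) (trans (reflexive (≡.cong (λ d → ξ i (nat d)) (dig-0 i))) (ξ-0 i))) (identityˡ ε)

    elt-shift : ∀ i z → conj G φ (elt i z) ≈ elt (i ℕ.+ r) (π ^ r O.* z)
    elt-shift ℕ.zero    z = trans (conj-identity φ) (sym (elt-multiple r z))
    elt-shift (ℕ.suc i) z = trans (conj-∙ φ _ _) (∙-cong (elt-shift i z)
      (trans (shift i _) (reflexive (≡.cong (λ d → ξ (i ℕ.+ r) (nat d)) (≡.sym (dig-shift r i z))))))

    F-shift : ∀ i z → conj G φ (F i z) ≈ F (i ℕ.+ r) (π ^ r O.* z)
    F-shift i z = trans (conj-∙ φ _ _) (∙-cong (elt-shift i z)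
      (trans (shift i _) (ξ-cong (i ℕ.+ r) (O.sym (quo-shift r i z)))))

    affine-shift : ∀ i {s a} b z → s ∙ φ ≈ φ ∙ s →
                   affine (i ℕ.+ r) s a (π ^ r O.* b) (π ^ r O.* z) ∙ φ ≈ φ ∙ affine i s a b z
    affine-shift i {s} {a} b z commute = begin
      ((F (i ℕ.+ r) (a O.* (π ^ r O.* z) O.+ π ^ r O.* b) ∙ s) ∙ F (i ℕ.+ r) (π ^ r O.* z) ⁻¹) ∙ φ
        ≈⟨ ∙-congʳ (∙-cong (∙-congʳ (trans (F-cong (i ℕ.+ r) (ring a (π ^ r) z b)) (sym (F-shift i _)))) (⁻¹-cong (sym (F-shift i z)))) ⟩
      ((conj G φ (F i (a O.* z O.+ b)) ∙ s) ∙ conj G φ (F i z) ⁻¹) ∙ φ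
        ≈⟨ solve 4 (λ φ f s g → ((((φ ⊙ f) ⊙ φ ⊖) ⊙ s) ⊙ ((φ ⊙ g) ⊙ φ ⊖) ⊖) ⊙ φ ⊜ (φ ⊙ f) ⊙ (φ ⊖ ⊙ (s ⊙ φ)) ⊙ g ⊖) refl φ _ s (F i z) ⟩
      ((φ ∙ F i (a O.* z O.+ b)) ∙ (φ ⁻¹ ∙ (s ∙ φ))) ∙ F i z ⁻¹
        ≈⟨ ∙-congʳ (∙-congˡ (∙-congˡ commute)) ⟩
      ((φ ∙ F i (a O.* z O.+ b)) ∙ (φ ⁻¹ ∙ (φ ∙ s))) ∙ F i z ⁻¹
        ≈⟨ solve 4 (λ φ f s g → ((φ ⊙ f) ⊙ (φ ⊖ ⊙ (φ ⊙ s))) ⊙ g ⊖ ⊜ φ ⊙ ((f ⊙ s) ⊙ g ⊖)) refl φ _ s (F i z) ⟩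
      φ ∙ ((F i (a O.* z O.+ b) ∙ s) ∙ F i z ⁻¹) ∎
      where
      ring : ∀ a q z b → a O.* (q O.* z) O.+ q O.* b O.≈ q O.* (a O.* z O.+ b)
      ring = S.solve 4 (λ a q z b → a S.:* (q S.:* z) S.:+ q S.:* b S.:= q S.:* (a S.:* z S.:+ b)) O.refl
        where module S = SemiringSolver O.commutativeSemiring

-- The half tree of the cosets z + pⁱℤ_p.

module HalfTreeCoordinates (p : ℕ) (𝐊 : LocalField) (P : PadicField p 𝐊) where
  open LocalField 𝐊
  open Valuation p 𝐊 P using (module O)
  open Expansions p 𝐊 P

  Position : Set
  Position = ℕ × O.Carrier

  infix 4 _≃_
  record _≃_ (x y : Position) : Set where
    constructor same
    field
      level : proj₁ x ≡ proj₁ y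
      close : proj₂ x ≡ proj₂ y [mod proj₁ x ]

  ≃-refl : ∀ {x} → x ≃ x
  ≃-refl = same ≡.refl (mod-refl O.refl)

  ≃-sym : ∀ {x y} → x ≃ y → y ≃ x
  ≃-sym (same ≡.refl h) = same ≡.refl (mod-sym h)

  ≃-trans : ∀ {x y z} → x ≃ y → y ≃ z → x ≃ z
  ≃-trans (same ≡.refl h) (same ≡.refl k) = same ≡.refl (mod-trans h k)

  -- The vertices (and the edges) of the half trees, as cosets z + pⁱℤ_p.
  positions : Setoid 0ℓ 0ℓ
  positions = record
    { Carrier       = Position
    ; _≈_           = _≃_
    ; isEquivalence = record { refl = ≃-refl ; sym = ≃-sym ; trans = ≃-trans }
    }

  record Child (x y : Position) : Set where
    constructor child
    field
      level : proj₁ y ≡ ℕ.suc (proj₁ x)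
      close : proj₂ y ≡ proj₂ x [mod proj₁ x ]

  Child-respects : ∀ {x x′ y y′} → x ≃ x′ → y ≃ y′ → Child x y → Child x′ y′
  Child-respects (same ≡.refl h) (same ≡.refl k) (child ≡.refl c) =
    child ≡.refl (mod-trans (mod-weaken (mod-sym k)) (mod-trans c h))

  -- An edge carries the position of its end farther from the origin, and its other end is the
  -- parent of that position. At level 0 there is no parent: this is the loose end.
  Incident : Position → Position → Set
  Incident x e = x ≃ e ⊎ Child x e

  Incident-respects : ∀ {x x′ e e′} → x ≃ x′ → e ≃ e′ → Incident x e → Incident x′ e′
  Incident-respects h k (inj₁ q) = inj₁ (≃-trans (≃-sym h) (≃-trans q k))
  Incident-respects h k (inj₂ q) = inj₂ (Child-respects h k q)

  record Coordinates (H : HalfTree) : Set where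
    open HalfTree H
    field
      onVertices : Inverse vertices positions
      onEdges    : Inverse edges positions

    posᵛ : Vertex → Position
    posᵛ = Inverse.to onVertices

    posᵉ : Edge → Position
    posᵉ = Inverse.to onEdges

    field
      incidence    : ∀ v e → (v ∈ᵉ e) ⇔ Incident (posᵛ v) (posᵉ e)
      origin-level : proj₁ (posᵛ origin) ≡ 0

  module _ {H : HalfTree} (𝐜 : Coordinates H) where
    open HalfTree H
    open Coordinates 𝐜

    level : Vertex → ℕ
    level v = proj₁ (posᵛ v)

    vertexAt : Position → Vertex
    vertexAt = Inverse.from onVertices

    posᵛ-vertexAt : ∀ x → posᵛ (vertexAt x) ≃ x
    posᵛ-vertexAt = Inverse.strictlyInverseˡ onVertices

    posᵉ-edgeAt : ∀ x → posᵉ (Inverse.from onEdges x) ≃ x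
    posᵉ-edgeAt = Inverse.strictlyInverseˡ onEdges

    posᵛ-cong : ∀ {v w} → v ≈ᵛ w → posᵛ v ≃ posᵛ w
    posᵛ-cong = Inverse.to-cong onVertices

    posᵛ-injective : ∀ {v w} → posᵛ v ≃ posᵛ w → v ≈ᵛ w
    posᵛ-injective {v} {w} h = trans (sym (Inverse.strictlyInverseʳ onVertices v))
      (trans (Inverse.from-cong onVertices h) (Inverse.strictlyInverseʳ onVertices w))
      where open Setoid vertices using (sym; trans)

    Adjacent-sym : ∀ {v w} → Adjacent v w → Adjacent w v
    Adjacent-sym {v} {w} (v≉w , e , ends) = (λ w≈v → v≉w (sym w≈v)) , e , λ u →
      mk⇔ (⊎-swap ∘ Equivalence.to (ends u)) (Equivalence.from (ends u) ∘ ⊎-swap)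
      where open Setoid vertices using (sym)

    private
      child-unequal : ∀ {v w} → Child (posᵛ v) (posᵛ w) → ¬ v ≈ᵛ w
      child-unequal {v} {w} (child l _) v≈w =
        ℕP.1+n≢n (≡.sym (≡.trans (_≃_.level (posᵛ-cong v≈w)) l))

      twins : ∀ {x y e} → Child x e → Child y e → x ≃ y
      twins (child ≡.refl h) (child ≡.refl k) = same ≡.refl (mod-trans (mod-sym h) k)

      one-below : ∀ {x y e} → x ≃ e → Child y e → Child y x
      one-below h c = Child-respects ≃-refl (≃-sym h) c

    Child⇒Adjacent : ∀ {v w} → Child (posᵛ v) (posᵛ w) → Adjacent v w
    Child⇒Adjacent {v} {w} c = child-unequal c , e , λ u → mk⇔ (to u) (from u)
      where
      e = Inverse.from onEdges (posᵛ w)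
      e-pos : posᵉ e ≃ posᵛ w
      e-pos = posᵉ-edgeAt (posᵛ w)
      ends : ∀ u → Incident (posᵛ u) (posᵛ w) → u ≈ᵛ v ⊎ u ≈ᵛ w
      ends u (inj₁ h) = inj₂ (posᵛ-injective h)
      ends u (inj₂ d) = inj₁ (posᵛ-injective (twins d c))
      to : ∀ u → u ∈ᵉ e → u ≈ᵛ v ⊎ u ≈ᵛ w
      to u i = ends u (Incident-respects ≃-refl e-pos (Equivalence.to (incidence u e) i))
      from : ∀ u → u ≈ᵛ v ⊎ u ≈ᵛ w → u ∈ᵉ e
      from u (inj₁ h) = Equivalence.from (incidence u e)
        (inj₂ (Child-respects (≃-sym (posᵛ-cong h)) (≃-sym e-pos) c))
      from u (inj₂ h) = Equivalence.from (incidence u e) (inj₁ (≃-trans (posᵛ-cong h) (≃-sym e-pos)))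

    -- An edge contains only the vertex at its own position and the unique parent, so two distinct
    -- vertices on it are these two.
    Adjacent⇒Child : ∀ {v w} → Adjacent v w → Child (posᵛ v) (posᵛ w) ⊎ Child (posᵛ w) (posᵛ v)
    Adjacent⇒Child {v} {w} (v≉w , e , ends) =
      cases (Equivalence.to (incidence v e) (Equivalence.from (ends v) (inj₁ (Setoid.refl vertices))))
            (Equivalence.to (incidence w e) (Equivalence.from (ends w) (inj₂ (Setoid.refl vertices))))
      where
      cases : Incident (posᵛ v) (posᵉ e) → Incident (posᵛ w) (posᵉ e) →
              Child (posᵛ v) (posᵛ w) ⊎ Child (posᵛ w) (posᵛ v)
      cases (inj₁ h) (inj₁ k) = contradiction (posᵛ-injective (≃-trans h (≃-sym k))) v≉w
      cases (inj₁ h) (inj₂ k) = inj₂ (one-below h k)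
      cases (inj₂ h) (inj₁ k) = inj₁ (one-below k h)
      cases (inj₂ h) (inj₂ k) = contradiction (posᵛ-injective (twins h k)) v≉w

    Adjacent⇒level≤ : ∀ {v w} → Adjacent v w → level v ℕ.≤ ℕ.suc (level w)
    Adjacent⇒level≤ {v} {w} a with Adjacent⇒Child a
    ... | inj₁ (child l _) = ℕP.m≤n⇒m≤1+n (≡.subst (level v ℕ.≤_) (≡.sym l) (ℕP.n≤1+n (level v)))
    ... | inj₂ (child l _) = ℕP.≤-reflexive l

    -- Levels change by one along an edge, so the length of a path to the origin bounds the levels
    -- of all vertices it passes.
    On⇒level≤ : ∀ {z v w n} {π : Path v w n} → z On π → level z ℕ.≤ level w ℕ.+ n
    path⇒level≤ : ∀ {v w n} → Path v w n → level v ℕ.≤ level w ℕ.+ n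
    path⇒level≤ {w = w} (stop h) = ℕP.≤-reflexive (≡.trans (_≃_.level (posᵛ-cong h)) (≡.sym (ℕP.+-identityʳ (level w))))
    path⇒level≤ {v} {w} (step {n = n} a π) = ℕP.≤-trans (Adjacent⇒level≤ a)
      (ℕP.≤-trans (ℕ.s≤s (path⇒level≤ π)) (ℕP.≤-reflexive (≡.sym (ℕP.+-suc (level w) n))))
    On⇒level≤ {π = stop v≈w} (here-stop h) = ℕP.≤-trans (ℕP.≤-reflexive (_≃_.level (posᵛ-cong h))) (path⇒level≤ (stop v≈w))
    On⇒level≤ {π = step a π} (here-step h) = ℕP.≤-trans (ℕP.≤-reflexive (_≃_.level (posᵛ-cong h))) (path⇒level≤ (step a π))
    On⇒level≤ {w = w} {π = step {n = n} a π} (later o) = ℕP.≤-trans (On⇒level≤ o) (ℕP.+-monoʳ-≤ (level w) (ℕP.n≤1+n n))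

    -- Keeping the number and lowering the level leads to the origin, where all numbers are
    -- congruent.
    descend : ∀ i v → level v ≡ i → Path v origin i
    descend ℕ.zero    v l = stop (posᵛ-injective (same (≡.trans l (≡.sym origin-level))
      (≡.subst (λ i → proj₂ (posᵛ v) ≡ proj₂ (posᵛ origin) [mod i ]) (≡.sym l) mod-0)))
    descend (ℕ.suc i) v l = step (Adjacent-sym (Child⇒Adjacent c)) (descend i u (_≃_.level (posᵛ-vertexAt _)))
      where
      u = vertexAt (i , proj₂ (posᵛ v))
      c : Child (posᵛ u) (posᵛ v)
      c = Child-respects (≃-sym (posᵛ-vertexAt (i , proj₂ (posᵛ v)))) ≃-refl (child l (mod-refl O.refl))

    source-On : ∀ {v w n} (π : Path v w n) → v On π
    source-On (stop _)   = here-stop (Setoid.refl vertices)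
    source-On (step _ _) = here-step (Setoid.refl vertices)

    Child⇒∈]_[ : ∀ v {w} → Child (posᵛ v) (posᵛ w) → w ∈] v [
    Child⇒∈]_[ v {w} c = Child⇒Adjacent c , _ , π , geodesic , later (source-On (descend (level v) v ≡.refl))
      where
      π : Path w origin (ℕ.suc (level v))
      π = step (Adjacent-sym (Child⇒Adjacent c)) (descend (level v) v ≡.refl)
      geodesic : Geodesic π
      geodesic {m} ρ = ≡.subst (ℕ._≤ m) (Child.level c) (≡.subst (λ l → level w ℕ.≤ l ℕ.+ m) origin-level (path⇒level≤ ρ))

    -- If w were the parent of v, a geodesic from w to the origin would have length at most level w
    -- by `descend`, yet pass through v, whose level is larger.
    ∈]_[⇒Child : ∀ v {w} → w ∈] v [ → Child (posᵛ v) (posᵛ w)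
    ∈]_[⇒Child v {w} (a , n , π , geodesic , on) with Adjacent⇒Child a
    ... | inj₁ c = c
    ... | inj₂ (child l _) = contradiction
      (ℕP.≤-trans (≡.subst (λ o → level v ℕ.≤ o ℕ.+ n) origin-level (On⇒level≤ on)) (geodesic (descend (level w) w ≡.refl)))
      (ℕP.<⇒≱ (ℕP.≤-reflexive (≡.sym l)))

  isomorphism : ∀ {Y Z} → Coordinates Y → Coordinates Z → Y ≅ Z
  isomorphism {Y} {Z} 𝐜 𝐝 = record
    { onVertices = Compose.inverse (𝐜.onVertices) (Symmetry.inverse 𝐝.onVertices)
    ; onEdges    = Compose.inverse (𝐜.onEdges) (Symmetry.inverse 𝐝.onEdges)
    ; incidence  = λ v e → mk⇔
        (Equivalence.from (𝐝.incidence _ _) ∘ Incident-respects (≃-sym (posᵛ-vertexAt 𝐝 _)) (≃-sym (posᵉ-edgeAt 𝐝 _)) ∘ Equivalence.to (𝐜.incidence v e))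
        (Equivalence.from (𝐜.incidence v e) ∘ Incident-respects (posᵛ-vertexAt 𝐝 _) (posᵉ-edgeAt 𝐝 _) ∘ Equivalence.to (𝐝.incidence _ _))
    }
    where
    module 𝐜 = Coordinates 𝐜
    module 𝐝 = Coordinates 𝐝

-- Affine matrices and the coordinates on 𝔛₊.

module AffineMatrices (R : Ring) where
  open CommutativeRing R hiding (zero)
  open Matrices₂ R
  open Group (GL 2 R) using () renaming (_∙_ to _∙₂_; _≈_ to _≈₂_)
  private module G₂ = Group (GL 2 R)

  -- A acts on the projective line by t ↦ a t + b.
  record Affine₂ (A : ∣ GL 2 R ∣ᵍ) (a b : Carrier) : Set where
    constructor affine₂
    field
      entry₁₁ : val A zero zero ≈ a
      entry₁₂ : val A zero (suc zero) ≈ b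
      entry₂₁ : val A (suc zero) zero ≈ 0#
      entry₂₂ : val A (suc zero) (suc zero) ≈ 1#
  open Affine₂

  Affine₂-cong : ∀ {A a b a′ b′} → a ≈ a′ → b ≈ b′ → Affine₂ A a b → Affine₂ A a′ b′
  Affine₂-cong h k (affine₂ p q r s) = affine₂ (trans p h) (trans q k) r s

  Affine₂-unique : ∀ {A B a b} → Affine₂ A a b → Affine₂ B a b → A ≈₂ B
  Affine₂-unique p q = mk≈ᵘ λ where
    zero       zero       → trans (entry₁₁ p) (sym (entry₁₁ q))
    zero       (suc zero) → trans (entry₁₂ p) (sym (entry₁₂ q))
    (suc zero) zero       → trans (entry₂₁ p) (sym (entry₂₁ q))
    (suc zero) (suc zero) → trans (entry₂₂ p) (sym (entry₂₂ q))

  Affine₂-respects : ∀ {A B a b} → A ≈₂ B → Affine₂ A a b → Affine₂ B a b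
  Affine₂-respects (mk≈ᵘ e) (affine₂ p q r s) = affine₂
    (trans (sym (e zero zero)) p) (trans (sym (e zero (suc zero))) q)
    (trans (sym (e (suc zero) zero)) r) (trans (sym (e (suc zero) (suc zero))) s)

  private
    sum₂ : ∀ {x y x′ y′} → x ≈ x′ → y ≈ y′ → x + (y + 0#) ≈ x′ + y′
    sum₂ h k = +-cong h (trans (+-identityʳ _) k)

  Affine₂-∙ : ∀ {A B a b a′ b′} → Affine₂ A a b → Affine₂ B a′ b′ → Affine₂ (A ∙₂ B) (a * a′) (a * b′ + b)
  Affine₂-∙ (affine₂ p q r s) (affine₂ p′ q′ r′ s′) = affine₂
    (trans (sum₂ (*-cong p p′) (trans (*-congˡ r′) (zeroʳ _))) (+-identityʳ _))
    (sum₂ (*-cong p q′) (trans (*-cong q s′) (*-identityʳ _)))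
    (trans (sum₂ (trans (*-congʳ r) (zeroˡ _)) (trans (*-congˡ r′) (zeroʳ _))) (+-identityʳ _))
    (trans (sum₂ (trans (*-congʳ r) (zeroˡ _)) (trans (*-cong s s′) (*-identityʳ _))) (+-identityˡ _))

  upper-affine : ∀ u → Affine₂ (upper u) 1# u
  upper-affine u = affine₂ refl refl refl refl

  diag₁ : ∣ R ˣ ∣ᵍ → ∣ GL 2 R ∣ᵍ
  diag₁ a = diag a (Group.ε (R ˣ))

  diag₁-affine : ∀ a → Affine₂ (diag₁ a) (val a) 0#
  diag₁-affine a = affine₂ refl refl refl refl

  diag₁-isHom : IsGroupHom (R ˣ) (GL 2 R) diag₁
  diag₁-isHom = record
    { isMonoidHomomorphism = record
      { isMagmaHomomorphism = record
        { isRelHomomorphism = record { cong = λ {a} {b} (mk≈ᵘ h) →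
            Affine₂-unique {diag₁ a} {diag₁ b} (Affine₂-cong h refl (diag₁-affine a)) (diag₁-affine b) }
        ; homo = λ a b → Affine₂-unique {diag₁ (Group._∙_ (R ˣ) a b)} {diag₁ a ∙₂ diag₁ b} (diag₁-affine _)
            (Affine₂-cong refl (trans (+-identityʳ _) (zeroʳ _)) (Affine₂-∙ (diag₁-affine a) (diag₁-affine b)))
        }
      ; ε-homo = mk≈ᵘ λ where
          zero       zero       → refl
          zero       (suc zero) → refl
          (suc zero) zero       → refl
          (suc zero) (suc zero) → refl
      }
    ; ⁻¹-homo = λ _ → mk≈ᵘ (λ _ _ → refl)
    }

module TreeCoordinates (p : ℕ) (𝐊 : LocalField) (P : PadicField p 𝐊) where
  open LocalField 𝐊 renaming (K to ℚₚ)
  open Valuation p 𝐊 P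
  open Expansions p 𝐊 P
  open HalfTreeCoordinates p 𝐊 P
  open AffineMatrices ℚₚ
  private module 𝒪₂ = AffineMatrices 𝒪
  open Tree 𝐊 using (GL₂; φ; ν; γ; 𝔛⁰; 𝔳; 𝔢; 𝔛₊; _·ᵖ_)
  open Matrices₂ ℚₚ using (upper; homothety)
  open Group GL₂ using (_∙_; _≈_)
  open Setoid 𝔛⁰ using () renaming (_≈_ to _≈ᵗ_; refl to ≈ᵗ-refl; sym to ≈ᵗ-sym; trans to ≈ᵗ-trans)
  open Setoid (unorderedPairs 𝔛⁰) using () renaming (_≈_ to _≈ᵖ_; refl to ≈ᵖ-refl; sym to ≈ᵖ-sym; trans to ≈ᵖ-trans)
  private module G₂ = Group GL₂

  ι₂ : ∣ GL 2 𝒪 ∣ᵍ → ∣ GL₂ ∣ᵍ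
  ι₂ = mapGL {𝒪} {ℚₚ} ι ι-isHom

  ι₂-affine : ∀ {A a b} → 𝒪₂.Affine₂ A a b → Affine₂ (ι₂ A) (ι a) (ι b)
  ι₂-affine (𝒪₂.affine₂ p q r s) =
    affine₂ (ι.⟦⟧-cong p) (ι.⟦⟧-cong q) (K.trans (ι.⟦⟧-cong r) ι.0#-homo) (K.trans (ι.⟦⟧-cong s) ι.1#-homo)

  ≈⇒≈ᵗ : ∀ {g h} → g ≈ h → g ≈ᵗ h
  ≈⇒≈ᵗ {g} {h} e with sameCoset z k f ← ≈ᵗ-refl {g} = sameCoset z k (G₂.trans (G₂.sym e) f)

  -- h = gk for the matrix k ∈ GL₂(ℤ_p) with rows (a, c) and (0, 1); the scalar is 1.
  coset-intro : ∀ {g h x u} (a : ∣ 𝒪 ˣ ∣ᵍ) c → Affine₂ g x u → Affine₂ h (x K.* ι (val a)) (x K.* ι c K.+ u) → g ≈ᵗ h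
  coset-intro {g} {h} {x} {u} a c gᵃ hᵃ = sameCoset (Group.ε (ℚₚ ˣ)) k
    (Affine₂-unique hᵃ (Affine₂-∙ (Affine₂-respects (G₂.sym (G₂.trans (G₂.∙-congˡ homothety-1) (G₂.identityʳ g))) gᵃ) (ι₂-affine kᵃ)))
    where
    k = Group._∙_ (GL 2 𝒪) (Matrices₂.upper 𝒪 c) (𝒪₂.diag₁ a)
    kᵃ : 𝒪₂.Affine₂ k (val a) c
    kᵃ = 𝒪₂.Affine₂-cong (O.*-identityˡ _) (O.trans (O.+-congʳ (O.zeroʳ _)) (O.+-identityˡ c))
      (𝒪₂.Affine₂-∙ (𝒪₂.upper-affine c) (𝒪₂.diag₁-affine a))
    homothety-1 : homothety (Group.ε (ℚₚ ˣ)) ≈ G₂.ε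
    homothety-1 = GroupMorphisms.IsGroupHomomorphism.ε-homo diag₁-isHom

  -- If h = g z k with z ∈ ℚ_pˣ and k ∈ GL₂(ℤ_p), then k is upper triangular and z = k₂₂⁻¹ is integral.
  coset-elim : ∀ {g h x u y v} → Affine₂ g x u → Affine₂ h y v → g ≈ᵗ h →
               ∃[ a ] ∃[ c ] y K.≈ x K.* ι a × v K.≈ x K.* ι c K.+ u
  coset-elim {g} {h} {x} {u} {y} {v} (affine₂ g₁ g₂ g₃ g₄) (affine₂ h₁ h₂ h₃ h₄) (sameCoset z k (mk≈ᵘ e)) =
    k′₂₂ O.* k₁₁ , k′₂₂ O.* k₁₂ , y≈ , v≈
    where
    open SetoidReasoning K.setoid
    open SemiringSolver K.commutativeSemiring using (solve; _:=_; _:*_; _:+_; con)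
    k₁₁ = val k zero zero
    k₁₂ = val k zero (suc zero)
    k₂₁ = val k (suc zero) zero
    k₂₂ = val k (suc zero) (suc zero)
    k′₁₂ = inv k zero (suc zero)
    k′₂₂ = inv k (suc zero) (suc zero)
    z₀ = val z

    gz₁₁ : val (g ∙ homothety z) zero zero K.≈ x K.* z₀
    gz₁₁ = K.trans (K.+-cong (K.*-congʳ g₁) (K.trans (K.+-congʳ (K.zeroʳ _)) (K.+-identityˡ _))) (K.+-identityʳ _)
    gz₁₂ : val (g ∙ homothety z) zero (suc zero) K.≈ u K.* z₀
    gz₁₂ = K.trans (K.+-cong (K.zeroʳ _) (K.trans (K.+-congʳ (K.*-congʳ g₂)) (K.+-identityʳ _))) (K.+-identityˡ _)
    gz₂₁ : val (g ∙ homothety z) (suc zero) zero K.≈ K.0#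
    gz₂₁ = K.trans (K.+-cong (K.trans (K.*-congʳ g₃) (K.zeroˡ _)) (K.trans (K.+-congʳ (K.zeroʳ _)) (K.+-identityˡ _))) (K.+-identityʳ _)
    gz₂₂ : val (g ∙ homothety z) (suc zero) (suc zero) K.≈ z₀
    gz₂₂ = K.trans (K.+-cong (K.zeroʳ _) (K.trans (K.+-congʳ (K.trans (K.*-congʳ g₄) (K.*-identityˡ _))) (K.+-identityʳ _))) (K.+-identityˡ _)

    row : ∀ {a b c d a′ b′} → a K.≈ a′ → b K.≈ b′ → a K.* c K.+ (b K.* d K.+ K.0#) K.≈ a′ K.* c K.+ b′ K.* d
    row h h′ = K.+-cong (K.*-congʳ h) (K.trans (K.+-identityʳ _) (K.*-congʳ h′))

    row₂₁ : z₀ K.* ι k₂₁ K.≈ K.0#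
    row₂₁ = K.trans (K.sym (K.trans (e (suc zero) zero) (K.trans (row gz₂₁ gz₂₂) (K.trans (K.+-congʳ (K.zeroˡ _)) (K.+-identityˡ _))))) h₃

    row₂₂ : z₀ K.* ι k₂₂ K.≈ K.1#
    row₂₂ = K.trans (K.sym (K.trans (e (suc zero) (suc zero)) (K.trans (row gz₂₁ gz₂₂) (K.trans (K.+-congʳ (K.zeroˡ _)) (K.+-identityˡ _))))) h₄

    k₂₁≈0 : k₂₁ O.≈ O.0#
    k₂₁≈0 = ι-injective (begin
      ι k₂₁                        ≈⟨ K.*-identityˡ _ ⟨
      K.1# K.* ι k₂₁               ≈⟨ K.*-congʳ (inv∙val z) ⟨
      (inv z K.* z₀) K.* ι k₂₁     ≈⟨ K.*-assoc _ _ _ ⟩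
      inv z K.* (z₀ K.* ι k₂₁)     ≈⟨ K.*-congˡ row₂₁ ⟩
      inv z K.* K.0#               ≈⟨ K.zeroʳ _ ⟩
      K.0#                         ≈⟨ ι.0#-homo ⟨
      ι O.0#                       ∎)

    k₂₂-unit : k₂₂ O.* k′₂₂ O.≈ O.1#
    k₂₂-unit = O.trans (O.sym (O.trans (O.+-cong (O.trans (O.*-congʳ k₂₁≈0) (O.zeroˡ _)) (O.+-identityʳ _)) (O.+-identityˡ _)))
      (val∙inv k (suc zero) (suc zero))

    z≈ : z₀ K.≈ ι k′₂₂
    z≈ = begin
      z₀                                  ≈⟨ K.*-identityʳ _ ⟨
      z₀ K.* K.1#                         ≈⟨ K.*-congˡ (K.trans (K.sym ι.1#-homo) (ι.⟦⟧-cong (O.sym k₂₂-unit))) ⟩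
      z₀ K.* ι (k₂₂ O.* k′₂₂)             ≈⟨ K.*-congˡ (ι.*-homo _ _) ⟩
      z₀ K.* (ι k₂₂ K.* ι k′₂₂)           ≈⟨ K.*-assoc _ _ _ ⟨
      (z₀ K.* ι k₂₂) K.* ι k′₂₂           ≈⟨ K.*-congʳ row₂₂ ⟩
      K.1# K.* ι k′₂₂                     ≈⟨ K.*-identityˡ _ ⟩
      ι k′₂₂                              ∎

    y≈ : y K.≈ x K.* ι (k′₂₂ O.* k₁₁)
    y≈ = begin
      y                                                 ≈⟨ h₁ ⟨
      val h zero zero                                   ≈⟨ e zero zero ⟩
      _                                                 ≈⟨ row gz₁₁ gz₁₂ ⟩
      (x K.* z₀) K.* ι k₁₁ K.+ (u K.* z₀) K.* ι k₂₁     ≈⟨ K.+-cong (K.*-assoc _ _ _) (K.trans (K.*-assoc _ _ _) (K.trans (K.*-congˡ row₂₁) (K.zeroʳ u))) ⟩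
      x K.* (z₀ K.* ι k₁₁) K.+ K.0#                     ≈⟨ K.+-identityʳ _ ⟩
      x K.* (z₀ K.* ι k₁₁)                              ≈⟨ K.*-congˡ (K.trans (K.*-congʳ z≈) (K.sym (ι.*-homo _ _))) ⟩
      x K.* ι (k′₂₂ O.* k₁₁)                            ∎

    v≈ : v K.≈ x K.* ι (k′₂₂ O.* k₁₂) K.+ u
    v≈ = begin
      v                                                 ≈⟨ h₂ ⟨
      val h zero (suc zero)                             ≈⟨ e zero (suc zero) ⟩
      _                                                 ≈⟨ row gz₁₁ gz₁₂ ⟩
      (x K.* z₀) K.* ι k₁₂ K.+ (u K.* z₀) K.* ι k₂₂     ≈⟨ K.+-cong (K.*-assoc _ _ _) (K.trans (K.*-assoc _ _ _) (K.trans (K.*-congˡ row₂₂) (K.*-identityʳ u))) ⟩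
      x K.* (z₀ K.* ι k₁₂) K.+ u                        ≈⟨ K.+-congʳ (K.*-congˡ (K.trans (K.*-congʳ z≈) (K.sym (ι.*-homo _ _)))) ⟩
      x K.* ι (k′₂₂ O.* k₁₂) K.+ u                      ∎

  𝔳-affine : ∀ k → Affine₂ (𝔳 k) (pow k) K.0#
  𝔳-affine k = Affine₂-respects (power-homo (ℚₚ ˣ) GL₂ diag₁ diag₁-isHom ϖ k) (diag₁-affine (power (ℚₚ ˣ) ϖ k))

  vertex : ℤ → O.Carrier → ∣ GL₂ ∣ᵍ
  vertex k z = upper (ι z) ∙ 𝔳 k

  vertex-affine : ∀ k z → Affine₂ (vertex k z) (pow k) (ι z)
  vertex-affine k z = Affine₂-cong (K.*-identityˡ _) (K.trans (K.+-congʳ (K.zeroʳ _)) (K.+-identityˡ _))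
    (Affine₂-∙ (upper-affine (ι z)) (𝔳-affine k))

  vertex-intro : ∀ k {z z′} c → ι z′ K.≈ pow k K.* ι c K.+ ι z → vertex k z ≈ᵗ vertex k z′
  vertex-intro k {z} {z′} c h = coset-intro (Group.ε (𝒪 ˣ)) c (vertex-affine k z)
    (Affine₂-cong (K.sym (K.trans (K.*-congˡ ι.1#-homo) (K.*-identityʳ _))) h (vertex-affine k z′))

  -- pᵏ and pˡ are integral multiples of each other, hence k = l.
  vertex-elim : ∀ {k l z z′} → vertex k z ≈ᵗ vertex l z′ → k ≡ l × ∃[ c ] ι z′ K.≈ pow k K.* ι c K.+ ι z
  vertex-elim {k} {l} {z} {z′} h = conclude (coset-elim (vertex-affine k z) (vertex-affine l z′) h)
    (coset-elim (vertex-affine l z′) (vertex-affine k z) (≈ᵗ-sym h))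
    where
    conclude : (∃[ a ] ∃[ c ] pow l K.≈ pow k K.* ι a × ι z′ K.≈ pow k K.* ι c K.+ ι z) →
               (∃[ a ] ∃[ c ] pow k K.≈ pow l K.* ι a × ι z K.≈ pow l K.* ι c K.+ ι z′) →
               k ≡ l × ∃[ c ] ι z′ K.≈ pow k K.* ι c K.+ ι z
    conclude (a , c , e , f) (a′ , _ , e′ , _) = ℤP.≤-antisym (pow∈⇒≤ l k (a , e)) (pow∈⇒≤ k l (a′ , e′)) , c , f

  integral-mod : ∀ {i z z′} → z′ ≡ z [mod i ] → ∃[ c ] ι z′ K.≈ pow (+ i) K.* ι c K.+ ι z
  integral-mod {i} (by c h) = c , K.trans (ι.⟦⟧-cong h) (K.trans (ι.+-homo _ _) (K.trans (K.+-comm _ _)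
    (K.+-congʳ (K.trans (ι.*-homo _ _) (K.*-congʳ (K.sym (pow-nat i)))))))

  mod-integral : ∀ {i z z′} c → ι z′ K.≈ pow (+ i) K.* ι c K.+ ι z → z′ ≡ z [mod i ]
  mod-integral {i} c h = by c (ι-injective (K.trans h (K.trans (K.+-congʳ (K.trans (K.*-congʳ (pow-nat i)) (K.sym (ι.*-homo _ _))))
    (K.trans (K.+-comm _ _) (K.sym (ι.+-homo _ _))))))

  vertex-≃ : ∀ {i j z z′} → (i , z) ≃ (j , z′) → vertex (+ i) z ≈ᵗ vertex (+ j) z′
  vertex-≃ {i} {_} {z} {z′} (same ≡.refl h) = from-integral (integral-mod (mod-sym h))
    where
    from-integral : (∃[ c ] ι z′ K.≈ pow (+ i) K.* ι c K.+ ι z) → vertex (+ i) z ≈ᵗ vertex (+ i) z′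
    from-integral (c , e) = vertex-intro (+ i) {z} {z′} c e

  ≃-vertex : ∀ {i j z z′} → vertex (+ i) z ≈ᵗ vertex (+ j) z′ → (i , z) ≃ (j , z′)
  ≃-vertex {i} {j} {z} {z′} h = to-mod (vertex-elim {+ i} {+ j} {z} {z′} h)
    where
    to-mod : (+ i ≡ + j × ∃[ c ] ι z′ K.≈ pow (+ i) K.* ι c K.+ ι z) → (i , z) ≃ (j , z′)
    to-mod (e , c , f) = same (ℤP.+-injective e) (mod-sym (mod-integral c f))

  -- For i = 0 the level is -1. There any two integral numbers are congruent, the witness being c =
  -- π(z′ - z).
  vertex-pred-≃ : ∀ i {z z′} → z ≡ z′ [mod i ] → vertex (+ i ℤ.- 1ℤ) z ≈ᵗ vertex (+ i ℤ.- 1ℤ) z′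
  vertex-pred-≃ ℕ.zero {z} {z′} _ = vertex-intro -[1+ 0 ] (π O.* (z′ O.- z)) (begin
    ι z′                                             ≈⟨ ι.⟦⟧-cong difference ⟩
    ι ((z′ O.- z) O.+ z)                             ≈⟨ ι.+-homo _ _ ⟩
    ι (z′ O.- z) K.+ ι z                             ≈⟨ K.+-congʳ unscale ⟨
    pow -[1+ 0 ] K.* ι (π O.* (z′ O.- z)) K.+ ι z    ∎)
    where
    open SetoidReasoning K.setoid
    difference : z′ O.≈ (z′ O.- z) O.+ z
    difference = O.sym (O.trans (O.+-assoc _ _ _) (O.trans (O.+-congˡ (O.-‿inverseˡ z)) (O.+-identityʳ z′)))
    unscale : pow -[1+ 0 ] K.* ι (π O.* (z′ O.- z)) K.≈ ι (z′ O.- z)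
    unscale = begin
      pow -[1+ 0 ] K.* ι (π O.* (z′ O.- z))          ≈⟨ K.*-congˡ (K.trans (ι.*-homo _ _) (K.*-congʳ (K.trans (K.sym ϖ≈p) (K.sym (K.*-identityʳ _))))) ⟩
      pow -[1+ 0 ] K.* (pow (+ 1) K.* ι (z′ O.- z))  ≈⟨ K.*-assoc _ _ _ ⟨
      (pow -[1+ 0 ] K.* pow (+ 1)) K.* ι (z′ O.- z)  ≈⟨ K.*-congʳ (pow-inverse (+ 1)) ⟩
      K.1# K.* ι (z′ O.- z)                          ≈⟨ K.*-identityˡ _ ⟩
      ι (z′ O.- z)                                   ∎
  vertex-pred-≃ (ℕ.suc i) h = vertex-≃ {i} (same ≡.refl (mod-weaken h))

  edge : ℕ → O.Carrier → ∣ GL₂ ∣ᵍ × ∣ GL₂ ∣ᵍ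
  edge i z = upper (ι z) ·ᵖ 𝔢 i

  edge-≃ : ∀ {i j z z′} → (i , z) ≃ (j , z′) → edge i z ≈ᵖ edge j z′
  edge-≃ {i} (same ≡.refl h) = inj₁ (vertex-≃ (same ≡.refl h) , vertex-pred-≃ i h)

  private
    -- Two edges cannot match with their ends interchanged, since i - 1 = j and i = j - 1 are
    -- incompatible.
    crossed : ∀ i j → + i ℤ.- 1ℤ ≡ + j → + i ≢ + j ℤ.- 1ℤ
    crossed (ℕ.suc ℕ.zero)    _ ≡.refl ()
    crossed (ℕ.suc (ℕ.suc i)) _ ≡.refl ()

  ≃-edge : ∀ {i j z z′} → edge i z ≈ᵖ edge j z′ → (i , z) ≃ (j , z′)
  ≃-edge (inj₁ (h , _)) = ≃-vertex h
  ≃-edge {i} {j} (inj₂ (h , k)) = contradiction (proj₁ (vertex-elim h)) (crossed i j (proj₁ (vertex-elim k)))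

  -- The end of an edge nearer to 𝔳₀, which is missing for 𝔢₀.
  lower-end : ∀ i j {z w} → vertex (+ i) z ≈ᵗ vertex (+ j ℤ.- 1ℤ) w ⇔ Child (i , z) (j , w)
  lower-end i j {z} {w} = mk⇔ (to j) (from j)
    where
    to : ∀ j → vertex (+ i) z ≈ᵗ vertex (+ j ℤ.- 1ℤ) w → Child (i , z) (j , w)
    to ℕ.zero    h = ⊥-elim (negative (proj₁ (vertex-elim h)))
      where
      negative : + i ≢ -[1+ 0 ]
      negative ()
    to (ℕ.suc j) h = Child-respects (≃-sym (≃-vertex {i} {j} {z} {w} h)) ≃-refl (child ≡.refl (mod-refl O.refl))
    from : ∀ j → Child (i , z) (j , w) → vertex (+ i) z ≈ᵗ vertex (+ j ℤ.- 1ℤ) w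
    from _ (child ≡.refl h) = vertex-≃ {i} {i} (same ≡.refl (mod-sym h))

  -- The position is read off from the proof of membership in 𝔛₊; `≃-vertex` and `≃-edge` show that
  -- it does not depend on this proof.
  𝔛₊-coordinates : Coordinates 𝔛₊
  𝔛₊-coordinates = record
    { onVertices = record
      { to        = λ (_ , u , i , _) → i , u
      ; from      = λ (i , z) → vertex (+ i) z , z , i , ≈ᵗ-refl
      ; to-cong   = λ {(_ , _ , _ , h)} {(_ , _ , _ , k)} e → ≃-vertex (≈ᵗ-trans (≈ᵗ-sym h) (≈ᵗ-trans e k))
      ; from-cong = vertex-≃
      ; inverse   = (λ {x} {(_ , _ , _ , h)} e → ≃-vertex (≈ᵗ-trans (≈ᵗ-sym h) e))
                  , (λ {(_ , _ , _ , h)} {x} e → ≈ᵗ-trans (vertex-≃ e) (≈ᵗ-sym h))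
      }
    ; onEdges = record
      { to        = λ (_ , u , i , _) → i , u
      ; from      = λ (i , z) → edge i z , z , i , ≈ᵖ-refl
      ; to-cong   = λ {(_ , _ , _ , h)} {(_ , _ , _ , k)} e → ≃-edge (≈ᵖ-trans (≈ᵖ-sym h) (≈ᵖ-trans e k))
      ; from-cong = edge-≃
      ; inverse   = (λ {x} {(_ , _ , _ , h)} e → ≃-edge (≈ᵖ-trans (≈ᵖ-sym h) e))
                  , (λ {(_ , _ , _ , h)} {x} e → ≈ᵖ-trans (edge-≃ e) (≈ᵖ-sym h))
      }
    ; incidence    = incidence
    ; origin-level = ≡.refl
    }
    where
    open HalfTree 𝔛₊ using (Vertex; Edge; _∈ᵉ_)
    ends-cong : ∀ {v e f} → e ≈ᵖ f → v ≈ᵗ proj₁ e ⊎ v ≈ᵗ proj₂ e → v ≈ᵗ proj₁ f ⊎ v ≈ᵗ proj₂ f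
    ends-cong (inj₁ (h , k)) (inj₁ e) = inj₁ (≈ᵗ-trans e h)
    ends-cong (inj₁ (h , k)) (inj₂ e) = inj₂ (≈ᵗ-trans e k)
    ends-cong (inj₂ (h , k)) (inj₁ e) = inj₂ (≈ᵗ-trans e h)
    ends-cong (inj₂ (h , k)) (inj₂ e) = inj₁ (≈ᵗ-trans e k)
    incidence : ∀ (v : Vertex) (e : Edge) → (v ∈ᵉ e) ⇔
                Incident (proj₁ (proj₂ (proj₂ v)) , proj₁ (proj₂ v)) (proj₁ (proj₂ (proj₂ e)) , proj₁ (proj₂ e))
    incidence (x , u , i , h) (e , w , j , k) = mk⇔ (to ∘ ends-cong k) (ends-cong (≈ᵖ-sym k) ∘ from)
      where
      to : x ≈ᵗ vertex (+ j) w ⊎ x ≈ᵗ vertex (+ j ℤ.- 1ℤ) w → Incident (i , u) (j , w)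
      to (inj₁ g) = inj₁ (≃-vertex (≈ᵗ-trans (≈ᵗ-sym h) g))
      to (inj₂ g) = inj₂ (Equivalence.to (lower-end i j) (≈ᵗ-trans (≈ᵗ-sym h) g))
      from : Incident (i , u) (j , w) → x ≈ᵗ vertex (+ j) w ⊎ x ≈ᵗ vertex (+ j ℤ.- 1ℤ) w
      from (inj₁ g) = inj₁ (≈ᵗ-trans h (vertex-≃ g))
      from (inj₂ g) = inj₂ (≈ᵗ-trans h (Equivalence.from (lower-end i j) g))

  -- m carries the data (pᵏ, z) to (apᵏ, az + b), and the unit a is absorbed by GL₂(ℤ_p).
  affine-vertex : ∀ {m} (a : ∣ 𝒪 ˣ ∣ᵍ) b → Affine₂ m (ι (val a)) (ι b) → ∀ k z →
                  vertex k (val a O.* z O.+ b) ≈ᵗ m ∙ vertex k z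
  affine-vertex a b mᵃ k z = coset-intro a O.0# (vertex-affine k _)
    (Affine₂-cong (K.*-comm _ _)
      (K.trans (K.+-congʳ (K.sym (ι.*-homo _ _))) (K.trans (K.sym (ι.+-homo _ _))
        (K.sym (K.trans (K.+-congʳ (K.trans (K.*-congˡ ι.0#-homo) (K.zeroʳ _))) (K.+-identityˡ _)))))
      (Affine₂-∙ mᵃ (vertex-affine k z)))

  ν-affine : ∀ b → Affine₂ (power GL₂ ν (+ b)) (ι O.1#) (ι (nat b))
  ν-affine ℕ.zero    = affine₂ (K.sym ι.1#-homo) (K.sym ι.0#-homo) K.refl K.refl
  ν-affine (ℕ.suc b) = Affine₂-cong (K.*-identityˡ _)
    (K.trans (K.+-congʳ (K.*-identityˡ _)) (K.trans (K.+-comm _ _) (K.trans (K.+-congʳ (K.sym ι.1#-homo)) (K.sym (ι.+-homo _ _)))))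
    (Affine₂-∙ (upper-affine K.1#) (ν-affine b))

  γ-affine : ∀ a → Affine₂ (γ a) (ι (val a)) (ι O.0#)
  γ-affine a = Affine₂-cong K.refl (K.sym ι.0#-homo) (diag₁-affine _)

  φ-vertex : ∀ r k z → vertex (k ℤ.+ + r) (π ^ r O.* z) ≈ power GL₂ φ (+ r) ∙ vertex k z
  φ-vertex r k z = Affine₂-unique (vertex-affine (k ℤ.+ + r) (π ^ r O.* z))
    (Affine₂-cong (K.trans (K.sym (pow-+ (+ r) k)) (K.reflexive (≡.cong pow (ℤP.+-comm (+ r) k))))
      (K.trans (K.+-identityʳ _) (K.trans (K.*-congʳ (pow-nat r)) (K.sym (ι.*-homo _ _))))
      (Affine₂-∙ (𝔳-affine (+ r)) (vertex-affine k z)))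

  φ-edge : ∀ r i z → edge (i ℕ.+ r) (π ^ r O.* z) ≈ᵖ (power GL₂ φ (+ r) ·ᵖ edge i z)
  φ-edge r i z = inj₁ (≈⇒≈ᵗ (φ-vertex r (+ i) z) , ≈⇒≈ᵗ (G₂.trans (G₂.reflexive (≡.cong (λ k → vertex k (π ^ r O.* z)) index)) (φ-vertex r (+ i ℤ.- 1ℤ) z)))
    where
    index : + (i ℕ.+ r) ℤ.- 1ℤ ≡ (+ i ℤ.- 1ℤ) ℤ.+ + r
    index = ≡.trans (ℤP.+-assoc (+ i) (+ r) (ℤ.- 1ℤ)) (≡.trans (≡.cong (λ k → + i ℤ.+ k) (ℤP.+-comm (+ r) (ℤ.- 1ℤ))) (≡.sym (ℤP.+-assoc (+ i) (ℤ.- 1ℤ) (+ r))))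

-- The axioms for the inverse limit ℤ_p.

module Congruences where
  open import Data.Integer.Base using (_+_; _*_; _-_; -_; _^_)
  open import Data.Integer.Divisibility.Signed
  open import Data.Integer.Tactic.RingSolver using (solve-∀)

  infix 4 _≅_mod_
  record _≅_mod_ (a b m : ℤ) : Set where
    constructor mk≅
    field
      divides-difference : m ∣ a - b
  open _≅_mod_ public

  ∣-by : ∀ {m x y} → x ≡ y → m ∣ x → m ∣ y
  ∣-by {m} = ≡.subst (m ∣_)

  ≅-reflexive : ∀ {m a b} → a ≡ b → a ≅ b mod m
  ≅-reflexive {a = a} ≡.refl = mk≅ (divides 0ℤ (ℤP.+-inverseʳ a))

  ≅-sym : ∀ {m a b} → a ≅ b mod m → b ≅ a mod m
  ≅-sym {a = a} {b} (mk≅ h) = mk≅ (∣-by (flip a b) (∣m⇒∣-m h))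
    where
    flip : ∀ a b → - (a - b) ≡ b - a
    flip = solve-∀

  ≅-trans : ∀ {m a b c} → a ≅ b mod m → b ≅ c mod m → a ≅ c mod m
  ≅-trans {a = a} {b} {c} (mk≅ h) (mk≅ k) = mk≅ (∣-by (telescope a b c) (∣m∣n⇒∣m+n h k))
    where
    telescope : ∀ a b c → (a - b) + (b - c) ≡ a - c
    telescope = solve-∀

  ≅-+ : ∀ {m a b c d} → a ≅ b mod m → c ≅ d mod m → a + c ≅ b + d mod m
  ≅-+ {a = a} {b} {c} {d} (mk≅ h) (mk≅ k) = mk≅ (∣-by (regroup a b c d) (∣m∣n⇒∣m+n h k))
    where
    regroup : ∀ a b c d → (a - b) + (c - d) ≡ (a + c) - (b + d)
    regroup = solve-∀

  ≅-* : ∀ {m a b c d} → a ≅ b mod m → c ≅ d mod m → a * c ≅ b * d mod m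
  ≅-* {a = a} {b} {c} {d} (mk≅ h) (mk≅ k) = mk≅ (∣-by (regroup a b c d) (∣m∣n⇒∣m+n (∣m⇒∣m*n c h) (∣n⇒∣m*n b k)))
    where
    regroup : ∀ a b c d → (a - b) * c + b * (c - d) ≡ a * c - b * d
    regroup = solve-∀

  ≅-^ : ∀ {m a b} n → a ≅ b mod m → a ^ n ≅ b ^ n mod m
  ≅-^ ℕ.zero    h = ≅-reflexive ≡.refl
  ≅-^ (ℕ.suc n) h = ≅-* h (≅-^ n h)

  ≅-weaken : ∀ {m n a b} → n ∣ m → a ≅ b mod m → a ≅ b mod n
  ≅-weaken n∣m (mk≅ h) = mk≅ (∣-trans n∣m h)

  ^-+ : ∀ a m n → a ^ (m ℕ.+ n) ≡ a ^ m * a ^ n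
  ^-+ = ℤP.^-distribˡ-+-*

  -- The binomial formula up to multiples of x².
  power-1+ : ∀ x n → ∃[ w ] (1ℤ + x) ^ n ≡ 1ℤ + + n * x + (x * x) * w
  power-1+ x ℕ.zero    = 0ℤ , expand₀ x
    where
    expand₀ : ∀ x → 1ℤ ≡ 1ℤ + 0ℤ * x + (x * x) * 0ℤ
    expand₀ = solve-∀
  power-1+ x (ℕ.suc n) with w , e ← power-1+ x n = + n + w + x * w ,
    ≡.trans (≡.cong ((1ℤ + x) *_) e) (≡.trans (expand x (+ n) w)
      (≡.cong (λ k → 1ℤ + k * x + (x * x) * (+ n + w + x * w)) (≡.sym (ℤP.pos-+ 1 n))))
    where
    expand : ∀ x n w → (1ℤ + x) * (1ℤ + n * x + (x * x) * w) ≡ 1ℤ + (1ℤ + n) * x + (x * x) * (n + w + x * w)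
    expand = solve-∀

  module _ (p : ℕ) where
    p^ : ℕ → ℤ
    p^ n = + (p ℕ.^ n)

    p^-suc : ∀ n → p^ (ℕ.suc n) ≡ + p * p^ n
    p^-suc n = ℤP.pos-* p (p ℕ.^ n)

    p^-∣ : ∀ m n → p^ n ∣ p^ (m ℕ.+ n)
    p^-∣ ℕ.zero    n = ∣-refl
    p^-∣ (ℕ.suc m) n = ∣-by (≡.sym (p^-suc (m ℕ.+ n))) (∣n⇒∣m*n (+ p) (p^-∣ m n))

    p^-∣-≤ : ∀ {n k} → n ℕ.≤ k → p^ n ∣ p^ k
    p^-∣-≤ {n} {k} n≤k = ≡.subst (λ i → p^ n ∣ p^ i) (ℕP.m∸n+n≡m n≤k) (p^-∣ (k ℕ.∸ n) n)

    -- With x = y - 1, both px and x² are divisible by pᵏ⁺².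
    power-≅1-step : ∀ {y} k → y ≅ 1ℤ mod p^ (ℕ.suc k) → y ^ p ≅ 1ℤ mod p^ (ℕ.suc (ℕ.suc k))
    power-≅1-step {y} k (mk≅ h@(divides t e)) with w , f ← power-1+ (y - 1ℤ) p = mk≅ (∣-by (≡.sym difference)
        (∣m∣n⇒∣m+n (∣-by (≡.cong (+ p *_) (≡.sym e)) (divides t (≡.trans (rearrange (+ p) t (p^ (ℕ.suc k))) (≡.cong (t *_) (≡.sym (p^-suc (ℕ.suc k)))))))
          (∣m⇒∣m*n w (∣-trans (≡.subst (_∣ p^ (ℕ.suc k) * p^ (ℕ.suc k)) (≡.sym (p^-suc (ℕ.suc k))) (*-monoˡ-∣ (p^ (ℕ.suc k)) p∣)) square))))
      where
      difference : y ^ p - 1ℤ ≡ + p * (y - 1ℤ) + ((y - 1ℤ) * (y - 1ℤ)) * w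
      difference = ≡.trans (≡.cong (λ z → z ^ p - 1ℤ) (shift y)) (≡.trans (≡.cong (_- 1ℤ) f) (drop (+ p * (y - 1ℤ)) _))
        where
        shift : ∀ y → y ≡ 1ℤ + (y - 1ℤ)
        shift = solve-∀
        drop : ∀ a b → (1ℤ + a + b) - 1ℤ ≡ a + b
        drop = solve-∀
      rearrange : ∀ p t q → p * (t * q) ≡ t * (p * q)
      rearrange = solve-∀
      p∣ : + p ∣ p^ (ℕ.suc k)
      p∣ = ∣-by (≡.sym (p^-suc k)) (∣m⇒∣m*n (p^ k) ∣-refl)
      square : p^ (ℕ.suc k) * p^ (ℕ.suc k) ∣ (y - 1ℤ) * (y - 1ℤ)
      square = ∣-trans (*-monoˡ-∣ (p^ (ℕ.suc k)) h) (*-monoʳ-∣ (y - 1ℤ) h)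

    power-≅1 : ∀ {y} k → y ≅ 1ℤ mod + p → y ^ (p ℕ.^ k) ≅ 1ℤ mod p^ (ℕ.suc k)
    power-≅1 {y} ℕ.zero    h = ≡.subst₂ (λ z m → z ≅ 1ℤ mod m) (≡.sym (ℤP.^-identityʳ y)) (≡.sym (≡.trans (p^-suc 0) (ℤP.*-identityʳ (+ p)))) h
    power-≅1 {y} (ℕ.suc k) h = ≡.subst (λ z → z ≅ 1ℤ mod p^ (ℕ.suc (ℕ.suc k)))
      (≡.trans (ℤP.^-*-assoc y (p ℕ.^ k) p) (≡.cong (y ^_) (ℕP.*-comm (p ℕ.^ k) p)))
      (power-≅1-step k (power-≅1 k h))

    -- 1 + pᴹ + … + p⁽ⁿ⁻¹⁾ᴹ, approximating 1/(1 - pᴹ).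
    repunit : ℕ → ℕ → ℕ
    repunit M ℕ.zero    = 0
    repunit M (ℕ.suc n) = 1 ℕ.+ repunit M n ℕ.* (p ℕ.^ M)

    -- The definition multiplies by pᴹ and adds 1, which gives the fixed-point equation of the root;
    -- adding the top term instead gives the convergence.
    repunit-top : ∀ M n → repunit M (ℕ.suc n) ≡ repunit M n ℕ.+ p ℕ.^ (n ℕ.* M)
    repunit-top M ℕ.zero    = ≡.refl
    repunit-top M (ℕ.suc n) = ≡.cong ℕ.suc (≡.trans (≡.cong (ℕ._* (p ℕ.^ M)) (repunit-top M n))
      (≡.trans (ℕP.*-distribʳ-+ (p ℕ.^ M) (repunit M n) (p ℕ.^ (n ℕ.* M)))
        (≡.cong (λ z → repunit M n ℕ.* (p ℕ.^ M) ℕ.+ z)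
          (≡.trans (≡.sym (ℕP.^-distribˡ-+-* p (n ℕ.* M) M)) (≡.cong (p ℕ.^_) (ℕP.+-comm (n ℕ.* M) M))))))

module PadicNumbers (p : ℕ) (p-prime : Prime p) where
  open import Data.Integer.Divisibility.Signed
  open import Data.Integer.DivMod using (_%ℕ_; _/ℕ_; n%ℕd<d; a≡a%ℕn+[a/ℕn]*n)
  open import Data.Integer.Tactic.RingSolver using (solve-∀)
  open Congruences
  open PadicInteger
  open LocalField (padic p) using (ι; ϖ) renaming (K to ℚₚ)
  open PadicAxioms p (padic p)
  open Exp O.semiring using () renaming (_^_ to _^ₚ_)
  private module Loc = Localisation (ℤₚ-ring p) (fromℤ p (+ p))

  private instance
    p≢0 : ℕ.NonZero p
    p≢0 = prime⇒nonZero p-prime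

  p>1′ : 1 ℕ.< p
  p>1′ = ℕ.nonTrivial⇒n>1 p {{prime⇒nonTrivial p-prime}}

  q^ : ℕ → ℤ
  q^ = p^ p

  ≋-intro : ∀ {a b} → (∀ n → approx a n ≅ approx b n mod q^ n) → a O.≈ b
  ≋-intro h = mk≋ λ n → divides-difference (h n)

  ≋-elim : ∀ {a b} → a O.≈ b → ∀ n → approx a n ≅ approx b n mod q^ n
  ≋-elim (mk≋ h) n = mk≅ (h n)

  coherent′ : ∀ a n → approx a (ℕ.suc n) ≅ approx a n mod q^ n
  coherent′ a n = mk≅ (coherent a n)

  coherent-1 : ∀ a n → approx a (ℕ.suc n) ≅ approx a 1 mod + p
  coherent-1 a ℕ.zero    = ≅-reflexive ≡.refl
  coherent-1 a (ℕ.suc n) = ≅-trans (≅-weaken p∣ (coherent′ a (ℕ.suc n))) (coherent-1 a n)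
    where
    p∣ : + p ∣ q^ (ℕ.suc n)
    p∣ = ∣-by (≡.sym (p^-suc p n)) (∣m⇒∣m*n (q^ n) ∣-refl)

  limit : (s : ℕ → ℤ) → (∀ n → s (ℕ.suc n) ≅ s n mod q^ n) → PadicInteger p
  limit s h = record { approx = s ; coherent = λ n → divides-difference (h n) }

  approx-nat : ∀ n k → approx (nat n) k ≡ + n
  approx-nat ℕ.zero    k = ≡.refl
  approx-nat (ℕ.suc n) k = ≡.cong (λ i → 1ℤ ℤ.+ i) (approx-nat n k)

  approx-π : ∀ k → approx (π) k ≡ + p
  approx-π = approx-nat p

  approx-^ : ∀ a n k → approx (a ^ₚ n) k ≡ approx a k ℤ.^ n
  approx-^ a ℕ.zero    k = ≡.refl
  approx-^ a (ℕ.suc n) k = ≡.cong (approx a k ℤ.*_) (approx-^ a n k)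

  π≈ : π O.≈ fromℤ p (+ p)
  π≈ = ≋-intro λ n → ≅-reflexive (approx-π n)

  cancel-p : ∀ n {x y} → + p ℤ.* x ≅ + p ℤ.* y mod q^ (ℕ.suc n) → x ≅ y mod q^ n
  cancel-p n {x} {y} (mk≅ h) = mk≅ (*-cancelˡ-∣ (+ p) (≡.subst₂ _∣_ (p^-suc p n) (factor (+ p) x y) h))
    where
    factor : ∀ p x y → p ℤ.* x ℤ.- p ℤ.* y ≡ p ℤ.* (x ℤ.- y)
    factor = solve-∀

  -- Cancelling p costs one power of p, so congruence modulo pⁿ comes from the approximations at n +
  -- 1.
  π-cancelₚ : π-Cancel
  π-cancelₚ a b h = ≋-intro λ n → ≅-trans (≅-sym (coherent′ a n)) (≅-trans
    (cancel-p n (≡.subst (λ q → q ℤ.* approx a (ℕ.suc n) ≅ q ℤ.* approx b (ℕ.suc n) mod q^ (ℕ.suc n)) (approx-π (ℕ.suc n)) (≋-elim h (ℕ.suc n))))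
    (coherent′ b n))

  -- The digit is the residue of the first approximation, and the tail at n is (aₙ₊₁ - d)/p, the
  -- index being one higher because of the division.
  expandₚ : Expand
  expandₚ a = d , limit q coherent-q , n%ℕd<d (approx a 1) p , ≋-intro equal
    where
    d = approx a 1 %ℕ p

    p∣ : ∀ n → + p ∣ approx a (ℕ.suc n) ℤ.- + d
    p∣ n = divides-difference (≅-trans (coherent-1 a n) (mk≅ (divides (approx a 1 /ℕ p)
      (≡.trans (≡.cong (ℤ._- + d) (a≡a%ℕn+[a/ℕn]*n (approx a 1) p)) (drop (+ d) (approx a 1 /ℕ p ℤ.* + p))))))
      where
      drop : ∀ d x → (d ℤ.+ x) ℤ.- d ≡ x
      drop = solve-∀

    q : ℕ → ℤ
    q n = quotient (p∣ n)

    q-equation : ∀ n → + d ℤ.+ + p ℤ.* q n ≡ approx a (ℕ.suc n)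
    q-equation n = ≡.trans (≡.cong (λ z → + d ℤ.+ z) (≡.trans (ℤP.*-comm (+ p) (q n)) (≡.sym (_∣_.equality (p∣ n)))))
      (restore (+ d) (approx a (ℕ.suc n)))
      where
      restore : ∀ d x → d ℤ.+ (x ℤ.- d) ≡ x
      restore = solve-∀

    cancel-d : ∀ {m x y} → + d ℤ.+ x ≅ + d ℤ.+ y mod m → x ≅ y mod m
    cancel-d {m} {x} {y} (mk≅ h) = mk≅ (∣-by (drop (+ d) x y) h)
      where
      drop : ∀ d x y → (d ℤ.+ x) ℤ.- (d ℤ.+ y) ≡ x ℤ.- y
      drop = solve-∀

    coherent-q : ∀ n → q (ℕ.suc n) ≅ q n mod q^ n
    coherent-q n = cancel-p n (cancel-d (≡.subst₂ (λ x y → x ≅ y mod q^ (ℕ.suc n))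
      (≡.sym (q-equation (ℕ.suc n))) (≡.sym (q-equation n)) (coherent′ a (ℕ.suc n))))

    equal : ∀ n → approx a n ≅ approx (nat d) n ℤ.+ approx (π) n ℤ.* q n mod q^ n
    equal n = ≅-trans (≅-sym (coherent′ a n)) (≅-reflexive (≡.trans (≡.sym (q-equation n))
      (≡.sym (≡.cong₂ (λ x y → x ℤ.+ y ℤ.* q n) (approx-nat d n) (approx-π n)))))

  small-multiple : ∀ {d e} → d ℕ.< p → + p ∣ + d ℤ.- + e → e ℕ.≤ d → d ≡ e
  small-multiple {d} {e} d<p h e≤d with d ℕ.∸ e in eq
  ... | ℕ.zero  = ℕP.≤-antisym (ℕP.m∸n≡0⇒m≤n eq) e≤d
  ... | ℕ.suc k = contradiction (ℕP.<-≤-trans d<p p≤d) (ℕP.<-irrefl ≡.refl)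
    where
    p∣d-e : p ℕD.∣ d ℕ.∸ e
    p∣d-e = ∣⇒∣ᵤ (∣-by (≡.trans (ℤP.m-n≡m⊖n d e) (ℤP.⊖-≥ e≤d)) h)
    p≤d : p ℕ.≤ d
    p≤d = ℕP.≤-trans (ℕD.∣⇒≤ {{ℕ.>-nonZero (≡.subst (0 ℕ.<_) (≡.sym eq) ℕ.z<s)}} p∣d-e) (ℕP.m∸n≤m d e)

  residue-unique : ∀ {d e} → d ℕ.< p → e ℕ.< p → + d ≅ + e mod + p → d ≡ e
  residue-unique {d} {e} d<p e<p h = by-order (ℕP.≤-total e d)
    where
    by-order : e ℕ.≤ d ⊎ d ℕ.≤ e → d ≡ e
    by-order (inj₁ e≤d) = small-multiple d<p (divides-difference h) e≤d
    by-order (inj₂ d≤e) = ≡.sym (small-multiple e<p (divides-difference (≅-sym h)) d≤e)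

  residue : ∀ d b → approx (nat d O.+ π O.* b) 1 ≅ + d mod + p
  residue d b = ≅-trans (≅-reflexive (≡.cong₂ (λ x y → x ℤ.+ y ℤ.* approx b 1) (approx-nat d 1) (approx-π 1)))
    (mk≅ (∣-by (cancel (+ d) (+ p ℤ.* approx b 1)) (∣m⇒∣m*n (approx b 1) ∣-refl)))
    where
    cancel : ∀ k y → y ≡ (k ℤ.+ y) ℤ.- k
    cancel = solve-∀

  ≋-elim-1 : ∀ {a b} → a O.≈ b → approx a 1 ≅ approx b 1 mod + p
  ≋-elim-1 h = ≅-weaken (∣-by (≡.sym (≡.trans (p^-suc p 0) (ℤP.*-identityʳ (+ p)))) ∣-refl) (≋-elim h 1)

  digit-uniqueₚ : Digit-unique
  digit-uniqueₚ d e b c d<p e<p h =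
    residue-unique d<p e<p (≅-trans (≅-sym (residue d b)) (≅-trans (≋-elim-1 h) (residue e c)))

  -- With x = -pz, the inverse of 1 - x is approximated by 1 + x + ... + xⁿ⁻¹, the error being the
  -- multiple xⁿ of pⁿ.
  1+π-unitₚ : 1+π-Unit
  1+π-unitₚ z = limit w coherent-w , ≋-intro λ n →
    ≡.subst (λ q → (1ℤ ℤ.+ q ℤ.* approx z n) ℤ.* w n ≅ 1ℤ mod q^ n) (≡.sym (approx-π n)) (inverse-w n)
    where
    x : ℕ → ℤ
    x n = ℤ.- (+ p ℤ.* approx z n)

    geometric : ℤ → ℕ → ℤ
    geometric x ℕ.zero    = 0ℤ
    geometric x (ℕ.suc n) = 1ℤ ℤ.+ x ℤ.* geometric x n

    geometric-sum : ∀ x n → (1ℤ ℤ.- x) ℤ.* geometric x n ≡ 1ℤ ℤ.- x ℤ.^ n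
    geometric-sum x ℕ.zero    = ℤP.*-zeroʳ (1ℤ ℤ.- x)
    geometric-sum x (ℕ.suc n) = ≡.trans (expand x (geometric x n)) (≡.trans
      (≡.cong (λ s → (1ℤ ℤ.- x) ℤ.+ x ℤ.* s) (geometric-sum x n)) (collect x (x ℤ.^ n)))
      where
      expand : ∀ x s → (1ℤ ℤ.- x) ℤ.* (1ℤ ℤ.+ x ℤ.* s) ≡ (1ℤ ℤ.- x) ℤ.+ x ℤ.* ((1ℤ ℤ.- x) ℤ.* s)
      expand = solve-∀
      collect : ∀ x t → (1ℤ ℤ.- x) ℤ.+ x ℤ.* (1ℤ ℤ.- t) ≡ 1ℤ ℤ.- x ℤ.* t
      collect = solve-∀

    w : ℕ → ℤ
    w n = geometric (x n) n

    power-x : ∀ n k → q^ k ∣ x n ℤ.^ k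
    power-x n ℕ.zero    = ∣-refl
    power-x n (ℕ.suc k) = ∣-by (≡.sym (neg-mul (+ p) (approx z n) (x n ℤ.^ k))) (∣m⇒∣m*n (ℤ.- approx z n)
      (≡.subst (_∣ + p ℤ.* x n ℤ.^ k) (≡.sym (p^-suc p k)) (*-monoʳ-∣ (+ p) (power-x n k))))
      where
      neg-mul : ∀ p z t → ℤ.- (p ℤ.* z) ℤ.* t ≡ (p ℤ.* t) ℤ.* ℤ.- z
      neg-mul = solve-∀

    inverse-w : ∀ n → (1ℤ ℤ.+ + p ℤ.* approx z n) ℤ.* w n ≅ 1ℤ mod q^ n
    inverse-w n = ≅-trans (≅-reflexive (≡.trans (≡.cong (ℤ._* w n) (sign (+ p ℤ.* approx z n))) (geometric-sum (x n) n)))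
      (mk≅ (∣-by (drop (x n ℤ.^ n)) (∣m⇒∣-m (power-x n n))))
      where
      sign : ∀ y → 1ℤ ℤ.+ y ≡ 1ℤ ℤ.- (ℤ.- y)
      sign = solve-∀
      drop : ∀ t → ℤ.- t ≡ (1ℤ ℤ.- t) ℤ.- 1ℤ
      drop = solve-∀

    -- Inverses modulo pⁿ are unique.
    coherent-w : ∀ n → w (ℕ.suc n) ≅ w n mod q^ n
    coherent-w n = ≅-trans (≅-reflexive (≡.sym (ℤP.*-identityʳ w′))) (≅-trans
      (≅-* {b = w′} (≅-reflexive ≡.refl) (≅-sym (inverse-w n))) (≅-trans
      (≅-reflexive (rearrange w′ (1ℤ ℤ.+ + p ℤ.* approx z n) (w n))) (≅-trans
      (≅-* (≅-* (≅-+ {b = 1ℤ} (≅-reflexive ≡.refl) (≅-* {b = + p} (≅-reflexive ≡.refl) (≅-sym (coherent′ z n)))) (≅-reflexive {b = w′} ≡.refl)) (≅-reflexive {b = w n} ≡.refl)) (≅-trans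
      (≅-* (≅-weaken (p^-∣ p 1 n) (inverse-w (ℕ.suc n))) (≅-reflexive {b = w n} ≡.refl))
      (≅-reflexive (ℤP.*-identityˡ (w n)))))))
      where
      w′ = w (ℕ.suc n)
      rearrange : ∀ a b c → a ℤ.* (b ℤ.* c) ≡ (b ℤ.* a) ℤ.* c
      rearrange = solve-∀

  -- The root is c = b^(1/(1 - pᴹ)), with the exponent expanded as 1 + pᴹ + p²ᴹ + ...; at n the
  -- first n terms of this series are used.
  rootₚ : Take-root
  rootₚ b z M M>0 b≈ = cₚ , one-unit (expandₚ cₚ) , fixed-point
    where
    y : ℕ → ℤ
    y n = 1ℤ ℤ.+ + p ℤ.* approx z n

    y≅1 : ∀ n → y n ≅ 1ℤ mod + p
    y≅1 n = mk≅ (∣-by (drop (+ p ℤ.* approx z n)) (∣m⇒∣m*n (approx z n) ∣-refl))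
      where
      drop : ∀ t → t ≡ (1ℤ ℤ.+ t) ℤ.- 1ℤ
      drop = solve-∀

    s : ℕ → ℕ
    s = repunit p M

    c : ℕ → ℤ
    c n = y n ℤ.^ s n

    n≤1+nM : ∀ n → n ℕ.≤ ℕ.suc (n ℕ.* M)
    n≤1+nM n = ℕP.m≤n⇒m≤1+n (ℕP.≤-trans (ℕP.≤-reflexive (≡.sym (ℕP.*-identityʳ n))) (ℕP.*-monoʳ-≤ n M>0))

    -- y^(s (n + 1)) = y^(s n) · y^(pⁿᴹ), and the last factor is 1 modulo pⁿ.
    grow : ∀ n → y n ℤ.^ s (ℕ.suc n) ≅ c n mod q^ n
    grow n = ≅-trans (≅-reflexive (≡.trans (≡.cong (y n ℤ.^_) (repunit-top p M n)) (^-+ (y n) (s n) (p ℕ.^ (n ℕ.* M)))))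
      (≅-trans (≅-* (≅-reflexive {b = c n} ≡.refl) (≅-weaken (p^-∣-≤ p (n≤1+nM n)) (power-≅1 p (n ℕ.* M) (y≅1 n))))
        (≅-reflexive (ℤP.*-identityʳ (c n))))

    coherent-c : ∀ n → c (ℕ.suc n) ≅ c n mod q^ n
    coherent-c n = ≅-trans (≅-^ (s (ℕ.suc n)) (≅-+ {b = 1ℤ} (≅-reflexive ≡.refl) (≅-* {b = + p} (≅-reflexive ≡.refl) (coherent′ z n)))) (grow n)

    cₚ : PadicInteger p
    cₚ = limit c coherent-c

    b≅y : ∀ n → approx b n ≅ y n mod q^ n
    b≅y n = ≅-trans (≋-elim b≈ n) (≅-reflexive (≡.cong (λ q → 1ℤ ℤ.+ q ℤ.* approx z n) (approx-π n)))

    -- s (n + 1) = 1 + s n · pᴹ turns y^(s (n + 1)) into y · c^(pᴹ), and by `grow` it is congruent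
    -- to c.
    fixed-point : cₚ O.≈ b O.* cₚ ^ₚ (p ℕ.^ M)
    fixed-point = ≋-intro λ n → ≅-trans (≅-sym (grow n)) (≅-trans (≅-reflexive
      (≡.trans (^-+ (y n) 1 (s n ℕ.* (p ℕ.^ M))) (≡.cong₂ ℤ._*_ (ℤP.^-identityʳ (y n)) (≡.sym (ℤP.^-*-assoc (y n) (s n) (p ℕ.^ M))))))
      (≅-* (≅-sym (b≅y n)) (≅-reflexive (≡.sym (approx-^ cₚ (p ℕ.^ M) n)))))

    c₁≅1 : c 1 ≅ 1ℤ mod + p
    c₁≅1 = ≅-trans (≅-^ (s 1) (y≅1 1)) (≅-reflexive (ℤP.^-zeroˡ (s 1)))

    one-unit : (∃[ d ] ∃[ b ] d ℕ.< p × cₚ O.≈ nat d O.+ π O.* b) → ∃[ b ] cₚ O.≈ O.1# O.+ π O.* b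
    one-unit (d , b , d<p , e) = b , O.trans e (O.+-congʳ (O.trans (O.reflexive (≡.cong nat d≡1)) (O.+-identityʳ O.1#)))
      where
      d≡1 : d ≡ 1
      d≡1 = residue-unique d<p p>1′ (≅-trans (≅-sym (≅-trans (≋-elim-1 e) (residue d b))) c₁≅1)

  private
    f = fromℤ p (+ p)
    open Exp (CommutativeRing.semiring (ℤₚ-ring p)) using (_^_)

    approx-f^ : ∀ n k → approx (f ^ n) k ≡ (+ p) ℤ.^ n
    approx-f^ ℕ.zero    k = ≡.refl
    approx-f^ (ℕ.suc n) k = ≡.cong (+ p ℤ.*_) (approx-f^ n k)

    cancel-p^ : ∀ m n {x y} → (+ p) ℤ.^ m ℤ.* x ≅ (+ p) ℤ.^ m ℤ.* y mod q^ (m ℕ.+ n) → x ≅ y mod q^ n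
    cancel-p^ ℕ.zero    n {x} {y} h = ≡.subst₂ (λ s t → s ≅ t mod q^ n) (ℤP.*-identityˡ x) (ℤP.*-identityˡ y) h
    cancel-p^ (ℕ.suc m) n {x} {y} h = cancel-p^ m n (cancel-p (m ℕ.+ n)
      (≡.subst₂ (λ s t → s ≅ t mod q^ (ℕ.suc m ℕ.+ n)) (ℤP.*-assoc (+ p) ((+ p) ℤ.^ m) x) (ℤP.*-assoc (+ p) ((+ p) ℤ.^ m) y) h))

    coherent-+ : ∀ a m n → approx a (m ℕ.+ n) ≅ approx a n mod q^ n
    coherent-+ a ℕ.zero    n = ≅-reflexive ≡.refl
    coherent-+ a (ℕ.suc m) n = ≅-trans (≅-weaken (p^-∣ p m n) (coherent′ a (m ℕ.+ n))) (coherent-+ a m n)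

  -- Equality of the fractions gives pᵐa = pᵐb for some m. Comparing approximations at m + n and
  -- cancelling pᵐ leaves a congruence modulo pⁿ.
  ι-injectiveₚ : ι-Injective
  ι-injectiveₚ a b (m Loc., h) = ≋-intro λ n → ≅-trans (≅-sym (coherent-+ a m n)) (≅-trans
    (cancel-p^ m n (≡.subst₂ (λ s t → s ≅ t mod q^ (m ℕ.+ n))
      (≡.cong₂ ℤ._*_ (approx-f^ m (m ℕ.+ n)) (ℤP.*-identityˡ (approx a (m ℕ.+ n))))
      (≡.cong₂ ℤ._*_ (approx-f^ m (m ℕ.+ n)) (ℤP.*-identityˡ (approx b (m ℕ.+ n))))
      (≋-elim h (m ℕ.+ n))))
    (coherent-+ b m n))

  ϖ≈pₚ : val ϖ K.≈ ι (π)
  ϖ≈pₚ = RingMorphisms.IsRingHomomorphism.⟦⟧-cong (LocalField.ι-isHom (padic p)) (O.sym π≈)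

  private
    ϖ^ : ℕ → Loc.Fraction
    ϖ^ k = val (power (ℚₚ ˣ) ϖ (+ k))

    ϖ^-den : ∀ k → Loc.Fraction.den (ϖ^ k) ≡ 0
    ϖ^-den ℕ.zero    = ≡.refl
    ϖ^-den (ℕ.suc k) = ϖ^-den k

    ϖ^-num : ∀ k n → approx (Loc.Fraction.num (ϖ^ k)) n ≡ (+ p) ℤ.^ k
    ϖ^-num ℕ.zero    n = ≡.refl
    ϖ^-num (ℕ.suc k) n = ≡.cong (+ p ℤ.*_) (ϖ^-num k n)

  fractionₚ : Fraction
  fractionₚ (a Loc./^ k) = k , a , (0 Loc., ≋-intro λ n → ≅-reflexive
    (≡.trans (≡.cong (λ z → 1ℤ ℤ.* (1ℤ ℤ.* (approx a n ℤ.* z))) (ϖ^-num k n))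
      (≡.trans (rearrange (approx a n) ((+ p) ℤ.^ k))
        (≡.cong (λ z → 1ℤ ℤ.* (z ℤ.* approx a n)) (≡.trans (≡.sym (approx-f^ k n))
          (≡.cong (λ i → approx (f ^ i) n) (≡.sym (≡.trans (≡.cong (k ℕ.+_) (ϖ^-den k)) (ℕP.+-identityʳ k)))))))))
    where
    rearrange : ∀ a z → 1ℤ ℤ.* (1ℤ ℤ.* (a ℤ.* z)) ≡ 1ℤ ℤ.* (z ℤ.* a)
    rearrange = solve-∀

  padicField : PadicField p (padic p)
  padicField = record
    { prime         = p-prime
    ; ι-injective′ = ι-injectiveₚ
    ; ϖ≈p          = ϖ≈pₚ
    ; π-cancel′ = π-cancelₚ
    ; expand       = expandₚ
    ; digit-unique′ = digit-uniqueₚ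
    ; 1+π-unit     = 1+π-unitₚ
    ; fraction     = fractionₚ
    ; take-root    = rootₚ
    }

-- Units of ℤ_p, and generators of N₀⁽ⁱ⁾ modulo N₀⁽ⁱ⁺¹⁾.

module Residues (p : ℕ) (𝐊 : LocalField) (P : PadicField p 𝐊) where
  open LocalField 𝐊
  open Valuation p 𝐊 P
  open Expansions p 𝐊 P using (expansion; digit; rest; digit<p)
  open CommutativeRing 𝒪
  open SemiringSolver commutativeSemiring using (solve; _:=_; _:*_; _:+_)
  open SetoidReasoning setoid
  open Bézout.Identity using (+-; -+)

  nat-+ : ∀ m n → nat (m ℕ.+ n) ≈ nat m + nat n
  nat-+ = Mult.×-homo-+ +-monoid 1#

  nat-* : ∀ m n → nat (m ℕ.* n) ≈ nat m * nat n
  nat-* = SemiringMult.×1-homo-* semiring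

  nat-1 : nat 1 ≈ 1#
  nat-1 = +-identityʳ 1#

  private
    unit-from : ∀ {c e} z → c * e ≈ 1# + π * z → ∃[ w ] c * w ≈ 1#
    unit-from {c} {e} z h with w , u ← 1+π-unit z =
      e * w , trans (sym (*-assoc c e w)) (trans (*-congʳ h) u)

  -- Bézout inverts d modulo p, which brings d + pb to the form 1 + pz, a unit. The cases are the
  -- two signs in Bézout's identity.
  nonzero-digit-unit : ∀ {d} b → 0 ℕ.< d → d ℕ.< p → ∃[ w ] (nat d + π * b) * w ≈ 1#
  nonzero-digit-unit {d} b 0<d d<p with coprime-Bézout (prime⇒coprime prime {{ℕ.>-nonZero 0<d}} d<p)
  ... | -+ x y eq = unit-from (nat x + b * nat y) (begin
    (nat d + π * b) * nat y                ≈⟨ solve 4 (λ d q b y → (d :+ q :* b) :* y := y :* d :+ q :* (b :* y)) refl (nat d) π b (nat y) ⟩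
    nat y * nat d + π * (b * nat y)        ≈⟨ +-congʳ (nat-* y d) ⟨
    nat (y ℕ.* d) + π * (b * nat y)        ≈⟨ +-congʳ (reflexive (≡.cong nat eq)) ⟨
    nat (1 ℕ.+ x ℕ.* p) + π * (b * nat y)  ≈⟨ +-congʳ (trans (nat-+ 1 (x ℕ.* p)) (+-cong nat-1 (nat-* x p))) ⟩
    (1# + nat x * π) + π * (b * nat y)     ≈⟨ solve 5 (λ o x q b y → (o :+ x :* q) :+ q :* (b :* y) := o :+ q :* (x :+ b :* y)) refl 1# (nat x) π b (nat y) ⟩
    1# + π * (nat x + b * nat y)           ∎)
  ... | +- x y eq = unit-from (- (nat x + b * nat y)) (begin
    c * - nat y                            ≈⟨ RingProperties.-‿distribʳ-* ring c (nat y) ⟨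
    - (c * nat y)                          ≈⟨ move sum-≈ ⟩
    1# + - (π * (nat x + b * nat y))       ≈⟨ +-congˡ (RingProperties.-‿distribʳ-* ring π _) ⟩
    1# + π * - (nat x + b * nat y)         ∎)
    where
    c = nat d + π * b
    sum-≈ : 1# + c * nat y ≈ π * (nat x + b * nat y)
    sum-≈ = begin
      1# + (nat d + π * b) * nat y             ≈⟨ solve 5 (λ o d q b y → o :+ (d :+ q :* b) :* y := (o :+ y :* d) :+ q :* (b :* y)) refl 1# (nat d) π b (nat y) ⟩
      (1# + nat y * nat d) + π * (b * nat y)   ≈⟨ +-congʳ (trans (nat-+ 1 (y ℕ.* d)) (+-cong nat-1 (nat-* y d))) ⟨
      nat (1 ℕ.+ y ℕ.* d) + π * (b * nat y)    ≈⟨ +-congʳ (trans (reflexive (≡.cong nat eq)) (nat-* x p)) ⟩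
      nat x * π + π * (b * nat y)              ≈⟨ solve 4 (λ x q b y → x :* q :+ q :* (b :* y) := q :* (x :+ b :* y)) refl (nat x) π b (nat y) ⟩
      π * (nat x + b * nat y)                  ∎
    move : ∀ {a b} → 1# + a ≈ b → - a ≈ 1# + - b
    move {a} {b} h = sym (begin
      1# + - b                ≈⟨ +-congˡ (-‿cong h) ⟨
      1# + - (1# + a)         ≈⟨ +-congˡ (GroupProperties.⁻¹-anti-homo-∙ +-group 1# a) ⟩
      1# + (- a + - 1#)       ≈⟨ +-congˡ (+-comm _ _) ⟩
      1# + (- 1# + - a)       ≈⟨ +-assoc _ _ _ ⟨
      (1# + - 1#) + - a       ≈⟨ trans (+-congʳ (-‿inverseʳ 1#)) (+-identityˡ _) ⟩
      - a                     ∎)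

  unit-or-divisible : ∀ c → (∃[ b ] c ≈ π * b) ⊎ (∃[ w ] c * w ≈ 1#)
  unit-or-divisible c = by-digit (digit c) ≡.refl
    where
    by-digit : ∀ d → digit c ≡ d → (∃[ b ] c ≈ π * b) ⊎ (∃[ w ] c * w ≈ 1#)
    by-digit ℕ.zero    e = inj₁ (rest c , trans (expansion c) (trans (+-congʳ (reflexive (≡.cong nat e))) (+-identityˡ _)))
    by-digit (ℕ.suc d) e with w , h ← nonzero-digit-unit (rest c) (≡.subst (0 ℕ.<_) (≡.sym e) ℕ.z<s) (digit<p c) =
      inj₂ (w , trans (*-congʳ (expansion c)) h)

  ι-nat : ∀ n u → ι (nat n) K.* u K.≈ power K.+-group u (+ n)
  ι-nat ℕ.zero    u = K.trans (K.*-congʳ ι.0#-homo) (K.zeroˡ u)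
  ι-nat (ℕ.suc n) u = K.trans (K.*-congʳ (ι.+-homo 1# (nat n))) (K.trans (K.distribʳ u _ _)
    (K.+-cong (K.trans (K.*-congʳ ι.1#-homo) (K.*-identityˡ u)) (ι-nat n u)))

-- The value k and the n values of f are n + 1 elements of Fin n; a coincidence among them has to
-- involve k.
injective⇒surjective : ∀ {n} (f : Fin n → Fin n) → (∀ i j → f i ≡ f j → i ≡ j) → ∀ k → ∃[ i ] f i ≡ k
injective⇒surjective {n} f injective k = collision (FinP.pigeonhole ℕP.≤-refl g)
  where
  g : Fin (ℕ.suc n) → Fin n
  g zero    = k
  g (suc i) = f i
  collision : (∃[ i ] ∃[ j ] i Fin.< j × g i ≡ g j) → ∃[ i ] f i ≡ k
  collision (zero  , suc j , _   , e) = j , ≡.sym e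
  collision (suc i , suc j , i<j , e) = contradiction i<j (ℕP.<-irrefl (≡.cong (Fin.toℕ ∘ suc) (injective i j e)))

module Galleries (p : ℕ) (𝐊 : LocalField) (P : PadicField p 𝐊) (𝐆 : SplitReductiveGroup (LocalField.K 𝐊))
  (R : RootDatum 𝐆) (chev : ChevalleySystem 𝐆 R) (Φ⁺ : PositiveSystem 𝐆 R) (𝒞 : Building.Gallery 𝐊 𝐆 R p Φ⁺) where
  open LocalField 𝐊 renaming (K to ℚₚ)
  open Valuation p 𝐊 P
  open Residues p 𝐊 P using (unit-or-divisible)
  open Building 𝐊 𝐆 R using (G; Iwahori; HasIndex)
  open Building.Gallery 𝒞
  open RootDatum R using (Φ)
  open PositiveSystem Φ⁺ using (Positive)
  open Group G hiding (identity; inverse)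
  open RootGroups p 𝐊 P 𝐆 R
  private module I (i : ℕ) = IwahoriGroup p 𝐊 P 𝐆 R chev (C i)

  -- Membership in the generated group first has to be turned into membership of u in the ideal `𝔞`.
  Iwahori-scale : ∀ i {β u} c → Iwahori (C i) (x β u) → Iwahori (C i) (x β (ι c K.* u))
  Iwahori-scale i {β} {u} c h = member (inj₂ (β , I.F-intro i
    (I.𝔞-ι* i c (IwahoriFacts.Iwahori-root p 𝐊 P 𝐆 R chev (C i) Φ⁺ β h)) refl))

  -- The root is a field instead of being fixed as α⁽ⁱ⁾, so that the conjugate by φ of a generator
  -- is again a generator without its root being identified.
  record Generator (i : ℕ) : Set where
    field
      β        : Φ
      positive : Positive β
      u        : K.Carrier
      inside   : Iwahori (C i) (x β u)
      outside  : ¬ Iwahori (C (ℕ.suc i)) (x β u)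
      next     : Iwahori (C (ℕ.suc i)) (x β (ι π K.* u))

    ξ : O.Carrier → Carrier
    ξ c = x β (ι c K.* u)

    ξ-cong : ∀ {c d} → c O.≈ d → ξ c ≈ ξ d
    ξ-cong h = x-cong (K.*-congʳ (ι.⟦⟧-cong h))

    ξ-+ : ∀ c d → ξ (c O.+ d) ≈ ξ c ∙ ξ d
    ξ-+ c d = trans (x-cong (K.trans (K.*-congʳ (ι.+-homo c d)) (K.distribʳ u _ _))) (x-+ β _ _)

    ξ∈N : ∀ c → N₀[ i ] (ξ c)
    ξ∈N c = Iwahori-scale i c inside , member (β , positive , ι c K.* u , refl)

    ξπ∈N : ∀ c → N₀[ ℕ.suc i ] (ξ (π O.* c))
    ξπ∈N c = respects (x-cong (K.trans (K.sym (K.*-assoc _ _ _)) (K.*-congʳ (K.trans (K.sym (ι.*-homo c π)) (ι.⟦⟧-cong (O.*-comm c π))))))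
        (Iwahori-scale (ℕ.suc i) c next)
      , member (β , positive , ι (π O.* c) K.* u , refl)

    -- For a unit c, scaling back by c⁻¹ would bring x β u into the next group, against `outside`.
    ξ∈N⇒π∣ : ∀ c → N₀[ ℕ.suc i ] (ξ c) → ∃[ b ] c O.≈ π O.* b
    ξ∈N⇒π∣ c (h , _) = by-cases (unit-or-divisible c)
      where
      by-cases : (∃[ b ] c O.≈ π O.* b) ⊎ (∃[ w ] c O.* w O.≈ O.1#) → ∃[ b ] c O.≈ π O.* b
      by-cases (inj₁ d)       = d
      by-cases (inj₂ (w , e)) = contradiction (respects (x-cong (begin
          ι w K.* (ι c K.* u)   ≈⟨ K.*-assoc _ _ _ ⟨
          (ι w K.* ι c) K.* u   ≈⟨ K.*-congʳ (ι.*-homo w c) ⟨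
          ι (w O.* c) K.* u     ≈⟨ K.*-congʳ (ι.⟦⟧-cong (O.trans (O.*-comm w c) e)) ⟩
          ι O.1# K.* u          ≈⟨ K.*-congʳ ι.1#-homo ⟩
          K.1# K.* u            ≈⟨ K.*-identityˡ u ⟩
          u                     ∎)) (Iwahori-scale (ℕ.suc i) w h)) outside
        where open SetoidReasoning K.setoid

  N-ε : ∀ i → N₀[ i ] ε
  N-ε i = identity , identity

  N-∙ : ∀ {i g h} → N₀[ i ] g → N₀[ i ] h → N₀[ i ] (g ∙ h)
  N-∙ (a , b) (c , d) = product a c , product b d

  N-⁻¹ : ∀ {i g} → N₀[ i ] g → N₀[ i ] (g ⁻¹)
  N-⁻¹ (a , b) = inverse a , inverse b

  N-respects : ∀ {i g h} → g ≈ h → N₀[ i ] g → N₀[ i ] h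
  N-respects e (a , b) = respects e a , respects e b

  module _ {i : ℕ} (g : Generator i) where
    open Generator g

    private
      open BigCellRelations G using (divide)

      -- f sends a digit d to the coset of ξ d. Different digits have different cosets, and there
      -- are p of either, so every coset is met.
      digits-cover : (ix : HasIndex N₀[ i ] N₀[ ℕ.suc i ] p) → ∀ {h} → N₀[ i ] h → ∃[ d ] N₀[ ℕ.suc i ] (ξ d ⁻¹ ∙ h)
      digits-cover (r , r∈ , locate , _) {h} h∈ = found (injective⇒surjective f f-injective (proj₁ (locate h h∈)))
        where
        f : Fin p → Fin p
        f d = proj₁ (locate (ξ (nat (Fin.toℕ d))) (ξ∈N _))

        f∈ : ∀ d → N₀[ ℕ.suc i ] (r (f d) ⁻¹ ∙ ξ (nat (Fin.toℕ d)))
        f∈ d = proj₂ (locate (ξ (nat (Fin.toℕ d))) (ξ∈N _))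

        equal-digits : ∀ {d e} → d ℕ.< p → e ℕ.< p → (∃[ b ] nat e O.- nat d O.≈ π O.* b) → d ≡ e
        equal-digits {d} {e} d<p e<p (b , h) = ≡.sym (digit-unique e<p d<p (begin
          nat e O.+ π O.* O.0#                  ≈⟨ O.trans (O.+-congˡ (O.zeroʳ π)) (O.+-identityʳ _) ⟩
          nat e                                 ≈⟨ O.trans (O.+-congˡ (O.-‿inverseˡ (nat d))) (O.+-identityʳ _) ⟨
          nat e O.+ (O.- nat d O.+ nat d)       ≈⟨ O.+-assoc _ _ _ ⟨
          (nat e O.- nat d) O.+ nat d           ≈⟨ O.+-comm _ _ ⟩
          nat d O.+ (nat e O.- nat d)           ≈⟨ O.+-congˡ h ⟩
          nat d O.+ π O.* b                     ∎))
          where open SetoidReasoning O.setoid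

        difference : ∀ a b → ξ a ⁻¹ ∙ ξ b ≈ ξ (b O.- a)
        difference a b = sym (trans (ξ-cong (O.+-comm b (O.- a))) (trans (ξ-+ _ _) (∙-congʳ
          (trans (x-cong (K.trans (K.*-congʳ (ι.-‿homo a)) (K.sym (RingProperties.-‿distribˡ-* K.ring _ u)))) (x-neg β _)))))

        f-injective : ∀ d e → f d ≡ f e → d ≡ e
        f-injective d e h = FinP.toℕ-injective (equal-digits (FinP.toℕ<n d) (FinP.toℕ<n e) (ξ∈N⇒π∣ _
          (N-respects (trans (divide (r (f e)) _ _) (difference _ _))
            (N-∙ (N-⁻¹ (≡.subst (λ k → N₀[ ℕ.suc i ] (r k ⁻¹ ∙ ξ (nat (Fin.toℕ d)))) h (f∈ d))) (f∈ e)))))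

        found : (∃[ d ] f d ≡ proj₁ (locate h h∈)) → ∃[ d ] N₀[ ℕ.suc i ] (ξ d ⁻¹ ∙ h)
        found (d , e) = nat (Fin.toℕ d) , N-respects (divide (r (proj₁ (locate h h∈))) _ h)
          (N-∙ (N-⁻¹ (≡.subst (λ k → N₀[ ℕ.suc i ] (r k ⁻¹ ∙ ξ (nat (Fin.toℕ d)))) e (f∈ d))) (proj₂ (locate h h∈)))

    generator-cover : ∀ {h} → N₀[ i ] h → ∃[ d ] N₀[ ℕ.suc i ] (ξ d ⁻¹ ∙ h)
    generator-cover = digits-cover (index-p i)

  tower : (∀ i → Generator i) → Tower p 𝐊 P G N₀[_]
  tower gen = record
    { N-ε = N-ε ; N-∙ = N-∙ ; N-⁻¹ = N-⁻¹ ; N-respects = N-respects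
    ; N-decrease = λ {i} → decreasing i _
    ; ξ       = λ i → Generator.ξ (gen i)
    ; ξ-cong  = λ i → Generator.ξ-cong (gen i)
    ; ξ-+     = λ i → Generator.ξ-+ (gen i)
    ; ξ∈N     = λ i → Generator.ξ∈N (gen i)
    ; ξπ∈N    = λ i → Generator.ξπ∈N (gen i)
    ; ξ∈N⇒π∣  = λ i → Generator.ξ∈N⇒π∣ (gen i)
    ; cover   = λ {i} → generator-cover (gen i)
    }

module GalleryGenerators (p : ℕ) (𝐊 : LocalField) (P : PadicField p 𝐊) (𝐆 : SplitReductiveGroup (LocalField.K 𝐊))
  (R : RootDatum 𝐆) (chev : ChevalleySystem 𝐆 R) (Φ⁺ : PositiveSystem 𝐆 R) (𝒞 : Building.Gallery 𝐊 𝐆 R p Φ⁺) where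
  open LocalField 𝐊 renaming (K to ℚₚ)
  open Valuation p 𝐊 P
  open Residues p 𝐊 P using (ι-nat)
  open Building 𝐊 𝐆 R using (G; rootGroup; Products; _^ᵍ_; HasIndex)
  open Building.Gallery 𝒞
  open RootDatum R using (Φ; root; #Φ)
  open PositiveSystem Φ⁺ using (Positive; positives; ℓ)
  open Group G hiding (identity; inverse)
  open RootGroups p 𝐊 P 𝐆 R
  open Galleries p 𝐊 P 𝐆 R chev Φ⁺ 𝒞
  open BigCellRelations G using (divide)
  open Powers G using (⋅-ε)

  -- h lies in the subgroup exactly when h and ε have the same coset representative, which is
  -- decidable in Fin p.
  decide : ∀ i {h} → N₀[ i ] h → Dec (N₀[ ℕ.suc i ] h)
  decide i {h} h∈ = by-index (index-p i)
    where
    by-index : HasIndex N₀[ i ] N₀[ ℕ.suc i ] p → Dec (N₀[ ℕ.suc i ] h)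
    by-index (r , r∈ , locate , unique) = compare-cosets (locate h h∈) (locate ε (N-ε i))
      where
      compare-cosets : (∃[ j ] N₀[ ℕ.suc i ] (r j ⁻¹ ∙ h)) → (∃[ k ] N₀[ ℕ.suc i ] (r k ⁻¹ ∙ ε)) → Dec (N₀[ ℕ.suc i ] h)
      compare-cosets (j , hj) (k , hk) = by-equality (j FinP.≟ k)
        where
        by-equality : Dec (j ≡ k) → Dec (N₀[ ℕ.suc i ] h)
        by-equality (yes e) = yes (N-respects (trans (divide (r j) ε h) (trans (∙-congʳ (GroupProperties.ε⁻¹≈ε G)) (identityˡ h)))
          (N-∙ (N-⁻¹ (≡.subst (λ k → N₀[ ℕ.suc i ] (r k ⁻¹ ∙ ε)) (≡.sym e) hk)) hj))
        by-equality (no ne) = no λ h∈′ → ne (unique j k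
          (N-respects (trans (∙-congˡ (⁻¹-cong (identityʳ _))) (trans (∙-congʳ (trans (assoc _ h (h ⁻¹)) (trans (∙-congˡ (inverseʳ h)) (identityʳ _))))
            (∙-congˡ (GroupProperties.⁻¹-involutive G (r k)))))
            (N-∙ (N-∙ hj (N-⁻¹ h∈′)) (N-⁻¹ hk))))

  outside-element : ∀ i → ∃[ h ] N₀[ i ] h × ¬ N₀[ ℕ.suc i ] h
  outside-element i = by-index p p>1 (index-p i)
    where
    by-index : ∀ n → 1 ℕ.< n → HasIndex N₀[ i ] N₀[ ℕ.suc i ] n → ∃[ h ] N₀[ i ] h × ¬ N₀[ ℕ.suc i ] h
    by-index (ℕ.suc (ℕ.suc n)) _ (r , r∈ , _ , unique) = by-first (decide i (r∈ zero))
      where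
      by-first : Dec (N₀[ ℕ.suc i ] (r zero)) → ∃[ h ] N₀[ i ] h × ¬ N₀[ ℕ.suc i ] h
      by-first (no  r₀∉) = r zero , r∈ zero , r₀∉
      by-first (yes r₀∈) = r (suc zero) , r∈ (suc zero) , λ r₁∈ → FinP.0≢1+n (unique zero (suc zero) (N-∙ (N-⁻¹ r₀∈) r₁∈))
    by-index (ℕ.suc ℕ.zero) (ℕ.s≤s ()) _

  Scaled : ℕ → Φ → Carrier → Set
  Scaled i β a = ∃[ b ] N₀ b × rootGroup β b × a ≈ b ^ᵍ (p ℕ.^ e[ i , β ])

  Scaled-ε : ∀ i β → Scaled i β ε
  Scaled-ε i β = ε , N-ε 0 , (K.0# , sym (x-0 β)) , sym (⋅-ε (p ℕ.^ e[ i , β ]))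

  Products-ε : ∀ {S : Φ → Carrier → Set} → (∀ γ → S γ ε) → ∀ L → Products L S ε
  Products-ε s []      = refl
  Products-ε s (γ ∷ L) = ε , ε , s γ , Products-ε s L , sym (identityˡ ε)

  Products-single : ∀ {S : Φ → Carrier → Set} → (∀ γ → S γ ε) → ∀ {β a} L → β ∈ L → S β a → Products L S a
  Products-single s {a = a} (γ ∷ L) (here ≡.refl) h = a , ε , h , Products-ε s L , sym (identityʳ a)
  Products-single s {a = a} (γ ∷ L) (there m)     h = ε , a , s γ , Products-single s L m h , sym (identityˡ a)

  Scaled∈N : ∀ i {β a} → β ∈ positives → Scaled i β a → N₀[ i ] a
  Scaled∈N i m s = Equivalence.from (factors i _) (Products-single (Scaled-ε i) positives m s)

  private
    OutsideFactor : ℕ → Set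
    OutsideFactor i = ∃[ β ] ∃[ a ] β ∈ positives × Scaled i β a × N₀[ i ] a × ¬ N₀[ ℕ.suc i ] a

    -- If all factors were in the subgroup, so would be their product; `decide` tests them one after
    -- the other.
    search : ∀ i L → (∀ {β} → β ∈ L → β ∈ positives) → ∀ {h} → Products L (Scaled i) h → ¬ N₀[ ℕ.suc i ] h → OutsideFactor i
    search i []      L⊆ h≈ε h∉ = contradiction (N-respects (sym h≈ε) (N-ε (ℕ.suc i))) h∉
    search i (β ∷ L) L⊆ {h} (a , b , sa , pb , e) h∉ = by-first (decide i a∈)
      where
      a∈ : N₀[ i ] a
      a∈ = Scaled∈N i (L⊆ (here ≡.refl)) sa
      by-first : Dec (N₀[ ℕ.suc i ] a) → OutsideFactor i
      by-first (no  a∉)  = β , a , L⊆ (here ≡.refl) , sa , a∈ , a∉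
      by-first (yes a∈′) = search i L (L⊆ ∘ there) pb (λ b∈ → h∉ (N-respects (sym e) (N-∙ a∈′ b∈)))

    outside-factor : ∀ i → OutsideFactor i
    outside-factor i = from-element (outside-element i)
      where
      from-element : (∃[ h ] N₀[ i ] h × ¬ N₀[ ℕ.suc i ] h) → OutsideFactor i
      from-element (h , h∈ , h∉) = search i positives (λ m → m) (Equivalence.to (factors i h) h∈) h∉

  e-suc : ∀ i β → e[ ℕ.suc i , β ] ≡ List.length (List.filter (λ j → β FinP.≟ α j) (List.upTo i)) ℕ.+ List.length (List.filter (λ j → β FinP.≟ α j) (i ∷ []))
  e-suc i β = ≡.trans (≡.cong (List.length ∘ List.filter (λ j → β FinP.≟ α j)) (≡.sym (upTo-∷ʳ i)))
    (≡.trans (≡.cong List.length (filter-++ (λ j → β FinP.≟ α j) (List.upTo i) (i ∷ [])))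
      (length-++ (List.filter (λ j → β FinP.≟ α j) (List.upTo i))))

  e-other : ∀ {i β} → β ≢ α i → e[ ℕ.suc i , β ] ≡ e[ i , β ]
  e-other {i} {β} ne = ≡.trans (e-suc i β) (≡.trans (≡.cong (λ l → e[ i , β ] ℕ.+ List.length l) (filter-reject (λ j → β FinP.≟ α j) ne)) (ℕP.+-identityʳ _))

  e-same : ∀ i → e[ ℕ.suc i , α i ] ≡ ℕ.suc e[ i , α i ]
  e-same i = ≡.trans (e-suc i (α i)) (≡.trans (≡.cong (λ l → e[ i , α i ] ℕ.+ List.length l) (filter-accept (λ j → α i FinP.≟ α j) ≡.refl)) (ℕP.+-comm _ 1))

  x-power : ∀ β v n → x β (power K.+-group v (+ n)) ≈ x β v ^ᵍ n
  x-power β v n = power-homo K.+-group G (x β) (_⟹_.isHom (RootDatum.x R β) (base ℚₚ)) v (+ n)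

  -- Some element outside N₀⁽ⁱ⁺¹⁾ exists, and one of its factors a = b^(p^e), e = e[ i , β ], is
  -- outside too. For β ≠ α⁽ⁱ⁾ the exponent at i + 1 is still e, and `factors` would put a inside.
  -- So β = α⁽ⁱ⁾, and the exponent e + 1 puts aᵖ inside.
  gallery-generator : ∀ i → Σ[ g ∈ Generator i ] Generator.β g ≡ α i
  gallery-generator i = from-factor (outside-factor i)
    where
    from-factor : OutsideFactor i → Σ[ g ∈ Generator i ] Generator.β g ≡ α i
    from-factor (β , a , m , s@(b , b∈ , (v , b≈) , a≈) , a∈ , a∉) = by-root (β FinP.≟ α i)
      where
      pβ : Positive β
      pβ = proj₂ (∈-filter⁻ (λ α → 0ℤ ℤP.<? ⟪ root α , ℓ ⟫) {xs = List.allFin #Φ} m)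

      q = p ℕ.^ e[ i , β ]
      u = power K.+-group v (+ q)

      a≈x : a ≈ x β u
      a≈x = trans a≈ (trans (Powers.power-cong G (+ q) b≈) (sym (x-power β v q)))

      next≈ : x β (ι π K.* u) ≈ b ^ᵍ (p ℕ.* q)
      next≈ = trans (x-cong (ι-nat p u)) (trans (x-power β u p) (trans (Powers.power-cong G (+ p) (trans (sym a≈x) a≈))
        (trans (Powers.power-power G b (+ q) (+ p)) (reflexive (≡.cong (power G b) (≡.sym (ℤP.pos-* p q)))))))

      by-root : Dec (β ≡ α i) → Σ[ g ∈ Generator i ] Generator.β g ≡ α i
      by-root (no  ne) = contradiction (Scaled∈N (ℕ.suc i) m
        (b , b∈ , (v , b≈) , trans a≈ (reflexive (≡.cong (λ k → b ^ᵍ (p ℕ.^ k)) (≡.sym (e-other ne)))))) a∉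
      by-root (yes β≡) = record
        { β = β ; positive = pβ ; u = u
        ; inside  = respects a≈x (proj₁ a∈)
        ; outside = λ h → a∉ (respects (sym a≈x) h , respects (sym a≈x) (member (β , pβ , u , refl)))
        ; next    = proj₁ (Scaled∈N (ℕ.suc i) m (b , b∈ , (v , b≈) ,
            trans next≈ (reflexive (≡.cong (λ k → b ^ᵍ (p ℕ.^ k)) (≡.sym (exponent β≡))))))
        } , β≡
        where
        exponent : β ≡ α i → e[ ℕ.suc i , β ] ≡ ℕ.suc e[ i , β ]
        exponent ≡.refl = e-same i

  decreasing-≤ : ∀ {i j g} → i ℕ.≤ j → N₀[ j ] g → N₀[ i ] g
  decreasing-≤ {i} {j} {g} i≤j h = go (j ℕ.∸ i) (≡.subst (λ k → N₀[ k ] g) (≡.sym (ℕP.m∸n+n≡m i≤j)) h)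
    where
    go : ∀ k → N₀[ k ℕ.+ i ] g → N₀[ i ] g
    go ℕ.zero    h = h
    go (ℕ.suc k) h = go k (decreasing (k ℕ.+ i) g h)

  separated : ∀ {i j} → i ℕ.< j → ¬ (∀ g → N₀[ i ] g → N₀[ j ] g)
  separated {i} {j} i<j f = from-element (outside-element i)
    where
    from-element : (∃[ h ] N₀[ i ] h × ¬ N₀[ ℕ.suc i ] h) → ⊥
    from-element (h , h∈ , h∉) = h∉ (decreasing-≤ i<j (f h h∈))

-- Homomorphisms from ℤ_pˣ to ℚ_pˣ have integral values.

module UnitHomomorphisms (p : ℕ) (𝐊 : LocalField) (P : PadicField p 𝐊) where
  open LocalField 𝐊
  open Valuation p 𝐊 P
  open Expansions p 𝐊 P using (digit; rest; expansion; digit<p)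
  open Residues p 𝐊 P using (unit-or-divisible)
  private
    module Oˣ = Group (𝒪 ˣ)
    module Kˣ = Group (K ˣ)

  unit : ∀ {a w} → a O.* w O.≈ O.1# → ∣ 𝒪 ˣ ∣ᵍ
  unit {a} {w} h = record { val = a ; inv = w ; val∙inv = h ; inv∙val = O.trans (O.*-comm w a) h }

  record HasValuation (x : ∣ K ˣ ∣ᵍ) (k : ℤ) : Set where
    constructor hasValuation
    field
      unit-part : ∣ 𝒪 ˣ ∣ᵍ
      equation  : val x K.≈ pow k K.* ι (val unit-part)

  valuation-respects : ∀ {x y k} → x Kˣ.≈ y → HasValuation x k → HasValuation y k
  valuation-respects (mk≈ᵘ h) (hasValuation w e) = hasValuation w (K.trans (K.sym h) e)

  valuation-∙ : ∀ {x y k l} → HasValuation x k → HasValuation y l → HasValuation (x Kˣ.∙ y) (k ℤ.+ l)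
  valuation-∙ {k = k} {l} (hasValuation w e) (hasValuation w′ e′) = hasValuation (w Oˣ.∙ w′) (begin
    _                                                   ≈⟨ K.*-cong e e′ ⟩
    (pow k K.* ι (val w)) K.* (pow l K.* ι (val w′))    ≈⟨ S.solve 4 (λ a b c d → (a S.:* b) S.:* (c S.:* d) S.:= (a S.:* c) S.:* (b S.:* d)) K.refl _ _ _ _ ⟩
    (pow k K.* pow l) K.* (ι (val w) K.* ι (val w′))    ≈⟨ K.*-cong (pow-+ k l) (ι.*-homo _ _) ⟨
    pow (k ℤ.+ l) K.* ι (val w O.* val w′)              ∎)
    where
    open SetoidReasoning K.setoid
    module S = SemiringSolver K.commutativeSemiring

  private
    valuation-≤ : ∀ {x k l} → HasValuation x k → HasValuation x l → k ℤ.≤ l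
    valuation-≤ {x} {k} {l} (hasValuation w e) (hasValuation w′ e′) = pow∈⇒≤ l k (val w O.* inv w′ , (begin
      pow l                                             ≈⟨ K.*-identityʳ _ ⟨
      pow l K.* K.1#                                    ≈⟨ K.*-congˡ (K.trans (K.sym ι.1#-homo) (K.trans (ι.⟦⟧-cong (O.sym (val∙inv w′))) (ι.*-homo _ _))) ⟩
      pow l K.* (ι (val w′) K.* ι (inv w′))             ≈⟨ K.*-assoc _ _ _ ⟨
      (pow l K.* ι (val w′)) K.* ι (inv w′)             ≈⟨ K.*-congʳ (K.trans (K.sym e′) e) ⟩
      (pow k K.* ι (val w)) K.* ι (inv w′)              ≈⟨ K.*-assoc _ _ _ ⟩
      pow k K.* (ι (val w) K.* ι (inv w′))              ≈⟨ K.*-congˡ (ι.*-homo _ _) ⟨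
      pow k K.* ι (val w O.* inv w′)                    ∎))
      where open SetoidReasoning K.setoid

  valuation-unique : ∀ {x k l} → HasValuation x k → HasValuation x l → k ≡ l
  valuation-unique h h′ = ℤP.≤-antisym (valuation-≤ h h′) (valuation-≤ h′ h)

  private
    -- π is divided out of a as long as it divides a; for n = 0 the equation itself makes a a unit.
    split-π : ∀ n a b → a O.* b O.≈ π ^ n → ∃[ i ] Σ[ w ∈ ∣ 𝒪 ˣ ∣ᵍ ] a O.≈ π ^ i O.* val w
    split-π n a b h = by-cases n h (unit-or-divisible a)
      where
      by-cases : ∀ n → a O.* b O.≈ π ^ n → (∃[ c ] a O.≈ π O.* c) ⊎ (∃[ w ] a O.* w O.≈ O.1#) →
                 ∃[ i ] Σ[ w ∈ ∣ 𝒪 ˣ ∣ᵍ ] a O.≈ π ^ i O.* val w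
      by-cases n         h (inj₂ (w , u)) = 0 , unit u , O.sym (O.*-identityˡ a)
      by-cases ℕ.zero    h (inj₁ _)       = 0 , unit h , O.sym (O.*-identityˡ a)
      by-cases (ℕ.suc n) h (inj₁ (c , e)) = extend (split-π n c b (π-cancel (O.trans (O.sym (O.*-assoc π c b)) (O.trans (O.*-congʳ (O.sym e)) h))))
        where
        extend : (∃[ i ] Σ[ w ∈ ∣ 𝒪 ˣ ∣ᵍ ] c O.≈ π ^ i O.* val w) → ∃[ i ] Σ[ w ∈ ∣ 𝒪 ˣ ∣ᵍ ] a O.≈ π ^ i O.* val w
        extend (i , w , f) = ℕ.suc i , w , O.trans e (O.trans (O.*-congˡ f) (O.sym (O.*-assoc _ _ _)))

  -- Clearing denominators of x and x⁻¹ gives integral a and b with ab = pᵏ⁺ˡ, so a is a power of p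
  -- times a unit.
  valuation : ∀ x → ∃[ k ] HasValuation x k
  valuation x = from-fractions (fraction (val x)) (fraction (inv x))
    where
    open SetoidReasoning K.setoid
    module S = SemiringSolver K.commutativeSemiring
    from-fractions : (∃[ k ] ∃[ a ] val x K.* pow (+ k) K.≈ ι a) → (∃[ l ] ∃[ b ] inv x K.* pow (+ l) K.≈ ι b) →
                     ∃[ k ] HasValuation x k
    from-fractions (k , a , e) (l , b , f) = from-split (split-π (k ℕ.+ l) a b (ι-injective (begin
        ι (a O.* b)                                       ≈⟨ ι.*-homo a b ⟩
        ι a K.* ι b                                       ≈⟨ K.*-cong e f ⟨
        (val x K.* pow (+ k)) K.* (inv x K.* pow (+ l))   ≈⟨ S.solve 4 (λ a b c d → (a S.:* b) S.:* (c S.:* d) S.:= (a S.:* c) S.:* (b S.:* d)) K.refl _ _ _ _ ⟩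
        (val x K.* inv x) K.* (pow (+ k) K.* pow (+ l))   ≈⟨ K.*-cong (val∙inv x) (K.sym (pow-+ (+ k) (+ l))) ⟩
        K.1# K.* pow (+ (k ℕ.+ l))                        ≈⟨ K.*-identityˡ _ ⟩
        pow (+ (k ℕ.+ l))                                 ≈⟨ pow-nat (k ℕ.+ l) ⟩
        ι (π ^ (k ℕ.+ l))                                 ∎)))
      where
      from-split : (∃[ i ] Σ[ w ∈ ∣ 𝒪 ˣ ∣ᵍ ] a O.≈ π ^ i O.* val w) → ∃[ k ] HasValuation x k
      from-split (i , w , g) = ℤ.- (+ k) ℤ.+ + i , hasValuation w (pow-cancel (+ k) (begin
        pow (+ k) K.* val x                                    ≈⟨ K.trans (K.*-comm _ _) e ⟩
        ι a                                                    ≈⟨ K.trans (ι.⟦⟧-cong g) (ι.*-homo _ _) ⟩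
        ι (π ^ i) K.* ι (val w)                                ≈⟨ K.*-congʳ (pow-nat i) ⟨
        pow (+ i) K.* ι (val w)                                ≡⟨ ≡.cong (λ j → pow j K.* ι (val w)) index ⟨
        pow (+ k ℤ.+ (ℤ.- (+ k) ℤ.+ + i)) K.* ι (val w)        ≈⟨ K.*-congʳ (pow-+ (+ k) (ℤ.- (+ k) ℤ.+ + i)) ⟩
        (pow (+ k) K.* pow (ℤ.- (+ k) ℤ.+ + i)) K.* ι (val w)  ≈⟨ K.*-assoc _ _ _ ⟩
        pow (+ k) K.* (pow (ℤ.- (+ k) ℤ.+ + i) K.* ι (val w))  ∎))
        where
        index : + k ℤ.+ (ℤ.- (+ k) ℤ.+ + i) ≡ + i
        index = ≡.trans (≡.sym (ℤP.+-assoc (+ k) (ℤ.- (+ k)) (+ i))) (≡.trans (≡.cong (ℤ._+ + i) (ℤP.+-inverseʳ (+ k))) (ℤP.+-identityˡ (+ i)))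

  n<p^n : ∀ n → n ℕ.< p ℕ.^ n
  n<p^n ℕ.zero    = ℕ.z<s
  n<p^n (ℕ.suc n) = ℕP.<-≤-trans (ℕ.s≤s (n<p^n n)) (ℕP.≤-trans double (ℕP.*-monoˡ-≤ (p ℕ.^ n) p>1))
    where
    double : ℕ.suc (p ℕ.^ n) ℕ.≤ 2 ℕ.* (p ℕ.^ n)
    double = ≡.subst (ℕ.suc (p ℕ.^ n) ℕ.≤_) (≡.cong (p ℕ.^ n ℕ.+_) (≡.sym (ℕP.+-identityʳ (p ℕ.^ n))))
      (ℕP.+-monoˡ-≤ (p ℕ.^ n) (ℕP.≤-<-trans ℕ.z≤n (n<p^n n)))

  -- If l = k + pᴹ l with |k| + 1 < pᴹ then k = 0.
  infinitely-divisible : ∀ M k l → ℕ.suc ℤ.∣ k ∣ ℕ.< p ℕ.^ M → l ≡ k ℤ.+ + (p ℕ.^ M) ℤ.* l → k ≡ 0ℤ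
  infinitely-divisible M k l small h = by-size ℤ.∣ l ∣ ≡.refl
    where
    open import Data.Integer.Tactic.RingSolver using (solve-∀)
    q = p ℕ.^ M
    solved : k ≡ l ℤ.- + q ℤ.* l
    solved = ≡.trans (isolate k (+ q ℤ.* l)) (≡.cong (ℤ._- + q ℤ.* l) (≡.sym h))
      where
      isolate : ∀ k x → k ≡ (k ℤ.+ x) ℤ.- x
      isolate = solve-∀
    size : q ℕ.* ℤ.∣ l ∣ ℕ.≤ ℤ.∣ l ∣ ℕ.+ ℤ.∣ k ∣
    size = ≡.subst (ℕ._≤ ℤ.∣ l ∣ ℕ.+ ℤ.∣ k ∣) (ℤP.∣i*j∣≡∣i∣*∣j∣ (+ q) l)
      (≡.subst (λ z → ℤ.∣ z ∣ ℕ.≤ ℤ.∣ l ∣ ℕ.+ ℤ.∣ k ∣) {x = l ℤ.- k} {y = + q ℤ.* l} (≡.trans (≡.cong (λ z → l ℤ.- z) solved) (rearrange l (+ q ℤ.* l))) (ℤP.∣i-j∣≤∣i∣+∣j∣ l k))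
      where
      rearrange : ∀ l x → l ℤ.- (l ℤ.- x) ≡ x
      rearrange = solve-∀
    by-size : ∀ n → ℤ.∣ l ∣ ≡ n → k ≡ 0ℤ
    by-size ℕ.zero    e = ≡.trans solved (≡.trans (≡.cong (λ z → z ℤ.- + q ℤ.* z) {x = l} (ℤP.∣i∣≡0⇒i≡0 e)) (≡.trans (ℤP.+-identityˡ _) (≡.cong ℤ.-_ (ℤP.*-zeroʳ (+ q)))))
    by-size (ℕ.suc n) e = contradiction (≡.subst (λ m → q ℕ.* m ℕ.≤ m ℕ.+ ℤ.∣ k ∣) e size) (ℕP.<⇒≱ (too-big n))
      where
      too-big : ∀ n → ℕ.suc n ℕ.+ ℤ.∣ k ∣ ℕ.< q ℕ.* ℕ.suc n
      too-big ℕ.zero    = ≡.subst (ℕ.suc ℤ.∣ k ∣ ℕ.<_) (≡.sym (ℕP.*-identityʳ q)) small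
      too-big (ℕ.suc n) = ≡.subst (ℕ.suc (ℕ.suc n) ℕ.+ ℤ.∣ k ∣ ℕ.<_) (≡.sym (ℕP.*-suc q (ℕ.suc n)))
        (ℕP.+-mono-≤ (ℕP.≤-trans (ℕ.s≤s ℕ.z≤n) small) (too-big n))

  module _ (ψ : ∣ 𝒪 ˣ ∣ᵍ → ∣ K ˣ ∣ᵍ) (ψ-cong : ∀ {a b} → a Oˣ.≈ b → ψ a Kˣ.≈ ψ b)
           (ψ-∙ : ∀ a b → ψ (a Oˣ.∙ b) Kˣ.≈ ψ a Kˣ.∙ ψ b) where

    valuation-power : ∀ a k n → HasValuation (ψ a) k → HasValuation (ψ (power (𝒪 ˣ) a (+ ℕ.suc n))) (+ ℕ.suc n ℤ.* k)
    valuation-power a k ℕ.zero    h = ≡.subst (HasValuation _) (≡.sym (ℤP.*-identityˡ k)) (valuation-respects (ψ-cong (Oˣ.sym (Oˣ.identityʳ a))) h)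
    valuation-power a k (ℕ.suc n) h = ≡.subst (HasValuation _) (≡.sym (ℤP.suc-* (+ ℕ.suc n) k))
      (valuation-respects (Kˣ.sym (ψ-∙ a _)) (valuation-∙ h (valuation-power a k n h)))

    power-val : ∀ (a : ∣ 𝒪 ˣ ∣ᵍ) n → val (power (𝒪 ˣ) a (+ n)) O.≈ val a ^ n
    power-val a ℕ.zero    = O.refl
    power-val a (ℕ.suc n) = O.*-congˡ (power-val a n)

    -- b = c^(1 - pᴹ) for every M.
    valuation-1+π : ∀ b z → val b O.≈ O.1# O.+ π O.* z → HasValuation (ψ b) 0ℤ
    valuation-1+π b z b≈ = from-valuation (valuation (ψ b))
      where
      from-valuation : (∃[ k ] HasValuation (ψ b) k) → HasValuation (ψ b) 0ℤ
      from-valuation (k , h) = from-root (take-root (val b) z M ℕ.z<s b≈)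
        where
        -- So large that |k| + 1 < pᴹ.
        M = ℕ.suc ℤ.∣ k ∣
        from-root : (∃[ c ] (∃[ z′ ] c O.≈ O.1# O.+ π O.* z′) × c O.≈ val b O.* c ^ (p ℕ.^ M)) → HasValuation (ψ b) 0ℤ
        from-root (c , (z′ , c≈) , fixed) = from-c (valuation (ψ cˣ))
          where
          cˣ : ∣ 𝒪 ˣ ∣ᵍ
          cˣ = unit (O.trans (O.*-congʳ c≈) (proj₂ (1+π-unit z′)))
          from-c : (∃[ l ] HasValuation (ψ cˣ) l) → HasValuation (ψ b) 0ℤ
          from-c (l , g) = ≡.subst (HasValuation (ψ b)) (infinitely-divisible M k l (n<p^n M) (valuation-unique g by-power)) h
            where
            nonzero : ∃[ n ] ℕ.suc n ≡ p ℕ.^ M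
            nonzero = ℕ.pred (p ℕ.^ M) , ℕP.suc-pred (p ℕ.^ M) {{ℕ.>-nonZero (ℕP.≤-<-trans ℕ.z≤n (n<p^n M))}}
            by-power : HasValuation (ψ cˣ) (k ℤ.+ + (p ℕ.^ M) ℤ.* l)
            by-power = valuation-respects (Kˣ.trans (Kˣ.sym (ψ-∙ b _)) (ψ-cong (mk≈ᵘ (O.trans (O.*-congˡ (power-val cˣ (p ℕ.^ M))) (O.sym fixed)))))
              (valuation-∙ h (≡.subst (λ q → HasValuation (ψ (power (𝒪 ˣ) cˣ (+ q))) (+ q ℤ.* l)) (proj₂ nonzero)
                (valuation-power cˣ l (proj₁ nonzero) g)))

    -- Two of the p + 1 powers a⁰, ..., aᵖ have the same first digit, and their quotient lies in 1 +
    -- pℤ_p.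
    finite-order : ∀ a → ∃[ n ] ∃[ z ] val (power (𝒪 ˣ) a (+ ℕ.suc n)) O.≈ O.1# O.+ π O.* z
    finite-order a = from-collision (FinP.pigeonhole (ℕP.n<1+n p) (λ i → Fin.fromℕ< (digit<p (aⁿ (Fin.toℕ i)))))
      where
      aⁿ : ℕ → O.Carrier
      aⁿ n = val (power (𝒪 ˣ) a (+ n))
      from-collision : (∃[ i ] ∃[ j ] i Fin.< j × Fin.fromℕ< (digit<p (aⁿ (Fin.toℕ i))) ≡ Fin.fromℕ< (digit<p (aⁿ (Fin.toℕ j)))) →
                       ∃[ n ] ∃[ z ] val (power (𝒪 ˣ) a (+ ℕ.suc n)) O.≈ O.1# O.+ π O.* z
      from-collision (i , j , i<j , e) = from-difference (ℕP.m≤n⇒∃[o]m+o≡n i<j)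
        where
        m = Fin.toℕ i
        r = inv (power (𝒪 ˣ) a (+ m))
        from-difference : (∃[ k ] ℕ.suc m ℕ.+ k ≡ Fin.toℕ j) → ∃[ n ] ∃[ z ] val (power (𝒪 ˣ) a (+ ℕ.suc n)) O.≈ O.1# O.+ π O.* z
        from-difference (k , f) = k , r O.* (rest (aⁿ (Fin.toℕ j)) O.- rest (aⁿ m)) , (begin
          aⁿ (ℕ.suc k)                                            ≈⟨ O.*-identityˡ _ ⟨
          O.1# O.* aⁿ (ℕ.suc k)                                   ≈⟨ O.*-congʳ (inv∙val (power (𝒪 ˣ) a (+ m))) ⟨
          (r O.* aⁿ m) O.* aⁿ (ℕ.suc k)                           ≈⟨ O.*-assoc _ _ _ ⟩
          r O.* (aⁿ m O.* aⁿ (ℕ.suc k))                           ≈⟨ O.*-congˡ (val≈ (Powers.power-+ (𝒪 ˣ) a (+ m) (+ ℕ.suc k))) ⟨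
          r O.* aⁿ (m ℕ.+ ℕ.suc k)                                ≡⟨ ≡.cong (λ n → r O.* aⁿ n) (≡.trans (ℕP.+-suc m k) f) ⟩
          r O.* aⁿ (Fin.toℕ j)                                    ≈⟨ O.*-congˡ same-digit ⟩
          r O.* (aⁿ m O.+ π O.* (rest (aⁿ (Fin.toℕ j)) O.- rest (aⁿ m)))
            ≈⟨ O.distribˡ _ _ _ ⟩
          r O.* aⁿ m O.+ r O.* (π O.* (rest (aⁿ (Fin.toℕ j)) O.- rest (aⁿ m)))
            ≈⟨ O.+-cong (inv∙val (power (𝒪 ˣ) a (+ m))) (O.trans (O.sym (O.*-assoc _ _ _)) (O.trans (O.*-congʳ (O.*-comm _ _)) (O.*-assoc _ _ _))) ⟩
          O.1# O.+ π O.* (r O.* (rest (aⁿ (Fin.toℕ j)) O.- rest (aⁿ m))) ∎)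
          where
          open SetoidReasoning O.setoid
          digits : digit (aⁿ (Fin.toℕ j)) ≡ digit (aⁿ m)
          digits = ≡.trans (≡.sym (FinP.toℕ-fromℕ< (digit<p (aⁿ (Fin.toℕ j))))) (≡.trans (≡.cong Fin.toℕ (≡.sym e)) (FinP.toℕ-fromℕ< (digit<p (aⁿ m))))
          same-digit : aⁿ (Fin.toℕ j) O.≈ aⁿ m O.+ π O.* (rest (aⁿ (Fin.toℕ j)) O.- rest (aⁿ m))
          same-digit = begin
            aⁿ (Fin.toℕ j)                                            ≈⟨ expansion _ ⟩
            nat (digit (aⁿ (Fin.toℕ j))) O.+ π O.* rest (aⁿ (Fin.toℕ j)) ≡⟨ ≡.cong (λ d → nat d O.+ π O.* rest (aⁿ (Fin.toℕ j))) digits ⟩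
            nat (digit (aⁿ m)) O.+ π O.* rest (aⁿ (Fin.toℕ j))        ≈⟨ O.+-congˡ (O.*-congˡ split) ⟩
            nat (digit (aⁿ m)) O.+ π O.* (rest (aⁿ m) O.+ (rest (aⁿ (Fin.toℕ j)) O.- rest (aⁿ m))) ≈⟨ O.+-congˡ (O.distribˡ _ _ _) ⟩
            nat (digit (aⁿ m)) O.+ (π O.* rest (aⁿ m) O.+ π O.* (rest (aⁿ (Fin.toℕ j)) O.- rest (aⁿ m))) ≈⟨ O.+-assoc _ _ _ ⟨
            (nat (digit (aⁿ m)) O.+ π O.* rest (aⁿ m)) O.+ π O.* (rest (aⁿ (Fin.toℕ j)) O.- rest (aⁿ m)) ≈⟨ O.+-congʳ (expansion _) ⟨
            aⁿ m O.+ π O.* (rest (aⁿ (Fin.toℕ j)) O.- rest (aⁿ m))    ∎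
            where
            split : ∀ {x y} → x O.≈ y O.+ (x O.- y)
            split {x} {y} = O.sym (O.trans (O.+-comm _ _) (O.trans (O.+-assoc _ _ _) (O.trans (O.+-congˡ (O.-‿inverseˡ y)) (O.+-identityʳ x))))

    -- ℤ_pˣ is generated by torsion and infinitely divisible elements up to p-powers, so it has no
    -- nontrivial homomorphism to ℤ.
    homomorphism-integral : ∀ a → ∃[ w ] val (ψ a) K.≈ ι w
    homomorphism-integral a = from-order (finite-order a) (valuation (ψ a))
      where
      from-order : (∃[ n ] ∃[ z ] val (power (𝒪 ˣ) a (+ ℕ.suc n)) O.≈ O.1# O.+ π O.* z) →
                   (∃[ k ] HasValuation (ψ a) k) → ∃[ w ] val (ψ a) K.≈ ι w
      from-order (n , z , e) (k , h) = integral-part (≡.subst (HasValuation (ψ a)) k≡0 h)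
        where
        k≡0 : k ≡ 0ℤ
        k≡0 = ℤP.*-cancelˡ-≡ (+ ℕ.suc n) k 0ℤ (≡.trans (valuation-unique (valuation-power a k n h) (valuation-1+π _ z e)) (≡.sym (ℤP.*-zeroʳ (+ ℕ.suc n))))
        integral-part : HasValuation (ψ a) 0ℤ → ∃[ w ] val (ψ a) K.≈ ι w
        integral-part (hasValuation w f) = val w , K.trans f (K.*-identityˡ _)

-- Chambers n·C⁽ⁱ⁾ and the coordinates on Y.

module Chambers (p : ℕ) (𝐊 : LocalField) (P : PadicField p 𝐊) (𝐆 : SplitReductiveGroup (LocalField.K 𝐊))
  (R : RootDatum 𝐆) (chev : ChevalleySystem 𝐆 R) (Φ⁺ : PositiveSystem 𝐆 R) (𝒞 : Building.Gallery 𝐊 𝐆 R p Φ⁺) where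
  open LocalField 𝐊 renaming (K to ℚₚ)
  open Valuation p 𝐊 P using (module K)
  open Building 𝐊 𝐆 R using (G; inT; Iwahori; Moves; Chamber; chambers; _⋆_; _∼_; _·_; [_])
  open Building.Gallery 𝒞
  open Group G hiding (identity; inverse)
  open Conjugation G
  open BigCellRelations G
  open RootGroups p 𝐊 P 𝐆 R
  open Galleries p 𝐊 P 𝐆 R chev Φ⁺ 𝒞 using (N-respects; N-∙; N-⁻¹)
  open GalleryGenerators p 𝐊 P 𝐆 R chev Φ⁺ 𝒞 using (separated)
  open Setoid chambers public using () renaming (refl to ∼-refl; sym to ∼-sym; trans to ∼-trans)

  ≈⇒∼ : ∀ {g h} D → g ≈ h → (g ⋆ D) ∼ (h ⋆ D)
  ≈⇒∼ {g} {h} D e = record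
    { n       = _∼_.n r
    ; moves   = _∼_.moves r
    ; iwahori = respects (∙-congʳ (∙-congˡ e)) (_∼_.iwahori r)
    }
    where r = ∼-refl {g ⋆ D}

  ·-cong : ∀ g {c d} → c ∼ d → g · c ∼ g · d
  ·-cong g {c} {d} r = record
    { n       = _∼_.n r
    ; moves   = _∼_.moves r
    ; iwahori = respects (∙-congʳ (sym (divideˡ g (Chamber.translate c) (Chamber.translate d)))) (_∼_.iwahori r)
    }

  ·-assoc : ∀ g h c → g · h · c ∼ (g ∙ h) · c
  ·-assoc g h (k ⋆ D) = ≈⇒∼ D (sym (assoc g h k))

  ·-≈ : ∀ {g h} c → g ≈ h → g · c ∼ h · c
  ·-≈ (k ⋆ D) e = ≈⇒∼ D (∙-congʳ e)

  Moves-ε : ∀ D → Moves ε D D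
  Moves-ε D = (λ t → (t , conj-by-ε (inT t)) , (t , trans (conj-cong (GroupProperties.ε⁻¹≈ε G) refl) (conj-by-ε (inT t))))
    , λ g → mk⇔ (respects (sym (conj-by-ε g))) (respects (conj-by-ε g))

  Iwahori-fixes : ∀ {g h} D → Iwahori D (g ⁻¹ ∙ h) → g · [ D ] ∼ h · [ D ]
  Iwahori-fixes {g} {h} D i = record
    { n       = ε
    ; moves   = Moves-ε D
    ; iwahori = respects (trans (sym (identityʳ _)) (∙-congʳ (sym (∙-cong (⁻¹-cong (identityʳ g)) (identityʳ h))))) i
    }

  N-fixes : ∀ i {g h} → N₀[ i ] (g ⁻¹ ∙ h) → g · [ C i ] ∼ h · [ C i ]
  N-fixes i (h , _) = Iwahori-fixes (C i) h

  -- gC = hD implies that g⁻¹h carries I_D to I_C.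
  module Equal {g h D E} (r : g · [ D ] ∼ h · [ E ]) where
    m = _∼_.n r

    iwahori : Iwahori D ((g ⁻¹ ∙ h) ∙ m)
    iwahori = respects (∙-congʳ (∙-cong (⁻¹-cong (identityʳ g)) (identityʳ h))) (_∼_.iwahori r)

    to : ∀ {k} → Iwahori D k → Iwahori E (conj G m k)
    to {k} = Equivalence.to (proj₂ (_∼_.moves r) k)

    from : ∀ {k} → Iwahori E (conj G m k) → Iwahori D k
    from {k} = Equivalence.from (proj₂ (_∼_.moves r) k)

    transport : ∀ {k} → Iwahori D k → Iwahori E (conj G (h ⁻¹ ∙ g) k)
    transport {k} i = respects (transport-identity g h m k) (to (product (product (inverse iwahori) i) iwahori))

  -- With u = g⁻¹h ∈ N, equality of the chambers gives um ∈ I for I the Iwahori subgroup of C i. So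
  -- u ∈ I and m ∈ I, hence C i and C j have the same Iwahori subgroup, and i = j because the groups
  -- N₀⁽ⁱ⁾ strictly decrease.
  N-chambers : ∀ {i j g h} → N₀ g → N₀ h → g · [ C i ] ∼ h · [ C j ] → i ≡ j × N₀[ i ] (g ⁻¹ ∙ h)
  N-chambers {i} {j} {g} {h} g∈ h∈ r = i≡j , gh∈ , n∈
    where
    open Equal r
    n∈ : N (g ⁻¹ ∙ h)
    n∈ = product (inverse (proj₂ g∈)) (proj₂ h∈)
    gh∈ : Iwahori (C i) (g ⁻¹ ∙ h)
    gh∈ = IwahoriFacts.Iwahori-N-part p 𝐊 P 𝐆 R chev (C i) Φ⁺ n∈ (proj₁ (_∼_.moves r)) iwahori
    m∈ : Iwahori (C i) m
    m∈ = respects (cancelˡ (g ⁻¹ ∙ h) m) (product (inverse gh∈) iwahori)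
    forward : ∀ k → Iwahori (C i) k → Iwahori (C j) k
    forward k k∈ = respects (conj-inverseʳ m k) (to (product (product (inverse m∈) k∈) (inverse (inverse m∈))))
    backward : ∀ k → Iwahori (C j) k → Iwahori (C i) k
    backward k k∈ = respects (conj-inverseʳ m k) (product (product m∈ (from (respects (sym (conj-inverseʳ m k)) k∈))) (inverse m∈))
    i≡j : i ≡ j
    i≡j = by-order (ℕP.<-cmp i j)
      where
      open import Relation.Binary.Definitions using (Tri)
      by-order : Tri (i ℕ.< j) (i ≡ j) (j ℕ.< i) → i ≡ j
      by-order (tri< i<j _ _) = contradiction (λ k (a , b) → forward k a , b) (separated i<j)
      by-order (tri≈ _ e _)   = e
      by-order (tri> _ _ j<i) = contradiction (λ k (a , b) → backward k a , b) (separated j<i)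

module YCoordinates (p : ℕ) (𝐊 : LocalField) (P : PadicField p 𝐊) (𝐆 : SplitReductiveGroup (LocalField.K 𝐊))
  (R : RootDatum 𝐆) (chev : ChevalleySystem 𝐆 R) (Φ⁺ : PositiveSystem 𝐆 R) (𝒞 : Building.Gallery 𝐊 𝐆 R p Φ⁺)
  (tower : Tower p 𝐊 P (Building.G 𝐊 𝐆 R) (Building.Gallery.N₀[_] 𝒞)) where
  open Valuation p 𝐊 P using (module O)
  open Expansions p 𝐊 P
  open HalfTreeCoordinates p 𝐊 P
  open Building 𝐊 𝐆 R using (G; Chamber; _∼_; _·_; [_]; module HalfTreeY)
  open Building.Gallery 𝒞
  open HalfTreeY Φ⁺ 𝒞 using (Y; InY)
  open Group G hiding (identity; inverse)
  open TowerCoordinates p 𝐊 P G N₀[_] tower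
  open Tower tower
  open Chambers p 𝐊 P 𝐆 R chev Φ⁺ 𝒞
  open BigCellRelations G using (divide)

  chamber : Position → Chamber
  chamber (i , z) = F i z · [ C i ]

  position : ∀ {c} → InY c → Position
  position (n , n∈ , i , _) = i , proj₁ (F-surjective i n∈)

  chamber-position : ∀ {c} (y : InY c) → c ∼ chamber (position y)
  chamber-position (n , n∈ , i , r) = ∼-trans r (∼-sym (N-fixes i (proj₂ (F-surjective i n∈))))

  chamber∈Y : ∀ x → InY (chamber x)
  chamber∈Y (i , z) = F i z , F∈N i z , i , ∼-refl

  chamber-≃ : ∀ {x y} → x ≃ y → chamber x ∼ chamber y
  chamber-≃ {i , z} (same ≡.refl h) = N-fixes i (F-mod-N i h)

  ≃-chamber : ∀ {x y} → chamber x ∼ chamber y → x ≃ y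
  ≃-chamber {i , z} {j , w} r = from-N (N-chambers (F∈N i z) (F∈N j w) r)
    where
    from-N : i ≡ j × N₀[ i ] (F i z ⁻¹ ∙ F j w) → (i , z) ≃ (j , w)
    from-N (≡.refl , h) = same ≡.refl (mod-sym (F-injective i h))

  -- F (i + 1) z and F i z agree modulo N₀⁽ⁱ⁺¹⁾.
  chamber-refine : ∀ i z → F i z · [ C (ℕ.suc i) ] ∼ chamber (ℕ.suc i , z)
  chamber-refine i z = ∼-sym (N-fixes (ℕ.suc i) (F-suc-N i z))

  chamber-coarsen : ∀ i z → F (ℕ.suc i) z · [ C i ] ∼ chamber (i , z)
  chamber-coarsen i z = N-fixes i (N-decrease (F-suc-N i z))

  private
    chambers-inverse : Inverse (subsetoid (Building.chambers 𝐊 𝐆 R) InY) positions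
    chambers-inverse = record
      { to        = λ (_ , y) → position y
      ; from      = λ x → chamber x , chamber∈Y x
      ; to-cong   = λ {(_ , y)} {(_ , y′)} r → ≃-chamber (∼-trans (∼-sym (chamber-position y)) (∼-trans r (chamber-position y′)))
      ; from-cong = chamber-≃
      ; inverse   = (λ {x} {(_ , y)} r → ≃-chamber (∼-trans (∼-sym (chamber-position y)) r))
                  , (λ {(_ , y)} {x} e → ∼-trans (chamber-≃ e) (∼-sym (chamber-position y)))
      }

    Ends : Chamber → Chamber → Set
    Ends v e = (∃[ n ] N₀ n × ∃[ i ] e ∼ n · [ C (ℕ.suc i) ] × (v ∼ n · [ C i ] ⊎ v ∼ n · [ C (ℕ.suc i) ]))
               ⊎ (e ∼ [ C 0 ] × v ∼ [ C 0 ])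

    base-chamber : ∀ z → chamber (0 , z) ∼ [ C 0 ]
    base-chamber z = ∼-trans (N-fixes 0 {F 0 z} {ε} (N-∙ (N-⁻¹ (F∈N 0 z)) (N-ε 0))) (≈⇒∼ (C 0) (identityʳ ε))

    incident : ∀ {v e} (v∈ : InY v) (e∈ : InY e) → Ends v e → Incident (position v∈) (position e∈)
    incident v∈ e∈ (inj₂ (e∼ , v∼)) =
      inj₁ (≃-chamber (∼-trans (∼-sym (chamber-position v∈)) (∼-trans v∼ (∼-trans (∼-sym e∼) (chamber-position e∈)))))
    incident v∈ e∈ (inj₁ (n , n∈ , i , e∼ , inj₂ v∼)) =
      inj₁ (≃-chamber (∼-trans (∼-sym (chamber-position v∈)) (∼-trans v∼ (∼-trans (∼-sym e∼) (chamber-position e∈)))))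
    -- One number z gives the positions of both ends: n agrees with F (i + 1) z modulo N₀⁽ⁱ⁺¹⁾,
    -- hence with F i z modulo N₀⁽ⁱ⁾.
    incident v∈ e∈ (inj₁ (n , n∈ , i , e∼ , inj₁ v∼)) = from-surjective (F-surjective (ℕ.suc i) n∈)
      where
      from-surjective : (∃[ z ] N₀[ ℕ.suc i ] (F (ℕ.suc i) z ⁻¹ ∙ n)) → Incident (position v∈) (position e∈)
      from-surjective (z , h) = inj₂ (Child-respects
        (≃-chamber (∼-trans (N-fixes i (N-respects (divide (F (ℕ.suc i) z) (F i z) n) (N-∙ (N-⁻¹ (N-decrease (F-suc-N i z))) (N-decrease h))))
          (∼-trans (∼-sym v∼) (chamber-position v∈))))
        (≃-chamber (∼-trans (N-fixes (ℕ.suc i) h) (∼-trans (∼-sym e∼) (chamber-position e∈))))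
        (child ≡.refl (mod-refl O.refl)))

    ends : ∀ {v e} x y → v ∼ chamber x → e ∼ chamber y → Incident x y → Ends v e
    ends x (ℕ.zero , z)  v∼ e∼ (inj₁ h) = inj₂ (∼-trans e∼ (base-chamber z) , ∼-trans v∼ (∼-trans (chamber-≃ h) (base-chamber z)))
    ends x (ℕ.suc i , z) v∼ e∼ (inj₁ h) = inj₁ (F (ℕ.suc i) z , F∈N (ℕ.suc i) z , i , e∼ , inj₂ (∼-trans v∼ (chamber-≃ h)))
    ends (i , w) (_ , z) v∼ e∼ (inj₂ (child ≡.refl h)) = inj₁ (F (ℕ.suc i) z , F∈N (ℕ.suc i) z , i , e∼ ,
      inj₁ (∼-trans v∼ (∼-trans (chamber-≃ (same ≡.refl (mod-sym h))) (∼-sym (chamber-coarsen i z)))))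

  Y-coordinates : Coordinates Y
  Y-coordinates = record
    { onVertices   = chambers-inverse
    ; onEdges      = chambers-inverse
    ; incidence    = λ (_ , v∈) (_ , e∈) → mk⇔ (incident v∈ e∈) (ends _ _ (chamber-position v∈) (chamber-position e∈))
    ; origin-level = ≡.refl
    }

  module _ {s a} (σ : Scales s a) (s-fixes : ∀ i → s · [ C i ] ∼ [ C i ]) where
    -- As s fixes all chambers of the gallery, j is free; j = i + 1 is the case of the children.
    affine-chamber′ : ∀ i j b z → affine i s a b z · F i z · [ C j ] ∼ F i (a O.* z O.+ b) · [ C j ]
    affine-chamber′ i j b z = ∼-trans (·-assoc _ _ [ C j ]) (∼-trans (·-≈ [ C j ] (affine-apply i s a b z))
      (∼-trans (∼-sym (·-assoc _ s [ C j ])) (·-cong _ (s-fixes j))))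

    affine-chamber : ∀ i b z → affine i s a b z · chamber (i , z) ∼ chamber (i , a O.* z O.+ b)
    affine-chamber i b z = affine-chamber′ i i b z

    -- The element was formed at the parent z. Because w ≡ z modulo pⁱ it is also the one formed at
    -- w, and F i w and F (i + 1) w carry C⁽ⁱ⁺¹⁾ to the same chamber. So one element of G induces
    -- the map on all of ]v[.
    affine-child : ∀ i b z {w} → w ≡ z [mod i ] →
                   affine i s a b z · chamber (ℕ.suc i , w) ∼ chamber (ℕ.suc i , a O.* w O.+ b)
    affine-child i b z {w} h = ∼-trans (·-cong _ (∼-sym (chamber-refine i w)))
      (∼-trans (·-≈ _ (affine-mod i b σ (mod-sym h)))
        (∼-trans (affine-chamber′ i (ℕ.suc i) b w) (chamber-refine i (a O.* w O.+ b))))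

-- The isomorphism Θ and the elements g and h.

module Comparisons (p : ℕ) (𝐊 : LocalField) (P : PadicField p 𝐊) (𝐆 : SplitReductiveGroup (LocalField.K 𝐊))
  (R : RootDatum 𝐆) (chev : ChevalleySystem 𝐆 R) (Φ⁺ : PositiveSystem 𝐆 R) (𝒞 : Building.Gallery 𝐊 𝐆 R p Φ⁺)
  (tower : Tower p 𝐊 P (Building.G 𝐊 𝐆 R) (Building.Gallery.N₀[_] 𝒞)) where
  open LocalField 𝐊 renaming (K to ℚₚ)
  open Valuation p 𝐊 P using (module O; module K; nat; π; _^_)
  open Expansions p 𝐊 P
  open Residues p 𝐊 P using (nat-1; nat-*)
  open HalfTreeCoordinates p 𝐊 P
  open TreeCoordinates p 𝐊 P
  open AffineMatrices ℚₚ using (Affine₂)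
  open Building 𝐊 𝐆 R using (G; torus; inT; _∼_; _·_; [_])
  open Building.Gallery 𝒞 using (C; N₀[_])
  open Comparison 𝐊 𝐆 R Φ⁺ p 𝒞 using (Y; 𝔛₊; Vertex; _≈ᵛ_; _∈]_[; _↦⟨_⟩_; _↦[_,_]_; Induces;
    PropertyA; PropertyB; PropertyC; Section; PreservesY¹; γ; 𝔛⁰)
  open Group G hiding (identity; inverse)
  open Tower tower
  open TowerCoordinates p 𝐊 P G N₀[_] tower
  open Chambers p 𝐊 P 𝐆 R chev Φ⁺ 𝒞
  open YCoordinates p 𝐊 P 𝐆 R chev Φ⁺ 𝒞 tower
  open RootGroups p 𝐊 P 𝐆 R using (inT-cong)
  private
    module 𝔛⁰ = Setoid 𝔛⁰
    module 𝔛¹ = Setoid (unorderedPairs 𝔛⁰)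
    module Oˣ = Group (𝒪 ˣ)

  Θ : Y ≅ 𝔛₊
  Θ = isomorphism Y-coordinates 𝔛₊-coordinates

  pos : Vertex → Position
  pos (_ , y) = position y

  chamber-pos : ∀ v → proj₁ v ∼ chamber (pos v)
  chamber-pos (_ , y) = chamber-position y

  at-position : Position → Vertex
  at-position x = chamber x , chamber∈Y x

  pos-at : ∀ x → pos (at-position x) ≃ x
  pos-at x = ≃-chamber (∼-sym (chamber-pos (at-position x)))

  pos-cong : ∀ {v w} → v ≈ᵛ w → pos v ≃ pos w
  pos-cong {v} {w} r = ≃-chamber (∼-trans (∼-sym (chamber-pos v)) (∼-trans r (chamber-pos w)))

  pos-chamber : ∀ {v} x → proj₁ v ∼ chamber x → pos v ≃ x
  pos-chamber {v} x r = ≃-chamber (∼-trans (∼-sym (chamber-pos v)) r)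

  affineAt : Position → Carrier → O.Carrier → O.Carrier → Carrier
  affineAt (i , z) s a b = affine i s a b z

  affineAt-≃ : ∀ {x y s a} b → Scales s a → x ≃ y → affineAt x s a b ≈ affineAt y s a b
  affineAt-≃ {i , _} b σ (same ≡.refl h) = affine-mod i b σ h

  affineAt-≈ : ∀ x {s s′ a a′ b b′} → s ≈ s′ → a O.≈ a′ → b O.≈ b′ → affineAt x s a b ≈ affineAt x s′ a′ b′
  affineAt-≈ (i , z) s≈ a≈ b≈ = ∙-congʳ (∙-cong (F-cong i (O.+-cong (O.*-congʳ a≈) b≈)) s≈)

  image : O.Carrier → O.Carrier → Position → Position
  image a b (i , z) = i , a O.* z O.+ b

  image-≃ : ∀ a b {x y} → x ≃ y → image a b x ≃ image a b y
  image-≃ a b (same ≡.refl h) = same ≡.refl (mod-affine a b h)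

  -- An affine transformation of ℤ_p on both sides: z ↦ a z + b is m on 𝔛₊ and affineAt _ s a b on Y.
  module Action {s} (a : ∣ 𝒪 ˣ ∣ᵍ) (b : O.Carrier) {m} (mᵃ : Affine₂ m (ι (val a)) (ι b))
                (σ : Scales s (val a)) (s-fixes : ∀ i → s · [ C i ] ∼ [ C i ]) where

    tree-image : ∀ v v′ → pos v′ ≃ image (val a) b (pos v) → v ↦[ Θ , m ] v′
    tree-image v v′ h = 𝔛⁰.trans (vertex-≃ h) (affine-vertex a b mᵃ (+ proj₁ (pos v)) (proj₂ (pos v)))

    chamber-image : ∀ v → affineAt (pos v) s (val a) b · proj₁ v ∼ chamber (image (val a) b (pos v))
    chamber-image v = ∼-trans (·-cong _ (chamber-pos v)) (affine-chamber σ s-fixes (proj₁ (pos v)) b (proj₂ (pos v)))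

    pos-image : ∀ v v′ → v ↦⟨ affineAt (pos v) s (val a) b ⟩ v′ → pos v′ ≃ image (val a) b (pos v)
    pos-image v v′ r = pos-chamber {v′} _ (∼-trans r (chamber-image v))

    target : Vertex → Vertex
    target v = at-position (image (val a) b (pos v))

    acts : ∀ v → v ↦⟨ affineAt (pos v) s (val a) b ⟩ target v
    acts v = ∼-sym (chamber-image v)

    private
      children : ∀ v w → w ∈] v [ → w ↦⟨ affineAt (pos v) s (val a) b ⟩ target w
      children v w w∈ = ∼-sym (∼-trans (·-cong _ (chamber-pos w)) (child-image (pos v) (pos w) (∈]_[⇒Child Y-coordinates v w∈)))
        where
        child-image : ∀ x y → Child x y → affineAt x s (val a) b · chamber y ∼ chamber (image (val a) b y)
        child-image (i , z) _ (child ≡.refl h) = affine-child σ s-fixes i b z h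

      image-child : ∀ {x y} → Child x y → Child (image (val a) b x) (image (val a) b y)
      image-child (child ≡.refl h) = child ≡.refl (mod-affine (val a) b h)

      target-child : ∀ v w → w ∈] v [ → target w ∈] target v [
      target-child v w w∈ = Child⇒∈]_[ Y-coordinates (target v) {target w}
        (Child-respects (≃-sym (pos-at _)) (≃-sym (pos-at _)) (image-child (∈]_[⇒Child Y-coordinates v w∈)))

      -- The inverse map z ↦ a⁻¹(z - b).
      preimage : Position → Position
      preimage = image (inv a) (inv a O.* O.- b)

      cancel : ∀ z → inv a O.* (val a O.* z O.+ b) O.+ inv a O.* O.- b O.≈ z
      cancel z = begin
        inv a O.* (val a O.* z O.+ b) O.+ inv a O.* O.- b   ≈⟨ O.distribˡ _ _ _ ⟨
        inv a O.* ((val a O.* z O.+ b) O.+ O.- b)           ≈⟨ O.*-congˡ (O.trans (O.+-assoc _ _ _) (O.trans (O.+-congˡ (O.-‿inverseʳ b)) (O.+-identityʳ _))) ⟩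
        inv a O.* (val a O.* z)                             ≈⟨ O.*-assoc _ _ _ ⟨
        (inv a O.* val a) O.* z                             ≈⟨ O.trans (O.*-congʳ (inv∙val a)) (O.*-identityˡ z) ⟩
        z                                                   ∎
        where open SetoidReasoning O.setoid

      cancel′ : ∀ z → val a O.* (inv a O.* z O.+ inv a O.* O.- b) O.+ b O.≈ z
      cancel′ z = begin
        val a O.* (inv a O.* z O.+ inv a O.* O.- b) O.+ b   ≈⟨ O.+-congʳ (O.*-congˡ (O.sym (O.distribˡ _ _ _))) ⟩
        val a O.* (inv a O.* (z O.+ O.- b)) O.+ b           ≈⟨ O.+-congʳ (O.trans (O.sym (O.*-assoc _ _ _)) (O.trans (O.*-congʳ (val∙inv a)) (O.*-identityˡ _))) ⟩
        (z O.+ O.- b) O.+ b                                 ≈⟨ O.trans (O.+-assoc _ _ _) (O.trans (O.+-congˡ (O.-‿inverseˡ b)) (O.+-identityʳ z)) ⟩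
        z                                                   ∎
        where open SetoidReasoning O.setoid

      preimage-child : ∀ x y → Child (image (val a) b x) y → Child x (preimage y)
      preimage-child (i , z) _ (child ≡.refl h) =
        child ≡.refl (mod-trans (mod-affine (inv a) (inv a O.* O.- b) h) (mod-refl (cancel z)))

      source : ∀ v w′ → w′ ∈] target v [ → Σ[ w ∈ Vertex ] w ∈] v [ × w ↦[ Θ , m ] w′
      source v w′ w∈ = w
        , Child⇒∈]_[ Y-coordinates v {w} (Child-respects ≃-refl (≃-sym (pos-at _)) (preimage-child (pos v) (pos w′)
            (Child-respects (pos-at _) ≃-refl (∈]_[⇒Child Y-coordinates (target v) w∈))))
        , tree-image w w′ (≃-sym (≃-trans (image-≃ (val a) b (pos-at (preimage (pos w′)))) (same ≡.refl (mod-refl (cancel′ (proj₂ (pos w′)))))))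
        where w = at-position (preimage (pos w′))

    induces : ∀ v → Induces Θ m v (affineAt (pos v) s (val a) b)
    induces v = target v , tree-image v (target v) (pos-at _)
      , (λ w w∈ → target w , target-child v w w∈ , tree-image w (target w) (pos-at _) , children v w w∈)
      , source v

  g : Vertex → ℕ → Carrier
  g v b = affineAt (pos v) ε O.1# (nat b)

  ε-fixes : ∀ i → ε · [ C i ] ∼ [ C i ]
  ε-fixes i = ≈⇒∼ (C i) (identityˡ ε)

  module ν^ (b : ℕ) = Action (Oˣ.ε) (nat b) (ν-affine b) scales-ε ε-fixes

  propertyA : PropertyA Θ g
  propertyA = record
    { g-cong  = λ {v} {v′} b r → affineAt-≃ (nat b) scales-ε (pos-cong {v} {v′} r)
    ; g∈N₀    = λ v b → affine∈N (proj₁ (pos v)) (nat b) (proj₂ (pos v))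
    ; induces = λ v b → ν^.induces b v
    }

  module TorusAction (τ : ∣ 𝒪 ˣ ∣ᵍ → ∣ torus ∣ᵍ) (section : Section τ)
    (τ-scales : ∀ a → Scales (inT (τ a)) (val a)) (τ-fixes : ∀ a i → inT (τ a) · [ C i ] ∼ [ C i ]) where

    h : Vertex → ∣ 𝒪 ˣ ∣ᵍ → Carrier
    h v a = affineAt (pos v) (inT (τ a)) (val a) O.0#

    module γ (a : ∣ 𝒪 ˣ ∣ᵍ) = Action a O.0# (γ-affine a) (τ-scales a) (τ-fixes a)

    τ-cong : ∀ {a a′} → a Oˣ.≈ a′ → Group._≈_ torus (τ a) (τ a′)
    τ-cong = GroupMorphisms.IsGroupHomomorphism.⟦⟧-cong (Section.isHom section)

    private
      compose-h-g : ∀ v v₁ a → v ↦⟨ g v 1 ⟩ v₁ →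
                    h v₁ a ∙ g v 1 ≈ affineAt (pos v) (inT (τ a) ∙ ε) (val a O.* O.1#) (val a O.* nat 1 O.+ O.0#)
      compose-h-g v v₁ a r = trans (∙-congʳ (affineAt-≃ O.0# (τ-scales a) (ν^.pos-image 1 v v₁ r)))
        (affine-compose (proj₁ (pos v)) (nat 1) O.0# scales-ε (τ-scales a) (proj₂ (pos v)) (mod-refl O.refl))

      compose-g-h : ∀ v v₂ a m → v ↦⟨ h v a ⟩ v₂ →
                    g v₂ m ∙ h v a ≈ affineAt (pos v) (ε ∙ inT (τ a)) (O.1# O.* val a) (O.1# O.* O.0# O.+ nat m)
      compose-g-h v v₂ a m r = trans (∙-congʳ (affineAt-≃ (nat m) scales-ε (γ.pos-image a v v₂ r)))
        (affine-compose (proj₁ (pos v)) O.0# (nat m) (τ-scales a) scales-ε (proj₂ (pos v)) (mod-refl O.refl))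

    propertyC : PropertyC τ Θ g h
    propertyC = record
      { h-cong  = λ {v} {v′} {a} {a′} r e → trans (affineAt-≃ O.0# (τ-scales a) (pos-cong {v} {v′} r))
                    (affineAt-≈ (pos v′) (inT-cong (τ-cong e)) (val≈ e) O.refl)
      ; h∈N₀τ   = λ v a → affine∈Ns (proj₁ (pos v)) O.0# (τ-scales a) (proj₂ (pos v))
      ; induces = λ v a → γ.induces a v
      ; h-acts  = λ v a → γ.target a v , γ.acts a v
      -- Both sides are attached to z ↦ az + a, on the left as a(z + 1), on the right as az + m with
      -- m = a.
      ; cocycle = λ m a a≈m v v₁ v₂ r₁ r₂ → trans (compose-h-g v v₁ a r₁) (trans
          (affineAt-≈ (pos v) (trans (identityʳ _) (sym (identityˡ _))) (O.*-comm _ _)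
            (O.trans (O.+-identityʳ _) (O.trans (O.*-congˡ nat-1) (O.trans (O.*-identityʳ _)
              (O.trans a≈m (O.sym (O.trans (O.+-congʳ (O.zeroʳ _)) (O.+-identityˡ _))))))))
          (sym (compose-g-h v v₂ a m r₂)))
      }

  module ShiftAction (φ : Carrier) (r : ℕ) (shifts : ∀ i → φ · [ C i ] ∼ [ C (i ℕ.+ r) ])
    (ξ-shift : ∀ i c → conj G φ (ξ i c) ≈ ξ (i ℕ.+ r) c) where
    open Shifted φ r ξ-shift
    open BigCellRelations G using (conj-swap)

    shifted : Position → Position
    shifted (i , z) = i ℕ.+ r , π ^ r O.* z

    -- φ F i z = F (i + r) (pʳz) φ, and φ carries C⁽ⁱ⁾ to C⁽ⁱ⁺ʳ⁾.
    chamber-shift : ∀ x → φ · chamber x ∼ chamber (shifted x)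
    chamber-shift (i , z) = ∼-trans (·-assoc φ (F i z) [ C i ]) (∼-trans (·-≈ [ C i ] (conj-swap φ (F i z)))
      (∼-trans (∼-sym (·-assoc (conj G φ (F i z)) φ [ C i ])) (∼-trans (·-cong _ (shifts i)) (·-≈ _ (F-shift i z)))))

    preservesY¹ : PreservesY¹ φ
    preservesY¹ e = at-position (shifted (pos e)) , ∼-sym (∼-trans (·-cong φ (chamber-pos e)) (chamber-shift (pos e)))

    pos-shift : ∀ v v′ → v ↦⟨ φ ⟩ v′ → pos v′ ≃ shifted (pos v)
    pos-shift v v′ h = pos-chamber {v′} _ (∼-trans h (∼-trans (·-cong φ (chamber-pos v)) (chamber-shift (pos v))))

    affineAt-shift : ∀ v v′ {s a b b′} → Scales s a → s ∙ φ ≈ φ ∙ s → b′ O.≈ π ^ r O.* b → v ↦⟨ φ ⟩ v′ →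
                     affineAt (pos v′) s a b′ ∙ φ ≈ φ ∙ affineAt (pos v) s a b
    affineAt-shift v v′ {s} {a} {b} {b′} σ commute b≈ h = trans
      (∙-congʳ (trans (affineAt-≃ b′ σ (pos-shift v v′ h)) (affineAt-≈ (shifted (pos v)) refl O.refl b≈)))
      (affine-shift (proj₁ (pos v)) b (proj₂ (pos v)) commute)

    nat-^ : ∀ n → nat (p ℕ.^ n) O.≈ π ^ n
    nat-^ ℕ.zero    = nat-1
    nat-^ (ℕ.suc n) = O.trans (nat-* p (p ℕ.^ n)) (O.*-congˡ (nat-^ n))

    propertyB : PropertyB φ r Θ g
    propertyB = record
      { equivariantᵛ = λ v v′ h → 𝔛⁰.trans (vertex-≃ (pos-shift v v′ h)) (≈⇒≈ᵗ (φ-vertex r (+ proj₁ (pos v)) (proj₂ (pos v))))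
      ; equivariantᵉ = λ e e′ h → 𝔛¹.trans (edge-≃ (pos-shift e e′ h)) (φ-edge r (proj₁ (pos e)) (proj₂ (pos e)))
      -- Under z ↦ pʳz the translation by 1 becomes the translation by pʳ.
      ; commutes     = λ v v′ h → affineAt-shift v v′ scales-ε (trans (identityˡ φ) (sym (identityʳ φ)))
          (O.trans (nat-^ r) (O.sym (O.trans (O.*-congˡ nat-1) (O.*-identityʳ _)))) h
      }

-- Choices compatible with φ, and torus elements that fix chambers.

-- Only the values of base on 0 ≤ i < r enter.
module Periodic {A : ℕ → Set} (r : ℕ) {{r≢0 : ℕ.NonZero r}} (base : ∀ i → A i) (step : ∀ i → A i → A (i ℕ.+ r)) where

  private
    shift-index : ∀ q j → (j ℕ.+ q ℕ.* r) ℕ.+ r ≡ j ℕ.+ ℕ.suc q ℕ.* r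
    shift-index q j = ≡.trans (ℕP.+-assoc j (q ℕ.* r) r) (≡.cong (j ℕ.+_) (ℕP.+-comm (q ℕ.* r) r))

    iterate : ∀ q j → A (j ℕ.+ q ℕ.* r)
    iterate ℕ.zero    j = base (j ℕ.+ 0)
    iterate (ℕ.suc q) j = ≡.subst A (shift-index q j) (step (j ℕ.+ q ℕ.* r) (iterate q j))

  family : ∀ i → A i
  family i = ≡.subst A (≡.sym (m≡m%n+[m/n]*n i r)) (iterate (i / r) (i % r))

  module _ {B : Set} (f : ∀ i → A i → B) where
    private
      f-subst : ∀ {i j} (e : i ≡ j) a → f j (≡.subst A e a) ≡ f i a
      f-subst ≡.refl a = ≡.refl

      step-subst : ∀ {i j} (e : i ≡ j) a → f (j ℕ.+ r) (step j (≡.subst A e a)) ≡ f (i ℕ.+ r) (step i a)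
      step-subst ≡.refl a = ≡.refl

    -- The intermediate terms live over indices that are only propositionally equal; f brings them
    -- into one type.
    family-step : ∀ i → f (i ℕ.+ r) (family (i ℕ.+ r)) ≡ f (i ℕ.+ r) (step i (family i))
    family-step i = ≡.trans (f-subst (≡.sym (m≡m%n+[m/n]*n (i ℕ.+ r) r)) _) (≡.trans
      (≡.cong₂ (λ q j → f (j ℕ.+ q ℕ.* r) (iterate q j)) quotient-suc ([m+n]%n≡m%n i r)) (≡.trans
      (f-subst (shift-index (i / r) (i % r)) _)
      (≡.sym (step-subst (≡.sym (m≡m%n+[m/n]*n i r)) _))))
      where
      quotient-suc : (i ℕ.+ r) / r ≡ ℕ.suc (i / r)
      quotient-suc = ≡.trans (m/n≡1+[m∸n]/n (ℕP.m≤n+m r i)) (≡.cong (λ k → ℕ.suc (k / r)) (ℕP.m+n∸n≡m i r))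

module NormaliserAction (p : ℕ) (𝐊 : LocalField) (P : PadicField p 𝐊) (𝐆 : SplitReductiveGroup (LocalField.K 𝐊))
  (R : RootDatum 𝐆) (chev : ChevalleySystem 𝐆 R) where
  open LocalField 𝐊 renaming (K to ℚₚ)
  open Valuation p 𝐊 P using (module K)
  open Building 𝐊 𝐆 R using (G; torus; inT)
  open RootDatum R using (Φ; w; reflect)
  open ChevalleySystem chev
  open Group G hiding (identity; inverse)
  open Conjugation G
  open RootGroups p 𝐊 P 𝐆 R

  record PermutesRootGroups (m : Carrier) : Set where
    constructor permutes
    field
      σ      : Φ → Φ
      factor : Φ → K.Carrier
      conj-m : ∀ α u → conj G m (x α u) ≈ x (σ α) (factor α K.* u)

  permutes-respects : ∀ {m m′} → m ≈ m′ → PermutesRootGroups m → PermutesRootGroups m′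
  permutes-respects e (permutes σ c h) = permutes σ c λ α u → trans (conj-cong (sym e) refl) (h α u)

  permutes-ε : PermutesRootGroups ε
  permutes-ε = permutes (λ α → α) (λ _ → K.1#) λ α u → trans (conj-by-ε _) (x-cong (K.sym (K.*-identityˡ u)))

  permutes-∙ : ∀ {m m′} → PermutesRootGroups m → PermutesRootGroups m′ → PermutesRootGroups (m ∙ m′)
  permutes-∙ {m} {m′} (permutes σ c h) (permutes σ′ c′ h′) = permutes (σ ∘ σ′) (λ α → c (σ′ α) K.* c′ α) λ α u →
    trans (conj-by-∙ m m′ (x α u)) (trans (conj-cong refl (h′ α u)) (trans (h (σ′ α) _) (x-cong (K.sym (K.*-assoc _ _ u)))))

  permutes-T : ∀ t → PermutesRootGroups (inT t)
  permutes-T t = permutes (λ α → α) (λ α → χ α t) λ α u → conj-x α t u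

  permutes-w : ∀ α → PermutesRootGroups (w α (base ℚₚ))
  permutes-w α = permutes (reflect α) (λ β → proj₁ (signed β)) (λ β → proj₂ (signed β))
    where
    signed : ∀ β → ∃[ c ] ∀ u → conj G (w α (base ℚₚ)) (x β u) ≈ x (reflect α β) (c K.* u)
    signed β = [ (λ h → K.1# , λ u → trans (h (base ℚₚ) u) (x-cong (K.sym (K.*-identityˡ u))))
               , (λ h → K.- K.1# , λ u → trans (h (base ℚₚ) u) (x-cong (K.sym (RingProperties.-1*x≈-x K.ring u))))
               ]′ (weyl α β)

  permutes-product : ∀ L → PermutesRootGroups (List.foldr (λ α g → w α (base ℚₚ) ∙ g) ε L)
  permutes-product []      = permutes-ε
  permutes-product (α ∷ L) = permutes-∙ (permutes-w α) (permutes-product L)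

  -- m is a product of an element of T and of the representatives w α. T scales the root groups by
  -- characters, and by `weyl` each w α permutes them up to sign.
  normaliser-permutes : ∀ {m} → NormalisesT 𝐆 m → PermutesRootGroups m
  normaliser-permutes {m} n = from-product (normaliser m n)
    where
    from-product : (∃[ t ] Σ[ L ∈ List Φ ] m ≈ inT t ∙ List.foldr (λ α g → w α (base ℚₚ) ∙ g) ε L) → PermutesRootGroups m
    from-product (t , L , e) = permutes-respects (sym e) (permutes-∙ (permutes-T t) (permutes-product L))

module TorusFixes (p : ℕ) (𝐊 : LocalField) (P : PadicField p 𝐊) (𝐆 : SplitReductiveGroup (LocalField.K 𝐊))
  (R : RootDatum 𝐆) (chev : ChevalleySystem 𝐆 R) where
  open LocalField 𝐊 renaming (K to ℚₚ)
  open Valuation p 𝐊 P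
  open Building 𝐊 𝐆 R using (G; torus; inT; Alcove; Iwahori; Moves; T₀; _∼_; _·_; [_])
  open RootDatum R using (Φ; root)
  open Group G hiding (identity; inverse)
  open Conjugation G
  open RootGroups p 𝐊 P 𝐆 R
  private
    module Oˣ = Group (𝒪 ˣ)
    module Kˣ = Group (ℚₚ ˣ)
    module 𝐓 = Group torus

  -- Read off from the action on x α 1, as x α is injective.
  χ-∙ : ∀ α t s → χ α (t 𝐓.∙ s) K.≈ χ α t K.* χ α s
  χ-∙ α t s = K.trans (K.sym (K.*-identityʳ _)) (K.trans (x-injective α (begin
      x α (χ α (t 𝐓.∙ s) K.* K.1#)           ≈⟨ conj-x α (t 𝐓.∙ s) K.1# ⟨
      conj G (inT (t 𝐓.∙ s)) (x α K.1#)      ≈⟨ conj-cong (inT-∙ t s) refl ⟩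
      conj G (inT t ∙ inT s) (x α K.1#)      ≈⟨ conj-by-∙ (inT t) (inT s) _ ⟩
      conj G (inT t) (conj G (inT s) (x α K.1#)) ≈⟨ conj-cong refl (conj-x α s K.1#) ⟩
      conj G (inT t) (x α (χ α s K.* K.1#))  ≈⟨ conj-x α t _ ⟩
      x α (χ α t K.* (χ α s K.* K.1#))       ∎)) (K.*-congˡ (K.*-identityʳ _)))
    where open SetoidReasoning setoid

  Integral : ∣ torus ∣ᵍ → Set
  Integral t = ∀ α → ∃[ w ] χ α t K.≈ ι w

  -- The section property speaks only of the roots α⁽ⁱ⁾. For all other roots it is the general
  -- result on homomorphisms from ℤ_pˣ that makes α ∘ τ integral.
  homomorphism-Integral : (τ : ∣ 𝒪 ˣ ∣ᵍ → ∣ torus ∣ᵍ) → IsGroupHom (𝒪 ˣ) torus τ → ∀ a → Integral (τ a)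
  homomorphism-Integral τ τ-isHom a α = UnitHomomorphisms.homomorphism-integral p 𝐊 P (λ a → character ℚₚ (root α) (τ a))
    (λ h → character-cong ℚₚ (root α) (τ.⟦⟧-cong h))
    (λ a b → Kˣ.trans (character-cong ℚₚ (root α) (τ.homo a b)) (mk≈ᵘ (χ-∙ α (τ a) (τ b)))) a
    where module τ = GroupMorphisms.IsGroupHomomorphism τ-isHom

  module _ (D : Alcove) where
    open IwahoriGroup p 𝐊 P 𝐆 R chev D using (F; F-elim; F-intro; 𝔞; 𝔞-cong; 𝔞-ι*)

    conj-Iwahori : ∀ {t g} → Integral t → Iwahori D g → Iwahori D (conj G (inT t) g)
    conj-Iwahori {t} int = generated-conj (inT t) generator-conj
      where
      root-conj : ∀ {α g} → (∃[ u ] 𝔞 α u × g ≈ x α u) → (∃[ w ] χ α t K.≈ ι w) → Iwahori D (conj G (inT t) g)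
      root-conj {α} (u , d , e) (w , f) = respects (trans (sym (conj-x α t u)) (conj-cong refl (sym e)))
        (member (inj₂ (α , F-intro (𝔞-cong (K.*-congʳ (K.sym f)) (𝔞-ι* w d)) refl)))
      generator-conj : ∀ {g} → (T₀ g ⊎ ∃[ α ] F α g) → Iwahori D (conj G (inT t) g)
      generator-conj (inj₁ (s , e)) = member (inj₁ (s , trans (conj-cong refl e)
        (trans (∙-congʳ (inT-commute t (integral s))) (trans (assoc _ _ _) (trans (∙-congˡ (inverseʳ _)) (identityʳ _))))))
      generator-conj (inj₂ (α , f)) = root-conj (F-elim f) (int α)

    torus-moves : ∀ t → Integral t → Integral (t 𝐓.⁻¹) → Moves (inT t) D D
    torus-moves t int int⁻¹ = (λ s → (s , commutes t s) , (s , trans (conj-cong (sym (inT-⁻¹ t)) refl) (commutes (t 𝐓.⁻¹) s)))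
      , λ g → mk⇔ (conj-Iwahori int) (λ h → respects (trans (conj-cong (inT-⁻¹ t) refl) (conj-inverseˡ (inT t) g)) (conj-Iwahori int⁻¹ h))
      where
      commutes : ∀ t s → conj G (inT t) (inT s) ≈ inT s
      commutes t s = trans (∙-congʳ (inT-commute t s)) (trans (assoc _ _ _) (trans (∙-congˡ (inverseʳ _)) (identityʳ _)))

    -- It is enough that t normalises I_D: the pairs (t , D) and (1 , D) are then equivalent through
    -- n = t ∈ N(T).
    torus-fixes : ∀ t → Integral t → Integral (t 𝐓.⁻¹) → inT t · [ D ] ∼ [ D ]
    torus-fixes t int int⁻¹ = record
      { n       = inT t
      ; moves   = torus-moves t int int⁻¹
      ; iwahori = respects (sym (trans (∙-congʳ (trans (identityʳ _) (⁻¹-cong (identityʳ _)))) (inverseˡ _))) identity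
      }

  homomorphism-fixes : (τ : ∣ 𝒪 ˣ ∣ᵍ → ∣ torus ∣ᵍ) → IsGroupHom (𝒪 ˣ) torus τ → ∀ D a → inT (τ a) · [ D ] ∼ [ D ]
  homomorphism-fixes τ τ-isHom D a = torus-fixes D (τ a) (homomorphism-Integral τ τ-isHom a) inverse-integral
    where
    inverse-integral : Integral (τ a 𝐓.⁻¹)
    inverse-integral α = from (homomorphism-Integral τ τ-isHom (a Oˣ.⁻¹) α)
      where
      from : (∃[ w ] χ α (τ (a Oˣ.⁻¹)) K.≈ ι w) → ∃[ w ] χ α (τ a 𝐓.⁻¹) K.≈ ι w
      from (w , e) = w , K.trans (val≈ (character-cong ℚₚ (root α)
        (𝐓.sym (GroupMorphisms.IsGroupHomomorphism.⁻¹-homo τ-isHom a)))) e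

module ShiftedGenerators (p : ℕ) (𝐊 : LocalField) (P : PadicField p 𝐊) (𝐆 : SplitReductiveGroup (LocalField.K 𝐊))
  (R : RootDatum 𝐆) (chev : ChevalleySystem 𝐆 R) (Φ⁺ : PositiveSystem 𝐆 R) (𝒞 : Building.Gallery 𝐊 𝐆 R p Φ⁺) where
  open LocalField 𝐊 renaming (K to ℚₚ)
  open Valuation p 𝐊 P
  open Building 𝐊 𝐆 R using (G; Iwahori; Alcove; _∼_; _·_; [_])
  open Building.Gallery 𝒞
  open RootDatum R using (neg)
  open PositiveSystem Φ⁺ using (Positive; Negative)
  open Group G hiding (identity; inverse)
  open Conjugation G
  open BigCellRelations G using (trivial-twist)
  open RootGroups p 𝐊 P 𝐆 R
  open Roots 𝐆 R using (slopes)
  open RootOrder 𝐆 R Φ⁺ (slopes Φ⁺) using (sign; neg-positive)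
  open Galleries p 𝐊 P 𝐆 R chev Φ⁺ 𝒞
  open Chambers p 𝐊 P 𝐆 R chev Φ⁺ 𝒞
  open NormaliserAction p 𝐊 P 𝐆 R chev
  open IntegersInℚ
  import Data.Rational.Properties as ℚP
  private
    module I (i : ℕ) = IwahoriGroup p 𝐊 P 𝐆 R chev (C i)
    module D (i : ℕ) = Depths 𝐆 R (Alcove.point (C i))

    Iwahori-root : ∀ i β {u} → Iwahori (C i) (x β u) → I.𝔞 i β u
    Iwahori-root i = IwahoriFacts.Iwahori-root p 𝐊 P 𝐆 R chev (C i) Φ⁺

    neg-swap : ∀ {a b} → a ≡ ℚ.- b → b ≡ ℚ.- a
    neg-swap ≡.refl = ≡.sym (GroupProperties.⁻¹-involutive ℚP.+-0-group _)

  -- For β < 0 the groups I_{C⁽ʲ⁾} ∩ N_β increase with j, as I_{C⁽ʲ⁾} ∩ N_{-β} decreases.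
  negative-increase : ∀ j {β u} → Negative β → Iwahori (C j) (x β u) → Iwahori (C (ℕ.suc j)) (x β u)
  negative-increase j {β} {u} β<0 h = from-level (Iwahori-root j β h)
    where
    δ = neg β
    from-level : I.𝔞 j β u → Iwahori (C (ℕ.suc j)) (x β u)
    from-level (I.mk𝔞 k deep d) = by-depth (D.depth (ℕ.suc j) β ℚP.≤? int k)
      where
      δ-level : ∀ i → D.depth i δ ≡ ℚ.- D.depth i β
      δ-level i = D.depth-neg i β

      by-depth : Dec (D.depth (ℕ.suc j) β ℚ.≤ int k) → Iwahori (C (ℕ.suc j)) (x β u)
      by-depth (yes deep′) = member (inj₂ (β , I.F-intro (ℕ.suc j) (I.mk𝔞 k deep′ d) refl))
      -- If k is below the depth of β at C⁽ʲ⁺¹⁾, then p⁻ᵏ is deep enough for -β there, hence by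
      -- `decreasing` also at C⁽ʲ⁾. This bounds the depth of β at C⁽ʲ⁾ below by k; so it equals k,
      -- and C⁽ʲ⁾ would meet a wall.
      by-depth (no shallow) = contradiction (ℚP.≤-antisym deep (lower (Iwahori-root j δ pow∈)))
          (D.depth≢int j (Alcove.generic (C j)) {β} {k})
        where
        δ-deep : D.depth (ℕ.suc j) δ ℚ.≤ int (ℤ.- k)
        δ-deep = ≡.subst₂ ℚ._≤_ (≡.sym (δ-level (ℕ.suc j))) (≡.sym (int-neg k)) (ℚP.neg-antimono-≤ (ℚP.<⇒≤ (ℚP.≰⇒> shallow)))
        pow∈ : Iwahori (C j) (x δ (pow (ℤ.- k)))
        pow∈ = proj₁ (decreasing j _
          ( member (inj₂ (δ , I.F-intro (ℕ.suc j) (I.mk𝔞 (ℤ.- k) δ-deep (∈-pow (ℤ.- k))) refl))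
          , member (δ , neg-positive β<0 , _ , refl)))
        lower : I.𝔞 j δ (pow (ℤ.- k)) → int k ℚ.≤ D.depth j β
        lower (I.mk𝔞 l deep″ d″) = ≡.subst₂ ℚ._≤_ (≡.sym (neg-swap (int-neg k))) (≡.sym (neg-swap (δ-level j)))
          (ℚP.neg-antimono-≤ (ℚP.≤-trans deep″ (int-mono (pow∈⇒≤ (ℤ.- k) l d″))))

  module _ {φ r} (normal : NormalisesT 𝐆 φ) (shifts : ∀ i → φ · [ C i ] ∼ [ C (i ℕ.+ r) ]) where
    open PermutesRootGroups (normaliser-permutes normal)

    private
      equal-chambers : ∀ i → φ · [ C i ] ∼ ε · [ C (i ℕ.+ r) ]
      equal-chambers i = ∼-trans (shifts i) (≈⇒∼ (C (i ℕ.+ r)) (sym (identityˡ ε)))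

      conj-φ : ∀ i {k} → Iwahori (C i) k → Iwahori (C (i ℕ.+ r)) (conj G φ k)
      conj-φ i {k} h = respects (conj-cong (trans (∙-congʳ (GroupProperties.ε⁻¹≈ε G)) (identityˡ φ)) refl)
        (Equal.transport (equal-chambers i) h)

      conj-φ⁻¹ : ∀ i {k} → Iwahori (C (i ℕ.+ r)) (conj G φ k) → Iwahori (C i) k
      conj-φ⁻¹ i {k} h = respects (trivial-twist φ k)
        (Equal.transport (∼-sym (equal-chambers i)) h)

    -- Conjugation by φ carries everything over except positivity. Were σ β negative,
    -- `negative-increase` would put the new element into the next Iwahori subgroup, against
    -- `outside`.
    shifted-generator : ∀ i → Generator i → Generator (i ℕ.+ r)
    shifted-generator i g = record
      { β        = β′
      ; positive = positive′ (sign β′)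
      ; u        = u′
      ; inside   = inside′
      ; outside  = outside′
      ; next     = respects (trans (conj-m β _) (x-cong move)) (conj-φ (ℕ.suc i) next)
      }
      where
      open Generator g
      β′ = σ β
      u′ = factor β K.* u

      move : ∀ {c} → factor β K.* (c K.* u) K.≈ c K.* u′
      move = K.trans (K.sym (K.*-assoc _ _ _)) (K.trans (K.*-congʳ (K.*-comm _ _)) (K.*-assoc _ _ _))

      inside′ : Iwahori (C (i ℕ.+ r)) (x β′ u′)
      inside′ = respects (conj-m β u) (conj-φ i inside)

      outside′ : ¬ Iwahori (C (ℕ.suc (i ℕ.+ r))) (x β′ u′)
      outside′ h = outside (conj-φ⁻¹ (ℕ.suc i) (respects (sym (conj-m β u)) h))

      positive′ : Positive β′ ⊎ Negative β′ → Positive β′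
      positive′ (inj₁ q) = q
      positive′ (inj₂ n) = contradiction (negative-increase (i ℕ.+ r) n inside′) outside′

    shifted-ξ : ∀ i g c → conj G φ (Generator.ξ g c) ≈ Generator.ξ (shifted-generator i g) c
    shifted-ξ i g c = trans (conj-m β (ι c K.* u))
      (x-cong (K.trans (K.sym (K.*-assoc _ _ _)) (K.trans (K.*-congʳ (K.*-comm _ _)) (K.*-assoc _ _ _))))
      where open Generator g

-- The four parts of the theorem.

module Theorem (p : ℕ) (𝐊 : LocalField) (P : PadicField p 𝐊) (𝐆 : SplitReductiveGroup (LocalField.K 𝐊))
  (R : RootDatum 𝐆) (chev : ChevalleySystem 𝐆 R) (Φ⁺ : PositiveSystem 𝐆 R) (𝒞 : Building.Gallery 𝐊 𝐆 R p Φ⁺) where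
  open LocalField 𝐊 renaming (K to ℚₚ)
  open Valuation p 𝐊 P using (module O; module K; π; _^_)
  open Building 𝐊 𝐆 R using (torus; inT; _∼_; _·_; [_])
  open Building.Gallery 𝒞 using (N₀[_])
  open Comparison 𝐊 𝐆 R Φ⁺ p 𝒞 using (G; Y; 𝔛₊; Vertex; Shift; Section; CommutesWith; PreservesY¹; PropertyA; PropertyB; PropertyC; PropertyD; C)
  open Group G hiding (identity; inverse)
  open Conjugation G
  open RootGroups p 𝐊 P 𝐆 R
  open Galleries p 𝐊 P 𝐆 R chev Φ⁺ 𝒞
  open GalleryGenerators p 𝐊 P 𝐆 R chev Φ⁺ 𝒞 using (gallery-generator)
  open ShiftedGenerators p 𝐊 P 𝐆 R chev Φ⁺ 𝒞
  open TorusFixes p 𝐊 P 𝐆 R chev using (homomorphism-fixes)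
  private module Cmp = Comparisons p 𝐊 P 𝐆 R chev Φ⁺ 𝒞

  ScaledBy : (∣ 𝒪 ˣ ∣ᵍ → ∣ torus ∣ᵍ) → ∀ {i} → Generator i → Set
  ScaledBy τ g = ∀ a c → conj G (inT (τ a)) (Generator.ξ g c) ≈ Generator.ξ g (val a O.* c)

  base-generator : ∀ i → Generator i
  base-generator i = proj₁ (gallery-generator i)

  base-scaled : ∀ τ → Section τ → ∀ i → ScaledBy τ (base-generator i)
  base-scaled τ s i a c = from-root (gallery-generator i)
    where
    from-root : (g : Σ[ g ∈ Generator i ] Generator.β g ≡ Building.Gallery.α 𝒞 i) →
                conj G (inT (τ a)) (Generator.ξ (proj₁ g) c) ≈ Generator.ξ (proj₁ g) (val a O.* c)
    from-root (g , e) = trans (conj-x β (τ a) _) (x-cong (K.trans (K.*-congʳ (K.trans (K.reflexive (≡.cong (λ α → χ α (τ a)) e)) (Section.section s i a)))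
      (K.trans (K.sym (K.*-assoc _ _ _)) (K.*-congʳ (K.sym (Valuation.ι.*-homo p 𝐊 P (val a) c))))))
      where open Generator g using (β)

  fixes : ∀ τ → Section τ → ∀ a i → inT (τ a) · [ C i ] ∼ [ C i ]
  fixes τ s a i = homomorphism-fixes τ (Section.isHom s) (C i) a

  part-a : Σ[ Θ ∈ Y ≅ 𝔛₊ ] Σ[ g ∈ (Vertex → ℕ → Carrier) ] PropertyA Θ g
  part-a = Cmp.Θ (tower base-generator) , Cmp.g (tower base-generator) , Cmp.propertyA (tower base-generator)

  part-c : ∀ τ → Section τ → Σ[ Θ ∈ Y ≅ 𝔛₊ ] Σ[ g ∈ (Vertex → ℕ → Carrier) ] Σ[ h ∈ (Vertex → ∣ 𝒪 ˣ ∣ᵍ → Carrier) ]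
           PropertyA Θ g × PropertyC τ Θ g h
  part-c τ s = M.Θ , M.g , M.TorusAction.h τ s scales (fixes τ s) , M.propertyA , M.TorusAction.propertyC τ s scales (fixes τ s)
    where
    module M = Cmp (tower base-generator)
    scales : ∀ a → TowerCoordinates.Scales p 𝐊 P G N₀[_] (tower base-generator) (inT (τ a)) (val a)
    scales a = TowerCoordinates.mkScales λ i c → base-scaled τ s i a c

  module Shifting {φ r} (s : Shift φ r) where
    open Shift s

    private instance
      r≢0 : ℕ.NonZero r
      r≢0 = ℕ.>-nonZero r>0

    shift-generator : ∀ i → Generator i → Generator (i ℕ.+ r)
    shift-generator = shifted-generator normalises shifts

    shift-ξ : ∀ i g c → conj G φ (Generator.ξ g c) ≈ Generator.ξ (shift-generator i g) c
    shift-ξ = shifted-ξ normalises shifts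

    module PartB where
      open Periodic {Generator} r base-generator shift-generator

      𝒯 = tower family

      ξ-shift : ∀ i c → conj G φ (Tower.ξ 𝒯 i c) ≈ Tower.ξ 𝒯 (i ℕ.+ r) c
      ξ-shift i c = trans (shift-ξ i (family i) c) (reflexive (≡.sym (family-step (λ _ g → Generator.ξ g c) i)))

      module M = Cmp 𝒯
      open M.ShiftAction φ r shifts ξ-shift public

    part-b : PreservesY¹ φ × (Σ[ Θ ∈ Y ≅ 𝔛₊ ] Σ[ g ∈ (Vertex → ℕ → Carrier) ] PropertyA Θ g × PropertyB φ r Θ g)
    part-b = PartB.preservesY¹ , PartB.M.Θ , PartB.M.g , PartB.M.propertyA , PartB.propertyB

    module PartD (τ : ∣ 𝒪 ˣ ∣ᵍ → ∣ torus ∣ᵍ) (sec : Section τ) (commutes : CommutesWith φ τ) where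
      -- As the root of a shifted generator has not been identified, the scaling by τ(a) is carried
      -- along the shifts; `step` deduces it from τ(a)φ = φτ(a).
      ScaledGenerator : ℕ → Set
      ScaledGenerator i = Σ[ g ∈ Generator i ] ScaledBy τ g

      step : ∀ i → ScaledGenerator i → ScaledGenerator (i ℕ.+ r)
      step i (g , σ) = shift-generator i g , λ a c →
        trans (conj-cong refl (sym (shift-ξ i g c))) (trans (conj-commute (commutes a) _)
          (trans (conj-cong refl (σ a c)) (shift-ξ i g _)))
        where
        conj-commute : ∀ {s} → s ∙ φ ≈ φ ∙ s → ∀ k → conj G s (conj G φ k) ≈ conj G φ (conj G s k)
        conj-commute {s} h k = trans (sym (conj-by-∙ s φ k)) (trans (conj-cong h refl) (conj-by-∙ φ s k))

      open Periodic {ScaledGenerator} r (λ i → base-generator i , base-scaled τ sec i) step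

      𝒯 = tower (λ i → proj₁ (family i))

      ξ-shift : ∀ i c → conj G φ (Tower.ξ 𝒯 i c) ≈ Tower.ξ 𝒯 (i ℕ.+ r) c
      ξ-shift i c = trans (shift-ξ i (proj₁ (family i)) c) (reflexive (≡.sym (family-step (λ _ g → Generator.ξ (proj₁ g) c) i)))

      scales : ∀ a → TowerCoordinates.Scales p 𝐊 P G N₀[_] 𝒯 (inT (τ a)) (val a)
      scales a = TowerCoordinates.mkScales λ i c → proj₂ (family i) a c

      module M = Cmp 𝒯
      open M.ShiftAction φ r shifts ξ-shift
      open M.TorusAction τ sec scales (fixes τ sec)

      propertyD : PropertyD φ h
      propertyD v v′ a v↦v′ = affineAt-shift v v′ (scales a) (commutes a) (O.sym (O.zeroʳ (π ^ r))) v↦v′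

      part-d : Σ[ Θ ∈ Y ≅ 𝔛₊ ] Σ[ g ∈ (Vertex → ℕ → Carrier) ] Σ[ h ∈ (Vertex → ∣ 𝒪 ˣ ∣ᵍ → Carrier) ]
               PropertyA Θ g × PropertyB φ r Θ g × PropertyC τ Θ g h × PropertyD φ h
      part-d = M.Θ , M.g , h , M.propertyA , propertyB , propertyC , propertyD

theorem3p2 : (p : ℕ) → Prime p →
    (𝐆 : SplitReductiveGroup (LocalField.K (padic p))) (R : RootDatum 𝐆) → ChevalleySystem 𝐆 R →
    (Φ⁺ : PositiveSystem 𝐆 R) (𝒞 : Building.Gallery (padic p) 𝐆 R p Φ⁺) →
    let open Comparison (padic p) 𝐆 R Φ⁺ p 𝒞 in
    (Σ[ Θ ∈ Y ≅ 𝔛₊ ] Σ[ g ∈ (Vertex → ℕ → ∣ G ∣ᵍ) ] PropertyA Θ g)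
    ×
    (∀ φ r → Shift φ r →
      PreservesY¹ φ ×
      (Σ[ Θ ∈ Y ≅ 𝔛₊ ] Σ[ g ∈ (Vertex → ℕ → ∣ G ∣ᵍ) ]
        PropertyA Θ g × PropertyB φ r Θ g))
    ×
    (∀ τ → Section τ →
      Σ[ Θ ∈ Y ≅ 𝔛₊ ] Σ[ g ∈ (Vertex → ℕ → ∣ G ∣ᵍ) ] Σ[ h ∈ (Vertex → ∣ ℤₚ ˣ ∣ᵍ → ∣ G ∣ᵍ) ]
        PropertyA Θ g × PropertyC τ Θ g h)
    ×
    (∀ φ r τ → Shift φ r → Section τ → CommutesWith φ τ →
      Σ[ Θ ∈ Y ≅ 𝔛₊ ] Σ[ g ∈ (Vertex → ℕ → ∣ G ∣ᵍ) ] Σ[ h ∈ (Vertex → ∣ ℤₚ ˣ ∣ᵍ → ∣ G ∣ᵍ) ]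
        PropertyA Θ g × PropertyB φ r Θ g × PropertyC τ Θ g h × PropertyD φ h)
theorem3p2 p p-prime 𝐆 R chev Φ⁺ 𝒞 =
  part-a , (λ φ r s → Shifting.part-b s) , part-c , (λ φ r τ s sec commutes → Shifting.PartD.part-d s τ sec commutes)
  where open Theorem p (padic p) (PadicNumbers.padicField p p-prime) 𝐆 R chev Φ⁺ 𝒞
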